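{- In any finite algebraic signature containing an operation of arity at least $2$, each of the following three decision problems is $\texttt{NL}$-complete: (1) Principal congruence membership. Instance: a finite algebra $\mathbf{A}$ of the signature and two unordered pairs $\{a,b\}$ and $\{c,d\}$ taken from $A$. Question: is $(a,b)$ in the principal congruence of $\mathbf{A}$ generated by $(c,d)$? (2) Subdirect irreducibility. Instance: a finite algebra $\mathbf{A}$ of the signature. Question: is $\mathbf{A}$ subdirectly irreducible? (3) Cong-class. Instance: a pair $(\mathbf{A},C)$, where $\mathbf{A}$ is a finite algebra of the signature and $C\subseteq A$. Question: is there a congruence $\theta$ on $\mathbf{A}$ in which $C$ is a congruence class?
   Context: $\texttt{NL}$ is the class of decision problems solvable in nondeterministic logarithmic space. The universe of an algebra $\mathbf{A}$ is denoted $A$. The principal congruence generated by a pair $(c,d)$ is the smallest congruence of $\mathbf{A}$ containing $(c,d)$. An algebra is subdirectly irreducible if there is a pair of distinct elements $a\neq b$ that is contained in the principal congruence generated by every pair of distinct elements; equivalently, if it has a unique minimum nontrivial congruence. Items (1) and (2) are due to Bergman and Slutzki. -}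

module Defs where

open import Data.Bool.Base using (true; false)
open import Data.Fin.Base using (Fin; zero; suc; toℕ)
open import Data.Fin.Patterns using (0F; 1F; 2F)
open import Data.Fin.Subset using (Subset; _∈_)
open import Data.List.Base as List
  using (List; []; _∷_; [_]; _++_; length; map; concatMap; allFin; cartesianProductWith)
import Data.List.Membership.Propositional as List∈
open import Data.Maybe.Base using (Maybe; just; nothing)
open import Data.Nat.Base using (ℕ; zero; suc; pred; _+_; _*_; _≤_; _⊓_; NonZero)
import Data.Nat.Binary.Base as ℕᵇ
open import Data.Nat.Logarithm using (⌊log₂_⌋)
open import Data.Product.Base using (Σ; ∃; ∃-syntax; Σ-syntax; _×_; _,_)
open import Data.Vec.Base as Vec using (Vec; []; _∷_)
open import Data.Vec.Relation.Binary.Pointwise.Inductive using (Pointwise; []; _∷_)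
open import Function.Base using (_∘_)
open import Function.Bundles using (_⇔_)
open import Level using (Level; 0ℓ; _⊔_) renaming (suc to lsuc)
open import Relation.Binary.Construct.Closure.ReflexiveTransitive using (Star)
open import Relation.Binary.Core using (Rel; _⇒_)
open import Relation.Binary.PropositionalEquality.Core using (_≡_; _≢_)
open import Relation.Binary.Structures using (IsEquivalence)
open import Relation.Unary using (Pred)

private
  variable
    ℓ ℓ′ : Level

------------------------------------------------------------------------
-- Turing machines with a read-only two-way input tape and read-write
-- work tapes

Language : ℕ → (ℓ : Level) → Set (lsuc ℓ)
Language σ ℓ = Pred (List (Fin σ)) ℓ

data Move : Set where
  left stay right : Move

data InputSymbol (σ : ℕ) : Set where
  ⊢ ⊣  : InputSymbol σ
  char : Fin σ → InputSymbol σ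

-- Position 0 of the input tape holds ⊢, positions 1 … n hold the word,
-- and position n + 1 holds ⊣.
readInput : ∀ {σ} → List (Fin σ) → ℕ → InputSymbol σ
readInput w zero = ⊢
readInput w (suc i) = go w i
  where
  go : List (Fin _) → ℕ → InputSymbol _
  go []      _       = ⊣
  go (a ∷ _) zero    = char a
  go (_ ∷ w) (suc i) = go w i

-- The input head never leaves the end markers.
moveInput : ∀ {σ} → List (Fin σ) → Move → ℕ → ℕ
moveInput w left  p = pred p
moveInput w stay  p = p
moveInput w right p = suc p ⊓ suc (length w)

-- The work alphabet is Fin (suc γ), with 0F the blank.  A two-way
-- infinite tape is stored as the finite stretch of cells visited so far:
-- the cells left of the head (nearest first), the scanned cell, and the
-- cells right of the head (nearest first).  All other cells are blank.
record Tape (γ : ℕ) : Set where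
  constructor tape
  field
    before  : List (Fin (suc γ))
    scanned : Fin (suc γ)
    after   : List (Fin (suc γ))

blankTape : ∀ {γ} → Tape γ
blankTape = tape [] zero []

visitedCells : ∀ {γ} → Tape γ → ℕ
visitedCells (tape ls _ rs) = length ls + suc (length rs)

writeAndMove : ∀ {γ} → Fin (suc γ) × Move → Tape γ → Tape γ
writeAndMove (b , stay)  (tape ls       _ rs)       = tape ls b rs
writeAndMove (b , left)  (tape []       _ rs)       = tape [] zero (b ∷ rs)
writeAndMove (b , left)  (tape (l ∷ ls) _ rs)       = tape ls l (b ∷ rs)
writeAndMove (b , right) (tape ls       _ [])       = tape (b ∷ ls) zero []
writeAndMove (b , right) (tape ls       _ (r ∷ rs)) = tape (b ∷ ls) r rs

-- q states, k work tapes, work alphabet of size 1 + γ.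
module _ (q k γ : ℕ) where

  record Config : Set where
    constructor config
    field
      state   : Fin q
      headPos : ℕ
      tapes   : Vec (Tape γ) k

  record Action : Set where
    constructor action
    field
      nextState  : Fin q
      inputMove  : Move
      tapeWrites : Vec (Fin (suc γ) × Move) k

  -- What a transition function with results in X may depend on.
  Transition : ℕ → Set → Set
  Transition σ X = Fin q → InputSymbol σ → Vec (Fin (suc γ)) k → X

module _ {q k γ σ : ℕ} where

  start : Fin q → Config q k γ
  start s = config s 0 (Vec.replicate k blankTape)

  observe : ∀ {X} → Transition q k γ σ X → List (Fin σ) → Config q k γ → X
  observe δ w (config s p ts) = δ s (readInput w p) (Vec.map Tape.scanned ts)

  perform : List (Fin σ) → Action q k γ → Config q k γ → Config q k γ
  perform w (action s m us) (config _ p ts) =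
    config s (moveInput w m p) (Vec.zipWith writeAndMove us ts)

space : ∀ {q k γ} → Config q k γ → ℕ
space c = Vec.sum (Vec.map visitedCells (Config.tapes c))

record NondeterministicTM (σ : ℕ) : Set where
  field
    {states workTapes workSymbols} : ℕ
    initial accepting : Fin states
    δ : Transition states workTapes workSymbols σ
          (List (Action states workTapes workSymbols))

  Configuration : Set
  Configuration = Config states workTapes workSymbols

  Step : List (Fin σ) → Rel Configuration 0ℓ
  Step w c c′ = ∃[ a ] a List∈.∈ observe δ w c × c′ ≡ perform w a c

  Reachable : List (Fin σ) → Pred Configuration 0ℓ
  Reachable w = Star (Step w) (start {σ = σ} initial)

  Accepts : Language σ 0ℓ
  Accepts w = ∃[ c ] Reachable w c × Config.state c ≡ accepting

  -- The bound holds on every computation branch.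
  RunsInLogSpace : Set
  RunsInLogSpace =
    ∃[ b ] ∀ w c → Reachable w c → space c ≤ b * suc ⌊log₂ length w ⌋

-- Deterministic machines with an additional write-only output tape, which
-- does not count towards the space used.  The machine halts where δ yields
-- nothing; otherwise it acts and writes at most one output symbol.
record Transducer (σ τ : ℕ) : Set where
  field
    {states workTapes workSymbols} : ℕ
    initial : Fin states
    δ : Transition states workTapes workSymbols σ
          (Maybe (Action states workTapes workSymbols × Maybe (Fin τ)))

  Configuration : Set
  Configuration = Config states workTapes workSymbols × List (Fin τ)

  Step : List (Fin σ) → Rel Configuration 0ℓ
  Step w (c , out) (c′ , out′) =
    ∃[ a ] ∃[ o ] observe δ w c ≡ just (a , o)
                × c′ ≡ perform w a c
                × out′ ≡ out ++ List.fromMaybe o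

  Reachable : List (Fin σ) → Pred Configuration 0ℓ
  Reachable w = Star (Step w) (start {σ = σ} initial , [])

  Computes : (List (Fin σ) → List (Fin τ)) → Set
  Computes f = ∀ w → ∃[ c ] Reachable w (c , f w) × observe δ w c ≡ nothing

  RunsInLogSpace : Set
  RunsInLogSpace =
    ∃[ b ] ∀ w c out → Reachable w (c , out) → space c ≤ b * suc ⌊log₂ length w ⌋

------------------------------------------------------------------------
-- NL and completeness under logarithmic-space many-one reductions

NL : ∀ {σ} → Language σ ℓ → Set ℓ
NL {σ = σ} L = Σ[ M ∈ NondeterministicTM σ ]
  let open NondeterministicTM M in
  RunsInLogSpace × (∀ w → L w ⇔ Accepts w)

LogSpaceComputable : ∀ {σ τ} → (List (Fin σ) → List (Fin τ)) → Set
LogSpaceComputable {σ} {τ} f = Σ[ M ∈ Transducer σ τ ]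
  let open Transducer M in
  RunsInLogSpace × Computes f

infix 4 _≤ₗ_

_≤ₗ_ : ∀ {σ τ} → Language σ ℓ → Language τ ℓ′ → Set (ℓ ⊔ ℓ′)
L ≤ₗ L′ = ∃[ f ] LogSpaceComputable f × (∀ w → L w ⇔ L′ (f w))

-- Considering languages at level 0ℓ loses nothing: every language in NL is
-- pointwise equivalent to some Accepts, which lives there.
NL-hard : ∀ {σ} → Language σ ℓ → Set (lsuc 0ℓ ⊔ ℓ)
NL-hard L = ∀ {σ} (K : Language σ 0ℓ) → NL K → K ≤ₗ L

NL-complete : ∀ {σ} → Language σ ℓ → Set (lsuc 0ℓ ⊔ ℓ)
NL-complete L = NL L × NL-hard L

-- The symbols 0F and 1F serve as digits and bits, 2F as the delimiter.
Word : Set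
Word = List (Fin 3)

record DecisionProblem (ℓ : Level) : Set (lsuc ℓ) where
  field
    Instance : Set
    encode   : Instance → Word
    Yes      : Pred Instance ℓ

  language : Language 3 ℓ
  language w = ∃[ I ] encode I ≡ w × Yes I

------------------------------------------------------------------------
-- Finite algebras and their congruences

record Signature : Set where
  field
    operations : ℕ
    arity      : Fin operations → ℕ

open Signature public

record FiniteAlgebra (S : Signature) : Set where
  field
    size : ℕ
    .{{nonEmpty}} : NonZero size

  Carrier : Set
  Carrier = Fin size

  field
    op : (f : Fin (operations S)) → Vec Carrier (arity S f) → Carrier

module _ {S : Signature} (A : FiniteAlgebra S) where
  open FiniteAlgebra A

  record IsCongruence (θ : Rel Carrier ℓ) : Set ℓ where
    field
      isEquivalence : IsEquivalence θ
      compatible    : ∀ f {xs ys} → Pointwise θ xs ys → θ (op f xs) (op f ys)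

  data Cg (c d : Carrier) : Rel Carrier 0ℓ where
    generator  : Cg c d c d
    refl       : ∀ {x} → Cg c d x x
    sym        : ∀ {x y} → Cg c d x y → Cg c d y x
    trans      : ∀ {x y z} → Cg c d x y → Cg c d y z → Cg c d x z
    compatible : ∀ f {xs ys} → Pointwise (Cg c d) xs ys → Cg c d (op f xs) (op f ys)

  Cg-isCongruence : ∀ c d → IsCongruence (Cg c d)
  Cg-isCongruence c d = record
    { isEquivalence = record { refl = refl ; sym = sym ; trans = trans }
    ; compatible    = compatible
    }

  Cg-smallest : ∀ {c d} {θ : Rel Carrier ℓ} → IsCongruence θ → θ c d → Cg c d ⇒ θ
  Cg-smallest {c = c} {d} {θ} θ-cong θcd = go
    where
    module θ = IsCongruence θ-cong
    module ≈ = IsEquivalence θ.isEquivalence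

    go  : Cg c d ⇒ θ
    go* : ∀ {n} {xs ys : Vec Carrier n} → Pointwise (Cg c d) xs ys → Pointwise θ xs ys

    go generator         = θcd
    go refl              = ≈.refl
    go (sym p)           = ≈.sym (go p)
    go (trans p q)       = ≈.trans (go p) (go q)
    go (compatible f ps) = θ.compatible f (go* ps)

    go* []       = []
    go* (p ∷ ps) = go p ∷ go* ps

  SubdirectlyIrreducible : Set
  SubdirectlyIrreducible =
    ∃[ a ] ∃[ b ] a ≢ b × (∀ c d → c ≢ d → Cg c d a b)

  IsClassOf : Subset size → Rel Carrier ℓ → Set ℓ
  IsClassOf C θ = ∃[ a ] ∀ x → x ∈ C ⇔ θ a x

------------------------------------------------------------------------
-- Encodings

-- Bijective base 2, least significant digit first: the symbols 0F and 1F
-- have the digit values 1 and 2, and the number zero has no digits.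
digits : ℕᵇ.ℕᵇ → Word
digits ℕᵇ.zero     = []
digits ℕᵇ.1+[2 n ] = 0F ∷ digits n
digits ℕᵇ.2[1+ n ] = 1F ∷ digits n

encodeℕ : ℕ → Word
encodeℕ n = digits (ℕᵇ.fromℕ n) ++ [ 2F ]

encodeFin : ∀ {n} → Fin n → Word
encodeFin = encodeℕ ∘ toℕ

-- In lexicographic order.
tuples : ∀ n k → List (Vec (Fin n) k)
tuples n zero    = [ [] ]
tuples n (suc k) = cartesianProductWith _∷_ (allFin n) (tuples n k)

-- The size of the universe, followed by the operation tables.
encodeAlgebra : ∀ {S} → FiniteAlgebra S → Word
encodeAlgebra {S} A =
  encodeℕ size ++ concatMap table (allFin (operations S))
  where
  open FiniteAlgebra A

  table : Fin (operations S) → Word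
  table f = concatMap (encodeFin ∘ op f) (tuples size (arity S f))

-- The characteristic bit string.
encodeSubset : ∀ {n} → Subset n → Word
encodeSubset = map (λ { false → 0F ; true → 1F }) ∘ Vec.toList

------------------------------------------------------------------------
-- The three problems, for a fixed signature

module _ (S : Signature) where

  -- An unordered pair is presented by listing its elements in either order;
  -- the answer does not depend on the order.
  PrincipalCongruenceMembership : DecisionProblem 0ℓ
  PrincipalCongruenceMembership = record
    { Instance = Σ[ A ∈ FiniteAlgebra S ] let open FiniteAlgebra A in
                   (Carrier × Carrier) × (Carrier × Carrier)
    ; encode   = λ { (A , (a , b) , (c , d)) →
                   encodeAlgebra A ++ encodeFin a ++ encodeFin b
                                   ++ encodeFin c ++ encodeFin d }
    ; Yes      = λ { (A , (a , b) , (c , d)) → Cg A c d a b }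
    }

  SubdirectIrreducibility : DecisionProblem 0ℓ
  SubdirectIrreducibility = record
    { Instance = FiniteAlgebra S
    ; encode   = encodeAlgebra
    ; Yes      = SubdirectlyIrreducible
    }

  CongClass : DecisionProblem (lsuc 0ℓ)
  CongClass = record
    { Instance = Σ[ A ∈ FiniteAlgebra S ] Subset (FiniteAlgebra.size A)
    ; encode   = λ { (A , C) → encodeAlgebra A ++ encodeSubset C }
    ; Yes      = λ { (A , C) → Σ[ θ ∈ Rel (FiniteAlgebra.Carrier A) 0ℓ ]
                               IsCongruence A θ × IsClassOf A C θ }
    }

{-# OPTIONS --safe #-}
module Submission where

open import Defs hiding (generator; refl; sym; trans; compatible)
open import Data.Bool.Base using (Bool; true; false; not; _∧_; _∨_; if_then_else_)
open import Data.Bool.Properties using (∧-zeroʳ; T-≡)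
open import Data.Empty using (⊥; ⊥-elim)
open import Data.Fin.Base as Fin
  using (Fin; zero; suc; toℕ; fromℕ; fromℕ<; inject₁; _↑ˡ_; _↑ʳ_; splitAt)
open import Data.Fin.Patterns
import Data.Fin.Properties as Fin
open import Data.Fin.Subset using (Subset; _∈_)
import Data.Fin.Subset.Properties as Subset
open import Data.List.Base as List
  using (List; []; _∷_; [_]; _++_; _ʳ++_; length; map; replicate; concatMap; allFin; applyUpTo; cartesianProductWith)
import Data.List.Membership.Propositional as List∈
import Data.List.Membership.Propositional.Properties as List∈
import Data.List.Properties as List
open import Data.List.Relation.Unary.Any using (here; there)
open import Data.Maybe.Base as Maybe using (Maybe; just; nothing)
open import Data.Nat.Base
  using (ℕ; zero; suc; pred; _+_; _*_; _^_; _∸_; _/_; _%_; ⌊_/2⌋; _⊓_; _≤_; _<_; z≤n; s≤s; _≡ᵇ_; _<ᵇ_;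
         NonZero; >-nonZero; >-nonZero⁻¹)
import Data.Nat.Binary.Base as ℕᵇ
import Data.Nat.Binary.Properties as ℕᵇ
open import Data.Nat.Divisibility using (n∣m*n)
open import Data.Nat.DivMod
  using (m≡m%n+[m/n]*n; m%n<n; [m+kn]%n≡m%n; m<n⇒m%n≡m; +-distrib-/-∣ʳ; m*n/n≡m; m<n⇒m/n≡0; m<n*o⇒m/o<n)
open import Data.Nat.Induction using (<-rec)
open import Data.Nat.Logarithm using (⌊log₂_⌋; ⌊log₂⌋-mono-≤; ⌊log₂[2^n]⌋≡n; ⌊log₂⌊n/2⌋⌋≡⌊log₂n⌋∸1)
import Data.Nat.Properties as ℕ
open import Data.Nat.Tactic.RingSolver using (solve-∀)
open import Data.Product.Base using (Σ; ∃; ∃₂; ∃-syntax; Σ-syntax; _×_; _,_; proj₁; proj₂)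
open import Data.Sum.Base using (_⊎_; inj₁; inj₂)
open import Data.Unit.Base using (⊤; tt)
open import Data.Vec.Base as Vec using (Vec; []; _∷_; lookup; _[_]≔_)
import Data.Vec.Properties as Vec
open import Data.Vec.Relation.Binary.Pointwise.Inductive using (Pointwise; []; _∷_)
open import Function.Base using (_∘_; id; case_of_)
open import Function.Bundles using (_⇔_; mk⇔; Equivalence)
open import Level using (Level; 0ℓ)
open import Relation.Binary.Construct.Closure.ReflexiveTransitive using (Star; ε; _◅_; _◅◅_)
open import Relation.Binary.PropositionalEquality
  using (_≡_; _≢_; refl; sym; trans; cong; cong₂; subst; subst₂; module ≡-Reasoning)
open import Relation.Binary.Structures using (IsEquivalence)
open import Relation.Nullary using (¬_; Dec; yes; no; contradiction)
open import Relation.Nullary.Decidable using (¬?; _×-dec_; _⊎-dec_; map′)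

-- Structured programs over work tapes, compiled to finite control

-- Membership in NL. By Maltsev's description, the congruence generated by a set of pairs consists
-- of chains whose links, read in either direction, are images of generating pairs under composites
-- of basic translations (one argument of a basic operation varies, the others are fixed). An image
-- is found by walking in pairs of elements, one basic translation at a time, and a chain by walking
-- in elements; a walk needs only its current position in memory. So membership in a principal
-- congruence is a nested reachability question, and subdirect irreducibility asks for a pair that
-- passes this test against all other pairs in turn. A subset `C` fails to be a congruence class
-- exactly if it is empty or some chain generated by the pairs within `C` leads from `C` out of `C`.
-- This puts the complement of the third problem into NL, and the theorem of Immerman and
-- Szelepcsényi (`NL-complement`) puts the problem itself there.
--
-- Hardness. Acceptance by a machine in logarithmic space is reachability in its configuration
-- graph, from a source to a target without outgoing edges. The graph is made into an algebra with
-- one product, on two copies `(0 , v)`, `(1 , v)` of each vertex and a tester `(2 , v)`.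
-- Multiplication by a copy of `u` carries a copy of `v` along an edge to `u`, so identifying the
-- two copies of the source identifies the copies of exactly the reachable vertices; this settles
-- the first problem. Testers see to the second one: any two distinct elements generate either the
-- pair of copies of the target at once or, by a reset, the pair of copies of the source. Hence the
-- target pair lies in every nontrivial congruence if the target is reachable; if it is not, the
-- congruence identifying copies of reachable vertices and the one identifying only the copies of
-- the target meet trivially. For the third problem one product is altered (`broken`) so that
-- identifying the copies of the target adds an element to the class of the sources. The copies of
-- the source then form a class exactly if the target is unreachable, and closure under complement
-- turns this into hardness. In the given signature, operations of arity at least two multiply their
-- first two arguments.
--
-- Machines. Three small languages replace the construction of machines by hand: truncated primitive
-- recursive functions (`Fn`), formulas with transitive closure and no negation outside their atoms
-- (`Formula`), and printing functions (`Out`). They compile to structured programs on counters, and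
-- these to Turing machines. A counter has as many digits as the input length has in binary, in a
-- base so large that the counters exceed a prescribed polynomial in the input length; all values
-- are truncated at the resulting cap. A first phase lays out the counters; the second works within
-- the cells laid out, so space stays logarithmic. `NL-by-formula` and `logSpace-by-printing` are
-- the yield of this. In the other direction `NL⇒GraphFor` presents every language in NL as
-- reachability in a graph whose edges are given by a truncated function.

module Programs (σ τ K β : ℕ) where

  Digit Symbol : Set
  Digit  = Fin (suc (suc β))
  Symbol = Fin (suc (suc (suc (suc β))))

  pattern blank = zero
  pattern home  = suc zero
  pattern digit d = suc (suc d)

  -- A guarded action cannot leave the stretch between the home symbol and the
  -- first blank, nor alter either of them.
  data Act : Set where
    raw     : (Symbol → Symbol × Move) → Act
    guarded : (InputSymbol σ → Digit → Digit × Move) → Act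

  interp : Act → InputSymbol σ → Symbol → Symbol × Move
  interp (raw f)     i a         = f a
  interp (guarded f) i blank     = blank , left
  interp (guarded f) i home      = home , right
  interp (guarded f) i (digit d) = let e , m = f i d in digit e , m

  data Instr : Set where
    onTape : Fin K → Act → Instr
    onHead : Move → Instr
    emit   : Fin τ → Instr

  data Test : Set where
    input? : (InputSymbol σ → Bool) → Test
    tape?  : Fin K → (Symbol → Bool) → Test
    coin?  : Test

  infixr 5 _⨾_

  data Prog : Set where
    instr : Instr → Prog
    _⨾_   : Prog → Prog → Prog
    ifte  : Test → Prog → Prog → Prog
    while : Test → Prog → Prog

  evalTest : Test → InputSymbol σ → Vec Symbol K → Bool → Bool
  evalTest (input? p)  i ss c = p i
  evalTest (tape? r p) i ss c = p (lookup ss r)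
  evalTest coin?       i ss c = c

  -- Control points are positions in the syntax tree rather than numbers, so that proofs can follow
  -- the structure of the program. Conditionals and loops have a further point, `nothing`, at which
  -- their test is evaluated.
  Ctl : Prog → Set
  Ctl (instr x)       = ⊤
  Ctl (P ⨾ Q)      = Ctl P ⊎ Ctl Q
  Ctl (ifte t P Q) = Maybe (Ctl P ⊎ Ctl Q)
  Ctl (while t P)  = Maybe (Ctl P)

  entry : ∀ P → Ctl P
  entry (instr x)       = tt
  entry (P ⨾ Q)      = inj₁ (entry P)
  entry (ifte t P Q) = nothing
  entry (while t P)  = nothing

  Effect : Set → Set
  Effect X = Maybe Instr × Maybe X

  -- Embeds an effect of a part into the whole; `y` is where control goes once the part has
  -- finished.
  redirect : ∀ {X Y : Set} → (X → Y) → Maybe Y → Effect X → Effect Y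
  redirect f y (x , just p)  = x , just (f p)
  redirect f y (x , nothing) = x , y

  next : ∀ P → Ctl P → InputSymbol σ → Vec Symbol K → Bool → Effect (Ctl P)
  next (instr x)       p              i ss c = just x , nothing
  next (P ⨾ Q)      (inj₁ p)       i ss c = redirect inj₁ (just (inj₂ (entry Q))) (next P p i ss c)
  next (P ⨾ Q)      (inj₂ q)       i ss c = redirect inj₂ nothing (next Q q i ss c)
  next (ifte t P Q) nothing        i ss c =
    nothing , just (just (if evalTest t i ss c then inj₁ (entry P) else inj₂ (entry Q)))
  next (ifte t P Q) (just (inj₁ p)) i ss c = redirect (just ∘ inj₁) nothing (next P p i ss c)
  next (ifte t P Q) (just (inj₂ q)) i ss c = redirect (just ∘ inj₂) nothing (next Q q i ss c)
  next (while t P)  nothing        i ss c =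
    nothing , (if evalTest t i ss c then just (just (entry P)) else nothing)
  next (while t P)  (just p)       i ss c = redirect just (just nothing) (next P p i ss c)

  ctlSize : Prog → ℕ
  ctlSize (instr x)       = 1
  ctlSize (P ⨾ Q)      = ctlSize P + ctlSize Q
  ctlSize (ifte t P Q) = suc (ctlSize P + ctlSize Q)
  ctlSize (while t P)  = suc (ctlSize P)

  encCtl : ∀ P → Ctl P → Fin (ctlSize P)
  encCtl (instr x)       p               = zero
  encCtl (P ⨾ Q)      (inj₁ p)        = encCtl P p ↑ˡ ctlSize Q
  encCtl (P ⨾ Q)      (inj₂ q)        = ctlSize P ↑ʳ encCtl Q q
  encCtl (ifte t P Q) nothing         = zero
  encCtl (ifte t P Q) (just (inj₁ p)) = suc (encCtl P p ↑ˡ ctlSize Q)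
  encCtl (ifte t P Q) (just (inj₂ q)) = suc (ctlSize P ↑ʳ encCtl Q q)
  encCtl (while t P)  nothing         = zero
  encCtl (while t P)  (just p)        = suc (encCtl P p)

  mutual
    decCtl : ∀ P → Fin (ctlSize P) → Ctl P
    decCtl (instr x)       i       = tt
    decCtl (P ⨾ Q)      i       = decSum P Q (splitAt (ctlSize P) i)
    decCtl (ifte t P Q) zero    = nothing
    decCtl (ifte t P Q) (suc i) = just (decSum P Q (splitAt (ctlSize P) i))
    decCtl (while t P)  zero    = nothing
    decCtl (while t P)  (suc i) = just (decCtl P i)

    decSum : ∀ P Q → Fin (ctlSize P) ⊎ Fin (ctlSize Q) → Ctl P ⊎ Ctl Q
    decSum P Q (inj₁ i) = inj₁ (decCtl P i)
    decSum P Q (inj₂ j) = inj₂ (decCtl Q j)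

  dec-enc : ∀ P p → decCtl P (encCtl P p) ≡ p
  dec-enc (instr x)       p               = refl
  dec-enc (P ⨾ Q)      (inj₁ p)
    rewrite Fin.splitAt-↑ˡ (ctlSize P) (encCtl P p) (ctlSize Q)         = cong inj₁ (dec-enc P p)
  dec-enc (P ⨾ Q)      (inj₂ q)
    rewrite Fin.splitAt-↑ʳ (ctlSize P) (ctlSize Q) (encCtl Q q)         = cong inj₂ (dec-enc Q q)
  dec-enc (ifte t P Q) nothing         = refl
  dec-enc (ifte t P Q) (just (inj₁ p))
    rewrite Fin.splitAt-↑ˡ (ctlSize P) (encCtl P p) (ctlSize Q)         = cong (just ∘ inj₁) (dec-enc P p)
  dec-enc (ifte t P Q) (just (inj₂ q))
    rewrite Fin.splitAt-↑ʳ (ctlSize P) (ctlSize Q) (encCtl Q q)         = cong (just ∘ inj₂) (dec-enc Q q)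
  dec-enc (while t P)  nothing         = refl
  dec-enc (while t P)  (just p)        = cong just (dec-enc P p)

  record Store : Set where
    constructor store
    field
      headAt  : ℕ
      tapesOf : Vec (Tape (suc (suc (suc β)))) K
      written : List (Fin τ)
  open Store public

  -- A machine that may only resolve coin tests by the values in C.
  module Semantics (w : List (Fin σ)) (C : Bool → Set) (someC : ∃ C) where

    inputAt : Store → InputSymbol σ
    inputAt s = readInput w (headAt s)

    scan : Store → Vec Symbol K
    scan s = Vec.map Tape.scanned (tapesOf s)

    apply : Instr → Store → Store
    apply (onTape r a) s = store (headAt s) (tapesOf s [ r ]≔
      writeAndMove (interp a (inputAt s) (Tape.scanned (lookup (tapesOf s) r))) (lookup (tapesOf s) r)) (written s)
    apply (onHead m)   s = store (moveInput w m (headAt s)) (tapesOf s) (written s)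
    apply (emit a)     s = store (headAt s) (tapesOf s) (written s ++ [ a ])

    applyM : Maybe Instr → Store → Store
    applyM (just x) = apply x
    applyM nothing  = id

    Holds : Test → Store → Bool → Set
    Holds t s b = ∃[ c ] C c × evalTest t (inputAt s) (scan s) c ≡ b

    infix 4 _⊢_⇓_
    -- A diverging run has no derivation, which is how a rejecting branch is expressed later on.
    data _⊢_⇓_ : Prog → Store → Store → Set where
      instr  : ∀ {x s} → instr x ⊢ s ⇓ apply x s
      _⨾_    : ∀ {P Q s s′ s″} → P ⊢ s ⇓ s′ → Q ⊢ s′ ⇓ s″ → (P ⨾ Q) ⊢ s ⇓ s″
      ifT    : ∀ {t P Q s s′} → Holds t s true → P ⊢ s ⇓ s′ → ifte t P Q ⊢ s ⇓ s′
      ifF    : ∀ {t P Q s s′} → Holds t s false → Q ⊢ s ⇓ s′ → ifte t P Q ⊢ s ⇓ s′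
      halt   : ∀ {t P s} → Holds t s false → while t P ⊢ s ⇓ s
      repeat : ∀ {t P s s′ s″} → Holds t s true → P ⊢ s ⇓ s′ → while t P ⊢ s′ ⇓ s″ → while t P ⊢ s ⇓ s″

    Point : Prog → Set
    Point P = Maybe (Ctl P) × Store

    _⊢_↦_ : ∀ P → Point P → Point P → Set
    P ⊢ x ↦ (mp′ , s′) = ∃[ p ] ∃[ s ] ∃[ c ] x ≡ (just p , s) × C c ×
      ∃[ ι ] next P p (inputAt s) (scan s) c ≡ (ι , mp′) × s′ ≡ applyM ι s

    infix 3 _⊢_↦*_
    _⊢_↦*_ : ∀ P → Point P → Point P → Set
    P ⊢ x ↦* y = Star (P ⊢_↦_) x y

    private
      step : ∀ P {p s c ι mp′} → C c → next P p (inputAt s) (scan s) c ≡ (ι , mp′) →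
             P ⊢ (just p , s) ↦ (mp′ , applyM ι s)
      step P Cc eq = _ , _ , _ , refl , Cc , _ , eq , refl

      decide : ∀ P t {s b} (f : Bool → Maybe (Ctl P)) {p} → Holds t s b →
               (∀ i ss c → next P p i ss c ≡ (nothing , f (evalTest t i ss c))) → P ⊢ (just p , s) ↦ (f b , s)
      decide P t f (c , Cc , refl) h = step P Cc (h _ _ c)

      -- A run of the part `P` is replayed inside `Q`, since the embedding `f` of control points
      -- commutes with `next`. Only the last step differs: where `P` stops, `Q` goes on at `y`.
      lift : ∀ P Q (f : Ctl P → Ctl Q) y →
             (∀ p i ss c → next Q (f p) i ss c ≡ redirect f y (next P p i ss c)) →
             ∀ {p s s′} → P ⊢ (just p , s) ↦* (nothing , s′) → Q ⊢ (just (f p) , s) ↦* (y , s′)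
      lift P Q f y h (_◅_ {j = nothing , _} (p , s , c , refl , Cc , ι , eq , refl) ε) =
        step Q Cc (trans (h p _ _ c) (cong (redirect f y) eq)) ◅ ε
      lift P Q f y h (_◅_ {j = just p′ , _} (p , s , c , refl , Cc , ι , eq , refl) xs) =
        step Q Cc (trans (h p _ _ c) (cong (redirect f y) eq)) ◅ lift P Q f y h xs
      lift P Q f y h (_◅_ {j = nothing , _} _ ((_ , _ , _ , () , _) ◅ _))

    complete : ∀ {P s s′} → P ⊢ s ⇓ s′ → P ⊢ (just (entry P) , s) ↦* (nothing , s′)
    complete {P@(instr _)} instr = step P (proj₂ someC) refl ◅ ε
    complete {R@(P ⨾ Q)} (p ⨾ q) = lift P R inj₁ (just (inj₂ (entry Q))) (λ _ _ _ _ → refl) (complete p) ◅◅ lift Q R inj₂ nothing (λ _ _ _ _ → refl) (complete q)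
    complete {R@(ifte t P Q)} (ifT h p) =
      decide R t (λ b → just (just (if b then inj₁ (entry P) else inj₂ (entry Q)))) h (λ _ _ _ → refl)
      ◅ lift P R (just ∘ inj₁) nothing (λ _ _ _ _ → refl) (complete p)
    complete {R@(ifte t P Q)} (ifF h q) =
      decide R t (λ b → just (just (if b then inj₁ (entry P) else inj₂ (entry Q)))) h (λ _ _ _ → refl)
      ◅ lift Q R (just ∘ inj₂) nothing (λ _ _ _ _ → refl) (complete q)
    complete {R@(while t P)} (halt h) =
      decide R t (λ b → if b then just (just (entry P)) else nothing) h (λ _ _ _ → refl) ◅ ε
    complete {R@(while t P)} (repeat h p q) =
      decide R t (λ b → if b then just (just (entry P)) else nothing) h (λ _ _ _ → refl)
      ◅ lift P R just (just nothing) (λ _ _ _ _ → refl) (complete p) ◅◅ complete q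

    -- The big-step behaviour of a program resumed at a control point.
    Resume : ∀ P → Ctl P → Store → Store → Set
    Resume (instr x)    p               s s′ = s′ ≡ apply x s
    Resume (P ⨾ Q)      (inj₁ p)        s s′ = ∃[ m ] Resume P p s m × (Q ⊢ m ⇓ s′)
    Resume (P ⨾ Q)      (inj₂ q)        s s′ = Resume Q q s s′
    Resume (ifte t P Q) nothing         s s′ = ifte t P Q ⊢ s ⇓ s′
    Resume (ifte t P Q) (just (inj₁ p)) s s′ = Resume P p s s′
    Resume (ifte t P Q) (just (inj₂ q)) s s′ = Resume Q q s s′
    Resume (while t P)  nothing         s s′ = while t P ⊢ s ⇓ s′
    Resume (while t P)  (just p)        s s′ = ∃[ m ] Resume P p s m × (while t P ⊢ m ⇓ s′)

    Resume? : ∀ P → Maybe (Ctl P) → Store → Store → Set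
    Resume? P (just p) s s′ = Resume P p s s′
    Resume? P nothing  s s′ = s′ ≡ s

    private
      at-entry : ∀ P {s s′} → Resume P (entry P) s s′ → P ⊢ s ⇓ s′
      at-entry (instr x)    refl        = instr
      at-entry (P ⨾ Q)      (m , p , q) = at-entry P p ⨾ q
      at-entry (ifte t P Q) d           = d
      at-entry (while t P)  d           = d

      -- The path is read from its end: what `Resume` promises after a step, it promises before the
      -- step. If a part has just finished, its own promise is `refl` and the rest of the promise
      -- passes to the continuation.
      back : ∀ P p {s s′ ι mp′} c → C c → next P p (inputAt s) (scan s) c ≡ (ι , mp′) →
             Resume? P mp′ (applyM ι s) s′ → Resume P p s s′
      back (instr x) p c Cc refl d = d
      back (P ⨾ Q) (inj₁ p) {s} c Cc eq d with next P p (inputAt s) (scan s) c in e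
      back (P ⨾ Q) (inj₁ p) c Cc refl (m , r , q) | ι , just p′ = m , back P p c Cc e r , q
      back (P ⨾ Q) (inj₁ p) c Cc refl d | ι , nothing = _ , back P p c Cc e refl , at-entry Q d
      back (P ⨾ Q) (inj₂ q) {s} c Cc eq d with next Q q (inputAt s) (scan s) c in e
      back (P ⨾ Q) (inj₂ q) c Cc refl d | ι , just q′  = back Q q c Cc e d
      back (P ⨾ Q) (inj₂ q) c Cc refl d | ι , nothing = back Q q c Cc e d
      back (ifte t P Q) nothing {s} c Cc eq d with evalTest t (inputAt s) (scan s) c in e
      back (ifte t P Q) nothing c Cc refl d | true  = ifT (c , Cc , e) (at-entry P d)
      back (ifte t P Q) nothing c Cc refl d | false = ifF (c , Cc , e) (at-entry Q d)
      back (ifte t P Q) (just (inj₁ p)) {s} c Cc eq d with next P p (inputAt s) (scan s) c in e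
      back (ifte t P Q) (just (inj₁ p)) c Cc refl d | ι , just p′  = back P p c Cc e d
      back (ifte t P Q) (just (inj₁ p)) c Cc refl d | ι , nothing = back P p c Cc e d
      back (ifte t P Q) (just (inj₂ q)) {s} c Cc eq d with next Q q (inputAt s) (scan s) c in e
      back (ifte t P Q) (just (inj₂ q)) c Cc refl d | ι , just q′  = back Q q c Cc e d
      back (ifte t P Q) (just (inj₂ q)) c Cc refl d | ι , nothing = back Q q c Cc e d
      back (while t P) nothing {s} c Cc eq d with evalTest t (inputAt s) (scan s) c in e
      back (while t P) nothing c Cc refl (m , p , q) | true  = repeat (c , Cc , e) (at-entry P p) q
      back (while t P) nothing c Cc refl refl | false = halt (c , Cc , e)
      back (while t P) (just p) {s} c Cc eq d with next P p (inputAt s) (scan s) c in e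
      back (while t P) (just p) c Cc refl (m , r , q) | ι , just p′ = m , back P p c Cc e r , q
      back (while t P) (just p) c Cc refl d | ι , nothing = _ , back P p c Cc e refl , d

      sound-at : ∀ P {mp s s′} → P ⊢ (mp , s) ↦* (nothing , s′) → Resume? P mp s s′
      sound-at P ε = refl
      sound-at P (_◅_ {j = mp′ , _} (p , s , c , refl , Cc , ι , eq , refl) xs) =
        back P p c Cc eq (sound-at P xs)

    sound : ∀ {P s s′} → P ⊢ (just (entry P) , s) ↦* (nothing , s′) → P ⊢ s ⇓ s′
    sound {P} d = at-entry P (sound-at P d)

-- Turing machines from programs

module Machines (σ τ K β : ℕ) where

  open Programs σ τ K β

  γ : ℕ
  γ = suc (suc (suc β))

  encCtl? : ∀ P → Maybe (Ctl P) → Fin (suc (ctlSize P))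
  encCtl? P nothing  = zero
  encCtl? P (just p) = suc (encCtl P p)

  decCtl? : ∀ P → Fin (suc (ctlSize P)) → Maybe (Ctl P)
  decCtl? P zero    = nothing
  decCtl? P (suc i) = just (decCtl P i)

  -- A machine step acts on every tape, an instruction on at most one; the other tapes rewrite their
  -- scanned symbol in place.
  idle : ∀ {k} → Vec Symbol k → Vec (Symbol × Move) k
  idle = Vec.map (_, stay)

  writes : Maybe Instr → InputSymbol σ → Vec Symbol K → Vec (Symbol × Move) K
  writes (just (onTape r a)) i ss = idle ss [ r ]≔ interp a i (lookup ss r)
  writes (just (onHead m))   i ss = idle ss
  writes (just (emit a))     i ss = idle ss
  writes nothing             i ss = idle ss

  headMove : Maybe Instr → Move
  headMove (just (onHead m)) = m
  headMove _                 = stay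

  output : Maybe Instr → Maybe (Fin τ)
  output (just (emit a)) = just a
  output _               = nothing

  toAction : ∀ P → InputSymbol σ → Vec Symbol K → Effect (Ctl P) → Action (suc (ctlSize P)) K γ
  toAction P i ss (ι , mp) = action (encCtl? P mp) (headMove ι) (writes ι i ss)

  perform-idle : ∀ {k} (ts : Vec (Tape γ) k) → Vec.zipWith writeAndMove (idle (Vec.map Tape.scanned ts)) ts ≡ ts
  perform-idle []                   = refl
  perform-idle (tape ls a rs ∷ ts) = cong (tape ls a rs ∷_) (perform-idle ts)

  perform-update : ∀ {k} (ts : Vec (Tape γ) k) r x →
    Vec.zipWith writeAndMove (idle (Vec.map Tape.scanned ts) [ r ]≔ x) ts ≡ ts [ r ]≔ writeAndMove x (lookup ts r)
  perform-update (t ∷ ts) zero    x = cong (_ ∷_) (perform-idle ts)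
  perform-update (t ∷ ts) (suc r) x = cong (_ ∷_) (perform-update ts r x)

  start-store : Store
  start-store = store 0 (Vec.replicate K blankTape) []

  cells : Store → ℕ
  cells s = Vec.sum (Vec.map visitedCells (tapesOf s))

  module Correspondence (P : Prog) (w : List (Fin σ)) (C : Bool → Set) (someC : ∃ C) where

    open Semantics w C someC

    conf : Point P → Config (suc (ctlSize P)) K γ
    conf (mp , s) = config (encCtl? P mp) (headAt s) (tapesOf s)

    perform-apply : ∀ s q ι mp →
      perform w (toAction P (inputAt s) (scan s) (ι , mp)) (config q (headAt s) (tapesOf s)) ≡ conf (mp , applyM ι s)
    perform-apply s q (just (onTape r a)) mp = cong (config _ _)
      (trans (perform-update (tapesOf s) r _)
        (cong (λ x → tapesOf s [ r ]≔ writeAndMove (interp a (inputAt s) x) (lookup (tapesOf s) r))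
          (Vec.lookup-map r Tape.scanned (tapesOf s))))
    perform-apply s q (just (onHead m)) mp = cong (config _ _) (perform-idle (tapesOf s))
    perform-apply s q (just (emit a)) mp   = cong (config _ _) (perform-idle (tapesOf s))
    perform-apply s q nothing mp         = cong (config _ _) (perform-idle (tapesOf s))

  -- Space: a program without coins takes a single path, along which space
  -- never shrinks; guarded actions never leave the cells laid out by it.

  CoinFree : Prog → Set
  CoinFree (instr x)             = ⊤
  CoinFree (P ⨾ Q)               = CoinFree P × CoinFree Q
  CoinFree (ifte coin? P Q)      = ⊥
  CoinFree (ifte _ P Q)          = CoinFree P × CoinFree Q
  CoinFree (while coin? P)       = ⊥
  CoinFree (while _ P)           = CoinFree P

  next-coinFree : ∀ P → CoinFree P → ∀ p i ss c c′ → next P p i ss c ≡ next P p i ss c′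
  next-coinFree (instr x) f p i ss c c′ = refl
  next-coinFree (P ⨾ Q) (f , g) (inj₁ p) i ss c c′ = cong (redirect _ _) (next-coinFree P f p i ss c c′)
  next-coinFree (P ⨾ Q) (f , g) (inj₂ q) i ss c c′ = cong (redirect _ _) (next-coinFree Q g q i ss c c′)
  next-coinFree (ifte (input? x) P Q) (f , g) nothing i ss c c′ = refl
  next-coinFree (ifte (input? x) P Q) (f , g) (just (inj₁ p)) i ss c c′ = cong (redirect _ _) (next-coinFree P f p i ss c c′)
  next-coinFree (ifte (input? x) P Q) (f , g) (just (inj₂ q)) i ss c c′ = cong (redirect _ _) (next-coinFree Q g q i ss c c′)
  next-coinFree (ifte (tape? r x) P Q) (f , g) nothing i ss c c′ = refl
  next-coinFree (ifte (tape? r x) P Q) (f , g) (just (inj₁ p)) i ss c c′ = cong (redirect _ _) (next-coinFree P f p i ss c c′)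
  next-coinFree (ifte (tape? r x) P Q) (f , g) (just (inj₂ q)) i ss c c′ = cong (redirect _ _) (next-coinFree Q g q i ss c c′)
  next-coinFree (while (input? x) P) f nothing i ss c c′ = refl
  next-coinFree (while (input? x) P) f (just p) i ss c c′ = cong (redirect _ _) (next-coinFree P f p i ss c c′)
  next-coinFree (while (tape? r x) P) f nothing i ss c c′ = refl
  next-coinFree (while (tape? r x) P) f (just p) i ss c c′ = cong (redirect _ _) (next-coinFree P f p i ss c c′)

  GuardedInstr : Instr → Set
  GuardedInstr (onTape r (raw f))     = ⊥
  GuardedInstr (onTape r (guarded f)) = ⊤
  GuardedInstr (onHead m)             = ⊤
  GuardedInstr (emit a)               = ⊤

  Guarded : Prog → Set
  Guarded (instr x)    = GuardedInstr x
  Guarded (P ⨾ Q)      = Guarded P × Guarded Q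
  Guarded (ifte _ P Q) = Guarded P × Guarded Q
  Guarded (while _ P)  = Guarded P

  GuardedInstr? : Maybe Instr → Set
  GuardedInstr? (just x) = GuardedInstr x
  GuardedInstr? nothing  = ⊤

  redirect-instr : ∀ {X Y : Set} {f : X → Y} {y} (e : Effect X) → proj₁ (redirect f y e) ≡ proj₁ e
  redirect-instr (x , just p)  = refl
  redirect-instr (x , nothing) = refl

  next-guarded : ∀ P → Guarded P → ∀ p i ss c → GuardedInstr? (proj₁ (next P p i ss c))
  next-guarded (instr x) g p i ss c = g
  next-guarded (P ⨾ Q) (g , h) (inj₁ p) i ss c = subst GuardedInstr? (sym (redirect-instr (next P p i ss c))) (next-guarded P g p i ss c)
  next-guarded (P ⨾ Q) (g , h) (inj₂ q) i ss c = subst GuardedInstr? (sym (redirect-instr (next Q q i ss c))) (next-guarded Q h q i ss c)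
  next-guarded (ifte t P Q) (g , h) nothing i ss c = tt
  next-guarded (ifte t P Q) (g , h) (just (inj₁ p)) i ss c = subst GuardedInstr? (sym (redirect-instr (next P p i ss c))) (next-guarded P g p i ss c)
  next-guarded (ifte t P Q) (g , h) (just (inj₂ q)) i ss c = subst GuardedInstr? (sym (redirect-instr (next Q q i ss c))) (next-guarded Q h q i ss c)
  next-guarded (while t P) g nothing i ss c = tt
  next-guarded (while t P) g (just p) i ss c = subst GuardedInstr? (sym (redirect-instr (next P p i ss c))) (next-guarded P g p i ss c)

  digits⌣ : List Digit → List Symbol
  digits⌣ = map (λ d → digit d)

  -- scanning xs ds has passed the digits xs (nearest first) and is about to
  -- read the digits ds; resting ds scans the home symbol.
  scanning : List Digit → List Digit → Tape γ
  scanning xs []       = tape (digits⌣ xs ++ [ home ]) blank []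
  scanning xs (d ∷ ds) = tape (digits⌣ xs ++ [ home ]) (digit d) (digits⌣ ds ++ [ blank ])

  resting : List Digit → Tape γ
  resting ds = tape [] home (digits⌣ ds ++ [ blank ])

  -- A tape laid out for `ℓ` digits holds the home symbol, the digits and one blank, hence `2 + ℓ`
  -- cells wherever its head is. Guarded actions preserve this, which makes the space of the second
  -- phase constant.
  data Shaped (ℓ : ℕ) : Tape γ → Set where
    at-rest : ∀ {ds} → length ds ≡ ℓ → Shaped ℓ (resting ds)
    at-scan : ∀ {xs ds} → length xs + length ds ≡ ℓ → Shaped ℓ (scanning xs ds)

  length-snoc : ∀ {a} xs → length (digits⌣ xs ++ [ a ]) ≡ suc (length xs)
  length-snoc []       = refl
  length-snoc (x ∷ xs) = cong suc (length-snoc xs)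

  visited-resting : ∀ ds → visitedCells (resting ds) ≡ 2 + length ds
  visited-resting ds = cong suc (length-snoc ds)

  visited-scanning : ∀ xs ds → visitedCells (scanning xs ds) ≡ 2 + (length xs + length ds)
  visited-scanning xs []       = trans (cong (_+ 1) (length-snoc xs)) (cong suc (ℕ.+-suc _ 0))
  visited-scanning xs (d ∷ ds) = trans (cong₂ _+_ (length-snoc xs) (cong suc (length-snoc ds))) (cong suc (ℕ.+-suc _ _))

  visited-shaped : ∀ {ℓ t} → Shaped ℓ t → visitedCells t ≡ 2 + ℓ
  visited-shaped (at-rest {ds} eq)      = trans (visited-resting ds) (cong (2 +_) eq)
  visited-shaped (at-scan {xs} {ds} eq) = trans (visited-scanning xs ds) (cong (2 +_) eq)

  shaped-act : ∀ {ℓ t} f i → Shaped ℓ t → Shaped ℓ (writeAndMove (interp (guarded f) i (Tape.scanned t)) t)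
  shaped-act f i (at-rest {[]} eq)    = at-scan {xs = []} {[]} eq
  shaped-act f i (at-rest {d ∷ ds} eq) = at-scan {xs = []} {d ∷ ds} eq
  shaped-act f i (at-scan {[]} {[]} eq)    = at-rest {ds = []} eq
  shaped-act f i (at-scan {x ∷ xs} {[]} eq) = at-scan {xs = xs} {x ∷ []} (trans (ℕ.+-suc _ _) eq)
  shaped-act f i (at-scan {xs} {d ∷ ds} eq) with f i d
  shaped-act f i (at-scan {xs} {d ∷ ds} eq)     | e , stay  = at-scan {xs = xs} {e ∷ ds} eq
  shaped-act f i (at-scan {[]} {d ∷ ds} eq)     | e , left  = at-rest {ds = e ∷ ds} eq
  shaped-act f i (at-scan {x ∷ xs} {d ∷ ds} eq) | e , left  = at-scan {xs = xs} {x ∷ e ∷ ds} (trans (ℕ.+-suc _ _) eq)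
  shaped-act f i (at-scan {xs} {d ∷ []} eq)     | e , right = at-scan {xs = e ∷ xs} {[]} (trans (sym (ℕ.+-suc _ _)) eq)
  shaped-act f i (at-scan {xs} {d ∷ d′ ∷ ds} eq) | e , right = at-scan {xs = e ∷ xs} {d′ ∷ ds} (trans (sym (ℕ.+-suc _ _)) eq)

  ShapedStore : ℕ → Store → Set
  ShapedStore ℓ s = ∀ r → Shaped ℓ (lookup (tapesOf s) r)

  shaped-update : ∀ {ℓ k} (ts : Vec (Tape γ) k) r {t} → (∀ r → Shaped ℓ (lookup ts r)) → Shaped ℓ t →
                  ∀ r′ → Shaped ℓ (lookup (ts [ r ]≔ t) r′)
  shaped-update (_ ∷ ts) zero    hs h zero     = h
  shaped-update (_ ∷ ts) zero    hs h (suc r′) = hs (suc r′)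
  shaped-update (_ ∷ ts) (suc r) hs h zero     = hs zero
  shaped-update (_ ∷ ts) (suc r) hs h (suc r′) = shaped-update ts r (hs ∘ suc) h r′

  cells-shaped : ∀ {ℓ k} (ts : Vec (Tape γ) k) → (∀ r → Shaped ℓ (lookup ts r)) →
                 Vec.sum (Vec.map visitedCells ts) ≡ k * (2 + ℓ)
  cells-shaped []       hs = refl
  cells-shaped (t ∷ ts) hs = cong₂ _+_ (visited-shaped (hs zero)) (cells-shaped ts (hs ∘ suc))

  visited-mono : ∀ (x : Symbol × Move) t → visitedCells t ≤ visitedCells (writeAndMove x t)
  visited-mono (b , stay)  (tape ls a rs)       = ℕ.≤-refl
  visited-mono (b , left)  (tape [] a rs)       = ℕ.n≤1+n _
  visited-mono (b , left)  (tape (l ∷ ls) a rs) = ℕ.≤-reflexive (sym (ℕ.+-suc _ _))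
  visited-mono (b , right) (tape ls a [])       = ℕ.n≤1+n _
  visited-mono (b , right) (tape ls a (r ∷ rs)) = ℕ.≤-reflexive (ℕ.+-suc _ _)

  sum-update : ∀ {k} (ts : Vec (Tape γ) k) r t → visitedCells (lookup ts r) ≤ visitedCells t →
               Vec.sum (Vec.map visitedCells ts) ≤ Vec.sum (Vec.map visitedCells (ts [ r ]≔ t))
  sum-update (_ ∷ ts) zero    t h = ℕ.+-monoˡ-≤ _ h
  sum-update (_ ∷ ts) (suc r) t h = ℕ.+-monoʳ-≤ _ (sum-update ts r t h)

  module TwoPhases (w : List (Fin σ)) (C : Bool → Set) (someC : ∃ C)
                   (P Q : Prog) (P-coinFree : CoinFree P) (Q-guarded : Guarded Q)
                   (ℓ : ℕ) (middle : Store) (middle-shaped : ShapedStore ℓ middle) where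

    open Semantics w C someC

    cells-mono : ∀ ι s → cells s ≤ cells (applyM ι s)
    cells-mono (just (onTape r a)) s = 
      sum-update (tapesOf s) r _ (visited-mono (interp a (inputAt s) (Tape.scanned (lookup (tapesOf s) r))) (lookup (tapesOf s) r))
    cells-mono (just (onHead m))   s = ℕ.≤-refl
    cells-mono (just (emit a))     s = ℕ.≤-refl
    cells-mono nothing             s = ℕ.≤-refl

    cells-mono* : ∀ {R x y} → R ⊢ x ↦* y → cells (proj₂ x) ≤ cells (proj₂ y)
    cells-mono* ε = ℕ.≤-refl
    cells-mono* ((_ , s , _ , refl , _ , ι , _ , refl) ◅ xs) = ℕ.≤-trans (cells-mono ι s) (cells-mono* xs)

    shaped-apply : ∀ ι {s} → GuardedInstr? ι → ShapedStore ℓ s → ShapedStore ℓ (applyM ι s)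
    shaped-apply (just (onTape r (guarded f))) {s} g h = 
      shaped-update (tapesOf s) r h (shaped-act f (inputAt s) (h r))
    shaped-apply (just (onHead m)) g h = h
    shaped-apply (just (emit a))   g h = h
    shaped-apply nothing           g h = h

    -- In the first phase the invariant is what remains of the known run of `P` to `middle`. Cells
    -- are never given back, so its existence bounds the current space by that of `middle`.
    Invariant : Point (P ⨾ Q) → Set
    Invariant (just (inj₁ p) , s) = P ⊢ (just p , s) ↦* (nothing , middle)
    Invariant (just (inj₂ q) , s) = ShapedStore ℓ s
    Invariant (nothing , s)       = ShapedStore ℓ s

    invariant-step : ∀ {x y} → (P ⨾ Q) ⊢ x ↦ y → Invariant x → Invariant y
    -- `P` is coin-free, so the step observed and the first step of the known run agree even if
    -- their coins differ.
    invariant-step (inj₁ p , s , c , refl , Cc , ι , eq , refl) ((p₁ , s₁ , c₁ , refl , Cc₁ , ι₁ , eq₁ , refl) ◅ xs)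
      with next P p (inputAt s) (scan s) c | trans (sym eq₁) (next-coinFree P P-coinFree p (inputAt s) (scan s) c₁ c)
    invariant-step (inj₁ p , s , c , refl , Cc , ι , refl , refl) (_ ◅ xs) | _ , just p′ | refl = xs
    invariant-step (inj₁ p , s , c , refl , Cc , ι , refl , refl) (_ ◅ ε)  | _ , nothing | refl = middle-shaped
    invariant-step (inj₁ p , s , c , refl , Cc , ι , refl , refl) (_ ◅ (_ , _ , _ , () , _) ◅ _)  | _ , nothing | refl
    invariant-step (inj₂ q , s , c , refl , Cc , ι , eq , refl) h
      with next Q q (inputAt s) (scan s) c | next-guarded Q Q-guarded q (inputAt s) (scan s) c
    invariant-step (inj₂ q , s , c , refl , Cc , ι , refl , refl) h | _ , just q′ | g = shaped-apply ι g h
    invariant-step (inj₂ q , s , c , refl , Cc , ι , refl , refl) h | _ , nothing | g = shaped-apply ι g h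

    invariant-path : ∀ {x y} → (P ⨾ Q) ⊢ x ↦* y → Invariant x → Invariant y
    invariant-path ε        h = h
    invariant-path (x ◅ xs) h = invariant-path xs (invariant-step x h)

    invariant-cells : ∀ mp s → Invariant (mp , s) → cells s ≤ K * (2 + ℓ)
    invariant-cells (just (inj₁ p)) s h =
      ℕ.≤-trans (cells-mono* h) (ℕ.≤-reflexive (cells-shaped (tapesOf middle) middle-shaped))
    invariant-cells (just (inj₂ q)) s h = ℕ.≤-reflexive (cells-shaped (tapesOf s) h)
    invariant-cells nothing         s h = ℕ.≤-reflexive (cells-shaped (tapesOf s) h)

    space-bound : P ⊢ start-store ⇓ middle → ∀ {mp s} →
                  (P ⨾ Q) ⊢ (just (entry (P ⨾ Q)) , start-store) ↦* (mp , s) → cells s ≤ K * (2 + ℓ)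
    space-bound run xs = invariant-cells _ _ (invariant-path xs (complete run))

  module ToNTM (P : Prog) where

    -- State 0 stands for the finished program; it accepts and has no actions. In every other state
    -- the two values of the coin are offered as two actions.
    acceptor : NondeterministicTM σ
    acceptor = record
      { states = suc (ctlSize P) ; workTapes = K ; workSymbols = γ
      ; initial = encCtl? P (just (entry P)) ; accepting = zero
      ; δ = λ q i ss → case decCtl? P q of λ
          { nothing  → []
          ; (just p) → toAction P i ss (next P p i ss true) ∷ toAction P i ss (next P p i ss false) ∷ [] } }

    open NondeterministicTM acceptor

    module _ (w : List (Fin σ)) where
      open Semantics w (λ _ → ⊤) (true , tt)
      open Correspondence P w (λ _ → ⊤) (true , tt)

      ↦⇒Step : ∀ {x y} → P ⊢ x ↦ y → Step w (conf x) (conf y)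
      ↦⇒Step (p , s , c , refl , _ , ι , eq , refl)
        rewrite dec-enc P p = toAction P (inputAt s) (scan s) (next P p (inputAt s) (scan s) c) , mem c ,
          sym (trans (cong (λ e → perform w (toAction P (inputAt s) (scan s) e) (conf (just p , s))) eq) (perform-apply s zero ι _))
        where
        mem : ∀ c → toAction P (inputAt s) (scan s) (next P p (inputAt s) (scan s) c) List∈.∈
                (toAction P (inputAt s) (scan s) (next P p (inputAt s) (scan s) true)
                 ∷ toAction P (inputAt s) (scan s) (next P p (inputAt s) (scan s) false) ∷ [])
        mem true  = here refl
        mem false = there (here refl)

      Step⇒↦ : ∀ x {c′} → Step w (conf x) c′ → ∃[ y ] P ⊢ x ↦ y × c′ ≡ conf y
      Step⇒↦ (just p , s) (a , a∈ , refl) rewrite dec-enc P p with a∈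
      ... | here refl         = _ , (p , s , true , refl , tt , _ , refl , refl) ,
        perform-apply s zero (proj₁ (next P p (inputAt s) (scan s) true)) (proj₂ (next P p (inputAt s) (scan s) true))
      ... | there (here refl) = _ , (p , s , false , refl , tt , _ , refl , refl) ,
        perform-apply s zero (proj₁ (next P p (inputAt s) (scan s) false)) (proj₂ (next P p (inputAt s) (scan s) false))

      ↦*⇒Steps : ∀ {x y} → P ⊢ x ↦* y → Star (Step w) (conf x) (conf y)
      ↦*⇒Steps ε        = ε
      ↦*⇒Steps (x ◅ xs) = ↦⇒Step x ◅ ↦*⇒Steps xs

      Steps⇒↦* : ∀ x {c′} → Star (Step w) (conf x) c′ → ∃[ y ] P ⊢ x ↦* y × c′ ≡ conf y
      Steps⇒↦* x ε = x , ε , refl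
      Steps⇒↦* x (st ◅ sts) with Step⇒↦ x st
      ... | y , xy , refl with Steps⇒↦* y sts
      ... | z , yz , eq = z , xy ◅ yz , eq

      accepts⇔ : Accepts w ⇔ (∃[ s ] P ⊢ start-store ⇓ s)
      accepts⇔ = mk⇔ to (λ (s , d) → _ , ↦*⇒Steps (complete d) , refl)
        where
        to : Accepts w → ∃[ s ] P ⊢ start-store ⇓ s
        to (c , r , eq) with Steps⇒↦* (just (entry P) , start-store) r
        to (c , r , eq) | (nothing , s) , xs , refl = s , sound xs

      reachable-space : ∀ {c} → Reachable w c → ∃₂ λ mp s → P ⊢ (just (entry P) , start-store) ↦* (mp , s) × space c ≡ cells s
      reachable-space r with Steps⇒↦* (just (entry P) , start-store) r
      ... | (mp , s) , xs , refl = mp , s , xs , refl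

  module ToTransducer (P : Prog) where

    transducer : Transducer σ τ
    transducer = record
      { states = suc (ctlSize P) ; workTapes = K ; workSymbols = γ
      ; initial = encCtl? P (just (entry P))
      ; δ = λ q i ss → Maybe.map
          (λ p → toAction P i ss (next P p i ss true) , output (proj₁ (next P p i ss true))) (decCtl? P q) }

    open Transducer transducer

    module _ (w : List (Fin σ)) where
      open Semantics w (_≡ true) (true , refl)
      open Correspondence P w (_≡ true) (true , refl)

      conf⁺ : Point P → Configuration
      conf⁺ (mp , s) = conf (mp , s) , written s

      written-apply : ∀ ι s → written (applyM ι s) ≡ written s ++ List.fromMaybe (output ι)
      written-apply (just (onTape _ _)) s = sym (List.++-identityʳ _)
      written-apply (just (onHead _))   s = sym (List.++-identityʳ _)
      written-apply (just (emit _))     s = refl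
      written-apply nothing             s = sym (List.++-identityʳ _)

      ↦⇒Step : ∀ {x y} → P ⊢ x ↦ y → Step w (conf⁺ x) (conf⁺ y)
      ↦⇒Step (p , s , true , refl , refl , ι , eq , refl) rewrite dec-enc P p | eq =
        _ , _ , refl , sym (perform-apply s zero ι _) , written-apply ι s

      Step⇒↦ : ∀ x {c′} → Step w (conf⁺ x) c′ → ∃[ y ] P ⊢ x ↦ y × c′ ≡ conf⁺ y
      Step⇒↦ (just p , s) (a , o , eq , refl , refl) rewrite dec-enc P p with eq
      ... | refl = _ , (p , s , true , refl , refl , _ , refl , refl) ,
        cong₂ _,_ (perform-apply s zero (proj₁ (next P p (inputAt s) (scan s) true)) (proj₂ (next P p (inputAt s) (scan s) true))) (sym (written-apply (proj₁ (next P p (inputAt s) (scan s) true)) s))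

      ↦*⇒Steps : ∀ {x y} → P ⊢ x ↦* y → Star (Step w) (conf⁺ x) (conf⁺ y)
      ↦*⇒Steps ε        = ε
      ↦*⇒Steps (x ◅ xs) = ↦⇒Step x ◅ ↦*⇒Steps xs

      Steps⇒↦* : ∀ x {c′} → Star (Step w) (conf⁺ x) c′ → ∃[ y ] P ⊢ x ↦* y × c′ ≡ conf⁺ y
      Steps⇒↦* x ε = x , ε , refl
      Steps⇒↦* x (st ◅ sts) with Step⇒↦ x st
      ... | y , xy , refl with Steps⇒↦* y sts
      ... | z , yz , eq = z , xy ◅ yz , eq

      computes : ∀ {s} → P ⊢ start-store ⇓ s → ∃[ c ] Reachable w (c , written s) × observe δ w c ≡ nothing
      computes d = _ , ↦*⇒Steps (complete d) , refl

      reachable-space : ∀ {c o} → Reachable w (c , o) → ∃₂ λ mp s → P ⊢ (just (entry P) , start-store) ↦* (mp , s) × space c ≡ cells s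
      reachable-space r with Steps⇒↦* (just (entry P) , start-store) r
      ... | (mp , s) , xs , refl = mp , s , xs , refl

-- Fixed-width counters

module Digits (β : ℕ) where

  Digit′ : Set
  Digit′ = Fin (suc (suc β))

  up : ∀ {m} → Fin (suc m) → Maybe (Fin (suc m))
  up {zero}  zero    = nothing
  up {suc m} zero    = just (suc zero)
  up {suc m} (suc i) = Maybe.map suc (up i)

  down : ∀ {m} → Fin (suc m) → Maybe (Fin (suc m))
  down zero    = nothing
  down (suc i) = just (inject₁ i)

  up-just : ∀ {m} (i : Fin (suc m)) {j} → up i ≡ just j → toℕ j ≡ suc (toℕ i) × down j ≡ just i
  up-just {suc m} zero    refl = refl , refl
  up-just {suc m} (suc i) eq with up i in e
  up-just {suc m} (suc i) refl | just j with up-just i e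
  up-just {suc m} (suc i) refl | just (suc j) | p , q = cong suc p , cong (just ∘ suc) (just-inj q)
    where just-inj : ∀ {A : Set} {x y : A} → just x ≡ just y → x ≡ y
          just-inj refl = refl

  up-nothing : ∀ {m} (i : Fin (suc m)) → up i ≡ nothing → i ≡ fromℕ m
  up-nothing {zero}  zero    eq = refl
  up-nothing {suc m} (suc i) eq with up i in e
  ... | nothing = cong suc (up-nothing i e)

  -- Least significant digit first. Incrementing the largest number wraps around to zero, which is
  -- how overflow is noticed.
  inc dec : List Digit′ → List Digit′
  inc []       = []
  inc (d ∷ ds) with up d
  ... | just e  = e ∷ ds
  ... | nothing = zero ∷ inc ds
  dec []       = []
  dec (d ∷ ds) with down d
  ... | just e  = e ∷ ds
  ... | nothing = fromℕ _ ∷ dec ds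

  dec-inc : ∀ ds → dec (inc ds) ≡ ds
  dec-inc []       = refl
  dec-inc (d ∷ ds) with up d in e
  ... | just e′ rewrite proj₂ (up-just d e) = refl
  ... | nothing = cong₂ _∷_ (sym (up-nothing d e)) (dec-inc ds)

  length-inc : ∀ ds → length (inc ds) ≡ length ds
  length-inc []       = refl
  length-inc (d ∷ ds) with up d
  ... | just e  = refl
  ... | nothing = cong suc (length-inc ds)

  base : ℕ
  base = suc (suc β)

  val : List Digit′ → ℕ
  val []       = 0
  val (d ∷ ds) = toℕ d + base * val ds

  val-inc : ∀ ds → suc (val ds) < base ^ length ds → val (inc ds) ≡ suc (val ds)
  val-inc []       (s≤s ())
  val-inc (d ∷ ds) h with up d in e
  ... | just e′ = cong (_+ base * val ds) (proj₁ (up-just d e))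
  ... | nothing = trans (cong (base *_) (val-inc ds small))
      (trans (ℕ.*-suc base (val ds)) (cong (λ x → suc (x + base * val ds)) (sym top)))
    where
    top : toℕ d ≡ suc β
    top = trans (cong toℕ (up-nothing d e)) (Fin.toℕ-fromℕ (suc β))
    small : suc (val ds) < base ^ length ds
    small = ℕ.*-cancelˡ-< base _ _ (subst (_< base ^ suc (length ds))
      (trans (cong (λ x → suc (x + base * val ds)) top) (sym (ℕ.*-suc base (val ds)))) h)

  -- Numerals are iterated increments, so that the program `incr` acts on them by definition and
  -- `decr` by `dec-inc`. Their value is `x` only below `base ^ ℓ`.
  num : ℕ → ℕ → List Digit′
  num ℓ zero    = replicate ℓ zero
  num ℓ (suc x) = inc (num ℓ x)

  length-num : ∀ ℓ x → length (num ℓ x) ≡ ℓ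
  length-num ℓ zero    = List.length-replicate ℓ
  length-num ℓ (suc x) = trans (length-inc (num ℓ x)) (length-num ℓ x)

  val-zeros : ∀ ℓ → val (replicate ℓ zero) ≡ 0
  val-zeros zero    = refl
  val-zeros (suc ℓ) rewrite val-zeros ℓ = ℕ.*-zeroʳ base

  val-num : ∀ ℓ x → x < base ^ ℓ → val (num ℓ x) ≡ x
  val-num ℓ zero    h = val-zeros ℓ
  val-num ℓ (suc x) h = trans (val-inc (num ℓ x) (subst₂ (λ a b → suc a < base ^ b) (sym ih) (sym (length-num ℓ x)) h)) (cong suc ih)
    where
    ih : val (num ℓ x) ≡ x
    ih = val-num ℓ x (ℕ.<-trans (ℕ.n<1+n x) h)

  -- Lets `setDigit`, which writes one digit into a counter at zero, be read as the assignment of a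
  -- number.
  num-digit : ∀ ℓ (d : Digit′) → num (suc ℓ) (toℕ d) ≡ d ∷ replicate ℓ zero
  num-digit ℓ d = go (toℕ d) d refl
    where
    up-inject₁ : ∀ {m} (i : Fin m) → up (inject₁ i) ≡ just (suc i)
    up-inject₁ {suc zero}    zero    = refl
    up-inject₁ {suc (suc m)} zero    = refl
    up-inject₁ {suc (suc m)} (suc i) rewrite up-inject₁ i = refl
    go : ∀ x (d : Digit′) → toℕ d ≡ x → num (suc ℓ) x ≡ d ∷ replicate ℓ zero
    go zero    zero    eq = refl
    go (suc x) (suc i) eq
      rewrite go x (inject₁ i) (trans (Fin.toℕ-inject₁ i) (ℕ.suc-injective eq)) | up-inject₁ i = refl

  val< : ∀ ds → val ds < base ^ length ds
  val< []       = s≤s z≤n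
  val< (d ∷ ds) = ℕ.≤-trans (ℕ.+-monoˡ-≤ (base * val ds) (Fin.toℕ<n d))
    (ℕ.≤-trans (ℕ.≤-reflexive (sym (ℕ.*-suc base (val ds)))) (ℕ.*-monoʳ-≤ base (val< ds)))

  val-overflow : ∀ ds → suc (val ds) ≡ base ^ length ds → val (inc ds) ≡ 0
  val-overflow []       h = refl
  val-overflow (d ∷ ds) h with up d in e
  ... | just e′ = contradiction (trans (cong (_+ base * val ds) (proj₁ (up-just d e))) h) (ℕ.<⇒≢ (val< (e′ ∷ ds)))
  ... | nothing = trans (cong (base *_) (val-overflow ds (ℕ.*-cancelˡ-≡ _ _ base (trans (ℕ.*-suc base (val ds))
      (trans (cong (λ x → suc (x + base * val ds)) (sym top)) h))))) (ℕ.*-zeroʳ base)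
    where
    top : toℕ d ≡ suc β
    top = trans (cong toℕ (up-nothing d e)) (Fin.toℕ-fromℕ (suc β))

  zero? : Digit′ → Bool
  zero? zero    = true
  zero? (suc _) = false

  allZero : List Digit′ → Bool
  allZero []       = true
  allZero (d ∷ ds) = zero? d ∧ allZero ds

  allZero-zeros : ∀ ℓ → allZero (replicate ℓ zero) ≡ true
  allZero-zeros zero    = refl
  allZero-zeros (suc ℓ) = allZero-zeros ℓ

  allZero-val : ∀ ds → allZero ds ≡ true → val ds ≡ 0
  allZero-val []          h = refl
  allZero-val (zero ∷ ds) h rewrite allZero-val ds h = ℕ.*-zeroʳ base

  val-allZero : ∀ ds → val ds ≡ 0 → allZero ds ≡ true
  val-allZero []          h = refl
  val-allZero (zero ∷ ds) h = val-allZero ds (ℕ.m*n≡0⇒m≡0 (val ds) base (trans (ℕ.*-comm (val ds) base) h))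

  allZero-num : ∀ ℓ x → suc x < base ^ ℓ → allZero (num ℓ (suc x)) ≡ false
  allZero-num ℓ x h with allZero (num ℓ (suc x)) in e
  ... | false = refl
  ... | true with trans (sym (allZero-val (num ℓ (suc x)) e)) (val-num ℓ (suc x) h)
  ... | ()

-- Programs on counters

module Counters (σ τ K β : ℕ) where

  open Programs σ τ K β
  open Machines σ τ K β
  open Digits β

  sweep : Fin K → (Digit → Digit × Move) → Instr
  sweep r f = onTape r (guarded (λ _ → f))

  isHome isBlank : Symbol → Bool
  isHome home = true
  isHome _    = false
  isBlank blank = true
  isBlank _     = false

  isDigit : (Digit → Bool) → Symbol → Bool
  isDigit p (digit d) = p d
  isDigit p _         = false

  is-nothing : {A : Set} → Maybe A → Bool
  is-nothing = not ∘ Maybe.is-just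

  goHome : Fin K → Prog
  goHome r = instr (sweep r (_, left)) ⨾ while (tape? r (not ∘ isHome)) (instr (sweep r (_, left)))

  -- The common form of increment and decrement: carry over the digits on which `f` fails, replacing
  -- them by `c`, and apply `f` to the digit reached. If that cell is the final blank, the guarded
  -- write only turns back.
  change : Fin K → (Digit → Maybe Digit) → Digit → Prog
  change r f c = instr (sweep r (_, right))
    ⨾ while (tape? r (isDigit (is-nothing ∘ f))) (instr (sweep r (λ d → c , right)))
    ⨾ instr (sweep r (λ d → Maybe.fromMaybe d (f d) , left))
    ⨾ while (tape? r (not ∘ isHome)) (instr (sweep r (_, left)))

  incTape decTape : Fin K → Prog
  incTape r = change r up zero
  decTape r = change r down (fromℕ _)

  skipZeros : Fin K → Prog
  skipZeros r = instr (sweep r (_, right)) ⨾ while (tape? r (isDigit zero?)) (instr (sweep r (_, right)))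

  -- Positivity is tested by running over the zero digits from the low end: the head stops on the
  -- blank exactly for the number zero. It is brought home before each run of the body.
  whilePos : Fin K → Prog → Prog
  whilePos r P = skipZeros r
    ⨾ while (tape? r (not ∘ isBlank)) (goHome r ⨾ P ⨾ skipZeros r)
    ⨾ goHome r

  setDigit : Fin K → (InputSymbol σ → Digit) → Prog
  setDigit r f = instr (sweep r (_, right)) ⨾ instr (onTape r (guarded (λ i _ → f i , left)))

  module CounterSpecs (w : List (Fin σ)) (C : Bool → Set) (someC : ∃ C) where

    open Semantics w C someC

    -- Total correctness together with determinacy. The second field allows a given run of a
    -- compound program to be cut at known intermediate stores.
    record Spec (P : Prog) (s s′ : Store) : Set where
      constructor spec
      field
        run  : P ⊢ s ⇓ s′
        only : ∀ {s″} → P ⊢ s ⇓ s″ → s″ ≡ s′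
    open Spec public

    record Sure (t : Test) (s : Store) (b : Bool) : Set where
      constructor sure
      field certain : ∀ c → evalTest t (inputAt s) (scan s) c ≡ b

    sure-holds : ∀ {t s b} → Sure t s b → Holds t s b
    sure-holds (sure h) = proj₁ someC , proj₂ someC , h _

    sure-only : ∀ {t s b b′} → Sure t s b → Holds t s b′ → b′ ≡ b
    sure-only (sure h) (c , _ , e) = trans (sym e) (h c)

    spec-instr : ∀ x {s s′} → apply x s ≡ s′ → Spec (instr x) s s′
    spec-instr x refl = spec instr λ { instr → refl }

    infixr 5 _⨟_
    _⨟_ : ∀ {P Q s s′ s″} → Spec P s s′ → Spec Q s′ s″ → Spec (P ⨾ Q) s s″
    _⨟_ {Q = Q} p q = spec (run p ⨾ run q) λ { (p′ ⨾ q′) → only q (subst (λ x → Q ⊢ x ⇓ _) (only p p′) q′) }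

    spec-halt : ∀ {t P s} → Sure t s false → Spec (while t P) s s
    spec-halt {t} {P} {s} h = spec (halt (sure-holds h)) λ
      { (halt _)       → refl
      ; (repeat e _ _) → case sure-only h e of λ () }

    spec-repeat : ∀ {t P s s′ s″} → Sure t s true → Spec P s s′ → Spec (while t P) s′ s″ → Spec (while t P) s s″
    spec-repeat {t} {P} {s} h p q = spec (repeat (sure-holds h) (run p) (run q)) λ
      { (halt e)         → case sure-only h e of λ ()
      ; (repeat _ p′ q′) → only q (subst (λ x → while t P ⊢ x ⇓ _) (only p p′) q′) }

    spec-ifT : ∀ {t P Q s s′} → Sure t s true → Spec P s s′ → Spec (ifte t P Q) s s′
    spec-ifT {t} {s = s} h p = spec (ifT (sure-holds h) (run p)) λ
      { (ifT _ p′) → only p p′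
      ; (ifF e _)  → case sure-only h e of λ () }

    spec-ifF : ∀ {t P Q s s′} → Sure t s false → Spec Q s s′ → Spec (ifte t P Q) s s′
    spec-ifF {t} {s = s} h p = spec (ifF (sure-holds h) (run p)) λ
      { (ifF _ p′) → only p p′
      ; (ifT e _)  → case sure-only h e of λ () }

    put : Fin K → Store → Tape γ → Store
    put r s t = store (headAt s) (tapesOf s [ r ]≔ t) (written s)

    put-id : ∀ r s {t} → lookup (tapesOf s) r ≡ t → put r s t ≡ s
    put-id r s refl = cong (λ ts → store (headAt s) ts (written s)) (Vec.[]≔-lookup (tapesOf s) r)

    -- Below the tape r varies over a fixed store.
    module _ (r : Fin K) (s : Store) where

      spec-tape : ∀ a t {t′} → writeAndMove (interp a (inputAt s) (Tape.scanned t)) t ≡ t′ →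
                  Spec (instr (onTape r a)) (put r s t) (put r s t′)
      spec-tape a t refl = spec-instr (onTape r a) (cong (λ ts → store (headAt s) ts (written s))
        (trans (Vec.[]≔-idempotent (tapesOf s) r)
          (cong (λ x → tapesOf s [ r ]≔ writeAndMove (interp a (inputAt s) (Tape.scanned x)) x) (Vec.lookup∘update r (tapesOf s) t))))

      sure-tape : ∀ p t {b} → p (Tape.scanned t) ≡ b → Sure (tape? r p) (put r s t) b
      sure-tape p t refl = sure λ c → cong p (trans (Vec.lookup-map r Tape.scanned (tapesOf s [ r ]≔ t))
        (cong Tape.scanned (Vec.lookup∘update r (tapesOf s) t)))

      returning : List Digit → List Digit → Tape γ
      returning []       ds = resting ds
      returning (x ∷ xs) ds = scanning xs (x ∷ ds)

      spec-return : ∀ xs ds → Spec (while (tape? r (not ∘ isHome)) (instr (sweep r (_, left))))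
                                   (put r s (returning xs ds)) (put r s (resting (xs ʳ++ ds)))
      spec-return []            ds = spec-halt (sure-tape _ (resting ds) refl)
      spec-return (x ∷ [])      ds = spec-repeat (sure-tape _ (scanning [] (x ∷ ds)) refl)
        (spec-tape _ (scanning [] (x ∷ ds)) refl) (spec-return [] (x ∷ ds))
      spec-return (x ∷ y ∷ xs)  ds = spec-repeat (sure-tape _ (scanning (y ∷ xs) (x ∷ ds)) refl)
        (spec-tape _ (scanning (y ∷ xs) (x ∷ ds)) refl) (spec-return (y ∷ xs) (x ∷ ds))

      step-home : ∀ f ds → Spec (instr (sweep r f)) (put r s (resting ds)) (put r s (scanning [] ds))
      step-home f []       = spec-tape _ (resting []) refl
      step-home f (d ∷ ds) = spec-tape _ (resting (d ∷ ds)) refl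

      step-right : ∀ f xs d ds {e} → f d ≡ (e , right) →
                   Spec (instr (sweep r f)) (put r s (scanning xs (d ∷ ds))) (put r s (scanning (e ∷ xs) ds))
      step-right f xs d []        eq = spec-tape _ (scanning xs (d ∷ [])) (cong (λ x → writeAndMove (digit (proj₁ x) , proj₂ x) (scanning xs (d ∷ []))) eq)
      step-right f xs d (d′ ∷ ds) eq = spec-tape _ (scanning xs (d ∷ d′ ∷ ds)) (cong (λ x → writeAndMove (digit (proj₁ x) , proj₂ x) (scanning xs (d ∷ d′ ∷ ds))) eq)

      step-left : ∀ (f : InputSymbol σ → Digit → Digit × Move) xs d ds {e} → f (inputAt s) d ≡ (e , left) →
                  Spec (instr (onTape r (guarded f))) (put r s (scanning xs (d ∷ ds))) (put r s (returning xs (e ∷ ds)))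
      step-left f []       d ds eq = spec-tape _ (scanning [] (d ∷ ds)) (cong (λ x → writeAndMove (digit (proj₁ x) , proj₂ x) (scanning [] (d ∷ ds))) eq)
      step-left f (x ∷ xs) d ds eq = spec-tape _ (scanning (x ∷ xs) (d ∷ ds)) (cong (λ y → writeAndMove (digit (proj₁ y) , proj₂ y) (scanning (x ∷ xs) (d ∷ ds))) eq)

      step-blank : ∀ f xs → Spec (instr (sweep r f)) (put r s (scanning xs [])) (put r s (returning xs []))
      step-blank f []       = spec-tape _ (scanning [] []) refl
      step-blank f (x ∷ xs) = spec-tape _ (scanning (x ∷ xs) []) refl

      spec-goHome : ∀ xs ds → Spec (goHome r) (put r s (scanning xs ds)) (put r s (resting (xs ʳ++ ds)))
      spec-goHome xs []       = step-blank _ xs ⨟ spec-return xs []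
      spec-goHome xs (d ∷ ds) = step-left _ xs d ds refl ⨟ spec-return xs (d ∷ ds)

      changed : (Digit → Maybe Digit) → Digit → List Digit → List Digit
      changed f c []       = []
      changed f c (d ∷ ds) with f d
      ... | just e  = e ∷ ds
      ... | nothing = c ∷ changed f c ds

      spec-change : ∀ f c ds → Spec (change r f c) (put r s (resting ds)) (put r s (resting (changed f c ds)))
      spec-change f c ds = step-home _ ds ⨟ go [] ds
        where
        go : ∀ xs ds → Spec (while (tape? r (isDigit (is-nothing ∘ f))) (instr (sweep r (λ d → c , right)))
               ⨾ instr (sweep r (λ d → Maybe.fromMaybe d (f d) , left))
               ⨾ while (tape? r (not ∘ isHome)) (instr (sweep r (_, left))))
               (put r s (scanning xs ds)) (put r s (resting (xs ʳ++ changed f c ds)))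
        go xs [] = spec-halt (sure-tape _ (scanning xs []) refl) ⨟ step-blank _ xs ⨟ spec-return xs []
        go xs (d ∷ ds) with f d in eq
        ... | just e = spec-halt (sure-tape _ (scanning xs (d ∷ ds)) (cong is-nothing eq))
                ⨟ step-left _ xs d ds (cong (λ x → Maybe.fromMaybe d x , left) eq) ⨟ spec-return xs (e ∷ ds)
        -- The recursive specification speaks of the loop followed by the return home. One more
        -- round has to be spliced in at the front of the loop, so both derivations are taken apart.
        ... | nothing with go (c ∷ xs) ds
        ... | spec (l ⨾ m) u = spec
              (repeat (sure-holds sureT) (run first) l ⨾ m)
              λ { (halt e ⨾ _)         → case sure-only sureT e of λ ()
                ; (repeat _ p l′ ⨾ m′) → u (subst (λ x → while t B ⊢ x ⇓ _) (only first p) l′ ⨾ m′) }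
          where
          t = tape? r (isDigit (is-nothing ∘ f))
          B = instr (sweep r (λ d → c , right))
          sureT = sure-tape (isDigit (is-nothing ∘ f)) (scanning xs (d ∷ ds)) (cong is-nothing eq)
          first = step-right (λ _ → c , right) xs d ds refl

      spec-incTape : ∀ ds → Spec (incTape r) (put r s (resting ds)) (put r s (resting (inc ds)))
      spec-incTape ds = subst (λ x → Spec (incTape r) (put r s (resting ds)) (put r s (resting x))) (same ds) (spec-change up zero ds)
        where
        same : ∀ ds → changed up zero ds ≡ inc ds
        same []       = refl
        same (d ∷ ds) with up d
        ... | just e  = refl
        ... | nothing = cong (zero ∷_) (same ds)

      spec-decTape : ∀ ds → Spec (decTape r) (put r s (resting ds)) (put r s (resting (dec ds)))
      spec-decTape ds = subst (λ x → Spec (decTape r) (put r s (resting ds)) (put r s (resting x))) (same ds) (spec-change down (fromℕ _) ds)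
        where
        same : ∀ ds → changed down (fromℕ _) ds ≡ dec ds
        same []       = refl
        same (d ∷ ds) with down d
        ... | just e  = refl
        ... | nothing = cong (fromℕ _ ∷_) (same ds)

      spec-setDigit : ∀ f d ds → Spec (setDigit r f) (put r s (resting (d ∷ ds))) (put r s (resting (f (inputAt s) ∷ ds)))
      spec-setDigit f d ds = step-home _ (d ∷ ds) ⨟ step-left (λ i _ → f i , left) [] d ds refl

      spec-skipZeros : ∀ ds → ∃₂ λ xs es → Spec (skipZeros r) (put r s (resting ds)) (put r s (scanning xs es))
        × xs ʳ++ es ≡ ds × isBlank (Tape.scanned (scanning xs es)) ≡ allZero ds
      spec-skipZeros ds = let (xs , es , p , q , z) = go [] ds in xs , es , step-home _ ds ⨟ p , q , z
        where
        go : ∀ ys ds → ∃₂ λ xs es →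
          Spec (while (tape? r (isDigit zero?)) (instr (sweep r (_, right)))) (put r s (scanning ys ds)) (put r s (scanning xs es))
          × xs ʳ++ es ≡ ys ʳ++ ds × isBlank (Tape.scanned (scanning xs es)) ≡ allZero ds
        go ys []           = ys , [] , spec-halt (sure-tape _ (scanning ys []) refl) , refl , refl
        go ys (suc d ∷ ds) = ys , suc d ∷ ds , spec-halt (sure-tape _ (scanning ys (suc d ∷ ds)) refl) , refl , refl
        go ys (zero ∷ ds)  =
          let (xs , es , p , q , z) = go (zero ∷ ys) ds in
          xs , es , spec-repeat (sure-tape _ (scanning ys (zero ∷ ds)) refl) (step-right _ ys zero ds refl) p , q , z

    whilePos-zero : ∀ r P {s ds} → lookup (tapesOf s) r ≡ resting ds → allZero ds ≡ true → Spec (whilePos r P) s s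
    whilePos-zero r P {s} {ds} at z with put-id r s at | spec-skipZeros r s ds
    ... | same | xs , es , skip , eq , b =
      subst (λ x → Spec (whilePos r P) x x) same
        (skip ⨟ spec-halt (sure-tape r s (not ∘ isBlank) (scanning xs es) (cong not (trans b z)))
              ⨟ subst (λ x → Spec (goHome r) (put r s (scanning xs es)) (put r s (resting x))) eq (spec-goHome r s xs es))

    module _ (r : Fin K) (P : Prog) {s : Store} {ds : List Digit}
             (at : lookup (tapesOf s) r ≡ resting ds) (nz : allZero ds ≡ false) where

      private
        t = tape? r (not ∘ isBlank)

        back : ∀ xs es → xs ʳ++ es ≡ ds → Spec (goHome r) (put r s (scanning xs es)) s
        back xs es eq = subst (Spec (goHome r) (put r s (scanning xs es)))
          (trans (cong (put r s ∘ resting) eq) (put-id r s at)) (spec-goHome r s xs es)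

      whilePos-unroll : ∀ {s′ s″} → P ⊢ s ⇓ s′ → whilePos r P ⊢ s′ ⇓ s″ → whilePos r P ⊢ s ⇓ s″
      whilePos-unroll p (sk ⨾ loop ⨾ gh) with spec-skipZeros r s ds
      ... | xs , es , skip , eq , b =
        subst (λ x → skipZeros r ⊢ x ⇓ put r s (scanning xs es)) (put-id r s at) (run skip)
        ⨾ repeat (sure-holds (sure-tape r s (not ∘ isBlank) (scanning xs es) (cong not (trans b nz))))
                 (run (back xs es eq) ⨾ p ⨾ sk) loop
        ⨾ gh

      -- Bodies that toss coins have no `Spec`; their loops are analysed round by round with this
      -- lemma and built up with `whilePos-unroll`.
      whilePos-split : ∀ {s″} → whilePos r P ⊢ s ⇓ s″ → ∃[ s′ ] (P ⊢ s ⇓ s′) × (whilePos r P ⊢ s′ ⇓ s″)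
      whilePos-split (sk ⨾ loop ⨾ gh) with spec-skipZeros r s ds
      ... | xs , es , skip , eq , b
        with only skip (subst (λ x → skipZeros r ⊢ x ⇓ _) (sym (put-id r s at)) sk)
      whilePos-split (sk ⨾ halt e ⨾ gh) | xs , es , skip , eq , b | refl =
        case sure-only (sure-tape r s (not ∘ isBlank) (scanning xs es) (cong not (trans b nz))) e of λ ()
      whilePos-split (sk ⨾ repeat e (g ⨾ p ⨾ sk′) loop ⨾ gh) | xs , es , skip , eq , b | refl
        rewrite only (back xs es eq) g = _ , p , sk′ ⨾ loop ⨾ gh

      whilePos-spec : ∀ {s′ s″} → Spec P s s′ → Spec (whilePos r P) s′ s″ → Spec (whilePos r P) s s″
      whilePos-spec p q = spec (whilePos-unroll (run p) (run q)) λ d →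
        let (_ , p′ , q′) = whilePos-split d in only q (subst (λ x → whilePos r P ⊢ x ⇓ _) (only p p′) q′)

-- Truncated primitive recursive functions, computed by programs on counters

-- Fn σ m: functions of m arguments and of an input word over Fin σ.
-- All values are truncated at cap.
data Fn (σ : ℕ) : ℕ → Set where
  var  : ∀ {m} → Fin m → Fn σ m
  zer  : ∀ {m} → Fn σ m
  succ : ∀ {m} → Fn σ m → Fn σ m
  prd  : ∀ {m} → Fn σ m → Fn σ m
  comp : ∀ {k m} → Fn σ k → Vec (Fn σ m) k → Fn σ m
  iter : ∀ {m} → Fn σ m → Fn σ m → Fn σ (2 + m) → Fn σ m
  sym′ : ∀ {m} → Fn σ m → Fn σ m
  len  : ∀ {m} → Fn σ m

notLeftEnd notRightEnd : ∀ {σ} → InputSymbol σ → Bool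
notLeftEnd ⊢ = false
notLeftEnd _ = true
notRightEnd ⊣ = false
notRightEnd _ = true

code : ∀ {σ} → InputSymbol σ → ℕ
code ⊢        = 0
code ⊣        = 1
code (char a) = 2 + toℕ a

code< : ∀ {σ} (a : InputSymbol σ) → code a < 2 + σ
code< ⊢        = s≤s z≤n
code< ⊣        = s≤s (s≤s z≤n)
code< (char a) = s≤s (s≤s (Fin.toℕ<n a))

readInput-notLeftEnd : ∀ {σ} (w : List (Fin σ)) i → notLeftEnd (readInput w (suc i)) ≡ true
readInput-notLeftEnd []      i       = refl
readInput-notLeftEnd (a ∷ w) zero    = refl
readInput-notLeftEnd (a ∷ w) (suc i) = readInput-notLeftEnd w i

readInput-inside : ∀ {σ} (w : List (Fin σ)) {i} → i < length w → notRightEnd (readInput w (suc i)) ≡ true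
readInput-inside (a ∷ w) {zero}  h       = refl
readInput-inside (a ∷ w) {suc i} (s≤s h) = readInput-inside w h

readInput-outside : ∀ {σ} (w : List (Fin σ)) {i} → length w ≤ i → readInput w (suc i) ≡ ⊣
readInput-outside []              h       = refl
readInput-outside (a ∷ w) {suc i} (s≤s h) = readInput-outside w h

-- All positions beyond the word read as the right end marker, which is where the head is held.
readInput-clamp : ∀ {σ} (w : List (Fin σ)) i → readInput w (i ⊓ suc (length w)) ≡ readInput w i
readInput-clamp w i with ℕ.≤-total i (suc (length w))
... | inj₁ h = cong (readInput w) (ℕ.m≤n⇒m⊓n≡m h)
readInput-clamp w (suc i) | inj₂ (s≤s h) = trans (cong (readInput w) (ℕ.m≥n⇒m⊓n≡n (s≤s h)))
  (trans (readInput-outside w ℕ.≤-refl) (sym (readInput-outside w h)))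

-- The step function is applied to the indices n − 1, …, 0 in this order.
foldDown : ∀ {A : Set} → (ℕ → A → A) → ℕ → A → A
foldDown f zero    a = a
foldDown f (suc n) a = foldDown f n (f n a)

module Evaluation {σ : ℕ} (w : List (Fin σ)) (cap : ℕ) where

  mutual
    eval : ∀ {m} → Fn σ m → Vec ℕ m → ℕ
    eval (var i)      ρ = lookup ρ i
    eval zer          ρ = 0
    eval (succ f)     ρ = suc (eval f ρ) ⊓ cap
    eval (prd f)      ρ = pred (eval f ρ)
    eval (comp f gs)  ρ = eval f (evals gs ρ)
    eval (iter n z s) ρ = foldDown (λ i a → eval s (i ∷ a ∷ ρ)) (eval n ρ) (eval z ρ)
    eval (sym′ f)     ρ = code (readInput w (eval f ρ))
    eval len          ρ = length w

    evals : ∀ {k m} → Vec (Fn σ m) k → Vec ℕ m → Vec ℕ k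
    evals []       ρ = []
    evals (g ∷ gs) ρ = eval g ρ ∷ evals gs ρ

mutual
  -- How many registers, from the result register upwards, the program for a function may overwrite.
  footprint : ∀ {σ m} → Fn σ m → ℕ
  footprint (var i)              = 2
  footprint zer                  = 1
  footprint (succ f)             = footprint f
  footprint (prd f)              = footprint f
  footprint (comp {k} f gs)      = 1 + (footprints gs + (k + footprint f))
  footprint (iter n z s)         = footprint n + (1 + (footprint z + (1 + footprint s)))
  footprint (sym′ f)             = footprint f
  footprint len                  = 1

  footprints : ∀ {σ k m} → Vec (Fn σ m) k → ℕ
  footprints []       = 0
  footprints (g ∷ gs) = footprint g + (1 + footprints gs)

module Registers (σ τ K-1 β : ℕ) (σ≤β : σ ≤ β) where

  K : ℕ
  K = suc K-1

  open Programs σ τ K β public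
  open Machines σ τ K β public
  open Digits β public
  open Counters σ τ K β public

  opaque
    -- Programs address registers by plain numbers. Numbers out of range fall back to register 0;
    -- the specifications assume `r < K`.
    reg : ℕ → Fin K
    reg r with r ℕ.<? K
    ... | yes r<K = fromℕ< r<K
    ... | no _    = zero

    toℕ-reg : ∀ {r} → r < K → toℕ (reg r) ≡ r
    toℕ-reg {r} r<K with r ℕ.<? K
    ... | yes p  = Fin.toℕ-fromℕ< p
    ... | no r≮K = contradiction r<K r≮K

  skip : Prog
  skip = instr (onHead stay)

  opaque
    incr decr : ℕ → Prog
    incr r = incTape (reg r)
    decr r = decTape (reg r)

    whileR : ℕ → Prog → Prog
    whileR r = whilePos (reg r)

    ifR : ℕ → Prog → Prog → Prog
    ifR r P Q = skipZeros (reg r) ⨾ ifte (tape? (reg r) (not ∘ isBlank)) (goHome (reg r) ⨾ P) (goHome (reg r) ⨾ Q)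

  opaque
    clear : ℕ → Prog
    clear r = whileR r (decr r)

    move : ℕ → ℕ → Prog
    move a b = clear b ⨾ whileR a (decr a ⨾ incr b)

    -- Transfer destroys its source, so `a` is emptied into the auxiliary register `t`, from which
    -- `a` and `b` are then filled together.
    copy : ℕ → ℕ → ℕ → Prog
    copy a b t = clear b ⨾ clear t ⨾ whileR a (decr a ⨾ incr t) ⨾ whileR t (decr t ⨾ incr a ⨾ incr b)

  rewind : Prog
  rewind = while (input? notLeftEnd) (instr (onHead left))

  codeDigit : InputSymbol σ → Digit
  codeDigit a = fromℕ< (ℕ.<-≤-trans (code< a) (s≤s (s≤s σ≤β)))

  registersFrom : ℕ → ∀ k → Vec ℕ k
  registersFrom d zero    = []
  registersFrom d (suc k) = d ∷ registersFrom (suc d) k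

  mutual
    evalP : ∀ {m} → Fn σ m → Vec ℕ m → ℕ → Prog
    evalP (var i)      rs d = copy (lookup rs i) d (suc d)
    evalP zer          rs d = clear d
    -- After an increment the counter is zero only if it has wrapped around; the decrement then
    -- takes it back to the cap.
    evalP (succ f)     rs d = evalP f rs d ⨾ incr d ⨾ ifR d skip (decr d)
    evalP (prd f)      rs d = evalP f rs d ⨾ ifR d (decr d) skip
    evalP (comp {k} f gs) rs d =
      evalsP gs rs (suc d) ⨾ evalP f (registersFrom (suc d) k) (suc d + k) ⨾ move (suc d + k) d
    evalP (iter n z s) rs d = evalP n rs d ⨾ evalP z rs (1 + d)
      ⨾ whileR d (decr d ⨾ evalP s (d ∷ 1 + d ∷ rs) (2 + d) ⨾ move (2 + d) (1 + d))
      ⨾ move (1 + d) d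
    -- The loop leaves `d` at zero, so overwriting its lowest digit makes it the code of the symbol;
    -- a code fits into one digit because `σ ≤ β`.
    evalP (sym′ f)     rs d = evalP f rs d ⨾ whileR d (decr d ⨾ instr (onHead right))
      ⨾ setDigit (reg d) codeDigit ⨾ rewind
    evalP len          rs d = clear d ⨾ instr (onHead right)
      ⨾ while (input? notRightEnd) (incr d ⨾ instr (onHead right)) ⨾ rewind

    evalsP : ∀ {k m} → Vec (Fn σ m) k → Vec ℕ m → ℕ → Prog
    evalsP []       rs d = skip
    evalsP (g ∷ gs) rs d = evalP g rs d ⨾ evalsP gs rs (suc d)

  set : (ℕ → ℕ) → ℕ → ℕ → ℕ → ℕ
  set R r x i with i ℕ.≟ r
  ... | yes _ = x
  ... | no _  = R i

  set-≡ : ∀ R r x → set R r x r ≡ x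
  set-≡ R r x with r ℕ.≟ r
  ... | yes _  = refl
  ... | no r≢r = contradiction refl r≢r

  set-≢ : ∀ R {r} x {i} → i ≢ r → set R r x i ≡ R i
  set-≢ R {r} x {i} i≢r with i ℕ.≟ r
  ... | yes i≡r = contradiction i≡r i≢r
  ... | no _    = refl

  tabulate-update : ∀ {A : Set} {k} (f : Fin k → A) (g : ℕ → A) (r : Fin k) {x} → g (toℕ r) ≡ x →
                    (∀ i → i ≢ r → f i ≡ g (toℕ i)) → Vec.tabulate f [ r ]≔ x ≡ Vec.tabulate (g ∘ toℕ)
  tabulate-update f g zero    h hs = cong₂ _∷_ (sym h) (Vec.tabulate-cong λ i → hs (suc i) λ ())
  tabulate-update f g (suc r) h hs = cong₂ _∷_ (hs zero λ ())
    (tabulate-update (f ∘ suc) (g ∘ suc) r h λ i i≢r → hs (suc i) (i≢r ∘ Fin.suc-injective))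

  module RegisterSpecs (w : List (Fin σ)) (C : Bool → Set) (someC : ∃ C)
                       (ℓ-1 cap : ℕ) (cap-eq : base ^ suc ℓ-1 ≡ suc cap) (w≤cap : length w ≤ cap) where

    open Semantics w C someC public
    open CounterSpecs w C someC public
    open Evaluation w cap public

    ℓ : ℕ
    ℓ = suc ℓ-1

    opaque
      st : ℕ → (ℕ → ℕ) → List (Fin τ) → Store
      st h R o = store h (Vec.tabulate λ r → resting (num ℓ (R (toℕ r)))) o

      st-put : ∀ {r} → r < K → ∀ {h R o} x → put (reg r) (st h R o) (resting (num ℓ x)) ≡ st h (set R r x) o
      st-put {r} r<K {h} {R} {o} x = cong (λ ts → store h ts o)
        (tabulate-update _ (λ i → resting (num ℓ (set R r x i))) (reg r)
          (cong (resting ∘ num ℓ) (trans (cong (set R r x) (toℕ-reg r<K)) (set-≡ R r x)))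
          λ i i≢r → cong (resting ∘ num ℓ) (sym (set-≢ R x λ e → i≢r (Fin.toℕ-injective (trans e (sym (toℕ-reg r<K)))))))

      st-lookup : ∀ {r} → r < K → ∀ {h R o x} → R r ≡ x → lookup (tapesOf (st h R o)) (reg r) ≡ resting (num ℓ x)
      st-lookup {r} r<K {R = R} refl = trans (Vec.lookup∘tabulate (λ i → resting (num ℓ (R (toℕ i)))) (reg r)) (cong (λ i → resting (num ℓ (R i))) (toℕ-reg r<K))

      onHead-spec : ∀ m {h R o} → Spec (instr (onHead m)) (st h R o) (st (moveInput w m h) R o)
      onHead-spec m = spec-instr (onHead m) refl

      emit-spec : ∀ a {h R o} → Spec (instr (emit a)) (st h R o) (st h R (o ++ [ a ]))
      emit-spec a = spec-instr (emit a) refl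

      inputAt-st : ∀ h R o → inputAt (st h R o) ≡ readInput w h
      inputAt-st h R o = refl

      written-st : ∀ h R o → written (st h R o) ≡ o
      written-st h R o = refl

    sure-input : ∀ p {h R o b} → p (readInput w h) ≡ b → Sure (input? p) (st h R o) b
    sure-input p {h} {R} {o} eq = sure λ c → trans (cong p (inputAt-st h R o)) eq

    opaque
      unfolding incr decr
      incr-spec : ∀ {r} → r < K → ∀ {h R o} → Spec (incr r) (st h R o) (st h (set R r (suc (R r))) o)
      incr-spec {r} r<K {h} {R} {o} = subst₂ (Spec (incr r)) (put-id (reg r) (st h R o) (st-lookup r<K refl)) (st-put r<K (suc (R r)))
        (spec-incTape (reg r) (st h R o) (num ℓ (R r)))

      decr-spec : ∀ {r} → r < K → ∀ {h R o x} → R r ≡ suc x → Spec (decr r) (st h R o) (st h (set R r x) o)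
      decr-spec {r} r<K {h} {R} {o} {x} eq = subst₂ (Spec (decr r)) (put-id (reg r) (st h R o) (st-lookup r<K eq))
        (trans (cong (put (reg r) (st h R o) ∘ resting) (dec-inc (num ℓ x))) (st-put r<K x))
        (spec-decTape (reg r) (st h R o) (num ℓ (suc x)))

    pos : ∀ {x} → suc x ≤ cap → allZero (num ℓ (suc x)) ≡ false
    pos {x} h = allZero-num ℓ x (subst (suc x <_) (sym cap-eq) (s≤s h))

    opaque
      unfolding whileR
      whileR-zero : ∀ {r P} → r < K → ∀ {h R o} → R r ≡ 0 → Spec (whileR r P) (st h R o) (st h R o)
      whileR-zero {r} {P} r<K eq = whilePos-zero (reg r) P {ds = num ℓ 0} (st-lookup r<K eq) (allZero-zeros ℓ)

      whileR-step : ∀ {r P} → r < K → ∀ {h R o x s′ s″} → R r ≡ suc x → suc x ≤ cap →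
                    Spec P (st h R o) s′ → Spec (whileR r P) s′ s″ → Spec (whileR r P) (st h R o) s″
      whileR-step {r} {P} r<K {R = R} eq x≤ = whilePos-spec (reg r) P (st-lookup r<K eq) (pos x≤)

      whileR-unroll : ∀ {r P} → r < K → ∀ {h R o x s′ s″} → R r ≡ suc x → suc x ≤ cap →
                      P ⊢ st h R o ⇓ s′ → whileR r P ⊢ s′ ⇓ s″ → whileR r P ⊢ st h R o ⇓ s″
      whileR-unroll {r} {P} r<K eq x≤ = whilePos-unroll (reg r) P (st-lookup r<K eq) (pos x≤)

      whileR-split : ∀ {r P} → r < K → ∀ {h R o x s″} → R r ≡ suc x → suc x ≤ cap →
                     whileR r P ⊢ st h R o ⇓ s″ → ∃[ s′ ] (P ⊢ st h R o ⇓ s′) × (whileR r P ⊢ s′ ⇓ s″)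
      whileR-split {r} {P} r<K eq x≤ = whilePos-split (reg r) P (st-lookup r<K eq) (pos x≤)

    opaque
      unfolding ifR
      ifR-at : ∀ r P Q {s ds s′} → lookup (tapesOf s) (reg r) ≡ resting ds →
               Spec (if allZero ds then Q else P) s s′ → Spec (ifR r P Q) s s′
      ifR-at r P Q {s} {ds} {s′} at p with put-id (reg r) s at | spec-skipZeros (reg r) s ds
      ... | same | xs , es , sk , eq , b =
        subst (λ x → Spec (ifR r P Q) x s′) same (sk ⨟ branch (allZero ds) b p)
        where
        home′ : Spec (goHome (reg r)) (put (reg r) s (scanning xs es)) s
        home′ = subst (Spec (goHome (reg r)) (put (reg r) s (scanning xs es)))
          (trans (cong (put (reg r) s ∘ resting) eq) same) (spec-goHome (reg r) s xs es)
        branch : ∀ z → isBlank (Tape.scanned (scanning xs es)) ≡ z → Spec (if z then Q else P) s s′ →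
                 Spec (ifte (tape? (reg r) (not ∘ isBlank)) (goHome (reg r) ⨾ P) (goHome (reg r) ⨾ Q))
                      (put (reg r) s (scanning xs es)) s′
        branch true  e p = spec-ifF (sure-tape (reg r) s (not ∘ isBlank) (scanning xs es) (cong not e)) (home′ ⨟ p)
        branch false e p = spec-ifT (sure-tape (reg r) s (not ∘ isBlank) (scanning xs es) (cong not e)) (home′ ⨟ p)

      ifR-split : ∀ r P Q {s ds s′} → lookup (tapesOf s) (reg r) ≡ resting ds →
                  ifR r P Q ⊢ s ⇓ s′ → (if allZero ds then Q else P) ⊢ s ⇓ s′
      ifR-split r P Q {s} {ds} {s′} at (sk ⨾ d) with put-id (reg r) s at | spec-skipZeros (reg r) s ds
      ... | same | xs , es , skips , eq , b
        with only skips (subst (λ x → skipZeros (reg r) ⊢ x ⇓ _) (sym same) sk)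
      ... | refl = branch (allZero ds) b d
        where
        home′ : Spec (goHome (reg r)) (put (reg r) s (scanning xs es)) s
        home′ = subst (Spec (goHome (reg r)) (put (reg r) s (scanning xs es)))
          (trans (cong (put (reg r) s ∘ resting) eq) same) (spec-goHome (reg r) s xs es)
        sureT : ∀ {z} → isBlank (Tape.scanned (scanning xs es)) ≡ z → Sure (tape? (reg r) (not ∘ isBlank)) (put (reg r) s (scanning xs es)) (not z)
        sureT e = sure-tape (reg r) s (not ∘ isBlank) (scanning xs es) (cong not e)
        branch : ∀ z → isBlank (Tape.scanned (scanning xs es)) ≡ z →
                 ifte (tape? (reg r) (not ∘ isBlank)) (goHome (reg r) ⨾ P) (goHome (reg r) ⨾ Q) ⊢ put (reg r) s (scanning xs es) ⇓ s′ →
                 (if z then Q else P) ⊢ s ⇓ s′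
        branch true  e (ifT h _)       = case sure-only (sureT e) h of λ ()
        branch true  e (ifF _ (g ⨾ q)) = subst (λ x → Q ⊢ x ⇓ s′) (only home′ g) q
        branch false e (ifT _ (g ⨾ p)) = subst (λ x → P ⊢ x ⇓ s′) (only home′ g) p
        branch false e (ifF h _)       = case sure-only (sureT e) h of λ ()

    ifR-zero-split : ∀ {r P Q} → r < K → ∀ {h R o s′} → R r ≡ 0 → ifR r P Q ⊢ st h R o ⇓ s′ → Q ⊢ st h R o ⇓ s′
    ifR-zero-split {r} {P} {Q} r<K {h} {R} {o} {s′} eq d = subst (λ z → (if z then Q else P) ⊢ st h R o ⇓ s′) (allZero-zeros ℓ)
      (ifR-split r P Q {ds = num ℓ 0} (st-lookup r<K eq) d)

    ifR-pos : ∀ {r P Q} → r < K → ∀ {h R o x s′} → R r ≡ suc x → suc x ≤ cap →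
              Spec P (st h R o) s′ → Spec (ifR r P Q) (st h R o) s′
    ifR-pos {r} {P} {Q} r<K {h} {R} {o} {s′ = s′} eq x≤ p =
      ifR-at r P Q (st-lookup r<K eq) (subst (λ z → Spec (if z then Q else P) (st h R o) s′) (sym (pos x≤)) p)

    ifR-zero : ∀ {r P Q} → r < K → ∀ {h R o s′} → R r ≡ 0 → Spec Q (st h R o) s′ → Spec (ifR r P Q) (st h R o) s′
    ifR-zero {r} {P} {Q} r<K {h} {R} {o} {s′} eq p =
      ifR-at r P Q {ds = num ℓ 0} (st-lookup r<K eq) (subst (λ z → Spec (if z then Q else P) (st h R o) s′) (sym (allZero-zeros ℓ)) p)

    ifR-overflow : ∀ {r P Q} → r < K → ∀ {h R o s′} → R r ≡ suc cap → Spec Q (st h R o) s′ → Spec (ifR r P Q) (st h R o) s′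
    ifR-overflow {r} {P} {Q} r<K {h} {R} {o} {s′} eq p =
      ifR-at r P Q (st-lookup r<K eq) (subst (λ z → Spec (if z then Q else P) (st h R o) s′) (sym over) p)
      where
      over : allZero (num ℓ (suc cap)) ≡ true
      over = val-allZero (num ℓ (suc cap)) (val-overflow (num ℓ cap)
        (trans (cong suc (val-num ℓ cap (subst (cap <_) (sym cap-eq) (ℕ.n<1+n cap)))) (trans (sym cap-eq) (cong (base ^_) (sym (length-num ℓ cap))))))

    Bounded : (ℕ → ℕ) → Set
    Bounded R = ∀ i → R i ≤ cap

    set-bounded : ∀ {R r x} → Bounded R → x ≤ cap → Bounded (set R r x)
    set-bounded {R} {r} b x≤ i with i ℕ.≟ r
    ... | yes _ = x≤
    ... | no _  = b i

    -- A specification that hides the final registers and keeps only the property `Q` of them, so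
    -- that specifications can be chained by `_>>>_` without writing out register contents.
    record Yields (P : Prog) (h : ℕ) (R : ℕ → ℕ) (o : List (Fin τ)) (h′ : ℕ) (o′ : List (Fin τ)) (Q : (ℕ → ℕ) → Set) : Set where
      constructor yields
      field
        {after}   : ℕ → ℕ
        execution : Spec P (st h R o) (st h′ after o′)
        property  : Q after

    Does : Prog → (ℕ → ℕ) → List (Fin τ) → ((ℕ → ℕ) → Set) → Set
    Does P R o Q = Yields P 0 R o 0 o Q

    infixr 1 _>>>_
    _>>>_ : ∀ {P P′ h h′ h″ R o o′ o″ Q Q′} → Yields P h R o h′ o′ Q → (∀ {R′} → Q R′ → Yields P′ h′ R′ o′ h″ o″ Q′) →
            Yields (P ⨾ P′) h R o h″ o″ Q′
    yields e q >>> k with k q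
    ... | yields e′ q′ = yields (e ⨟ e′) q′

    weaken : ∀ {P h h′ R o o′ Q Q′} → Yields P h R o h′ o′ Q → (∀ {R′} → Q R′ → Q′ R′) → Yields P h R o h′ o′ Q′
    weaken (yields e q) f = yields e (f q)

    incr-does : ∀ {r} → r < K → ∀ {h R o} → Yields (incr r) h R o h o (_≡ set R r (suc (R r)))
    incr-does r<K = yields (incr-spec r<K) refl

    decr-does : ∀ {r} → r < K → ∀ {h R o x} → R r ≡ suc x → Yields (decr r) h R o h o (_≡ set R r x)
    decr-does r<K eq = yields (decr-spec r<K eq) refl

    skip-does : ∀ {R o} → Does skip R o (_≡ R)
    skip-does = yields (onHead-spec stay) refl

    while-does : ∀ {r P} → r < K → ∀ {R o h h′ h″ x Q Q′} → R r ≡ suc x → suc x ≤ cap →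
                 Yields P h R o h′ o Q → (∀ {R′} → Q R′ → Yields (whileR r P) h′ R′ o h″ o Q′) → Yields (whileR r P) h R o h″ o Q′
    while-does r<K eq x≤ (yields e q) k with k q
    ... | yields e′ q′ = yields (whileR-step r<K eq x≤ e e′) q′

    Same : (ℕ → Set) → (ℕ → ℕ) → (ℕ → ℕ) → Set
    Same D R R′ = ∀ {i} → D i → R′ i ≡ R i

    opaque
      unfolding clear
      clear-does : ∀ {r} → r < K → ∀ {R o} → Bounded R → Does (clear r) R o λ R′ → Bounded R′ × R′ r ≡ 0 × Same (_≢ r) R R′
      clear-does {r} r<K {R} b = go _ refl b
        where
        go : ∀ x {R o} → R r ≡ x → Bounded R → Does (clear r) R o λ R′ → Bounded R′ × R′ r ≡ 0 × Same (_≢ r) R R′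
        go zero    eq b = yields (whileR-zero r<K eq) (b , eq , λ _ → refl)
        go (suc x) {R} eq b = while-does r<K eq x≤ (decr-does r<K eq) λ { refl →
          weaken (go x (set-≡ R r x) (set-bounded b (ℕ.≤-trans (ℕ.n≤1+n _) x≤)))
            λ (b′ , z , s) → b′ , z , λ i≢r → trans (s i≢r) (set-≢ R x i≢r) }
          where
          x≤ : suc x ≤ cap
          x≤ = subst (_≤ cap) eq (b r)

    transfer-does : ∀ {a b} → a < K → b < K → a ≢ b → ∀ {R o} → Bounded R → R b + R a ≤ cap →
      Does (whileR a (decr a ⨾ incr b)) R o λ R′ → Bounded R′ × R′ a ≡ 0 × R′ b ≡ R b + R a × Same (λ i → i ≢ a × i ≢ b) R R′
    transfer-does {a} {b} a<K b<K a≢b {R} {o} bd = go (R a) refl bd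
      where
      go : ∀ x {R o} → R a ≡ x → Bounded R → R b + x ≤ cap →
        Does (whileR a (decr a ⨾ incr b)) R o λ R′ → Bounded R′ × R′ a ≡ 0 × R′ b ≡ R b + x × Same (λ i → i ≢ a × i ≢ b) R R′
      go zero    eq bd h = yields (whileR-zero a<K eq) (bd , eq , sym (ℕ.+-identityʳ _) , λ _ → refl)
      go (suc x) {R} eq bd h = while-does a<K eq (subst (_≤ cap) eq (bd a))
        (decr-does a<K eq >>> λ { refl → incr-does b<K }) λ { refl →
          let R₁ = set R a x
              R₁b : R₁ b ≡ R b
              R₁b = set-≢ R x (a≢b ∘ sym)
              R₂b : set R₁ b (suc (R₁ b)) b ≡ suc (R b)
              R₂b = trans (set-≡ R₁ b _) (cong suc R₁b)
              h′ : suc (R b) + x ≤ cap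
              h′ = subst (_≤ cap) (ℕ.+-suc (R b) x) h
          in weaken (go x (trans (set-≢ R₁ _ a≢b) (set-≡ R a x))
                 (set-bounded (set-bounded bd (ℕ.m+n≤o⇒n≤o (suc (R b)) h′)) (subst (λ y → suc y ≤ cap) (sym R₁b) (ℕ.m+n≤o⇒m≤o _ h′)))
                 (subst (λ y → y + x ≤ cap) (sym R₂b) h′))
               λ (b′ , z , v , s) → b′ , z , trans v (trans (cong (_+ x) R₂b) (sym (ℕ.+-suc (R b) x))) ,
                 λ (i≢a , i≢b) → trans (s (i≢a , i≢b)) (trans (set-≢ R₁ _ i≢b) (set-≢ R x i≢a)) }

    opaque
      unfolding move
      move-does : ∀ {a b} → a < K → b < K → a ≢ b → ∀ {R o} → Bounded R →
        Does (move a b) R o λ R′ → Bounded R′ × R′ a ≡ 0 × R′ b ≡ R a × Same (λ i → i ≢ a × i ≢ b) R R′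
      move-does a<K b<K a≢b {R} bd = clear-does b<K bd >>> λ {R₁} (bd₁ , z , s) →
        weaken (transfer-does a<K b<K a≢b bd₁ (subst₂ (λ x y → x + y ≤ cap) (sym z) (sym (s a≢b)) (bd _)))
          λ (bd₂ , z₂ , v , s₂) → bd₂ , z₂ , trans v (cong₂ _+_ z (s a≢b)) , λ (i≢a , i≢b) → trans (s₂ (i≢a , i≢b)) (s i≢b)

    opaque
      unfolding copy
      copy-does : ∀ {a b t} → a < K → b < K → t < K → a ≢ b → a ≢ t → b ≢ t → ∀ {R o} → Bounded R →
        Does (copy a b t) R o λ R′ → Bounded R′ × R′ b ≡ R a × Same (λ i → i ≢ b × i ≢ t) R R′
      copy-does {a} {b} {t} a<K b<K t<K a≢b a≢t b≢t {R₀} bd₀ =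
        clear-does b<K bd₀ >>> λ {R₁} (bd₁ , z₁ , s₁) →
        clear-does t<K bd₁ >>> λ {R₂} (bd₂ , z₂ , s₂) →
        transfer-does a<K t<K a≢t bd₂ (subst (λ x → x + R₂ a ≤ cap) (sym z₂) (bd₂ a)) >>> λ {R₃} (bd₃ , z₃ , v₃ , s₃) →
        let Ra : R₃ t ≡ R₀ a
            Ra = trans v₃ (cong₂ _+_ z₂ (trans (s₂ a≢t) (s₁ a≢b)))
            Rb : R₃ b ≡ 0
            Rb = trans (s₃ (a≢b ∘ sym , b≢t)) (trans (s₂ b≢t) z₁)
        in weaken (go (R₃ t) refl bd₃ (subst (λ x → x + R₃ t ≤ cap) (sym z₃) (bd₃ t)) (subst (λ x → x + R₃ t ≤ cap) (sym Rb) (bd₃ t)))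
          λ {R′} (bd , va , vb , s) → bd , trans vb (trans (cong (_+ R₃ t) Rb) Ra) , λ {i} (i≢b , i≢t) →
            case i ℕ.≟ a of λ
              { (yes refl) → trans va (trans (cong (_+ R₃ t) z₃) Ra)
              ; (no i≢a)   → trans (s i≢a i≢b i≢t) (trans (s₃ (i≢a , i≢t)) (trans (s₂ i≢t) (s₁ i≢b))) }
        where
        go : ∀ x {R o} → R t ≡ x → Bounded R → R a + x ≤ cap → R b + x ≤ cap →
          Does (whileR t (decr t ⨾ incr a ⨾ incr b)) R o λ R′ →
            Bounded R′ × R′ a ≡ R a + x × R′ b ≡ R b + x × (∀ {i} → i ≢ a → i ≢ b → i ≢ t → R′ i ≡ R i)
        go zero    eq bd h k = yields (whileR-zero t<K eq) (bd , sym (ℕ.+-identityʳ _) , sym (ℕ.+-identityʳ _) , λ _ _ _ → refl)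
        go (suc x) {R} eq bd h k = while-does t<K eq (subst (_≤ cap) eq (bd t))
          (decr-does t<K eq >>> λ { refl → incr-does a<K >>> λ { refl → incr-does b<K } }) λ { refl →
            let R₁ = set R t x
                R₂ = set R₁ a (suc (R₁ a))
                R₃ = set R₂ b (suc (R₂ b))
                R₁a : R₁ a ≡ R a
                R₁a = set-≢ R x a≢t
                R₂b : R₂ b ≡ R b
                R₂b = trans (set-≢ R₁ _ (a≢b ∘ sym)) (set-≢ R x b≢t)
                R₃a : R₃ a ≡ suc (R a)
                R₃a = trans (set-≢ R₂ _ a≢b) (trans (set-≡ R₁ a _) (cong suc R₁a))
                R₃b : R₃ b ≡ suc (R b)
                R₃b = trans (set-≡ R₂ b _) (cong suc R₂b)
                R₃t : R₃ t ≡ x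
                R₃t = trans (set-≢ R₂ _ (b≢t ∘ sym)) (trans (set-≢ R₁ _ (a≢t ∘ sym)) (set-≡ R t x))
                h′ = subst (_≤ cap) (ℕ.+-suc (R a) x) h
                k′ = subst (_≤ cap) (ℕ.+-suc (R b) x) k
            in weaken (go x R₃t
                   (set-bounded (set-bounded (set-bounded bd (ℕ.m+n≤o⇒n≤o (suc (R a)) h′))
                      (subst (λ y → suc y ≤ cap) (sym R₁a) (ℕ.m+n≤o⇒m≤o _ h′)))
                      (subst (λ y → suc y ≤ cap) (sym R₂b) (ℕ.m+n≤o⇒m≤o _ k′)))
                   (subst (λ y → y + x ≤ cap) (sym R₃a) h′) (subst (λ y → y + x ≤ cap) (sym R₃b) k′))
                 λ (b′ , va , vb , s) → b′ ,
                   trans va (trans (cong (_+ x) R₃a) (sym (ℕ.+-suc (R a) x))) ,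
                   trans vb (trans (cong (_+ x) R₃b) (sym (ℕ.+-suc (R b) x))) ,
                   λ i≢a i≢b i≢t → trans (s i≢a i≢b i≢t)
                     (trans (set-≢ R₂ _ i≢b) (trans (set-≢ R₁ _ i≢a) (set-≢ R x i≢t))) }

footprint-pos : ∀ {σ m} (f : Fn σ m) → 1 ≤ footprint f
footprint-pos (var i)      = s≤s z≤n
footprint-pos zer          = s≤s z≤n
footprint-pos (succ f)     = footprint-pos f
footprint-pos (prd f)      = footprint-pos f
footprint-pos (comp f gs)  = s≤s z≤n
footprint-pos (iter n z s) = ℕ.≤-trans (footprint-pos n) (ℕ.m≤m+n _ _)
footprint-pos (sym′ f)     = footprint-pos f
footprint-pos len          = s≤s z≤n

-- Correctness of the programs that evaluate truncated functions

module EvalPrograms (σ τ K-1 β : ℕ) (σ≤β : σ ≤ β) (w : List (Fin σ)) (C : Bool → Set) (someC : ∃ C)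
                    (ℓ-1 cap : ℕ) (cap-eq : suc (suc β) ^ suc ℓ-1 ≡ suc cap) (w≤cap : length w ≤ cap) where

  open Registers σ τ K-1 β σ≤β
  open RegisterSpecs w C someC ℓ-1 cap cap-eq w≤cap

  -- Registers are allocated as a stack: those below d are in use.
  record Env {m} (R : ℕ → ℕ) (d : ℕ) (rs ρ : Vec ℕ m) : Set where
    constructor environment
    field
      binding : ∀ i → lookup rs i < d × R (lookup rs i) ≡ lookup ρ i

  env-frame : ∀ {m R R′ d d′} {rs ρ : Vec ℕ m} → Env R d rs ρ → d ≤ d′ → Same (_< d) R R′ → Env R′ d′ rs ρ
  env-frame (environment env) d≤d′ s = environment λ i → let (h , e) = env i in ℕ.<-≤-trans h d≤d′ , trans (s h) e

  env-push : ∀ {m R d x} {rs ρ : Vec ℕ m} → Env R d rs ρ → R d ≡ x → Env R (suc d) (d ∷ rs) (x ∷ ρ)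
  env-push (environment env) e = environment λ
    { zero → ℕ.n<1+n _ , e ; (suc i) → let (h , e′) = env i in ℕ.m<n⇒m<1+n h , e′ }

  env-pair : ∀ {m d R x y} {rs ρ : Vec ℕ m} → Env R d rs ρ → R d ≡ x → R (1 + d) ≡ y → Env R (2 + d) (d ∷ 1 + d ∷ rs) (x ∷ y ∷ ρ)
  env-pair (environment env) eqx eqy = environment λ
    { zero          → s≤s (ℕ.n≤1+n _) , eqx
    ; (suc zero)    → ℕ.n<1+n _ , eqy
    ; (suc (suc i)) → let (h , e) = env i in ℕ.m<n⇒m<1+n (ℕ.m<n⇒m<1+n h) , e }

  record Computed (d : ℕ) (R : ℕ → ℕ) (v : ℕ) (R′ : ℕ → ℕ) : Set where
    constructor computed
    field
      bounded : Bounded R′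
      frame   : Same (_< d) R R′
      value   : R′ d ≡ v

  fits : ∀ {a b} e → a + e ≡ b → b ≤ K → a ≤ K
  fits e refl h = ℕ.m+n≤o⇒m≤o _ h

  fits-fn : ∀ {d m} (f : Fn σ m) → d + footprint f ≤ K → d < K
  fits-fn {d} f h = ℕ.≤-trans (ℕ.≤-trans (ℕ.≤-reflexive (ℕ.+-comm 1 d)) (ℕ.+-monoʳ-≤ d (footprint-pos f))) h

  <⇒≢ : ∀ {i d} → i < d → i ≢ d
  <⇒≢ = ℕ.<⇒≢

  rewind-does : ∀ h {R o} → Yields rewind h R o 0 o (_≡ R)
  rewind-does zero    = yields (spec-halt (sure-input notLeftEnd refl)) refl
  rewind-does (suc h) with rewind-does h
  ... | yields e refl = yields (spec-repeat (sure-input notLeftEnd (readInput-notLeftEnd w h)) (onHead-spec left) e) refl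

  succ-does : ∀ {d R o v} → d < K → Bounded R → R d ≡ v →
              Does (incr d ⨾ ifR d skip (decr d)) R o (λ R′ → Computed d R (suc v ⊓ cap) R′)
  succ-does {d} {R} {o} d<K b refl with suc (R d) ℕ.≤? cap
  ... | yes v<cap = yields (incr-spec d<K ⨟ ifR-pos d<K (set-≡ R d _) v<cap (onHead-spec stay))
        (computed (set-bounded b v<cap) (λ i<d → set-≢ R _ (<⇒≢ i<d)) (trans (set-≡ R d _) (sym (ℕ.m≤n⇒m⊓n≡m v<cap))))
  ... | no v≮cap = yields (incr-spec d<K ⨟ ifR-overflow d<K over (decr-spec d<K over))
        (computed final (λ i<d → trans (set-≢ _ cap (<⇒≢ i<d)) (set-≢ R _ (<⇒≢ i<d)))
          (trans (set-≡ _ d cap) (sym (ℕ.m≥n⇒m⊓n≡n (ℕ.≤-trans (ℕ.≮⇒≥ v≮cap) (ℕ.n≤1+n _))))))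
    where
    over : set R d (suc (R d)) d ≡ suc cap
    over = trans (set-≡ R d _) (cong suc (ℕ.≤-antisym (b d) (ℕ.≮⇒≥ v≮cap)))
    final : Bounded (set (set R d (suc (R d))) d cap)
    final i with i ℕ.≟ d
    ... | yes _  = ℕ.≤-refl
    ... | no i≢d = ℕ.≤-trans (ℕ.≤-reflexive (set-≢ R _ i≢d)) (b i)

  pred-does : ∀ {d R o v} → d < K → Bounded R → R d ≡ v →
              Does (ifR d (decr d) skip) R o (λ R′ → Computed d R (pred v) R′)
  pred-does {v = zero}  d<K b eq = yields (ifR-zero d<K eq (onHead-spec stay)) (computed b (λ _ → refl) eq)
  pred-does {d} {R} {v = suc v} d<K b eq = yields (ifR-pos d<K eq v≤ (decr-spec d<K eq))
    (computed (set-bounded b (ℕ.≤-trans (ℕ.n≤1+n v) v≤)) (λ i<d → set-≢ R v (<⇒≢ i<d)) (set-≡ R d v))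
    where
    v≤ : suc v ≤ cap
    v≤ = subst (_≤ cap) eq (b d)

  clamp-suc : ∀ a n → suc (a ⊓ n) ⊓ n ≡ suc a ⊓ n
  clamp-suc a n with ℕ.≤-total a n
  ... | inj₁ h rewrite ℕ.m≤n⇒m⊓n≡m h = refl
  ... | inj₂ h rewrite ℕ.m≥n⇒m⊓n≡n h = trans (ℕ.m≥n⇒m⊓n≡n (ℕ.n≤1+n n)) (sym (ℕ.m≥n⇒m⊓n≡n (ℕ.m≤n⇒m≤1+n h)))

  -- The starting position is generalised to a truncated `a`, since the head stops at the right end
  -- marker while the counter may still be positive.
  seek-does : ∀ {d} → d < K → ∀ x a {R o} → Bounded R → R d ≡ x →
    Yields (whileR d (decr d ⨾ instr (onHead right))) (a ⊓ suc (length w)) R o ((x + a) ⊓ suc (length w)) o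
           (λ R′ → Bounded R′ × R′ d ≡ 0 × Same (_< d) R R′)
  seek-does d<K zero    a b eq = yields (whileR-zero d<K eq) (b , eq , λ _ → refl)
  seek-does {d} d<K (suc x) a {R} {o} b eq = while-does d<K {Q = _≡ set R d x} eq x≤
    (yields (decr-spec d<K eq ⨟ subst (λ h → Spec (instr (onHead right)) (st (a ⊓ suc (length w)) (set R d x) o) (st h (set R d x) o))
               (clamp-suc a (suc (length w))) (onHead-spec right)) refl)
    λ { refl → weaken (subst (λ y → Yields (whileR d (decr d ⨾ instr (onHead right))) (suc a ⊓ suc (length w)) (set R d x) o (y ⊓ suc (length w)) o (λ R′ → Bounded R′ × R′ d ≡ 0 × Same (_< d) (set R d x) R′))
                  (ℕ.+-suc x a) (seek-does d<K x (suc a) (set-bounded b (ℕ.≤-trans (ℕ.n≤1+n x) x≤)) (set-≡ R d x)))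
          λ (b′ , z , s) → b′ , z , λ i<d → trans (s i<d) (set-≢ R x (<⇒≢ i<d)) }
    where
    x≤ : suc x ≤ cap
    x≤ = subst (_≤ cap) eq (b d)

  code≤cap : ∀ (a : InputSymbol σ) → code a ≤ cap
  code≤cap a = ℕ.≤-pred (ℕ.≤-trans (ℕ.<-≤-trans (code< a) (s≤s (s≤s σ≤β)))
    (ℕ.≤-trans (ℕ.≤-reflexive (sym (ℕ.*-identityʳ base))) (ℕ.≤-trans (ℕ.*-monoʳ-≤ base (ℕ.m^n>0 base ℓ-1)) (ℕ.≤-reflexive cap-eq))))

  setDigit-does : ∀ {d} → d < K → ∀ {h R o} → Bounded R → R d ≡ 0 →
    Yields (setDigit (reg d) codeDigit) h R o h o (Computed d R (code (readInput w h)))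
  setDigit-does {d} d<K {h} {R} {o} b eq = yields
    (subst₂ (Spec (setDigit (reg d) codeDigit))
      (put-id (reg d) (st h R o) (st-lookup d<K eq))
      (trans (cong (put (reg d) (st h R o) ∘ resting) digits-eq) (st-put d<K _))
      (spec-setDigit (reg d) (st h R o) codeDigit zero (replicate ℓ-1 zero)))
    (computed (set-bounded b (code≤cap (readInput w h))) (λ i<d → set-≢ R _ (<⇒≢ i<d)) (set-≡ R d _))
    where
    digits-eq : codeDigit (inputAt (st h R o)) ∷ replicate ℓ-1 zero ≡ num ℓ (code (readInput w h))
    digits-eq = trans (sym (num-digit ℓ-1 (codeDigit (inputAt (st h R o)))))
      (cong (num ℓ) (trans (Fin.toℕ-fromℕ< _) (cong code (inputAt-st h R o))))

  length-does : ∀ {d} → d < K → ∀ k i {R o} → k + i ≡ length w → Bounded R → R d ≡ i →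
    Yields (while (input? notRightEnd) (incr d ⨾ instr (onHead right))) (suc i) R o (suc (length w)) o (Computed d R (length w))
  length-does d<K zero    i refl b eq = yields (spec-halt (sure-input notRightEnd (cong notRightEnd (readInput-outside w ℕ.≤-refl))))
    (computed b (λ _ → refl) eq)
  length-does {d} d<K (suc k) i {R} {o} h b eq
    with length-does d<K k (suc i) {set R d (suc (R d))} {o} (trans (ℕ.+-suc k i) h)
           (set-bounded b (ℕ.≤-trans (ℕ.≤-trans (ℕ.≤-reflexive (cong suc eq)) i<) w≤cap)) (trans (set-≡ R d _) (cong suc eq))
    where
    i< : i < length w
    i< = ℕ.≤-trans (s≤s (ℕ.m≤n+m i k)) (ℕ.≤-reflexive h)
  ... | yields e (computed b′ f v) = yields
    (spec-repeat (sure-input notRightEnd (readInput-inside w i<))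
      (incr-spec d<K ⨟ subst (λ x → Spec (instr (onHead right)) (st (suc i) (set R d (suc (R d))) o) (st x (set R d (suc (R d))) o))
         (ℕ.m≤n⇒m⊓n≡m (s≤s i<)) (onHead-spec right)) e)
    (computed b′ (λ i<d → trans (f i<d) (set-≢ R _ (<⇒≢ i<d))) v)
    where
    i< : i < length w
    i< = ℕ.≤-trans (s≤s (ℕ.m≤n+m i k)) (ℕ.≤-reflexive h)

  mutual
    -- Every subprogram keeps the registers below its own `d`. Intermediate results therefore
    -- survive if each is left at the next free register and the following part starts above it.
    eval-does : ∀ {m} (f : Fn σ m) rs d ρ {R o} → d + footprint f ≤ K → Env R d rs ρ → Bounded R →
                Does (evalP f rs d) R o (Computed d R (eval f ρ))
    eval-does (var i) rs d ρ {R} fit env b =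
      let (r<d , e) = Env.binding env i
          d+1<K = ℕ.≤-trans (ℕ.≤-reflexive (ℕ.+-comm 2 d)) fit
          d<K = ℕ.<-trans (ℕ.n<1+n d) d+1<K in
      weaken (copy-does (ℕ.<-trans r<d d<K) d<K d+1<K (<⇒≢ r<d) (<⇒≢ (ℕ.m<n⇒m<1+n r<d)) (<⇒≢ (ℕ.n<1+n d)) b)
        λ (b′ , v , s) → computed b′ (λ i<d → s (<⇒≢ i<d , <⇒≢ (ℕ.m<n⇒m<1+n i<d))) (trans v e)
    eval-does zer rs d ρ fit env b =
      weaken (clear-does (ℕ.≤-trans (ℕ.≤-reflexive (ℕ.+-comm 1 d)) fit) b) λ (b′ , z , s) → computed b′ (s ∘ <⇒≢) z
    eval-does (succ f) rs d ρ fit env b = eval-does f rs d ρ fit env b >>> λ (computed b₁ f₁ v₁) →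
      weaken (succ-does (fits-fn f fit) b₁ v₁) λ (computed b₂ f₂ v₂) → computed b₂ (λ i<d → trans (f₂ i<d) (f₁ i<d)) v₂
    eval-does (prd f) rs d ρ fit env b = eval-does f rs d ρ fit env b >>> λ (computed b₁ f₁ v₁) →
      weaken (pred-does (fits-fn f fit) b₁ v₁) λ (computed b₂ f₂ v₂) → computed b₂ (λ i<d → trans (f₂ i<d) (f₁ i<d)) v₂
    eval-does (comp {k} f gs) rs d ρ {R} fit env b =
      evals-does gs rs (suc d) ρ fit-gs (env-frame env (ℕ.n≤1+n d) λ _ → refl) b >>> λ (b₁ , f₁ , env₁) →
      eval-does f (registersFrom (suc d) k) (suc d + k) (evals gs ρ) fit-f env₁ b₁ >>> λ (computed b₂ f₂ v₂) →
      weaken (move-does (fits-fn f fit-f) d<K (λ e → <⇒≢ d<k (sym e)) b₂) λ (b₃ , _ , v₃ , s₃) →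
        computed b₃ (λ i<d → trans (s₃ (<⇒≢ (ℕ.<-trans i<d d<k) , <⇒≢ i<d)) (trans (f₂ (ℕ.<-trans i<d d<k)) (f₁ (ℕ.m<n⇒m<1+n i<d))))
          (trans v₃ v₂)
      where
      d<k : d < suc d + k
      d<k = s≤s (ℕ.m≤m+n d k)
      arith₁ : ∀ d g k f → suc d + g + (k + f) ≡ d + (1 + (g + (k + f)))
      arith₁ = solve-∀
      arith₂ : ∀ d g k f → suc d + k + f + g ≡ d + (1 + (g + (k + f)))
      arith₂ = solve-∀
      fit-gs : suc d + footprints gs ≤ K
      fit-gs = fits _ (arith₁ d (footprints gs) k (footprint f)) fit
      fit-f : suc d + k + footprint f ≤ K
      fit-f = fits _ (arith₂ d (footprints gs) k (footprint f)) fit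
      d<K : d < K
      d<K = ℕ.m+n≤o⇒m≤o (suc d) fit-gs
    eval-does (iter n z s) rs d ρ {R} {o} fit env b =
      eval-does n rs d ρ fit-n env b >>> λ {R₁} (computed b₁ f₁ v₁) →
      eval-does z rs (1 + d) ρ fit-z (env-frame env (ℕ.n≤1+n d) f₁) b₁ >>> λ {R₂} (computed b₂ f₂ v₂) →
      loop (eval n ρ) (eval z ρ) (trans (f₂ (ℕ.n<1+n d)) v₁) v₂
        (env-frame env ℕ.≤-refl (λ i<d → trans (f₂ (ℕ.m<n⇒m<1+n i<d)) (f₁ i<d))) b₂ >>> λ {R₃} (b₃ , v₃ , f₃) →
      weaken (move-does 1+d<K d<K (λ e → <⇒≢ (ℕ.n<1+n d) (sym e)) b₃) λ (b₄ , _ , v₄ , s₄) →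
        computed b₄ (λ i<d → trans (s₄ (<⇒≢ (ℕ.m<n⇒m<1+n i<d) , <⇒≢ i<d)) (trans (f₃ i<d) (trans (f₂ (ℕ.m<n⇒m<1+n i<d)) (f₁ i<d))))
          (trans v₄ v₃)
      where
      arith₁ : ∀ d n z s → suc d + z + (n + (1 + s)) ≡ d + (n + (1 + (z + (1 + s))))
      arith₁ = solve-∀
      arith₂ : ∀ d n z s → suc (suc d) + s + (n + z) ≡ d + (n + (1 + (z + (1 + s))))
      arith₂ = solve-∀
      fit-n : d + footprint n ≤ K
      fit-n = fits (1 + (footprint z + (1 + footprint s))) (ℕ.+-assoc d _ _) fit
      fit-z : suc d + footprint z ≤ K
      fit-z = fits _ (arith₁ d (footprint n) (footprint z) (footprint s)) fit
      fit-s : suc (suc d) + footprint s ≤ K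
      fit-s = fits _ (arith₂ d (footprint n) (footprint z) (footprint s)) fit
      2+d<K : 2 + d < K
      2+d<K = fits-fn s fit-s
      1+d<K : 1 + d < K
      1+d<K = ℕ.<-trans (ℕ.n<1+n _) 2+d<K
      d<K : d < K
      d<K = ℕ.<-trans (ℕ.n<1+n _) 1+d<K
      loop : ∀ x a {R o} → R d ≡ x → R (1 + d) ≡ a → Env R d rs ρ → Bounded R →
        Does (whileR d (decr d ⨾ evalP s (d ∷ 1 + d ∷ rs) (2 + d) ⨾ move (2 + d) (1 + d))) R o
          λ R′ → Bounded R′ × R′ (1 + d) ≡ foldDown (λ i a → eval s (i ∷ a ∷ ρ)) x a × Same (_< d) R R′
      loop zero    a ex ea env b = yields (whileR-zero d<K ex) (b , ea , λ _ → refl)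
      loop (suc x) a {R} ex ea env b = while-does d<K ex x≤
        (decr-does d<K ex >>> λ { refl →
          eval-does s (d ∷ 1 + d ∷ rs) (2 + d) (x ∷ a ∷ ρ) fit-s env′ (set-bounded b (ℕ.≤-trans (ℕ.n≤1+n x) x≤)) >>> λ (computed b₁ f₁ v₁) →
          weaken (move-does 2+d<K 1+d<K (λ e → <⇒≢ (ℕ.n<1+n (1 + d)) (sym e)) b₁) λ (b₂ , _ , v₂ , s₂) →
            b₂ , trans (s₂ (<⇒≢ (s≤s (ℕ.n≤1+n d)) , <⇒≢ (ℕ.n<1+n d))) (trans (f₁ (s≤s (ℕ.n≤1+n d))) (set-≡ R d x)) , trans v₂ v₁ ,
            λ {i} (i<d : i < d) → trans (s₂ (<⇒≢ (ℕ.m<n⇒m<1+n (ℕ.m<n⇒m<1+n i<d)) , <⇒≢ (ℕ.m<n⇒m<1+n i<d)))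
              (trans (f₁ (ℕ.m<n⇒m<1+n (ℕ.m<n⇒m<1+n i<d))) (set-≢ R x (<⇒≢ i<d))) })
        λ (b′ , ex′ , ea′ , f′) → weaken (loop x (eval s (x ∷ a ∷ ρ)) ex′ ea′ (env-frame env ℕ.≤-refl f′) b′)
          λ (b″ , ea″ , f″) → b″ , ea″ , λ i<d → trans (f″ i<d) (f′ i<d)
        where
        x≤ : suc x ≤ cap
        x≤ = subst (_≤ cap) ex (b d)
        env′ : Env (set R d x) (2 + d) (d ∷ 1 + d ∷ rs) (x ∷ a ∷ ρ)
        env′ = env-pair (env-frame env ℕ.≤-refl λ i<d → set-≢ R x (<⇒≢ i<d)) (set-≡ R d x)
          (trans (set-≢ R x (λ e → <⇒≢ (ℕ.n<1+n d) (sym e))) ea)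
    eval-does (sym′ f) rs d ρ {R} {o} fit env b = eval-does f rs d ρ fit env b >>> λ {R₁} (computed b₁ f₁ v₁) →
      subst (λ y → Yields (whileR d (decr d ⨾ instr (onHead right))) 0 R₁ o (y ⊓ suc (length w)) o (λ R′ → Bounded R′ × R′ d ≡ 0 × Same (_< d) R₁ R′))
        (ℕ.+-identityʳ (eval f ρ)) (seek-does d<K (eval f ρ) 0 b₁ v₁) >>> λ (b₂ , z₂ , f₂) →
      setDigit-does d<K b₂ z₂ >>> λ (computed b₃ f₃ v₃) →
      weaken (rewind-does _) λ { refl → computed b₃ (λ i<d → trans (f₃ i<d) (trans (f₂ i<d) (f₁ i<d)))
        (trans v₃ (cong code (readInput-clamp w (eval f ρ)))) }
      where
      d<K : d < K
      d<K = fits-fn f fit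
    eval-does len rs d ρ {R} {o} fit env b = clear-does d<K b >>> λ {R₁} (b₁ , z₁ , s₁) →
      yields {Q = _≡ R₁} (onHead-spec right) refl >>> λ { refl →
      length-does d<K (length w) 0 (ℕ.+-identityʳ _) b₁ z₁ >>> λ (computed b₂ f₂ v₂) →
      weaken (rewind-does _) λ { refl → computed b₂ (λ i<d → trans (f₂ i<d) (s₁ (<⇒≢ i<d))) v₂ } }
      where
      d<K : d < K
      d<K = ℕ.≤-trans (ℕ.≤-reflexive (ℕ.+-comm 1 d)) fit

    evals-does : ∀ {k m} (gs : Vec (Fn σ m) k) rs d ρ {R o} → d + footprints gs ≤ K → Env R d rs ρ → Bounded R →
      Does (evalsP gs rs d) R o λ R′ → Bounded R′ × Same (_< d) R R′ × Env R′ (d + k) (registersFrom d k) (evals gs ρ)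
    evals-does []       rs d ρ fit env b = weaken skip-does λ { refl → b , (λ _ → refl) , environment λ () }
    evals-does {suc k} (g ∷ gs) rs d ρ {R} fit env b =
      eval-does g rs d ρ (fits _ (ℕ.+-assoc d (footprint g) (1 + footprints gs)) fit) env b >>> λ (computed b₁ f₁ v₁) →
      weaken (evals-does gs rs (suc d) ρ (fits _ (arith d (footprint g) (footprints gs)) fit) (env-frame env (ℕ.n≤1+n d) f₁) b₁)
        λ {R′} (b₂ , f₂ , env₂) → b₂ , (λ i<d → trans (f₂ (ℕ.m<n⇒m<1+n i<d)) (f₁ i<d)) ,
          environment λ
            { zero    → ℕ.m<m+n d (s≤s z≤n) , trans (f₂ (ℕ.n<1+n d)) v₁
            ; (suc i) → let (h , e) = Env.binding env₂ i in subst (lookup (registersFrom (suc d) k) i <_) (sym (ℕ.+-suc d k)) h , e }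
      where
      arith : ∀ d g gs → suc d + gs + g ≡ d + (g + (1 + gs))
      arith = solve-∀

-- Formulas with transitive closure, decided by nondeterministic programs

data Formula (σ : ℕ) : ℕ → Set where
  at    : ∀ {m} → Fn σ m → Formula σ m
  _and_ : ∀ {m} → Formula σ m → Formula σ m → Formula σ m
  _or_  : ∀ {m} → Formula σ m → Formula σ m → Formula σ m
  ex    : ∀ {m} → Formula σ (1 + m) → Formula σ m
  all<  : ∀ {m} → Fn σ m → Formula σ (1 + m) → Formula σ m
  -- reach a b φ ψ: from the pair (a , b) some pair satisfying ψ can be reached
  -- along φ, whose variables are the new pair, the old pair, and the context.
  reach : ∀ {m} → Fn σ m → Fn σ m → Formula σ (4 + m) → Formula σ (2 + m) → Formula σ m

infixr 6 _and_
infixr 5 _or_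

module Satisfaction {σ : ℕ} (w : List (Fin σ)) (cap : ℕ) where

  open Evaluation w cap

  mutual
    Sat : ∀ {m} → Formula σ m → Vec ℕ m → Set
    Sat (at f)          ρ = 1 ≤ eval f ρ
    Sat (φ and ψ)       ρ = Sat φ ρ × Sat ψ ρ
    Sat (φ or ψ)        ρ = Sat φ ρ ⊎ Sat ψ ρ
    Sat (ex φ)          ρ = ∃[ x ] x ≤ cap × Sat φ (x ∷ ρ)
    Sat (all< f φ)      ρ = ∀ x → x < eval f ρ → Sat φ (x ∷ ρ)
    Sat (reach a b φ ψ) ρ = ∃₂ λ x y → Star (Link φ ρ) (eval a ρ , eval b ρ) (x , y) × Sat ψ (x ∷ y ∷ ρ)

    Link : ∀ {m} → Formula σ (4 + m) → Vec ℕ m → ℕ × ℕ → ℕ × ℕ → Set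
    Link φ ρ (x , y) (x′ , y′) = x′ ≤ cap × y′ ≤ cap × Sat φ (x′ ∷ y′ ∷ x ∷ y ∷ ρ)

footprintF : ∀ {σ m} → Formula σ m → ℕ
footprintF (at f)          = footprint f
footprintF (φ and ψ)       = footprintF φ + footprintF ψ
footprintF (φ or ψ)        = footprintF φ + footprintF ψ
footprintF (ex φ)          = 1 + footprintF φ
footprintF (all< f φ)      = footprint f + (1 + footprintF φ)
footprintF (reach a b φ ψ) = footprint a + (footprint b + (4 + (footprintF φ + footprintF ψ)))

-- Word-valued functions; the loop body sees the number of remaining rounds
-- and the number of completed ones.
data Out (σ τ : ℕ) : ℕ → Set where
  emit : ∀ {m} → Fin τ → Out σ τ m
  _▹_  : ∀ {m} → Out σ τ m → Out σ τ m → Out σ τ m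
  for  : ∀ {m} → Fn σ m → Out σ τ (2 + m) → Out σ τ m
  cond : ∀ {m} → Fn σ m → Out σ τ m → Out σ τ m → Out σ τ m

infixr 5 _▹_

rounds : ∀ {A : Set} → (ℕ → ℕ → List A) → ℕ → ℕ → List A
rounds g zero    i = []
rounds g (suc k) i = g k i ++ rounds g k (suc i)

module Printing {σ τ : ℕ} (w : List (Fin σ)) (cap : ℕ) where

  open Evaluation w cap

  isPos : ℕ → Bool
  isPos zero    = false
  isPos (suc _) = true

  print : ∀ {m} → Out σ τ m → Vec ℕ m → List (Fin τ)
  print (emit a)     ρ = [ a ]
  print (p ▹ q)      ρ = print p ρ ++ print q ρ
  print (for f p)    ρ = rounds (λ k i → print p (k ∷ i ∷ ρ)) (eval f ρ) 0
  print (cond f p q) ρ = if isPos (eval f ρ) then print p ρ else print q ρ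

footprintO : ∀ {σ τ m} → Out σ τ m → ℕ
footprintO (emit a)     = 0
footprintO (p ▹ q)      = footprintO p + footprintO q
footprintO (for f p)    = footprint f + (2 + footprintO p)
footprintO (cond f p q) = footprint f + (footprintO p + footprintO q)

-- Programs that assert formulas and print words

module Generators (σ τ K-1 β : ℕ) (σ≤β : σ ≤ β) where

  open Registers σ τ K-1 β σ≤β

  opaque
    -- The number is guessed in unary by coin tosses. As the increment saturates at the cap, exactly
    -- the numbers up to the cap can result.
    guess : ℕ → Prog
    guess r = clear r ⨾ while coin? (incr r ⨾ ifR r skip (decr r))

  -- Failure is divergence: a branch on which an atom turns out false never reaches the accepting
  -- state.
  hang : Prog
  hang = while (input? λ _ → true) skip

  -- Some branch halts exactly if the formula holds. A universal quantifier is a loop that asserts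
  -- its instances one after another, reusing the same registers; `reach` remembers only the current
  -- pair and a guessed next one.
  assertP : ∀ {m} → Formula σ m → Vec ℕ m → ℕ → Prog
  assertP (at f)          rs d = evalP f rs d ⨾ ifR d skip hang
  assertP (φ and ψ)       rs d = assertP φ rs d ⨾ assertP ψ rs d
  assertP (φ or ψ)        rs d = ifte coin? (assertP φ rs d) (assertP ψ rs d)
  assertP (ex φ)          rs d = guess d ⨾ assertP φ (d ∷ rs) (1 + d)
  assertP (all< f φ)      rs d = evalP f rs d ⨾ whileR d (decr d ⨾ assertP φ (d ∷ rs) (1 + d))
  assertP (reach a b φ ψ) rs d = evalP a rs d ⨾ evalP b rs (1 + d)
    ⨾ while coin? (guess (2 + d) ⨾ guess (3 + d)
        ⨾ assertP φ (2 + d ∷ 3 + d ∷ d ∷ 1 + d ∷ rs) (4 + d) ⨾ move (2 + d) d ⨾ move (3 + d) (1 + d))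
    ⨾ assertP ψ (d ∷ 1 + d ∷ rs) (2 + d)

  printP : ∀ {m} → Out σ τ m → Vec ℕ m → ℕ → Prog
  printP (emit a)     rs d = instr (emit a)
  printP (p ▹ q)      rs d = printP p rs d ⨾ printP q rs d
  printP (for f p)    rs d = evalP f rs d ⨾ clear (1 + d)
    ⨾ whileR d (decr d ⨾ printP p (d ∷ 1 + d ∷ rs) (2 + d) ⨾ incr (1 + d))
  printP (cond f p q) rs d = evalP f rs d ⨾ ifR d (printP p rs d) (printP q rs d)

module PrintPrograms (σ τ K-1 β : ℕ) (σ≤β : σ ≤ β) (w : List (Fin σ)) (C : Bool → Set) (someC : ∃ C)
                     (ℓ-1 cap : ℕ) (cap-eq : suc (suc β) ^ suc ℓ-1 ≡ suc cap) (w≤cap : length w ≤ cap) where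

  open Registers σ τ K-1 β σ≤β
  open RegisterSpecs w C someC ℓ-1 cap cap-eq w≤cap
  open EvalPrograms σ τ K-1 β σ≤β w C someC ℓ-1 cap cap-eq w≤cap
  open Generators σ τ K-1 β σ≤β
  open Printing {τ = τ} w cap

  print-does : ∀ {m} (p : Out σ τ m) rs d ρ {R o} → d + footprintO p ≤ K → Env R d rs ρ → Bounded R →
    Yields (printP p rs d) 0 R o 0 (o ++ print p ρ) λ R′ → Bounded R′ × Same (_< d) R R′
  print-does (emit a) rs d ρ fit env b = yields (emit-spec a) (b , λ _ → refl)
  print-does (p ▹ q) rs d ρ {R} {o} fit env b =
    print-does p rs d ρ (fits _ (ℕ.+-assoc d _ _) fit) env b >>> λ {R₁} (b₁ , f₁) →
    subst (λ o′ → Yields (printP q rs d) 0 R₁ (o ++ print p ρ) 0 o′ _) (List.++-assoc o _ _)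
      (weaken (print-does q rs d ρ (fits _ (arith d (footprintO p) (footprintO q)) fit) (env-frame env ℕ.≤-refl f₁) b₁)
        λ (b₂ , f₂) → b₂ , λ i<d → trans (f₂ i<d) (f₁ i<d))
    where
    arith : ∀ d p q → d + q + p ≡ d + (p + q)
    arith = solve-∀
  print-does (for f p) rs d ρ {R} {o} fit env b =
    eval-does f rs d ρ fit-f env b >>> λ {R₁} (computed b₁ f₁ v₁) →
    clear-does 1+d<K b₁ >>> λ {R₂} (b₂ , z₂ , s₂) →
    weaken (loop (eval f ρ) 0 (subst (_≤ cap) (trans v₁ (sym (ℕ.+-identityʳ _))) (b₁ d)) (trans (s₂ (<⇒≢ (ℕ.n<1+n d))) v₁) z₂
             (env-frame env ℕ.≤-refl λ i<d → trans (s₂ (<⇒≢ (ℕ.m<n⇒m<1+n i<d))) (f₁ i<d)) b₂)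
      λ (b₃ , f₃) → b₃ , λ i<d → trans (f₃ i<d) (trans (s₂ (<⇒≢ (ℕ.m<n⇒m<1+n i<d))) (f₁ i<d))
    where
    arith : ∀ d f p → 2 + d + p + f ≡ d + (f + (2 + p))
    arith = solve-∀
    fit-f : d + footprint f ≤ K
    fit-f = fits _ (ℕ.+-assoc d _ _) fit
    fit-p : 2 + d + footprintO p ≤ K
    fit-p = fits _ (arith d (footprint f) (footprintO p)) fit
    1+d<K : 1 + d < K
    1+d<K = ℕ.m+n≤o⇒m≤o (2 + d) fit-p
    d<K : d < K
    d<K = ℕ.<-trans (ℕ.n<1+n d) 1+d<K
    loop : ∀ k i {R o} → k + i ≤ cap → R d ≡ k → R (1 + d) ≡ i → Env R d rs ρ → Bounded R →
      Yields (whileR d (decr d ⨾ printP p (d ∷ 1 + d ∷ rs) (2 + d) ⨾ incr (1 + d))) 0 R o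
        0 (o ++ rounds (λ k i → print p (k ∷ i ∷ ρ)) k i) λ R′ → Bounded R′ × Same (_< d) R R′
    loop zero i {R} {o} h ek ei env b = subst (λ o′ → Yields _ 0 R o 0 o′ (λ R′ → Bounded R′ × Same (_< d) R R′)) (sym (List.++-identityʳ o))
      (yields {P = whileR d (decr d ⨾ printP p (d ∷ 1 + d ∷ rs) (2 + d) ⨾ incr (1 + d))} (whileR-zero d<K ek) (b , λ _ → refl))
    loop (suc k) i {R} {o} h ek ei env b
      with print-does p (d ∷ 1 + d ∷ rs) (2 + d) (k ∷ i ∷ ρ) {set R d k} {o} fit-p env′ (set-bounded b (ℕ.m+n≤o⇒m≤o k (ℕ.≤-trans (ℕ.n≤1+n _) h)))
      where
      env′ : Env (set R d k) (2 + d) (d ∷ 1 + d ∷ rs) (k ∷ i ∷ ρ)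
      env′ = env-pair (env-frame env ℕ.≤-refl λ i<d → set-≢ R k (<⇒≢ i<d)) (set-≡ R d k)
        (trans (set-≢ R k (λ e → <⇒≢ (ℕ.n<1+n d) (sym e))) ei)
    ... | yields {R₁} e₁ (b₁ , f₁)
      with loop k (suc i) {set R₁ (1 + d) (suc (R₁ (1 + d)))} {o ++ print p (k ∷ i ∷ ρ)}
             (subst (_≤ cap) (sym (ℕ.+-suc k i)) h)
             (trans (set-≢ R₁ _ (<⇒≢ (ℕ.n<1+n d))) (trans (f₁ (s≤s (ℕ.n≤1+n d))) (set-≡ R d k)))
             (trans (set-≡ R₁ (1 + d) _) (cong suc i-kept))
             (env-frame env ℕ.≤-refl frame)
             (set-bounded b₁ (subst (λ x → suc x ≤ cap) (sym i-kept) (ℕ.m+n≤o⇒n≤o k (subst (_≤ cap) (sym (ℕ.+-suc k i)) h))))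
      where
      i-kept : R₁ (1 + d) ≡ i
      i-kept = trans (f₁ (ℕ.n<1+n (1 + d))) (trans (set-≢ R k (λ e → <⇒≢ (ℕ.n<1+n d) (sym e))) ei)
      frame : Same (_< d) R (set R₁ (1 + d) (suc (R₁ (1 + d))))
      frame i<d = trans (set-≢ R₁ _ (<⇒≢ (ℕ.m<n⇒m<1+n i<d))) (trans (f₁ (ℕ.m<n⇒m<1+n (ℕ.m<n⇒m<1+n i<d))) (set-≢ R k (<⇒≢ i<d)))
    ... | yields {R₂} e₂ (b₂ , f₂) = subst (λ o′ → Yields (whileR d (decr d ⨾ printP p (d ∷ 1 + d ∷ rs) (2 + d) ⨾ incr (1 + d))) 0 R o 0 o′ λ R′ → Bounded R′ × Same (_< d) R R′)
        (List.++-assoc o _ _)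
        (yields (whileR-step d<K ek (subst (_≤ cap) ek (b d)) (decr-spec d<K ek ⨟ e₁ ⨟ incr-spec 1+d<K) e₂)
          (b₂ , λ i<d → trans (f₂ i<d) (trans (set-≢ R₁ _ (<⇒≢ (ℕ.m<n⇒m<1+n i<d)))
            (trans (f₁ (ℕ.m<n⇒m<1+n (ℕ.m<n⇒m<1+n i<d))) (set-≢ R k (<⇒≢ i<d))))))
  print-does (cond f p q) rs d ρ {R} {o} fit env b =
    eval-does f rs d ρ (fits _ (ℕ.+-assoc d _ _) fit) env b >>> λ {R₁} (computed b₁ f₁ v₁) → branch R₁ b₁ f₁ (eval f ρ) v₁
    where
    arith₁ : ∀ d f p q → d + p + (f + q) ≡ d + (f + (p + q))
    arith₁ = solve-∀
    arith₂ : ∀ d f p q → d + q + (f + p) ≡ d + (f + (p + q))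
    arith₂ = solve-∀
    d<K : d < K
    d<K = fits-fn f (fits _ (ℕ.+-assoc d _ _) fit)
    branch : ∀ R₁ → Bounded R₁ → Same (_< d) R R₁ → ∀ v → R₁ d ≡ v →
      Yields (ifR d (printP p rs d) (printP q rs d)) 0 R₁ o 0 (o ++ (if isPos v then print p ρ else print q ρ))
        λ R′ → Bounded R′ × Same (_< d) R R′
    branch R₁ b₁ f₁ zero e
      with print-does q rs d ρ {R₁} {o} (fits _ (arith₂ d (footprint f) (footprintO p) (footprintO q)) fit) (env-frame env ℕ.≤-refl f₁) b₁
    ... | yields e₂ (b₂ , f₂) = yields (ifR-zero d<K e e₂) (b₂ , λ i<d → trans (f₂ i<d) (f₁ i<d))
    branch R₁ b₁ f₁ (suc v) e
      with print-does p rs d ρ {R₁} {o} (fits _ (arith₁ d (footprint f) (footprintO p) (footprintO q)) fit) (env-frame env ℕ.≤-refl f₁) b₁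
    ... | yields e₂ (b₂ , f₂) = yields (ifR-pos d<K e (subst (_≤ cap) e (b₁ d)) e₂) (b₂ , λ i<d → trans (f₂ i<d) (f₁ i<d))

-- Soundness and completeness of the asserting programs

module AssertPrograms (σ τ K-1 β : ℕ) (σ≤β : σ ≤ β) (w : List (Fin σ))
                      (ℓ-1 cap : ℕ) (cap-eq : suc (suc β) ^ suc ℓ-1 ≡ suc cap) (w≤cap : length w ≤ cap) where

  open Registers σ τ K-1 β σ≤β
  open RegisterSpecs w (λ _ → ⊤) (true , tt) ℓ-1 cap cap-eq w≤cap
  open EvalPrograms σ τ K-1 β σ≤β w (λ _ → ⊤) (true , tt) ℓ-1 cap cap-eq w≤cap
  open Generators σ τ K-1 β σ≤β
  open Satisfaction w cap

  coin : ∀ {b : Bool} → Σ[ c ∈ Bool ] ⊤ × c ≡ b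
  coin {b = b} = b , tt , refl

  -- A determinate program ends only where its specification says, so any run met in an analysis may
  -- be replaced by the specified one.
  outcome : ∀ {P h h′ R o o′ Q s} → Yields P h R o h′ o′ Q → P ⊢ st h R o ⇓ s → ∃[ R′ ] s ≡ st h′ R′ o′ × Q R′
  outcome (yields e q) d = _ , only e d , q

  hang-never : ∀ {s s′} → ¬ (hang ⊢ s ⇓ s′)
  hang-never (halt (_ , _ , ()))
  hang-never (repeat _ _ d) = hang-never d

  module _ {r} (r<K : r < K) {o : List (Fin τ)} where

    private
      step-body : Prog
      step-body = incr r ⨾ ifR r skip (decr r)

    opaque
      unfolding guess
      guess-sound : ∀ {R s} → Bounded R → guess r ⊢ st 0 R o ⇓ s → ∃[ R′ ] s ≡ st 0 R′ o × Bounded R′ × Same (_< r) R R′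
      guess-sound {R} b (c ⨾ l) = let (R₁ , e , b₁ , _ , s₁) = outcome (clear-does r<K b) c in go l e b₁ (s₁ ∘ <⇒≢)
        where
        go : ∀ {R₁ s s′} → while coin? step-body ⊢ s ⇓ s′ → s ≡ st 0 R₁ o → Bounded R₁ → Same (_< r) R R₁ →
             ∃[ R′ ] s′ ≡ st 0 R′ o × Bounded R′ × Same (_< r) R R′
        go (halt _) e b f = _ , e , b , f
        go (repeat _ d l) refl b₁ f with outcome (succ-does r<K b₁ refl) d
        ... | R₂ , e , computed b₂ f₂ _ = go l e b₂ λ i<r → trans (f₂ i<r) (f i<r)

      guess-complete : ∀ {R} x → x ≤ cap → Bounded R →
        ∃[ R′ ] (guess r ⊢ st 0 R o ⇓ st 0 R′ o) × Bounded R′ × Same (_< r) R R′ × R′ r ≡ x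
      guess-complete {R} x x≤ b with clear-does r<K {R} {o} b
      ... | yields {R₁} e (b₁ , z , s₁) with go x b₁ (ℕ.≤-trans (ℕ.≤-reflexive (trans (cong (x +_) z) (ℕ.+-identityʳ x))) x≤)
        where
        go : ∀ k {R₁} → Bounded R₁ → k + R₁ r ≤ cap →
          ∃[ R′ ] (while coin? step-body ⊢ st 0 R₁ o ⇓ st 0 R′ o) × Bounded R′ × Same (_< r) R₁ R′ × R′ r ≡ k + R₁ r
        go zero    b h = _ , halt coin , b , (λ _ → refl) , refl
        go (suc k) {R₁} b h with succ-does {R = R₁} {o} r<K b refl
        ... | yields {R₂} e₂ (computed b₂ f₂ v₂) with trans v₂ (ℕ.m≤n⇒m⊓n≡m (ℕ.≤-trans (s≤s (ℕ.m≤n+m (R₁ r) k)) h))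
        ... | v₂′ with go k b₂ (ℕ.≤-trans (ℕ.≤-reflexive (trans (cong (k +_) v₂′) (ℕ.+-suc k _))) h)
        ... | R₃ , d , b₃ , f₃ , v₃ = R₃ , repeat coin (run e₂) d , b₃ , (λ i<r → trans (f₃ i<r) (f₂ i<r)) ,
              trans v₃ (trans (cong (k +_) v₂′) (ℕ.+-suc k _))
      ... | R₂ , d , b₂ , f₂ , v₂ = R₂ , run e ⨾ d , b₂ , (λ i<r → trans (f₂ i<r) (s₁ (<⇒≢ i<r))) ,
            trans v₂ (trans (cong (x +_) z) (ℕ.+-identityʳ x))

  Keeps : ℕ → (ℕ → ℕ) → List (Fin τ) → Store → Set
  Keeps d R o s = ∃[ R′ ] s ≡ st 0 R′ o × Bounded R′ × Same (_< d) R R′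

  module Fits-reach {m} (a b : Fn σ m) φ ψ d (fit : d + footprintF (reach a b φ ψ) ≤ K) where
    arith₁ : ∀ d a b p q → 1 + d + b + (a + (3 + (p + q))) ≡ d + (a + (b + (4 + (p + q))))
    arith₁ = solve-∀
    arith₂ : ∀ d a b p q → 4 + d + p + (a + b + q) ≡ d + (a + (b + (4 + (p + q))))
    arith₂ = solve-∀
    arith₃ : ∀ d a b p q → 2 + d + q + (a + b + (2 + p)) ≡ d + (a + (b + (4 + (p + q))))
    arith₃ = solve-∀
    fit-a : d + footprint a ≤ K
    fit-a = fits _ (ℕ.+-assoc d _ _) fit
    fit-b : 1 + d + footprint b ≤ K
    fit-b = fits _ (arith₁ d (footprint a) (footprint b) (footprintF φ) (footprintF ψ)) fit
    fit-φ : 4 + d + footprintF φ ≤ K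
    fit-φ = fits _ (arith₂ d (footprint a) (footprint b) (footprintF φ) (footprintF ψ)) fit
    fit-ψ : 2 + d + footprintF ψ ≤ K
    fit-ψ = fits _ (arith₃ d (footprint a) (footprint b) (footprintF φ) (footprintF ψ)) fit
    3+d<K : 3 + d < K
    3+d<K = ℕ.m+n≤o⇒m≤o (4 + d) fit-φ
    2+d<K : 2 + d < K
    2+d<K = ℕ.<-trans (ℕ.n<1+n _) 3+d<K
    1+d<K : 1 + d < K
    1+d<K = ℕ.<-trans (ℕ.n<1+n _) 2+d<K
    d<K : d < K
    d<K = ℕ.<-trans (ℕ.n<1+n _) 1+d<K

  up1 : ∀ {i d} → i < d → i < 1 + d
  up1 = ℕ.m<n⇒m<1+n

  up2 : ∀ {i d} → i < d → i < 2 + d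
  up2 = up1 ∘ up1

  private
    ≢′ : ∀ {i d : ℕ} → i < d → d ≢ i
    ≢′ h e = <⇒≢ h (sym e)

  -- Moving the guessed pair into place.
  advance-does : ∀ {d} → 3 + d < K → ∀ {R o} → Bounded R → Does (move (2 + d) d ⨾ move (3 + d) (1 + d)) R o
    λ R′ → Bounded R′ × R′ d ≡ R (2 + d) × R′ (1 + d) ≡ R (3 + d) × Same (_< d) R R′
  advance-does {d} 3+d<K {R} b =
    move-does (ℕ.<-trans (ℕ.n<1+n _) 3+d<K) (ℕ.<-trans (ℕ.<-trans (ℕ.n<1+n d) (ℕ.<-trans (ℕ.n<1+n _) (ℕ.n<1+n _))) 3+d<K)
      (≢′ (s≤s (ℕ.n≤1+n d))) b >>> λ {R₁} (b₁ , _ , v₁ , s₁) →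
    weaken (move-does 3+d<K (ℕ.<-trans (s≤s (s≤s (ℕ.n≤1+n d))) 3+d<K) (≢′ (s≤s (s≤s (ℕ.n≤1+n d)))) b₁) λ (b₂ , _ , v₂ , s₂) →
      b₂ , trans (s₂ (<⇒≢ (up2 (ℕ.n<1+n d)) , <⇒≢ (ℕ.n<1+n d))) v₁ ,
      trans v₂ (s₁ (≢′ (ℕ.n<1+n (2 + d)) , ≢′ (up2 (ℕ.n<1+n d)))) ,
      λ i<d → trans (s₂ (<⇒≢ (up1 (up2 i<d)) , <⇒≢ (up1 i<d))) (s₁ (<⇒≢ (up2 i<d) , <⇒≢ i<d))

  -- Determinate parts of the run are resolved by `outcome`, guesses by `guess-sound`. What a coin
  -- loop for `reach` has done is then recovered by induction on its rounds, each of which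
  -- contributes one `Link`.
  assert-sound : ∀ {m} (φ : Formula σ m) rs d ρ {R o s} → d + footprintF φ ≤ K → Env R d rs ρ → Bounded R →
    assertP φ rs d ⊢ st 0 R o ⇓ s → Sat φ ρ × Keeps d R o s
  assert-sound (at f) rs d ρ {R} {o} {s} fit env b (p ⨾ q) = go (eval f ρ) (outcome (eval-does f rs d ρ fit env b) p) q
    where
    go : ∀ v {m} → ∃[ R₁ ] (m ≡ st 0 R₁ o × Computed d R v R₁) → ifR d skip hang ⊢ m ⇓ s → 1 ≤ v × Keeps d R o s
    go zero (R₁ , refl , computed b₁ f₁ v₁) q = ⊥-elim (hang-never (ifR-zero-split {P = skip} {Q = hang} (fits-fn f fit) v₁ q))
    go (suc v) (R₁ , refl , computed b₁ f₁ v₁) q = s≤s z≤n , R₁ ,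
      only (ifR-pos {Q = hang} (fits-fn f fit) v₁ (subst (_≤ cap) v₁ (b₁ d)) (onHead-spec stay)) q , b₁ , f₁
  assert-sound (φ and ψ) rs d ρ fit env b (p ⨾ q)
    with assert-sound φ rs d ρ (fits _ (ℕ.+-assoc d _ _) fit) env b p
  ... | sφ , R₁ , refl , b₁ , f₁
    with assert-sound ψ rs d ρ (fits (footprintF φ) (arith d (footprintF φ) (footprintF ψ)) fit) (env-frame env ℕ.≤-refl f₁) b₁ q
    where
    arith : ∀ d p q → d + q + p ≡ d + (p + q)
    arith = solve-∀
  ... | sψ , R₂ , e₂ , b₂ , f₂ = (sφ , sψ) , R₂ , e₂ , b₂ , λ i<d → trans (f₂ i<d) (f₁ i<d)
  assert-sound (φ or ψ) rs d ρ fit env b (ifT _ p) =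
    let (s , k) = assert-sound φ rs d ρ (fits _ (ℕ.+-assoc d _ _) fit) env b p in inj₁ s , k
  assert-sound (φ or ψ) rs d ρ fit env b (ifF _ q) =
    let (s , k) = assert-sound ψ rs d ρ (fits (footprintF φ) (arith d (footprintF φ) (footprintF ψ)) fit) env b q in inj₂ s , k
    where
    arith : ∀ d p q → d + q + p ≡ d + (p + q)
    arith = solve-∀
  assert-sound (ex φ) rs d ρ fit env b (g ⨾ p)
    with guess-sound (ℕ.m+n≤o⇒m≤o (suc d) (ℕ.≤-trans (ℕ.≤-reflexive (sym (ℕ.+-suc d _))) fit)) b g
  ... | R₁ , refl , b₁ , f₁
    with assert-sound φ (d ∷ rs) (1 + d) (R₁ d ∷ ρ) (ℕ.≤-trans (ℕ.≤-reflexive (sym (ℕ.+-suc d _))) fit)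
           (env-push (env-frame env ℕ.≤-refl f₁) refl) b₁ p
  ... | s , R₂ , e₂ , b₂ , f₂ = (R₁ d , b₁ d , s) , R₂ , e₂ , b₂ , λ i<d → trans (f₂ (up1 i<d)) (f₁ i<d)
  assert-sound (all< f φ) rs d ρ {R} {o} fit env b (p ⨾ l)
    with outcome (eval-does f rs d ρ (fits _ (ℕ.+-assoc d _ _) fit) env b) p
  ... | R₁ , refl , computed b₁ f₁ v₁ = let (s , R₂ , e , b₂ , f₂) = loop (eval f ρ) v₁ (env-frame env ℕ.≤-refl f₁) b₁ l in
        s , R₂ , e , b₂ , λ i<d → trans (f₂ i<d) (f₁ i<d)
    where
    arith : ∀ d p q → 1 + d + q + p ≡ d + (p + (1 + q))
    arith = solve-∀
    fit-φ : 1 + d + footprintF φ ≤ K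
    fit-φ = fits (footprint f) (arith d (footprint f) (footprintF φ)) fit
    d<K : d < K
    d<K = ℕ.m+n≤o⇒m≤o (1 + d) fit-φ
    loop : ∀ k {R s} → R d ≡ k → Env R d rs ρ → Bounded R → whileR d (decr d ⨾ assertP φ (d ∷ rs) (1 + d)) ⊢ st 0 R o ⇓ s →
           (∀ x → x < k → Sat φ (x ∷ ρ)) × Keeps d R o s
    loop zero {R} ek env b l = (λ _ ()) , R , only (whileR-zero {P = decr d ⨾ assertP φ (d ∷ rs) (1 + d)} d<K ek) l , b , λ _ → refl
    loop (suc k) {R} ek env b l
      with whileR-split d<K ek (subst (_≤ cap) ek (b d)) l
    ... | _ , (dc ⨾ p) , l′ with outcome (decr-does d<K ek) dc
    ... | _ , refl , refl
      with assert-sound φ (d ∷ rs) (1 + d) (k ∷ ρ) fit-φ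
             (env-push (env-frame env ℕ.≤-refl λ i<d → set-≢ R k (<⇒≢ i<d)) (set-≡ R d k))
             (set-bounded b (ℕ.≤-trans (ℕ.n≤1+n k) (subst (_≤ cap) ek (b d)))) p
    ... | sk , R₂ , refl , b₂ , f₂
      with loop k (trans (f₂ (ℕ.n<1+n d)) (set-≡ R d k))
             (env-frame env ℕ.≤-refl λ i<d → trans (f₂ (up1 i<d)) (set-≢ R k (<⇒≢ i<d))) b₂ l′
    ... | sks , R₃ , e₃ , b₃ , f₃ =
      (λ x x≤k → case ℕ.m≤n⇒m<n∨m≡n (ℕ.≤-pred x≤k) of λ { (inj₁ x<k) → sks x x<k ; (inj₂ refl) → sk }) ,
      R₃ , e₃ , b₃ , λ i<d → trans (f₃ i<d) (trans (f₂ (up1 i<d)) (set-≢ R k (<⇒≢ i<d)))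
  assert-sound (reach a c φ ψ) rs d ρ {R} {o} fit env b (pa ⨾ pc ⨾ l ⨾ q)
    with outcome (eval-does a rs d ρ (Fits-reach.fit-a a c φ ψ d fit) env b) pa
  ... | R₁ , refl , computed b₁ f₁ v₁
    with outcome (eval-does c rs (1 + d) ρ (Fits-reach.fit-b a c φ ψ d fit) (env-frame env (ℕ.n≤1+n d) f₁) b₁) pc
  ... | R₂ , refl , computed b₂ f₂ v₂
    with loop l refl (trans (f₂ (ℕ.n<1+n d)) v₁) v₂ b₂ (λ i<d → trans (f₂ (up1 i<d)) (f₁ i<d))
    where
    open Fits-reach a c φ ψ d fit
    loop : ∀ {R₁ x y s s′} → while coin? (guess (2 + d) ⨾ guess (3 + d)
        ⨾ assertP φ (2 + d ∷ 3 + d ∷ d ∷ 1 + d ∷ rs) (4 + d) ⨾ move (2 + d) d ⨾ move (3 + d) (1 + d)) ⊢ s ⇓ s′ →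
      s ≡ st 0 R₁ o → R₁ d ≡ x → R₁ (1 + d) ≡ y → Bounded R₁ → Same (_< d) R R₁ →
      ∃₂ λ x′ y′ → Star (Link φ ρ) (x , y) (x′ , y′) ×
        ∃[ R′ ] s′ ≡ st 0 R′ o × R′ d ≡ x′ × R′ (1 + d) ≡ y′ × Bounded R′ × Same (_< d) R R′
    loop (halt _) e eqx eqy b f = _ , _ , ε , _ , e , eqx , eqy , b , f
    loop {R₁} {x} {y} (repeat _ (g₁ ⨾ g₂ ⨾ p ⨾ m) l) refl eqx eqy b₁ f₁
      with guess-sound 2+d<K b₁ g₁
    ... | R₂ , refl , b₂ , f₂ with guess-sound 3+d<K b₂ g₂
    ... | R₃ , refl , b₃ , f₃
      with assert-sound φ (2 + d ∷ 3 + d ∷ d ∷ 1 + d ∷ rs) (4 + d) (R₃ (2 + d) ∷ R₃ (3 + d) ∷ x ∷ y ∷ ρ) fit-φ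
             (env-pair (env-pair
               (env-frame env ℕ.≤-refl λ i<d → trans (f₃ (up1 (up2 i<d))) (trans (f₂ (up2 i<d)) (f₁ i<d)))
               (trans (f₃ (up1 (up1 (ℕ.n<1+n d)))) (trans (f₂ (up1 (ℕ.n<1+n d))) eqx))
               (trans (f₃ (up1 (ℕ.n<1+n (1 + d)))) (trans (f₂ (ℕ.n<1+n (1 + d))) eqy))) refl refl) b₃ p
    ... | sφ , R₄ , refl , b₄ , f₄
      with outcome (advance-does 3+d<K b₄) m
    ... | R₅ , refl , b₅ , vx , vy , f₅
      with loop l refl (trans vx (f₄ (up1 (ℕ.n<1+n _)))) (trans vy (f₄ (ℕ.n<1+n _))) b₅
             (λ i<d → trans (f₅ i<d) (trans (f₄ (up2 (up2 i<d))) (trans (f₃ (up1 (up2 i<d))) (trans (f₂ (up2 i<d)) (f₁ i<d)))))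
    ... | x′ , y′ , path , rest = x′ , y′ , (b₃ _ , b₃ _ , sφ) ◅ path , rest
  ... | x , y , path , R₃ , refl , eqx , eqy , b₃ , f₃
    with assert-sound ψ (d ∷ 1 + d ∷ rs) (2 + d) (x ∷ y ∷ ρ) (Fits-reach.fit-ψ a c φ ψ d fit)
           (env-pair (env-frame env ℕ.≤-refl f₃) eqx eqy) b₃ q
  ... | sψ , R₄ , e₄ , b₄ , f₄ = (x , y , path , sψ) , R₄ , e₄ , b₄ , λ i<d → trans (f₄ (up2 i<d)) (f₃ i<d)

  Reaches : Prog → ℕ → (ℕ → ℕ) → List (Fin τ) → Set
  Reaches P d R o = ∃[ R′ ] (P ⊢ st 0 R o ⇓ st 0 R′ o) × Bounded R′ × Same (_< d) R R′

  -- The evidence for the formula prescribes the guesses and the coins: witnesses are guessed, and a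
  -- path of links fixes the number of rounds of the loop.
  assert-complete : ∀ {m} (φ : Formula σ m) rs d ρ {R o} → d + footprintF φ ≤ K → Env R d rs ρ → Bounded R →
    Sat φ ρ → Reaches (assertP φ rs d) d R o
  assert-complete (at f) rs d ρ {R} {o} fit env b h with eval f ρ | eval-does f rs d ρ {R} {o} fit env b
  assert-complete (at f) rs d ρ fit env b (s≤s _) | suc v | yields {R₁} e (computed b₁ f₁ v₁) =
    R₁ , run e ⨾ run (ifR-pos {Q = hang} (fits-fn f fit) v₁ (subst (_≤ cap) v₁ (b₁ d)) (onHead-spec stay)) , b₁ , f₁
  assert-complete (φ and ψ) rs d ρ fit env b (hφ , hψ)
    with assert-complete φ rs d ρ (fits _ (ℕ.+-assoc d _ _) fit) env b hφ
  ... | R₁ , p , b₁ , f₁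
    with assert-complete ψ rs d ρ (fits (footprintF φ) (arith d (footprintF φ) (footprintF ψ)) fit) (env-frame env ℕ.≤-refl f₁) b₁ hψ
    where
    arith : ∀ d p q → d + q + p ≡ d + (p + q)
    arith = solve-∀
  ... | R₂ , q , b₂ , f₂ = R₂ , p ⨾ q , b₂ , λ i<d → trans (f₂ i<d) (f₁ i<d)
  assert-complete (φ or ψ) rs d ρ fit env b (inj₁ h) =
    let (R₁ , p , k) = assert-complete φ rs d ρ (fits _ (ℕ.+-assoc d _ _) fit) env b h in R₁ , ifT coin p , k
  assert-complete (φ or ψ) rs d ρ fit env b (inj₂ h) =
    let (R₁ , p , k) = assert-complete ψ rs d ρ (fits (footprintF φ) (arith d (footprintF φ) (footprintF ψ)) fit) env b h in R₁ , ifF coin p , k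
    where
    arith : ∀ d p q → d + q + p ≡ d + (p + q)
    arith = solve-∀
  assert-complete (ex φ) rs d ρ {R} {o} fit env b (x , x≤ , h)
    with guess-complete (ℕ.m+n≤o⇒m≤o (suc d) (ℕ.≤-trans (ℕ.≤-reflexive (sym (ℕ.+-suc d _))) fit)) {o} {R} x x≤ b
  ... | R₁ , g , b₁ , f₁ , v₁
    with assert-complete φ (d ∷ rs) (1 + d) (x ∷ ρ) (ℕ.≤-trans (ℕ.≤-reflexive (sym (ℕ.+-suc d _))) fit)
           (env-push (env-frame env ℕ.≤-refl f₁) v₁) b₁ h
  ... | R₂ , p , b₂ , f₂ = R₂ , g ⨾ p , b₂ , λ i<d → trans (f₂ (up1 i<d)) (f₁ i<d)
  assert-complete (all< f φ) rs d ρ {R} {o} fit env b h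
    with eval-does f rs d ρ {R} {o} (fits _ (ℕ.+-assoc d _ _) fit) env b
  ... | yields {R₁} e (computed b₁ f₁ v₁) =
        let (R₂ , l , b₂ , f₂) = loop (eval f ρ) h v₁ (env-frame env ℕ.≤-refl f₁) b₁ in
        R₂ , run e ⨾ l , b₂ , λ i<d → trans (f₂ i<d) (f₁ i<d)
    where
    arith : ∀ d p q → 1 + d + q + p ≡ d + (p + (1 + q))
    arith = solve-∀
    fit-φ : 1 + d + footprintF φ ≤ K
    fit-φ = fits (footprint f) (arith d (footprint f) (footprintF φ)) fit
    d<K : d < K
    d<K = ℕ.m+n≤o⇒m≤o (1 + d) fit-φ
    loop : ∀ k {R} → (∀ x → x < k → Sat φ (x ∷ ρ)) → R d ≡ k → Env R d rs ρ → Bounded R →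
           Reaches (whileR d (decr d ⨾ assertP φ (d ∷ rs) (1 + d))) d R o
    loop zero {R} h ek env b = R , run (whileR-zero d<K ek) , b , λ _ → refl
    loop (suc k) {R} h ek env b
      with assert-complete φ (d ∷ rs) (1 + d) (k ∷ ρ) {set R d k} {o} fit-φ
             (env-push (env-frame env ℕ.≤-refl λ i<d → set-≢ R k (<⇒≢ i<d)) (set-≡ R d k))
             (set-bounded b (ℕ.≤-trans (ℕ.n≤1+n k) (subst (_≤ cap) ek (b d)))) (h k (ℕ.n<1+n k))
    ... | R₂ , p , b₂ , f₂
      with loop k (λ x x<k → h x (ℕ.m<n⇒m<1+n x<k)) (trans (f₂ (ℕ.n<1+n d)) (set-≡ R d k))
             (env-frame env ℕ.≤-refl λ i<d → trans (f₂ (up1 i<d)) (set-≢ R k (<⇒≢ i<d))) b₂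
    ... | R₃ , l , b₃ , f₃ =
      R₃ , whileR-unroll d<K ek (subst (_≤ cap) ek (b d)) (run (decr-spec d<K ek) ⨾ p) l ,
      b₃ , λ i<d → trans (f₃ i<d) (trans (f₂ (up1 i<d)) (set-≢ R k (<⇒≢ i<d)))
  assert-complete (reach a c φ ψ) rs d ρ {R} {o} fit env b (x , y , path , hψ)
    with eval-does a rs d ρ {R} {o} (Fits-reach.fit-a a c φ ψ d fit) env b
  ... | yields {R₁} e₁ (computed b₁ f₁ v₁)
    with eval-does c rs (1 + d) ρ {R₁} {o} (Fits-reach.fit-b a c φ ψ d fit) (env-frame env (ℕ.n≤1+n d) f₁) b₁
  ... | yields {R₂} e₂ (computed b₂ f₂ v₂)
    with loop path (trans (f₂ (ℕ.n<1+n d)) v₁) v₂ b₂ (λ i<d → trans (f₂ (up1 i<d)) (f₁ i<d))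
    where
    open Fits-reach a c φ ψ d fit
    loop : ∀ {R₁ x y x′ y′} → Star (Link φ ρ) (x , y) (x′ , y′) → R₁ d ≡ x → R₁ (1 + d) ≡ y → Bounded R₁ → Same (_< d) R R₁ →
      ∃[ R′ ] (while coin? (guess (2 + d) ⨾ guess (3 + d)
        ⨾ assertP φ (2 + d ∷ 3 + d ∷ d ∷ 1 + d ∷ rs) (4 + d) ⨾ move (2 + d) d ⨾ move (3 + d) (1 + d)) ⊢ st 0 R₁ o ⇓ st 0 R′ o)
        × R′ d ≡ x′ × R′ (1 + d) ≡ y′ × Bounded R′ × Same (_< d) R R′
    loop {R₁} ε eqx eqy b f = R₁ , halt coin , eqx , eqy , b , f
    loop {R₁} {x} {y} (_◅_ {j = x₁ , y₁} (x₁≤ , y₁≤ , hφ) path) eqx eqy b₁ f₁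
      with guess-complete 2+d<K {o} x₁ x₁≤ b₁
    ... | R₂ , g₁ , b₂ , f₂ , ex₁ with guess-complete 3+d<K {o} y₁ y₁≤ b₂
    ... | R₃ , g₂ , b₃ , f₃ , ey₁
      with assert-complete φ (2 + d ∷ 3 + d ∷ d ∷ 1 + d ∷ rs) (4 + d) (x₁ ∷ y₁ ∷ x ∷ y ∷ ρ) {R₃} {o} fit-φ
             (env-pair (env-pair
               (env-frame env ℕ.≤-refl λ i<d → trans (f₃ (up1 (up2 i<d))) (trans (f₂ (up2 i<d)) (f₁ i<d)))
               (trans (f₃ (up1 (up1 (ℕ.n<1+n d)))) (trans (f₂ (up1 (ℕ.n<1+n d))) eqx))
               (trans (f₃ (up1 (ℕ.n<1+n (1 + d)))) (trans (f₂ (ℕ.n<1+n (1 + d))) eqy))) (trans (f₃ (ℕ.n<1+n (2 + d))) ex₁) ey₁) b₃ hφ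
    ... | R₄ , p , b₄ , f₄
      with advance-does 3+d<K {R₄} {o} b₄
    ... | yields {R₅} e₅ (b₅ , vx , vy , f₅)
      with loop path (trans vx (trans (f₄ (up1 (ℕ.n<1+n _))) (trans (f₃ (ℕ.n<1+n (2 + d))) ex₁))) (trans vy (trans (f₄ (ℕ.n<1+n _)) ey₁)) b₅
             (λ i<d → trans (f₅ i<d) (trans (f₄ (up2 (up2 i<d))) (trans (f₃ (up1 (up2 i<d))) (trans (f₂ (up2 i<d)) (f₁ i<d)))))
    ... | R₆ , l , rest = R₆ , repeat coin (g₁ ⨾ g₂ ⨾ p ⨾ run e₅) l , rest
  ... | R₃ , l , eqx , eqy , b₃ , f₃
    with assert-complete ψ (d ∷ 1 + d ∷ rs) (2 + d) (x ∷ y ∷ ρ) (Fits-reach.fit-ψ a c φ ψ d fit)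
           (env-pair (env-frame env ℕ.≤-refl f₃) eqx eqy) b₃ hψ
  ... | R₄ , q , b₄ , f₄ = R₄ , run e₁ ⨾ run e₂ ⨾ l ⨾ q , b₄ , λ i<d → trans (f₄ (up2 i<d)) (f₃ i<d)

-- Laying out the counters: every tape counts the input in binary

module Ruler (β : ℕ) where

  open Digits β

  -- The ruler is written with digits of the large base but read in binary: every nonzero digit
  -- counts as 1.
  bit : Digit′ → ℕ
  bit zero    = 0
  bit (suc _) = 1

  binc : List Digit′ → List Digit′
  binc []           = suc zero ∷ []
  binc (zero ∷ ds)  = suc zero ∷ ds
  binc (suc d ∷ ds) = zero ∷ binc ds

  ruler : ℕ → List Digit′
  ruler zero    = zero ∷ []
  ruler (suc n) = binc (ruler n)

  bval : List Digit′ → ℕ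
  bval []       = 0
  bval (d ∷ ds) = bit d + 2 * bval ds

  bval-binc : ∀ ds → bval (binc ds) ≡ suc (bval ds)
  bval-binc []           = refl
  bval-binc (zero ∷ ds)  = refl
  bval-binc (suc d ∷ ds) rewrite bval-binc ds = ℕ.*-suc 2 (bval ds)

  bval-ruler : ∀ n → bval (ruler n) ≡ n
  bval-ruler zero    = refl
  bval-ruler (suc n) = trans (bval-binc (ruler n)) (cong suc (bval-ruler n))

  bval< : ∀ ds → bval ds < 2 ^ length ds
  bval< []       = s≤s z≤n
  bval< (d ∷ ds) = ℕ.≤-trans (s≤s (ℕ.+-monoˡ-≤ (2 * bval ds) (bit≤1 d)))
    (ℕ.≤-trans (ℕ.≤-reflexive (sym (ℕ.*-suc 2 (bval ds)))) (ℕ.*-monoʳ-≤ 2 (bval< ds)))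
    where
    bit≤1 : ∀ d → bit d ≤ 1
    bit≤1 zero    = z≤n
    bit≤1 (suc _) = s≤s z≤n

  -- The highest digit is nonzero. This bounds the length of the binary numeral by the logarithm
  -- from above.
  data Leading : List Digit′ → Set where
    top  : ∀ {d} → Leading (suc d ∷ [])
    more : ∀ {d ds} → Leading ds → Leading (d ∷ ds)

  leading-binc : ∀ {ds} → Leading ds → Leading (binc ds)
  leading-binc top                  = more top
  leading-binc (more {zero} h)      = more h
  leading-binc (more {suc d} h)     = more (leading-binc h)

  leading-ruler : ∀ n → Leading (ruler (suc n))
  leading-ruler zero    = top
  leading-ruler (suc n) = leading-binc (leading-ruler n)

  leading-length : ∀ {ds} → Leading ds → ∃[ k ] length ds ≡ suc k × 2 ^ k ≤ bval ds
  leading-length top = 0 , refl , s≤s z≤n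
  leading-length (more {d} {ds} h) =
    let (k , e , p) = leading-length h in suc k , cong suc e , ℕ.≤-trans (ℕ.*-monoʳ-≤ 2 p) (ℕ.m≤n+m _ (bit d))

  ruler-length : ∀ n → ∃[ k ] length (ruler n) ≡ suc k × k ≤ ⌊log₂ n ⌋
  ruler-length zero    = 0 , refl , z≤n
  ruler-length (suc n) =
    let (k , e , p) = leading-length (leading-ruler n) in
    k , e , ℕ.≤-trans (ℕ.≤-reflexive (sym (⌊log₂[2^n]⌋≡n k))) (⌊log₂⌋-mono-≤ (ℕ.≤-trans p (ℕ.≤-reflexive (bval-ruler (suc n)))))

module Initialisation (σ τ K-1 β : ℕ) (σ≤β : σ ≤ β) where

  open Registers σ τ K-1 β σ≤β
  open Ruler β

  any-digit : Digit → Bool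
  any-digit _ = true

  carry : Fin K → Prog
  carry r = instr (sweep r (_, right))
    ⨾ while (tape? r (isDigit (not ∘ zero?))) (instr (sweep r (λ _ → zero , right)))
    -- The raw write may fall on the blank after the last digit and so lengthen the numeral.
    ⨾ instr (onTape r (raw λ _ → digit (suc zero) , left))
    ⨾ while (tape? r (not ∘ isHome)) (instr (sweep r (_, left)))

  -- The input symbols are counted in binary and the numeral is then overwritten by zeros: only its
  -- length is wanted, as the common width of the counters.
  initTape : Fin K → Prog
  initTape r = instr (onTape r (raw λ _ → home , right)) ⨾ instr (onTape r (raw λ _ → digit zero , left))
    ⨾ instr (onHead right)
    ⨾ while (input? notRightEnd) (carry r ⨾ instr (onHead right))
    ⨾ rewind
    ⨾ instr (sweep r (_, right))
    ⨾ while (tape? r (isDigit any-digit)) (instr (sweep r (λ _ → zero , right)))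
    ⨾ goHome r

  initUpTo : ℕ → Prog
  initUpTo zero    = skip
  initUpTo (suc j) = initUpTo j ⨾ initTape (reg j)

  init-coinFree : ∀ j → CoinFree (initUpTo j)
  init-coinFree zero    = tt
  init-coinFree (suc j) = init-coinFree j , _

  module InitSpecs (w : List (Fin σ)) (C : Bool → Set) (someC : ∃ C) where

    open Semantics w C someC
    open CounterSpecs w C someC

    module _ (r : Fin K) (ts : Vec (Tape γ) K) (o : List (Fin τ)) where

      -- Unlike in `scanning`, no blank is stored behind the digits that lie ahead of the head.
      laying : List Digit → List Digit → Tape γ
      laying xs []       = tape (digits⌣ xs ++ [ home ]) blank []
      laying xs (d ∷ ds) = tape (digits⌣ xs ++ [ home ]) (digit d) (digits⌣ ds)

      laid : List Digit → Tape γ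
      laid ds = tape [] home (digits⌣ ds)

      withdrawing : List Digit → List Digit → Tape γ
      withdrawing []       ds = laid ds
      withdrawing (x ∷ xs) ds = laying xs (x ∷ ds)

      S : ℕ → Tape γ → Store
      S h t = put r (store h ts o) t

      to-home : ∀ h xs ds → Spec (while (tape? r (not ∘ isHome)) (instr (sweep r (_, left)))) (S h (withdrawing xs ds)) (S h (laid (xs ʳ++ ds)))
      to-home h []           ds = spec-halt (sure-tape r (store h ts o) _ (laid ds) refl)
      to-home h (x ∷ [])     ds = spec-repeat (sure-tape r (store h ts o) _ (laying [] (x ∷ ds)) refl)
        (spec-tape r (store h ts o) _ (laying [] (x ∷ ds)) refl) (to-home h [] (x ∷ ds))
      to-home h (x ∷ y ∷ xs) ds = spec-repeat (sure-tape r (store h ts o) _ (laying (y ∷ xs) (x ∷ ds)) refl)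
        (spec-tape r (store h ts o) _ (laying (y ∷ xs) (x ∷ ds)) refl) (to-home h (y ∷ xs) (x ∷ ds))

      from-home : ∀ h ds → Spec (instr (sweep r (_, right))) (S h (laid ds)) (S h (laying [] ds))
      from-home h []       = spec-tape r (store h ts o) _ (laid []) refl
      from-home h (d ∷ ds) = spec-tape r (store h ts o) _ (laid (d ∷ ds)) refl

      rightwards : ∀ h xs d ds → Spec (instr (sweep r (λ _ → zero , right))) (S h (laying xs (d ∷ ds))) (S h (laying (zero ∷ xs) ds))
      rightwards h xs d []        = spec-tape r (store h ts o) _ (laying xs (d ∷ [])) refl
      rightwards h xs d (d′ ∷ ds) = spec-tape r (store h ts o) _ (laying xs (d ∷ d′ ∷ ds)) refl

      leftwards : ∀ h xs ds → Spec (instr (onTape r (raw λ _ → digit (suc zero) , left))) (S h (laying xs ds))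
                                   (S h (withdrawing xs (suc zero ∷ List.drop 1 ds)))
      leftwards h []       []       = spec-tape r (store h ts o) _ (laying [] []) refl
      leftwards h (x ∷ xs) []       = spec-tape r (store h ts o) _ (laying (x ∷ xs) []) refl
      leftwards h []       (d ∷ ds) = spec-tape r (store h ts o) _ (laying [] (d ∷ ds)) refl
      leftwards h (x ∷ xs) (d ∷ ds) = spec-tape r (store h ts o) _ (laying (x ∷ xs) (d ∷ ds)) refl

      spec-carry : ∀ h ds → Spec (carry r) (S h (laid ds)) (S h (laid (binc ds)))
      spec-carry h ds = from-home h ds ⨟ go [] ds
        where
        tst = tape? r (isDigit (not ∘ zero?))
        B = instr (sweep r (λ _ → zero , right))
        go : ∀ xs ds → Spec (while tst B ⨾ instr (onTape r (raw λ _ → digit (suc zero) , left))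
               ⨾ while (tape? r (not ∘ isHome)) (instr (sweep r (_, left))))
               (S h (laying xs ds)) (S h (laid (xs ʳ++ binc ds)))
        go xs []           = spec-halt (sure-tape r (store h ts o) _ (laying xs []) refl) ⨟ leftwards h xs [] ⨟ to-home h xs _
        go xs (zero ∷ ds)  = spec-halt (sure-tape r (store h ts o) _ (laying xs (zero ∷ ds)) refl) ⨟ leftwards h xs (zero ∷ ds) ⨟ to-home h xs _
        go xs (suc d ∷ ds) with go (zero ∷ xs) ds
        ... | spec (l ⨾ m) u = spec
              (repeat (sure-holds sureT) (run first) l ⨾ m)
              λ { (halt e ⨾ _)         → case sure-only sureT e of λ ()
                ; (repeat _ p l′ ⨾ m′) → u (subst (λ x → while tst B ⊢ x ⇓ _) (only first p) l′ ⨾ m′) }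
          where
          sureT : Sure tst (S h (laying xs (suc d ∷ ds))) true
          sureT = sure-tape r (store h ts o) _ (laying xs (suc d ∷ ds)) refl
          first = rightwards h xs (suc d) ds

      count : ∀ k i → k + i ≡ length w →
        Spec (while (input? notRightEnd) (carry r ⨾ instr (onHead right))) (S (suc i) (laid (ruler i))) (S (suc (length w)) (laid (ruler (length w))))
      count zero    i refl = spec-halt (sure λ _ → cong notRightEnd (readInput-outside w ℕ.≤-refl))
      count (suc k) i eq   = spec-repeat (sure λ _ → readInput-inside w i<)
        (spec-carry (suc i) (ruler i) ⨟ spec-instr (onHead right) (cong (λ h → S h (laid (binc (ruler i)))) (ℕ.m≤n⇒m⊓n≡m (s≤s i<))))
        (count k (suc i) (trans (ℕ.+-suc k i) eq))
        where
        i< : i < length w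
        i< = ℕ.≤-trans (s≤s (ℕ.m≤n+m i k)) (ℕ.≤-reflexive eq)

      back-to-start : ∀ h t → Spec rewind (S h t) (S 0 t)
      back-to-start zero    t = spec-halt (sure λ _ → refl)
      back-to-start (suc h) t = spec-repeat (sure λ _ → readInput-notLeftEnd w h) (spec-instr (onHead left) refl) (back-to-start h t)

      erase : ∀ k ds → Spec (while (tape? r (isDigit any-digit)) (instr (sweep r (λ _ → zero , right))))
        (S 0 (laying (replicate k zero) ds)) (S 0 (scanning (replicate (length ds + k) zero) []))
      erase k []       = spec-halt (sure-tape r (store 0 ts o) _ (laying (replicate k zero) []) refl)
      erase k (d ∷ ds) = spec-repeat (sure-tape r (store 0 ts o) _ (laying (replicate k zero) (d ∷ ds)) refl)
        (rightwards 0 (replicate k zero) d ds)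
        (subst (λ x → Spec (while (tape? r (isDigit any-digit)) (instr (sweep r (λ _ → zero , right)))) (S 0 (laying (replicate (suc k) zero) ds)) (S 0 (scanning (replicate x zero) []))) (ℕ.+-suc (length ds) k) (erase (suc k) ds))

      zeros-ʳ++ : ∀ k j → replicate {A = Digit} k zero ʳ++ replicate j zero ≡ replicate (k + j) zero
      zeros-ʳ++ zero    j = refl
      zeros-ʳ++ (suc k) j = trans (zeros-ʳ++ k (suc j)) (cong (λ x → replicate x zero) (ℕ.+-suc k j))

      spec-initTape : Spec (initTape r) (S 0 blankTape) (S 0 (resting (replicate (length (ruler (length w))) zero)))
      spec-initTape =
        spec-tape r (store 0 ts o) _ blankTape refl
        ⨟ spec-tape r (store 0 ts o) _ (tape [ home ] blank []) refl
        ⨟ spec-instr (onHead right) refl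
        ⨟ count (length w) 0 (ℕ.+-identityʳ _)
        ⨟ back-to-start _ _
        ⨟ from-home 0 (ruler (length w))
        ⨟ erase 0 (ruler (length w))
        ⨟ subst (λ x → Spec (goHome r) (S 0 (scanning (replicate (length (ruler (length w)) + 0) zero) [])) (S 0 (resting x)))
            (trans (zeros-ʳ++ _ 0) (cong (λ x → replicate x zero) (trans (ℕ.+-identityʳ _) (ℕ.+-identityʳ _))))
            (spec-goHome r (store 0 ts o) (replicate (length (ruler (length w)) + 0) zero) [])

    partly : ℕ → Fin K → Tape γ
    partly j i = if toℕ i <ᵇ j then resting (replicate (length (ruler (length w))) zero) else blankTape

    <ᵇ-true : ∀ {i j} → i < j → (i <ᵇ j) ≡ true
    <ᵇ-true {zero}  {suc j} h       = refl
    <ᵇ-true {suc i} {suc j} (s≤s h) = <ᵇ-true h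

    <ᵇ-false : ∀ {i j} → j ≤ i → (i <ᵇ j) ≡ false
    <ᵇ-false {i}     {zero}  h       = refl
    <ᵇ-false {suc i} {suc j} (s≤s h) = <ᵇ-false h

    <ᵇ-suc : ∀ i j → i ≢ j → (i <ᵇ j) ≡ (i <ᵇ suc j)
    <ᵇ-suc zero    zero    h = contradiction refl h
    <ᵇ-suc zero    (suc j) h = refl
    <ᵇ-suc (suc i) zero    h = refl
    <ᵇ-suc (suc i) (suc j) h = <ᵇ-suc i j (h ∘ cong suc)

    spec-initUpTo : ∀ j → j ≤ K → Spec (initUpTo j) (store 0 (Vec.tabulate (partly 0)) []) (store 0 (Vec.tabulate (partly j)) [])
    spec-initUpTo zero    h   = spec-instr (onHead stay) refl
    spec-initUpTo (suc j) j<K = spec-initUpTo j (ℕ.≤-trans (ℕ.n≤1+n j) j<K) ⨟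
      subst₂ (Spec (initTape (reg j))) before-eq after-eq (spec-initTape (reg j) (Vec.tabulate (partly j)) [])
      where
      before-eq : put (reg j) (store 0 (Vec.tabulate (partly j)) []) blankTape ≡ store 0 (Vec.tabulate (partly j)) []
      before-eq = put-id (reg j) _ (trans (Vec.lookup∘tabulate (partly j) (reg j))
        (cong (λ b → if b then resting (replicate (length (ruler (length w))) zero) else blankTape)
          (trans (cong (_<ᵇ j) (toℕ-reg j<K)) (<ᵇ-false (ℕ.≤-refl {j})))))
      after-eq : put (reg j) (store 0 (Vec.tabulate (partly j)) []) (resting (replicate (length (ruler (length w))) zero))
               ≡ store 0 (Vec.tabulate (partly (suc j))) []
      after-eq = cong (λ ts → store 0 ts []) (tabulate-update (partly j)
        (λ i → if i <ᵇ suc j then resting (replicate (length (ruler (length w))) zero) else blankTape) (reg j)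
        (cong (λ b → if b then resting (replicate (length (ruler (length w))) zero) else blankTape)
          (trans (cong (_<ᵇ suc j) (toℕ-reg j<K)) (<ᵇ-true (ℕ.n<1+n j))))
        λ i i≢j → cong (λ b → if b then resting (replicate (length (ruler (length w))) zero) else blankTape)
          (<ᵇ-suc (toℕ i) j λ e → i≢j (Fin.toℕ-injective (trans e (sym (toℕ-reg j<K))))))

    spec-init : Spec (initUpTo K) start-store (store 0 (Vec.tabulate {n = K} λ _ → resting (replicate (length (ruler (length w))) zero)) [])
    spec-init = subst₂ (Spec (initUpTo K)) (cong (λ ts → store 0 ts []) (tabulate-const K))
      (cong (λ ts → store 0 ts []) (Vec.tabulate-cong λ i →
        cong (λ b → if b then resting (replicate (length (ruler (length w))) zero) else blankTape) (<ᵇ-true (Fin.toℕ<n i))))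
      (spec-initUpTo K ℕ.≤-refl)
      where
      tabulate-const : ∀ {A : Set} {x : A} k → Vec.tabulate {n = k} (λ _ → x) ≡ Vec.replicate k x
      tabulate-const zero    = refl
      tabulate-const (suc k) = cong (_ ∷_) (tabulate-const k)

-- Guardedness of the generated programs

module Guardedness (σ τ K-1 β : ℕ) (σ≤β : σ ≤ β) where

  open Registers σ τ K-1 β σ≤β
  open Generators σ τ K-1 β σ≤β

  opaque
    unfolding incr whileR clear guess

    guarded-incr : ∀ r → Guarded (incr r)
    guarded-incr r = _

    guarded-decr : ∀ r → Guarded (decr r)
    guarded-decr r = _

    guarded-whileR : ∀ r P → Guarded P → Guarded (whileR r P)
    guarded-whileR r P g = _ , (_ , g , _) , _

    guarded-ifR : ∀ r P Q → Guarded P → Guarded Q → Guarded (ifR r P Q)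
    guarded-ifR r P Q g h = _ , (_ , g) , (_ , h)

    guarded-clear : ∀ r → Guarded (clear r)
    guarded-clear r = _

    guarded-move : ∀ a b → Guarded (move a b)
    guarded-move a b = _

    guarded-copy : ∀ a b t → Guarded (copy a b t)
    guarded-copy a b t = _

    guarded-guess : ∀ r → Guarded (guess r)
    guarded-guess r = _

  mutual
    guarded-eval : ∀ {m} (f : Fn σ m) rs d → Guarded (evalP f rs d)
    guarded-eval (var i)      rs d = guarded-copy _ _ _
    guarded-eval zer          rs d = guarded-clear d
    guarded-eval (succ f)     rs d = guarded-eval f rs d , guarded-incr d , guarded-ifR d skip (decr d) tt (guarded-decr d)
    guarded-eval (prd f)      rs d = guarded-eval f rs d , guarded-ifR d (decr d) skip (guarded-decr d) tt
    guarded-eval (comp f gs)  rs d = guarded-evals gs rs _ , guarded-eval f _ _ , guarded-move _ _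
    guarded-eval (iter n z s) rs d = guarded-eval n rs d , guarded-eval z rs _ ,
      guarded-whileR d _ (guarded-decr d , guarded-eval s _ _ , guarded-move _ _) , guarded-move _ _
    guarded-eval (sym′ f)     rs d = guarded-eval f rs d , guarded-whileR d _ (guarded-decr d , tt) , _
    guarded-eval len          rs d = guarded-clear d , tt , (guarded-incr d , tt) , _

    guarded-evals : ∀ {k m} (gs : Vec (Fn σ m) k) rs d → Guarded (evalsP gs rs d)
    guarded-evals []       rs d = tt
    guarded-evals (g ∷ gs) rs d = guarded-eval g rs d , guarded-evals gs rs (suc d)

  guarded-assert : ∀ {m} (φ : Formula σ m) rs d → Guarded (assertP φ rs d)
  guarded-assert (at f)          rs d = guarded-eval f rs d , guarded-ifR d skip hang tt tt
  guarded-assert (φ and ψ)       rs d = guarded-assert φ rs d , guarded-assert ψ rs d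
  guarded-assert (φ or ψ)        rs d = guarded-assert φ rs d , guarded-assert ψ rs d
  guarded-assert (ex φ)          rs d = guarded-guess d , guarded-assert φ _ _
  guarded-assert (all< f φ)      rs d = guarded-eval f rs d , guarded-whileR d _ (guarded-decr d , guarded-assert φ _ _)
  guarded-assert (reach a b φ ψ) rs d = guarded-eval a rs d , guarded-eval b rs _ ,
    (guarded-guess _ , guarded-guess _ , guarded-assert φ _ _ , guarded-move _ _ , guarded-move _ _) , guarded-assert ψ _ _

  guarded-print : ∀ {m} (p : Out σ τ m) rs d → Guarded (printP p rs d)
  guarded-print (emit a)     rs d = tt
  guarded-print (p ▹ q)      rs d = guarded-print p rs d , guarded-print q rs d
  guarded-print (for f p)    rs d = guarded-eval f rs d , guarded-clear _ ,
    guarded-whileR d _ (guarded-decr d , guarded-print p _ _ , guarded-incr _)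
  guarded-print (cond f p q) rs d = guarded-eval f rs d , guarded-ifR d _ _ (guarded-print p rs d) (guarded-print q rs d)

-- The logarithmic space classes in terms of formulas and printing functions

-- With this many digit values, counters as wide as the binary length of the
-- input hold numbers up to (2 + n) ^ c.
module Capacity (σ c : ℕ) where

  β : ℕ
  β = σ + 4 ^ c

  module _ (n : ℕ) where

    open Ruler β

    private
      ℓ : ℕ
      ℓ = length (ruler n)
      ℓ-1 : ℕ
      ℓ-1 = proj₁ (ruler-length n)
      ℓ-eq : ℓ ≡ suc ℓ-1
      ℓ-eq = proj₁ (proj₂ (ruler-length n))

    width-1 : ℕ
    width-1 = ℓ-1

    cap : ℕ
    cap = pred (suc (suc β) ^ suc width-1)

    cap-eq : suc (suc β) ^ suc width-1 ≡ suc cap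
    cap-eq = sym (ℕ.suc-pred _ {{>-nonZero (ℕ.m^n>0 (suc (suc β)) (suc width-1))}})

    n<2^ℓ : n < 2 ^ suc ℓ-1
    n<2^ℓ = subst₂ (λ x y → x < 2 ^ y) (bval-ruler n) ℓ-eq (bval< (ruler n))

    n≤cap : n ≤ cap
    n≤cap = ℕ.≤-pred (ℕ.≤-trans n<2^ℓ (ℕ.≤-trans (ℕ.^-monoˡ-≤ (suc ℓ-1) (s≤s (s≤s z≤n))) (ℕ.≤-reflexive cap-eq)))

    -- With `ℓ` digits one has `2 + n ≤ 4 ^ ℓ`, hence `(2 + n) ^ c ≤ (4 ^ c) ^ ℓ`, and the base was
    -- chosen above `4 ^ c`.
    capacity : (2 + n) ^ c ≤ cap
    capacity = ℕ.≤-pred (begin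
      suc ((2 + n) ^ c)                   ≤⟨ s≤s (ℕ.^-monoˡ-≤ c bound) ⟩
      suc ((4 ^ suc ℓ-1) ^ c)             ≡⟨ cong suc (trans (ℕ.^-*-assoc 4 (suc ℓ-1) c) (trans (cong (4 ^_) (ℕ.*-comm (suc ℓ-1) c)) (sym (ℕ.^-*-assoc 4 c (suc ℓ-1))))) ⟩
      -- One factor `2 + β` is split as `1 + (1 + β)`: the first summand pays for the additional 1,
      -- the second dominates `4 ^ c`.
      suc ((4 ^ c) ^ suc ℓ-1)             ≤⟨ ℕ.+-mono-≤ (ℕ.m^n>0 (suc (suc β)) ℓ-1) (ℕ.*-mono-≤ (x≤ 1) (ℕ.^-monoˡ-≤ ℓ-1 (x≤ 2))) ⟩
      suc (suc β) ^ ℓ-1 + suc β * suc (suc β) ^ ℓ-1 ≡⟨ cap-eq ⟩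
      suc cap                             ∎)
      where
      open ℕ.≤-Reasoning
      x≤ : ∀ k → 4 ^ c ≤ k + (σ + 4 ^ c)
      x≤ k = ℕ.≤-trans (ℕ.m≤n+m (4 ^ c) σ) (ℕ.m≤n+m _ k)
      bound : 2 + n ≤ 4 ^ suc ℓ-1
      bound = begin
        2 + n                         ≤⟨ s≤s n<2^ℓ ⟩
        1 + 2 ^ suc ℓ-1               ≤⟨ ℕ.+-monoˡ-≤ (2 ^ suc ℓ-1) (ℕ.m^n>0 2 (suc ℓ-1)) ⟩
        2 ^ suc ℓ-1 + 2 ^ suc ℓ-1     ≡⟨ cong (2 ^ suc ℓ-1 +_) (sym (ℕ.+-identityʳ _)) ⟩
        2 * 2 ^ suc ℓ-1               ≤⟨ ℕ.*-monoˡ-≤ (2 ^ suc ℓ-1) (ℕ.*-monoʳ-≤ 2 (ℕ.m^n>0 2 ℓ-1)) ⟩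
        2 ^ suc ℓ-1 * 2 ^ suc ℓ-1     ≡⟨ square (2 ^ ℓ-1) (4 ^ ℓ-1) (ℕ.^-distribˡ-+-* 2 ℓ-1 ℓ-1) (trans (ℕ.^-*-assoc 2 2 ℓ-1) (cong (2 ^_) (cong (ℓ-1 +_) (ℕ.+-identityʳ ℓ-1)))) ⟩
        4 ^ suc ℓ-1                   ∎
        where
        lem : ∀ x → 2 * x * (2 * x) ≡ 4 * (x * x)
        lem = solve-∀
        square : ∀ x y {z} → z ≡ x * x → y ≡ z → 2 * x * (2 * x) ≡ 4 * y
        square x y refl refl = lem x

    width-bound : ∀ K → K * (2 + suc width-1) ≤ (3 * K) * suc ⌊log₂ n ⌋
    width-bound K = begin
      K * (2 + suc width-1)         ≤⟨ ℕ.*-monoʳ-≤ K (ℕ.+-monoʳ-≤ 3 (proj₂ (proj₂ (ruler-length n)))) ⟩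
      K * (3 + ⌊log₂ n ⌋)           ≤⟨ ℕ.*-monoʳ-≤ K (ℕ.≤-trans (ℕ.+-monoʳ-≤ 3 (ℕ.m≤n*m ⌊log₂ n ⌋ 3)) (ℕ.≤-reflexive (sym (ℕ.*-suc 3 ⌊log₂ n ⌋)))) ⟩
      K * (3 * suc ⌊log₂ n ⌋)       ≡⟨ trans (sym (ℕ.*-assoc K 3 _)) (cong (_* suc ⌊log₂ n ⌋) (ℕ.*-comm K 3)) ⟩
      (3 * K) * suc ⌊log₂ n ⌋       ∎
      where open ℕ.≤-Reasoning

module Setup (σ τ c size : ℕ) where

  open Capacity σ c public

  σ≤β : σ ≤ β
  σ≤β = ℕ.m≤m+n σ (4 ^ c)

  open Registers σ τ size β σ≤β public
  open Generators σ τ size β σ≤β public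
  open Guardedness σ τ size β σ≤β public
  open Initialisation σ τ size β σ≤β public

  module Run (w : List (Fin σ)) (C : Bool → Set) (someC : ∃ C) where

    open RegisterSpecs w C someC (width-1 (length w)) (cap (length w)) (cap-eq (length w)) (n≤cap (length w)) public
    open InitSpecs w C someC public

    zeroed : Store
    zeroed = st 0 (λ _ → 0) []

    opaque
      unfolding st

      spec-zeroed : Spec (initUpTo K) start-store zeroed
      spec-zeroed = subst (λ l → Spec (initUpTo K) start-store (store 0 (Vec.tabulate {n = K} λ _ → resting (replicate l zero)) []))
        (proj₁ (proj₂ (Ruler.ruler-length β (length w)))) spec-init

      zeroed-shaped : ShapedStore (suc (width-1 (length w))) zeroed
      zeroed-shaped r = subst (Shaped _) (sym (Vec.lookup∘tabulate (λ _ → resting (num ℓ 0)) r)) (at-rest {ds = num ℓ 0} (length-num ℓ 0))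

    bounded-zero : Bounded (λ _ → 0)
    bounded-zero _ = z≤n

    space≤ : ∀ Q → Guarded Q → ∀ {mp s} → (initUpTo K ⨾ Q) ⊢ (just (entry (initUpTo K ⨾ Q)) , start-store) ↦* (mp , s) →
             cells s ≤ (3 * K) * suc ⌊log₂ length w ⌋
    space≤ Q g xs = ℕ.≤-trans
      (TwoPhases.space-bound w C someC (initUpTo K) Q (init-coinFree K) g _ zeroed zeroed-shaped (run spec-zeroed) xs)
      (width-bound (length w) K)

module _ {σ : ℕ} where

  -- The actual cap is dictated by the width of the counters and only bounded below by a polynomial,
  -- so a formula has to be right at every larger cap.
  Defines : ∀ {ℓ} → Formula σ 0 → ℕ → Language σ ℓ → Set ℓ
  Defines φ c L = ∀ w cap → (2 + length w) ^ c ≤ cap → L w ⇔ Satisfaction.Sat w cap φ []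

  NL-by-formula : ∀ {ℓ} (φ : Formula σ 0) c (L : Language σ ℓ) → Defines φ c L → NL L
  NL-by-formula φ c L defines = ToNTM.acceptor P , (3 * K , small) , λ w → mk⇔ (to w) (from w)
    where
    open Setup σ 0 c (footprintF φ)
    Q = assertP φ [] 0
    P = initUpTo K ⨾ Q
    small : ∀ w c → NondeterministicTM.Reachable (ToNTM.acceptor P) w c → space c ≤ (3 * K) * suc ⌊log₂ length w ⌋
    small w c r with ToNTM.reachable-space P w r
    ... | mp , s , xs , eq = ℕ.≤-trans (ℕ.≤-reflexive eq) (Run.space≤ w (λ _ → ⊤) (true , tt) Q (guarded-assert φ [] 0) xs)
    module _ (w : List (Fin σ)) where
      open Run w (λ _ → ⊤) (true , tt)
      open EvalPrograms σ 0 (footprintF φ) β σ≤β w (λ _ → ⊤) (true , tt) (width-1 (length w)) (cap (length w)) (cap-eq (length w)) (n≤cap (length w))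
      open AssertPrograms σ 0 (footprintF φ) β σ≤β w (width-1 (length w)) (cap (length w)) (cap-eq (length w)) (n≤cap (length w))
      fit : footprintF φ ≤ K
      fit = ℕ.n≤1+n _
      to : L w → NondeterministicTM.Accepts (ToNTM.acceptor P) w
      to l with assert-complete φ [] 0 [] {λ _ → 0} {[]} fit (environment λ ()) bounded-zero (Equivalence.to (defines w _ (capacity (length w))) l)
      ... | _ , d , _ = Equivalence.from (ToNTM.accepts⇔ P w) (_ , run spec-zeroed ⨾ d)
      from : NondeterministicTM.Accepts (ToNTM.acceptor P) w → L w
      from a with Equivalence.to (ToNTM.accepts⇔ P w) a
      ... | _ , (i ⨾ d) = Equivalence.from (defines w _ (capacity (length w)))
        (proj₁ (assert-sound φ [] 0 [] {λ _ → 0} {[]} fit (environment λ ()) bounded-zero (subst (λ s → Q ⊢ s ⇓ _) (only spec-zeroed i) d)))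

  logSpace-by-printing : ∀ {τ} (p : Out σ τ 0) c (f : List (Fin σ) → List (Fin τ)) →
    (∀ w cap → (2 + length w) ^ c ≤ cap → Printing.print w cap p [] ≡ f w) → LogSpaceComputable f
  logSpace-by-printing {τ} p c f prints = ToTransducer.transducer P , (3 * K , small) , computes
    where
    open Setup σ τ c (footprintO p)
    Q = printP p [] 0
    P = initUpTo K ⨾ Q
    small : ∀ w c o → Transducer.Reachable (ToTransducer.transducer P) w (c , o) → space c ≤ (3 * K) * suc ⌊log₂ length w ⌋
    small w c o r with ToTransducer.reachable-space P w r
    ... | mp , s , xs , eq = ℕ.≤-trans (ℕ.≤-reflexive eq) (Run.space≤ w (_≡ true) (true , refl) Q (guarded-print p [] 0) xs)
    module _ (w : List (Fin σ)) where
      open Run w (_≡ true) (true , refl)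
      open EvalPrograms σ τ (footprintO p) β σ≤β w (_≡ true) (true , refl) (width-1 (length w)) (cap (length w)) (cap-eq (length w)) (n≤cap (length w))
      open PrintPrograms σ τ (footprintO p) β σ≤β w (_≡ true) (true , refl) (width-1 (length w)) (cap (length w)) (cap-eq (length w)) (n≤cap (length w))
      Result : List (Fin τ) → Set
      Result o = ∃[ c ] Transducer.Reachable (ToTransducer.transducer P) w (c , o) × observe (Transducer.δ (ToTransducer.transducer P)) w c ≡ nothing
      computes : Result (f w)
      computes with print-does p [] 0 [] {λ _ → 0} {[]} (ℕ.n≤1+n _) (environment λ ()) bounded-zero
      ... | yields e _ = subst Result (trans (written-st _ _ _) (prints w _ (capacity (length w))))
        (ToTransducer.computes P w (run spec-zeroed ⨾ run e))

-- Derived functions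

module _ {σ : ℕ} where

  infixr 6 _∧ᶠ_
  infixr 5 _∨ᶠ_
  infix  7 _≐_ _≺_ _≼_
  infixl 8 _⊕_ _⊖_
  infixl 9 _⊗_

  opaque
    one : ∀ {m} → Fn σ m
    one = succ zer

    const# : ∀ {m} → ℕ → Fn σ m
    const# zero    = zer
    const# (suc k) = succ (const# k)

    _⊕_ _⊖_ : ∀ {m} → Fn σ m → Fn σ m → Fn σ m
    f ⊕ g = comp (iter (var 0F) (var 1F) (succ (var 1F))) (f ∷ g ∷ [])
    f ⊖ g = comp (iter (var 1F) (var 0F) (prd (var 1F))) (f ∷ g ∷ [])

    -- A conditional as a loop: if `c` is zero the body never runs and the initial value `g`
    -- remains; otherwise every round sets the value to `f`.
    choose : ∀ {m} → Fn σ m → Fn σ m → Fn σ m → Fn σ m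
    choose c f g = comp (iter (var 0F) (var 2F) (var 3F)) (c ∷ f ∷ g ∷ [])

    -- The body of a bounded search or sum as the body of an iteration.
    skipping : ∀ {m} → Fn σ (1 + m) → Fn σ (2 + m)
    skipping f = comp f (var 0F ∷ Vec.tabulate (λ i → var (suc (suc i))))

  opaque
    _⊗_ _≼_ _≺_ _∧ᶠ_ _∨ᶠ_ : ∀ {m} → Fn σ m → Fn σ m → Fn σ m
    neg : ∀ {m} → Fn σ m → Fn σ m

    f ⊗ g  = comp (iter (var 0F) zer (var 3F ⊕ var 1F)) (f ∷ g ∷ [])
    neg f  = choose f zer one
    f ∧ᶠ g = choose f g zer
    f ∨ᶠ g = choose f one g
    f ≼ g  = neg (f ⊖ g)
    f ≺ g  = g ⊖ f

  opaque
    _≐_ : ∀ {m} → Fn σ m → Fn σ m → Fn σ m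
    f ≐ g  = f ≼ g ∧ᶠ g ≼ f

    _^ᶠ_ : ∀ {m} → Fn σ m → ℕ → Fn σ m
    f ^ᶠ zero  = one
    f ^ᶠ suc k = f ⊗ f ^ᶠ k

    -- Iteration visits the indices downwards, so in `least` the last hit to overwrite the
    -- accumulator is the smallest one; without a hit the value is that of `b`.
    least some every total : ∀ {m} → Fn σ m → Fn σ (1 + m) → Fn σ m
    least b f = iter b b (choose (skipping f) (var 0F) (var 1F))
    some b f  = iter b zer (skipping f ∨ᶠ var 1F)
    every b f = iter b one (skipping f ∧ᶠ var 1F)
    total b f = iter b zer (skipping f ⊕ var 1F)

  opaque
    quot rem : ∀ {m} → Fn σ m → Fn σ m → Fn σ m
    quot f g = comp (least (succ (var 0F)) (var 1F ≺ succ (var 0F) ⊗ var 2F)) (f ∷ g ∷ [])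
    rem f g  = f ⊖ quot f g ⊗ g

  orFin : ∀ {m n} → (Fin n → Fn σ m) → Fn σ m
  orFin {n = zero}  f = zer
  orFin {n = suc n} f = f zero ∨ᶠ orFin (f ∘ suc)

  orVec : ∀ {m n k} → (Vec (Fin n) k → Fn σ m) → Fn σ m
  orVec {k = zero}  f = f []
  orVec {k = suc k} f = orFin λ x → orVec λ xs → f (x ∷ xs)

  orInput : ∀ {m s} → (InputSymbol s → Fn σ m) → Fn σ m
  orInput f = f ⊢ ∨ᶠ f ⊣ ∨ᶠ orFin (f ∘ char)

  orList : ∀ {m} {A : Set} → List A → (A → Fn σ m) → Fn σ m
  orList []       f = zer
  orList (x ∷ xs) f = f x ∨ᶠ orList xs f

-- Combining equivalences; values of the derived functions

<suc-cases : ∀ {i n} → i < suc n → i < n ⊎ i ≡ n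
<suc-cases h = ℕ.m≤n⇒m<n∨m≡n (ℕ.≤-pred h)

to↔ : ∀ {a b} {A : Set a} {B : Set b} → A ⇔ B → A → B
to↔ = Equivalence.to

from↔ : ∀ {a b} {A : Set a} {B : Set b} → A ⇔ B → B → A
from↔ = Equivalence.from

∀<suc : ∀ {n} (P : ℕ → Set) → (∀ i → i < n → P i) → P n → ∀ i → i < suc n → P i
∀<suc P h p i l with <suc-cases l
... | inj₁ i<n  = h i i<n
... | inj₂ refl = p

infixr 4 _⟫_
_⟫_ : ∀ {a b c} {A : Set a} {B : Set b} {C : Set c} → A ⇔ B → B ⇔ C → A ⇔ C
f ⟫ g = mk⇔ (to↔ g ∘ to↔ f) (from↔ f ∘ from↔ g)

_×⇔_ : ∀ {a b c d} {A : Set a} {B : Set b} {C : Set c} {D : Set d} → A ⇔ B → C ⇔ D → (A × C) ⇔ (B × D)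
f ×⇔ g = mk⇔ (λ (x , y) → to↔ f x , to↔ g y) (λ (x , y) → from↔ f x , from↔ g y)

_⊎⇔_ : ∀ {a b c d} {A : Set a} {B : Set b} {C : Set c} {D : Set d} → A ⇔ B → C ⇔ D → (A ⊎ C) ⇔ (B ⊎ D)
f ⊎⇔ g = mk⇔ (λ { (inj₁ x) → inj₁ (to↔ f x) ; (inj₂ y) → inj₂ (to↔ g y) })
              (λ { (inj₁ x) → inj₁ (from↔ f x) ; (inj₂ y) → inj₂ (from↔ g y) })

∃⇔ : ∀ {a b c} {A : Set a} {B : A → Set b} {C : A → Set c} → (∀ x → B x ⇔ C x) → ∃ B ⇔ ∃ C
∃⇔ f = mk⇔ (λ (x , y) → x , to↔ (f x) y) (λ (x , y) → x , from↔ (f x) y)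

id⇔ : ∀ {a} {A : Set a} → A ⇔ A
id⇔ = mk⇔ id id

≡⇔ : ∀ {A : Set} {x x′ y y′ : A} → x ≡ x′ → y ≡ y′ → (x ≡ y) ⇔ (x′ ≡ y′)
≡⇔ refl refl = id⇔

module Truth {σ : ℕ} (w : List (Fin σ)) (cap : ℕ) (1≤cap : 1 ≤ cap) where

  open Evaluation w cap

  True : ∀ {m} → Fn σ m → Vec ℕ m → Set
  True f ρ = 1 ≤ eval f ρ

  true? : ∀ {m} (f : Fn σ m) ρ → Dec (True f ρ)
  true? f ρ = 1 ℕ.≤? eval f ρ

  opaque
    unfolding one
    one-eval : ∀ {m} {ρ : Vec ℕ m} → eval one ρ ≡ 1
    one-eval = ℕ.m≤n⇒m⊓n≡m 1≤cap

    const-eval : ∀ {m} {ρ : Vec ℕ m} k → k ≤ cap → eval (const# k) ρ ≡ k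
    const-eval zero    h = refl
    const-eval {ρ = ρ} (suc k) h rewrite const-eval {ρ = ρ} k (ℕ.≤-trans (ℕ.n≤1+n k) h) = ℕ.m≤n⇒m⊓n≡m h

    succ-eval : ∀ {m} {ρ : Vec ℕ m} f {x} → eval f ρ ≡ x → suc x ≤ cap → eval (succ f) ρ ≡ suc x
    succ-eval f refl h = ℕ.m≤n⇒m⊓n≡m h

    truncated-sum : ∀ x y → y ≤ cap → foldDown (λ _ a → suc a ⊓ cap) x y ≡ (x + y) ⊓ cap
    truncated-sum zero    y h = sym (ℕ.m≤n⇒m⊓n≡m h)
    truncated-sum (suc x) y h with suc y ℕ.≤? cap
    ... | yes p = trans (truncated-sum x _ (ℕ.m⊓n≤n _ cap)) (trans (cong (λ z → (x + z) ⊓ cap) (ℕ.m≤n⇒m⊓n≡m p)) (cong (_⊓ cap) (ℕ.+-suc x y)))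
    ... | no p  = trans (truncated-sum x _ (ℕ.m⊓n≤n _ cap)) (trans (cong (λ z → (x + z) ⊓ cap) (ℕ.m≥n⇒m⊓n≡n (ℕ.≤-trans (ℕ.≮⇒≥ p) (ℕ.n≤1+n y))))
          (trans (ℕ.m≥n⇒m⊓n≡n (ℕ.m≤n+m cap x)) (sym (ℕ.m≥n⇒m⊓n≡n (ℕ.≤-trans (ℕ.≮⇒≥ p) (ℕ.m≤n+m y (suc x)))))))

    ⊕-trunc : ∀ {m} {ρ : Vec ℕ m} f g → eval g ρ ≤ cap → eval (f ⊕ g) ρ ≡ (eval f ρ + eval g ρ) ⊓ cap
    ⊕-trunc f g h = truncated-sum _ _ h

    ⊕-eval : ∀ {m} {ρ : Vec ℕ m} f g {x y} → eval f ρ ≡ x → eval g ρ ≡ y → x + y ≤ cap → eval (f ⊕ g) ρ ≡ x + y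
    ⊕-eval f g {x} {y} refl refl h = trans (⊕-trunc f g (ℕ.m+n≤o⇒n≤o x h)) (ℕ.m≤n⇒m⊓n≡m h)

    ⊖-eval : ∀ {m} {ρ : Vec ℕ m} f g → eval (f ⊖ g) ρ ≡ eval f ρ ∸ eval g ρ
    ⊖-eval {ρ = ρ} f g = go (eval g ρ) (eval f ρ)
      where
      go : ∀ y x → foldDown (λ _ a → pred a) y x ≡ x ∸ y
      go zero    x       = refl
      go (suc y) zero    = trans (go y 0) (ℕ.0∸n≡0 y)
      go (suc y) (suc x) = go y x

    choose-eval : ∀ {m} {ρ : Vec ℕ m} c f g → eval (choose c f g) ρ ≡ (if 0 <ᵇ eval c ρ then eval f ρ else eval g ρ)
    choose-eval {ρ = ρ} c f g with eval c ρ
    ... | zero  = refl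
    ... | suc k = go k
      where
      go : ∀ k → foldDown (λ _ _ → eval f ρ) k (eval f ρ) ≡ eval f ρ
      go zero    = refl
      go (suc k) = go k

    choose-true : ∀ {m} {ρ : Vec ℕ m} c f g → True c ρ → eval (choose c f g) ρ ≡ eval f ρ
    choose-true {ρ = ρ} c f g h rewrite choose-eval {ρ = ρ} c f g with eval c ρ | h
    ... | suc _ | _ = refl

    choose-false : ∀ {m} {ρ : Vec ℕ m} c f g → ¬ True c ρ → eval (choose c f g) ρ ≡ eval g ρ
    choose-false {ρ = ρ} c f g h rewrite choose-eval {ρ = ρ} c f g with eval c ρ
    ... | zero  = refl
    ... | suc _ = contradiction (s≤s z≤n) h

    evals-shift : ∀ {m k} (g : Fin k → Fin m) (ρ : Vec ℕ m) → evals (Vec.tabulate (var ∘ g)) ρ ≡ Vec.tabulate (lookup ρ ∘ g)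
    evals-shift {k = zero}  g ρ = refl
    evals-shift {k = suc k} g ρ = cong (_ ∷_) (evals-shift (g ∘ suc) ρ)

    skipping-eval : ∀ {m} (f : Fn σ (1 + m)) {i a ρ} → eval (skipping f) (i ∷ a ∷ ρ) ≡ eval f (i ∷ ρ)
    skipping-eval f {i} {a} {ρ} = cong (λ xs → eval f (i ∷ xs)) (trans (evals-shift (λ j → suc (suc j)) (i ∷ a ∷ ρ)) (Vec.tabulate∘lookup ρ))

    skipping⇔ : ∀ {m} (f : Fn σ (1 + m)) {i a ρ} → True (skipping f) (i ∷ a ∷ ρ) ⇔ True f (i ∷ ρ)
    skipping⇔ f {i} {a} {ρ} rewrite skipping-eval f {i} {a} {ρ} = id⇔

  opaque
    unfolding _⊗_

    ⊗-trunc : ∀ {m} {ρ : Vec ℕ m} f g → eval (f ⊗ g) ρ ≡ (eval f ρ * eval g ρ) ⊓ cap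
    ⊗-trunc {ρ = ρ} f g = trans (go (eval f ρ) 0 z≤n) (cong (_⊓ cap) (ℕ.+-identityʳ _))
      where
      y : ℕ
      y = eval g ρ
      trunc-+ : ∀ a b c → (a + (b + c) ⊓ cap) ⊓ cap ≡ (a + b + c) ⊓ cap
      trunc-+ a b c with ℕ.≤-total (b + c) cap
      ... | inj₁ h rewrite ℕ.m≤n⇒m⊓n≡m h = cong (_⊓ cap) (sym (ℕ.+-assoc a b c))
      ... | inj₂ h rewrite ℕ.m≥n⇒m⊓n≡n h = trans (ℕ.m≥n⇒m⊓n≡n (ℕ.m≤n+m cap a))
            (sym (ℕ.m≥n⇒m⊓n≡n (ℕ.≤-trans h (ℕ.≤-trans (ℕ.m≤n+m (b + c) a) (ℕ.≤-reflexive (sym (ℕ.+-assoc a b c)))))))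
      F : ℕ → ℕ → ℕ
      F i a = eval (var 3F ⊕ var 1F) (i ∷ a ∷ eval f ρ ∷ y ∷ [])
      go : ∀ x a → a ≤ cap → foldDown F x a ≡ (x * y + a) ⊓ cap
      go zero    a h = sym (ℕ.m≤n⇒m⊓n≡m h)
      go (suc x) a h = trans (cong (foldDown F x) (⊕-trunc (var 3F) (var 1F) h))
        (trans (go x ((y + a) ⊓ cap) (ℕ.m⊓n≤n _ cap)) (trans (trunc-+ (x * y) y a) (cong (λ z → (z + a) ⊓ cap) (ℕ.+-comm (x * y) y))))

    ⊗-eval : ∀ {m} {ρ : Vec ℕ m} f g {x y} → eval f ρ ≡ x → eval g ρ ≡ y → x * y ≤ cap → eval (f ⊗ g) ρ ≡ x * y
    ⊗-eval f g refl refl h = trans (⊗-trunc f g) (ℕ.m≤n⇒m⊓n≡m h)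

    neg⇔ : ∀ {m} {ρ : Vec ℕ m} f → True (neg f) ρ ⇔ (¬ True f ρ)
    neg⇔ {ρ = ρ} f with true? f ρ
    ... | yes h rewrite choose-true {ρ = ρ} f zer one h  = mk⇔ (λ ()) (λ n → contradiction h n)
    ... | no ¬h rewrite choose-false {ρ = ρ} f zer one ¬h | one-eval {ρ = ρ} = mk⇔ (λ _ → ¬h) (λ _ → s≤s z≤n)

    ∧⇔ : ∀ {m} {ρ : Vec ℕ m} f g → True (f ∧ᶠ g) ρ ⇔ (True f ρ × True g ρ)
    ∧⇔ {ρ = ρ} f g with true? f ρ
    ... | yes h rewrite choose-true {ρ = ρ} f g zer h  = mk⇔ (h ,_) proj₂
    ... | no ¬h rewrite choose-false {ρ = ρ} f g zer ¬h = mk⇔ (λ ()) (λ (h , _) → contradiction h ¬h)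

    ∨⇔ : ∀ {m} {ρ : Vec ℕ m} f g → True (f ∨ᶠ g) ρ ⇔ (True f ρ ⊎ True g ρ)
    ∨⇔ {ρ = ρ} f g with true? f ρ
    ... | yes h rewrite choose-true {ρ = ρ} f one g h | one-eval {ρ = ρ} = mk⇔ (λ _ → inj₁ h) (λ _ → s≤s z≤n)
    ... | no ¬h rewrite choose-false {ρ = ρ} f one g ¬h = mk⇔ inj₂ λ { (inj₁ h) → contradiction h ¬h ; (inj₂ h) → h }

    ≺⇔ : ∀ {m} {ρ : Vec ℕ m} f g → True (f ≺ g) ρ ⇔ (eval f ρ < eval g ρ)
    ≺⇔ {ρ = ρ} f g rewrite ⊖-eval {ρ = ρ} g f = mk⇔ (λ h → ℕ.m∸n≢0⇒n<m λ e → contradiction (subst (1 ≤_) e h) λ ()) ℕ.m<n⇒0<n∸m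

    ≼⇔ : ∀ {m} {ρ : Vec ℕ m} f g → True (f ≼ g) ρ ⇔ (eval f ρ ≤ eval g ρ)
    ≼⇔ f g = neg⇔ (f ⊖ g) ⟫ mk⇔ (λ h → ℕ.≮⇒≥ λ l → h (from↔ (≺⇔ g f) l)) (λ h l → ℕ.<⇒≱ (to↔ (≺⇔ g f) l) h)

  opaque
    unfolding _≐_

    ^-eval : ∀ {m} {ρ : Vec ℕ m} f k {x} → 1 ≤ x → eval f ρ ≡ x → x ^ k ≤ cap → eval (f ^ᶠ k) ρ ≡ x ^ k
    ^-eval f zero    1≤x e h = one-eval
    ^-eval f (suc k) {x@(suc _)} 1≤x e h = ⊗-eval f (f ^ᶠ k) e (^-eval f k 1≤x e (ℕ.≤-trans (ℕ.m≤n*m (x ^ k) x) h)) h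

    ≐⇔ : ∀ {m} {ρ : Vec ℕ m} f g → True (f ≐ g) ρ ⇔ (eval f ρ ≡ eval g ρ)
    ≐⇔ f g = ∧⇔ (f ≼ g) (g ≼ f) ⟫ (≼⇔ f g ×⇔ ≼⇔ g f) ⟫ mk⇔ (λ (h , k) → ℕ.≤-antisym h k) (λ e → ℕ.≤-reflexive e , ℕ.≤-reflexive (sym e))

    some⇔ : ∀ {m} {ρ : Vec ℕ m} b f → True (some b f) ρ ⇔ (∃[ i ] i < eval b ρ × True f (i ∷ ρ))
    some⇔ {ρ = ρ} b f = go (eval b ρ) ⟫ mk⇔ (λ { (inj₁ h) → h ; (inj₂ ()) }) inj₁
      where
      go : ∀ n {a} → (1 ≤ foldDown (λ i a → eval (skipping f ∨ᶠ var 1F) (i ∷ a ∷ ρ)) n a) ⇔ ((∃[ i ] i < n × True f (i ∷ ρ)) ⊎ 1 ≤ a)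
      go zero        = mk⇔ inj₂ λ { (inj₁ (_ , () , _)) ; (inj₂ h) → h }
      go (suc n) {a} = go n ⟫ (id⇔ ⊎⇔ (∨⇔ (skipping f) (var 1F) ⟫ (skipping⇔ f ⊎⇔ id⇔))) ⟫ mk⇔
        (λ { (inj₁ (i , l , h)) → inj₁ (i , ℕ.m<n⇒m<1+n l , h) ; (inj₂ (inj₁ h)) → inj₁ (n , ℕ.n<1+n n , h) ; (inj₂ (inj₂ h)) → inj₂ h })
        (λ { (inj₁ (i , l , h)) → ∀<suc (λ i → True f (i ∷ ρ) → (∃[ j ] j < n × True f (j ∷ ρ)) ⊎ (True f (n ∷ ρ) ⊎ 1 ≤ a)) (λ j j<n t → inj₁ (j , j<n , t)) (inj₂ ∘ inj₁) i l h
           ; (inj₂ h) → inj₂ (inj₂ h) })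

    every⇔ : ∀ {m} {ρ : Vec ℕ m} b f → True (every b f) ρ ⇔ (∀ i → i < eval b ρ → True f (i ∷ ρ))
    every⇔ {ρ = ρ} b f = go (eval b ρ) ⟫ mk⇔ proj₁ (λ h → h , ℕ.≤-reflexive (sym (one-eval {ρ = ρ})))
      where
      go : ∀ n {a} → (1 ≤ foldDown (λ i a → eval (skipping f ∧ᶠ var 1F) (i ∷ a ∷ ρ)) n a) ⇔ ((∀ i → i < n → True f (i ∷ ρ)) × 1 ≤ a)
      go zero        = mk⇔ ((λ _ ()) ,_) proj₂
      go (suc n) {a} = go n ⟫ (id⇔ ×⇔ (∧⇔ (skipping f) (var 1F) ⟫ (skipping⇔ f ×⇔ id⇔))) ⟫ mk⇔
        (λ (h , k , l) → ∀<suc (λ i → True f (i ∷ ρ)) h k , l)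
        (λ (h , l) → (λ i i<n → h i (ℕ.m<n⇒m<1+n i<n)) , h n (ℕ.n<1+n n) , l)

    least-eval : ∀ {m} {ρ : Vec ℕ m} b f {i} → i < eval b ρ → True f (i ∷ ρ) → (∀ j → j < i → ¬ True f (j ∷ ρ)) → eval (least b f) ρ ≡ i
    least-eval {ρ = ρ} b f {i} i<b hi hj = find (eval b ρ) i<b
      where
      F : ℕ → ℕ → ℕ
      F j a = eval (choose (skipping f) (var 0F) (var 1F)) (j ∷ a ∷ ρ)
      keep : ∀ n {a} → n ≤ i → foldDown F n a ≡ a
      keep zero    h = refl
      keep (suc n) {a} h = trans (cong (foldDown F n) (choose-false (skipping f) (var 0F) (var 1F) (hj n h ∘ to↔ (skipping⇔ f))))
        (keep n (ℕ.≤-trans (ℕ.n≤1+n n) h))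
      find : ∀ n {a} → i < n → foldDown F n a ≡ i
      find (suc n) {a} h with <suc-cases h
      ... | inj₁ i<n  = find n i<n
      ... | inj₂ refl = trans (cong (foldDown F n) (choose-true (skipping f) (var 0F) (var 1F) (from↔ (skipping⇔ f) hi))) (keep n ℕ.≤-refl)

  opaque
    unfolding quot

    -- The bound `x + y ≤ cap` keeps the products `(i + 1) * y` with `i ≤ q` untruncated, so the
    -- comparisons made up to the quotient are exact.
    quot-eval : ∀ {m} {ρ : Vec ℕ m} f g {x y q r} → eval f ρ ≡ x → eval g ρ ≡ y → x ≡ r + q * y → r < y → x + y ≤ cap → eval (quot f g) ρ ≡ q
    quot-eval f g {x} {y@(suc _)} {q} {r} ef eg e r<y h rewrite ef | eg = least-eval {ρ = x ∷ y ∷ []} (succ (var 0F)) P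
      (subst (q <_) (sym (ℕ.m≤n⇒m⊓n≡m (ℕ.≤-trans 1+x≤ h))) (s≤s q≤x))
      (from↔ (P⇔ q ℕ.≤-refl) (subst (_< suc q * y) (sym e) (ℕ.+-monoˡ-< (q * y) r<y)))
      λ j j< t → ℕ.<⇒≱ (to↔ (P⇔ j (ℕ.<⇒≤ j<)) t) (ℕ.≤-trans (ℕ.*-monoˡ-≤ y j<) qy≤x)
      where
      P : Fn σ 3
      P = var 1F ≺ succ (var 0F) ⊗ var 2F
      1+x≤ : suc x ≤ x + y
      1+x≤ = ℕ.m<m+n x (s≤s z≤n)
      qy≤x : q * y ≤ x
      qy≤x = ℕ.≤-trans (ℕ.m≤n+m (q * y) r) (ℕ.≤-reflexive (sym e))
      q≤x : q ≤ x
      q≤x = ℕ.≤-trans (ℕ.m≤m*n q y) qy≤x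
      P⇔ : ∀ i → i ≤ q → True P (i ∷ x ∷ y ∷ []) ⇔ (x < suc i * y)
      P⇔ i i≤q = ≺⇔ (var 1F) (succ (var 0F) ⊗ var 2F) ⟫ mk⇔ (subst (x <_) value) (subst (x <_) (sym value))
        where
        bound : suc i * y ≤ cap
        bound = ℕ.≤-trans (ℕ.≤-trans (ℕ.+-monoʳ-≤ y (ℕ.≤-trans (ℕ.*-monoˡ-≤ y i≤q) qy≤x)) (ℕ.≤-reflexive (ℕ.+-comm y x))) h
        value : eval (succ (var 0F) ⊗ var 2F) (i ∷ x ∷ y ∷ []) ≡ suc i * y
        value = ⊗-eval (succ (var 0F)) (var 2F) (ℕ.m≤n⇒m⊓n≡m (ℕ.≤-trans (ℕ.m≤m*n (suc i) y) bound)) refl bound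

    rem-eval : ∀ {m} {ρ : Vec ℕ m} f g {x y q r} → eval f ρ ≡ x → eval g ρ ≡ y → x ≡ r + q * y → r < y → x + y ≤ cap → eval (rem f g) ρ ≡ r
    rem-eval f g {x} {y} {q} {r} ef eg e r<y h = trans (⊖-eval f (quot f g ⊗ g)) (trans (cong₂ _∸_ (trans ef e)
        (⊗-eval (quot f g) g {q} (quot-eval f g ef eg e r<y h) eg (ℕ.≤-trans (ℕ.≤-trans (ℕ.m≤n+m (q * y) r) (ℕ.≤-reflexive (sym e))) (ℕ.m+n≤o⇒m≤o x h))))
      (ℕ.m+n∸n≡m r (q * y)))

  orFin⇔ : ∀ {m n} {ρ : Vec ℕ m} (f : Fin n → Fn σ m) → True (orFin f) ρ ⇔ (∃[ i ] True (f i) ρ)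
  orFin⇔ {n = zero}  f = mk⇔ (λ ()) λ ()
  orFin⇔ {n = suc n} f = ∨⇔ (f zero) (orFin (f ∘ suc)) ⟫ (id⇔ ⊎⇔ orFin⇔ (f ∘ suc)) ⟫
    mk⇔ (λ { (inj₁ h) → zero , h ; (inj₂ (i , h)) → suc i , h }) λ { (zero , h) → inj₁ h ; (suc i , h) → inj₂ (i , h) }

  orVec⇔ : ∀ {m n k} {ρ : Vec ℕ m} (f : Vec (Fin n) k → Fn σ m) → True (orVec f) ρ ⇔ (∃[ xs ] True (f xs) ρ)
  orVec⇔ {k = zero}  f = mk⇔ ([] ,_) λ { ([] , h) → h }
  orVec⇔ {k = suc k} f = orFin⇔ (λ x → orVec λ xs → f (x ∷ xs)) ⟫ ∃⇔ (λ x → orVec⇔ (λ xs → f (x ∷ xs))) ⟫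
    mk⇔ (λ (x , xs , h) → x ∷ xs , h) λ { (x ∷ xs , h) → x , xs , h }

  orInput⇔ : ∀ {m s} {ρ : Vec ℕ m} (f : InputSymbol s → Fn σ m) → True (orInput f) ρ ⇔ (∃[ a ] True (f a) ρ)
  orInput⇔ f = ∨⇔ (f ⊢) (f ⊣ ∨ᶠ orFin (f ∘ char)) ⟫ (id⇔ ⊎⇔ (∨⇔ (f ⊣) (orFin (f ∘ char)) ⟫ (id⇔ ⊎⇔ orFin⇔ (f ∘ char)))) ⟫
    mk⇔ (λ { (inj₁ h) → ⊢ , h ; (inj₂ (inj₁ h)) → ⊣ , h ; (inj₂ (inj₂ (a , h))) → char a , h })
        λ { (⊢ , h) → inj₁ h ; (⊣ , h) → inj₂ (inj₁ h) ; (char a , h) → inj₂ (inj₂ (a , h)) }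

  orList⇔ : ∀ {m} {A : Set} {ρ : Vec ℕ m} xs (f : A → Fn σ m) → True (orList xs f) ρ ⇔ (∃[ x ] x List∈.∈ xs × True (f x) ρ)
  orList⇔ []       f = mk⇔ (λ ()) λ { (_ , () , _) }
  orList⇔ (x ∷ xs) f = ∨⇔ (f x) (orList xs f) ⟫ (id⇔ ⊎⇔ orList⇔ xs f) ⟫
    mk⇔ (λ { (inj₁ h) → x , here refl , h ; (inj₂ (y , y∈ , h)) → y , there y∈ , h })
        λ { (_ , here refl , h) → inj₁ h ; (y , there y∈ , h) → inj₂ (y , y∈ , h) }

-- Reachability in graphs given by truncated functions

-- The interface between machines and reductions. The target is the largest vertex and by
-- `edge-range` has no outgoing edge. As for formulas, the functions have to be exact for all caps
-- above a polynomial.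
record GraphFor {σ ℓ} (L : Language σ ℓ) : Set (Level.suc 0ℓ Level.⊔ ℓ) where
  field
    exponent      : ℕ
    sourceF       : Fn σ 0
    targetF       : Fn σ 0
    edgeF         : Fn σ 2
    source target : List (Fin σ) → ℕ
    Edge          : List (Fin σ) → ℕ → ℕ → Set
    source<target : ∀ w → source w < target w
    target-small  : ∀ w → suc (target w) ≤ (2 + length w) ^ exponent
    edge-range    : ∀ {w v u} → Edge w v u → v < target w × u ≤ target w
    reachability  : ∀ w → L w ⇔ Star (Edge w) (source w) (target w)
    source-eval   : ∀ w cap → (2 + length w) ^ exponent ≤ cap → Evaluation.eval w cap sourceF [] ≡ source w
    target-eval   : ∀ w cap → (2 + length w) ^ exponent ≤ cap → Evaluation.eval w cap targetF [] ≡ target w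
    edge-eval     : ∀ w cap → (2 + length w) ^ exponent ≤ cap → ∀ v u → v ≤ target w → u ≤ target w →
                    (1 ≤ Evaluation.eval w cap edgeF (v ∷ u ∷ [])) ⇔ Edge w v u

k<2^k : ∀ k → k < 2 ^ k
k<2^k zero    = s≤s z≤n
k<2^k (suc k) = ℕ.≤-trans (ℕ.+-mono-≤ (ℕ.m^n>0 2 k) (k<2^k k)) (ℕ.≤-reflexive (cong (2 ^ k +_) (sym (ℕ.+-identityʳ _))))

2^⌊log₂n⌋≤n : ∀ n → 1 ≤ n → 2 ^ ⌊log₂ n ⌋ ≤ n
2^⌊log₂n⌋≤n = <-rec _ λ
  { (suc zero)    rec _ → s≤s z≤n
  ; n@(suc (suc m)) rec _ → begin
      2 ^ ⌊log₂ n ⌋               ≡⟨ cong (2 ^_) (log-suc n (⌊log₂⌋-mono-≤ {2} {n} (s≤s (s≤s z≤n)))) ⟩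
      2 * 2 ^ (⌊log₂ n ⌋ ∸ 1)     ≡⟨ cong (λ k → 2 * 2 ^ k) (sym (⌊log₂⌊n/2⌋⌋≡⌊log₂n⌋∸1 n)) ⟩
      2 * 2 ^ ⌊log₂ ⌊ n /2⌋ ⌋     ≤⟨ ℕ.*-monoʳ-≤ 2 (rec (ℕ.⌊n/2⌋<n (suc m)) (s≤s z≤n)) ⟩
      2 * ⌊ n /2⌋                 ≡⟨ cong (⌊ n /2⌋ +_) (ℕ.+-identityʳ _) ⟩
      ⌊ n /2⌋ + ⌊ n /2⌋           ≤⟨ ℕ.+-monoʳ-≤ ⌊ n /2⌋ (ℕ.⌊n/2⌋≤⌈n/2⌉ n) ⟩
      ⌊ n /2⌋ + ⌊ suc n /2⌋         ≡⟨ ℕ.⌊n/2⌋+⌈n/2⌉≡n n ⟩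
      n                           ∎ }
  where
  open ℕ.≤-Reasoning
  log-suc : ∀ n → 1 ≤ ⌊log₂ n ⌋ → ⌊log₂ n ⌋ ≡ suc (⌊log₂ n ⌋ ∸ 1)
  log-suc n h with ⌊log₂ n ⌋ | h
  ... | suc k | _ = refl

-- Bounds by powers of p = 2 + n
module Powers (p : ℕ) (2≤p : 2 ≤ p) where

  1≤p : 1 ≤ p
  1≤p = ℕ.≤-trans (s≤s z≤n) 2≤p

  instance
    p≢0 : NonZero p
    p≢0 = >-nonZero 1≤p

  p^-mono : ∀ {a b} → a ≤ b → p ^ a ≤ p ^ b
  p^-mono = ℕ.^-monoʳ-≤ p

  k≤p^ : ∀ k → k ≤ p ^ k
  k≤p^ k = ℕ.≤-trans (ℕ.<⇒≤ (k<2^k k)) (ℕ.^-monoˡ-≤ k 2≤p)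

  p^-+ : ∀ {x y} a b → x ≤ p ^ a → y ≤ p ^ b → x + y ≤ p ^ suc (a + b)
  p^-+ {x} {y} a b h k = begin
    x + y                          ≤⟨ ℕ.+-mono-≤ (ℕ.≤-trans h (p^-mono (ℕ.m≤m+n a b))) (ℕ.≤-trans k (p^-mono (ℕ.m≤n+m b a))) ⟩
    p ^ (a + b) + p ^ (a + b)      ≡⟨ cong (p ^ (a + b) +_) (sym (ℕ.+-identityʳ _)) ⟩
    2 * p ^ (a + b)                ≤⟨ ℕ.*-monoˡ-≤ (p ^ (a + b)) 2≤p ⟩
    p ^ suc (a + b)                ∎
    where open ℕ.≤-Reasoning

  p^-* : ∀ {x y} a b → x ≤ p ^ a → y ≤ p ^ b → x * y ≤ p ^ (a + b)
  p^-* a b h k = ℕ.≤-trans (ℕ.*-mono-≤ h k) (ℕ.≤-reflexive (sym (ℕ.^-distribˡ-+-* p a b)))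

-- Numbers as vectors of digits
module Mixed (N : ℕ) .{{N≢0 : NonZero N}} where

  enc : ∀ {m} → Vec ℕ m → ℕ
  enc []       = 0
  enc (x ∷ xs) = x + enc xs * N

  nth : ∀ {m} → Vec ℕ m → ℕ → ℕ
  nth []       i       = 0
  nth (x ∷ xs) zero    = x
  nth (x ∷ xs) (suc i) = nth xs i

  prefix : ∀ m → (ℕ → ℕ) → Vec ℕ m
  prefix zero    X = []
  prefix (suc m) X = X 0 ∷ prefix m (X ∘ suc)

  dig : ℕ → ℕ → ℕ
  dig zero    v = v % N
  dig (suc i) v = dig i (v / N)

  data Small : ∀ {m} → Vec ℕ m → Set where
    []  : Small []
    _∷_ : ∀ {m x} {xs : Vec ℕ m} → x < N → Small xs → Small (x ∷ xs)

  enc< : ∀ {m} {xs : Vec ℕ m} → Small xs → enc xs < N ^ m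
  enc< []       = s≤s z≤n
  enc< {suc m} {x ∷ xs} (h ∷ hs) = ℕ.≤-trans (ℕ.+-monoˡ-≤ (enc xs * N) h) (ℕ.≤-trans (ℕ.*-monoˡ-≤ N (enc< hs)) (ℕ.≤-reflexive (ℕ.*-comm (N ^ m) N)))

  dig< : ∀ i v → dig i v < N
  dig< zero    v = m%n<n v N
  dig< (suc i) v = dig< i (v / N)

  shift-% : ∀ {x} q → x < N → (x + q * N) % N ≡ x
  shift-% {x} q h = trans ([m+kn]%n≡m%n x q N) (m<n⇒m%n≡m h)

  shift-/ : ∀ {x} q → x < N → (x + q * N) / N ≡ q
  shift-/ {x} q h = trans (+-distrib-/-∣ʳ x (n∣m*n q)) (cong₂ _+_ (m<n⇒m/n≡0 h) (m*n/n≡m q N))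

  dig-zero : ∀ i → dig i 0 ≡ 0
  dig-zero zero    = m<n⇒m%n≡m (>-nonZero⁻¹ N)
  dig-zero (suc i) = trans (cong (dig i) (m<n⇒m/n≡0 (>-nonZero⁻¹ N))) (dig-zero i)

  dig-enc : ∀ {m} {xs : Vec ℕ m} → Small xs → ∀ i → dig i (enc xs) ≡ nth xs i
  dig-enc []       i       = dig-zero i
  dig-enc {xs = x ∷ xs} (h ∷ hs) zero    = shift-% (enc xs) h
  dig-enc {xs = x ∷ xs} (h ∷ hs) (suc i) = trans (cong (dig i) (shift-/ (enc xs) h)) (dig-enc hs i)

  enc-dig : ∀ m {v} → v < N ^ m → v ≡ enc (prefix m λ i → dig i v)
  enc-dig zero    (s≤s z≤n) = refl
  enc-dig (suc m) {v} h = trans (m≡m%n+[m/n]*n v N)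
    (cong (λ x → v % N + x * N) (enc-dig m (m<n*o⇒m/o<n (subst (v <_) (ℕ.*-comm N (N ^ m)) h))))

-- The configuration graph of a nondeterministic machine

module ConfigurationGraph {σ} (M : NondeterministicTM σ) (b : ℕ)
  (space≤ : ∀ w c → NondeterministicTM.Reachable M w c → space c ≤ b * suc ⌊log₂ length w ⌋) where

  open NondeterministicTM M renaming (states to q; workTapes to k; workSymbols to γ)

  -- A configuration has `m` fields: state, head position and three for each tape. Each field stays
  -- below `(2 + n) ^ e`; the four summands of `e` provide for states, head positions, symbols and
  -- the contents of half-tapes.
  g m e : ℕ
  g = suc γ
  m = 2 + k * 3
  e = q + (2 + (g + (1 + g) * (b * 2)))

  -- Bijective base `g`, nearest cell lowest. Stacks of different heights have different codes, and
  -- pushing and popping are arithmetic.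
  stackCode : List (Fin g) → ℕ
  stackCode []      = 0
  stackCode (a ∷ l) = 1 + toℕ a + g * stackCode l

  stackCode< : ∀ l → stackCode l < suc g ^ length l
  stackCode< []      = s≤s z≤n
  stackCode< (a ∷ l) = ℕ.≤-trans (s≤s (ℕ.+-mono-≤ (Fin.toℕ<n a) (ℕ.*-monoʳ-≤ g (ℕ.≤-refl {stackCode l}))))
    (ℕ.≤-trans (ℕ.≤-trans (ℕ.≤-reflexive (cong suc (sym (ℕ.*-suc g (stackCode l))))) (ℕ.+-monoˡ-≤ _ (s≤s z≤n)))
      (ℕ.*-monoʳ-≤ (suc g) (stackCode< l)))

  tapeFields : ∀ {k} → Vec (Tape γ) k → Vec ℕ (k * 3)
  tapeFields []                   = []
  tapeFields (tape ls a rs ∷ ts) = stackCode ls ∷ toℕ a ∷ stackCode rs ∷ tapeFields ts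

  fields : Configuration → Vec ℕ m
  fields (config s h ts) = toℕ s ∷ h ∷ tapeFields ts

  -- The first alternative is the blank that appears when the head leaves the stretch of visited
  -- cells.
  Pop : ℕ → ℕ → ℕ → Set
  Pop L S L′ = (L ≡ 0 × S ≡ 0 × L′ ≡ 0) ⊎ (S < g × L ≡ 1 + S + g * L′)

  -- A relation between old and new fields, so that an edge can be checked from the codes of its two
  -- ends by sums and products, with no division by `g`.
  TapeStep : Fin g × Move → ℕ → ℕ → ℕ → ℕ → ℕ → Set
  TapeStep (b , stay)  L R L′ S′ R′ = S′ ≡ toℕ b × L′ ≡ L × R′ ≡ R
  TapeStep (b , left)  L R L′ S′ R′ = R′ ≡ 1 + toℕ b + g * R × Pop L S′ L′
  TapeStep (b , right) L R L′ S′ R′ = L′ ≡ 1 + toℕ b + g * L × Pop R S′ R′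

  TapesStep : ∀ {k} → Vec (Fin g) k → Vec (Fin g × Move) k → (ℕ → ℕ) → (ℕ → ℕ) → Set
  TapesStep []       []       X Y = ⊤
  TapesStep (x ∷ xs) (u ∷ us) X Y =
    (X 1 ≡ toℕ x × TapeStep u (X 0) (X 2) (Y 0) (Y 1) (Y 2)) × TapesStep xs us (X ∘ (3 +_)) (Y ∘ (3 +_))

  -- Quotient and remainder by `g` are unique, so a relational pop has only the intended result.
  pop-unique : ∀ l {S L′} → Pop (stackCode l) S L′ → (case l of λ { [] → S ≡ 0 × L′ ≡ 0 ; (a ∷ l) → S ≡ toℕ a × L′ ≡ stackCode l })
  pop-unique []      (inj₁ (_ , e , f)) = e , f
  pop-unique (a ∷ l) {S} {L′} (inj₂ (S<g , eq)) = digit-eq , quotient-eq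
    where
    eq′ : toℕ a + stackCode l * g ≡ S + L′ * g
    eq′ = trans (cong (toℕ a +_) (ℕ.*-comm (stackCode l) g)) (trans (ℕ.suc-injective eq) (cong (S +_) (ℕ.*-comm g L′)))
    digit-eq : S ≡ toℕ a
    digit-eq = trans (sym (Mixed.shift-% g L′ S<g)) (trans (cong (_% g) (sym eq′)) (Mixed.shift-% g (stackCode l) (Fin.toℕ<n a)))
    quotient-eq : L′ ≡ stackCode l
    quotient-eq = trans (sym (Mixed.shift-/ g L′ S<g)) (trans (cong (_/ g) (sym eq′)) (Mixed.shift-/ g (stackCode l) (Fin.toℕ<n a)))

  tape-step : ∀ u ls a rs → let tape ls′ a′ rs′ = writeAndMove u (tape ls a rs) in
              TapeStep u (stackCode ls) (stackCode rs) (stackCode ls′) (toℕ a′) (stackCode rs′)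
  tape-step (b , stay)  ls       a rs       = refl , refl , refl
  tape-step (b , left)  []       a rs       = refl , inj₁ (refl , refl , refl)
  tape-step (b , left)  (l ∷ ls) a rs       = refl , inj₂ (Fin.toℕ<n l , refl)
  tape-step (b , right) ls       a []       = refl , inj₁ (refl , refl , refl)
  tape-step (b , right) ls       a (r ∷ rs) = refl , inj₂ (Fin.toℕ<n r , refl)

  tape-step-unique : ∀ u ls a rs {L S R} → let tape ls′ a′ rs′ = writeAndMove u (tape ls a rs) in
              TapeStep u (stackCode ls) (stackCode rs) L S R → L ≡ stackCode ls′ × S ≡ toℕ a′ × R ≡ stackCode rs′
  tape-step-unique (b , stay)  ls       a rs       (p , q , r) = q , p , r
  tape-step-unique (b , left)  []       a rs       (p , h) = let (x , y) = pop-unique [] h in y , x , p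
  tape-step-unique (b , left)  (l ∷ ls) a rs       (p , h) = let (x , y) = pop-unique (l ∷ ls) h in y , x , p
  tape-step-unique (b , right) ls       a []       (p , h) = let (x , y) = pop-unique [] h in p , x , y
  tape-step-unique (b , right) ls       a (r ∷ rs) (p , h) = let (x , y) = pop-unique (r ∷ rs) h in p , x , y

  module Fields (N : ℕ) .{{_ : NonZero N}} where

    open Mixed N

    tapes-step : ∀ {k} (ts : Vec (Tape γ) k) us →
      TapesStep (Vec.map Tape.scanned ts) us (nth (tapeFields ts)) (nth (tapeFields (Vec.zipWith writeAndMove us ts)))
    tapes-step []                   []       = tt
    tapes-step (tape ls a rs ∷ ts) (u ∷ us) = (refl , tape-step u ls a rs) , tapes-step ts us

    tapes-step-unique : ∀ {k} (ts : Vec (Tape γ) k) xs us {Y} → TapesStep xs us (nth (tapeFields ts)) Y →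
      xs ≡ Vec.map Tape.scanned ts × prefix (k * 3) Y ≡ tapeFields (Vec.zipWith writeAndMove us ts)
    tapes-step-unique []                   []       []       h = refl , refl
    tapes-step-unique (tape ls a rs ∷ ts) (x ∷ xs) (u ∷ us) ((e , h) , hs) =
      let (p , q , r) = tape-step-unique u ls a rs h
          (es , qs)   = tapes-step-unique ts xs us hs
      in cong₂ _∷_ (Fin.toℕ-injective (sym e)) es , cong₂ _∷_ p (cong₂ _∷_ q (cong₂ _∷_ r qs))

  module _ (w : List (Fin σ)) where

    Cond : Fin q → InputSymbol σ → Vec (Fin g) k → Action q k γ → (ℕ → ℕ) → (ℕ → ℕ) → Set
    Cond s a xs (action s′ mv us) X Y = X 0 ≡ toℕ s × readInput w (X 1) ≡ a × Y 0 ≡ toℕ s′ × Y 1 ≡ moveInput w mv (X 1)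
      × TapesStep xs us (X ∘ (2 +_)) (Y ∘ (2 +_))

    Transits : (ℕ → ℕ) → (ℕ → ℕ) → Set
    Transits X Y = ∃[ s ] ∃[ a ] ∃[ xs ] ∃[ act ] act List∈.∈ δ s a xs × Cond s a xs act X Y

    p N top : ℕ
    p = 2 + length w
    N = p ^ e
    top = p ^ (e * m)

    open Powers p (s≤s (s≤s z≤n))

    instance
      N≢0 : NonZero N
      N≢0 = ℕ.m^n≢0 p e

    open Mixed N
    open Fields N

    top-eq : N ^ m ≡ top
    top-eq = ℕ.^-*-assoc p e m

    -- `top` is an additional vertex below which all accepting configurations lie; it makes
    -- acceptance the reachability of a single vertex.
    Edge : ℕ → ℕ → Set
    Edge v u = (v < top × u < top × Transits (λ i → dig i v) (λ i → dig i u)) ⊎ (v < top × u ≡ top × dig 0 v ≡ toℕ accepting)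

    transits-cong : ∀ {X X′ Y Y′} → (∀ i → X i ≡ X′ i) → (∀ i → Y i ≡ Y′ i) → Transits X Y → Transits X′ Y′
    transits-cong {X} {X′} {Y} {Y′} eX eY (s , a , xs , act@(action _ mv us) , act∈ , h₀ , h₁ , h₂ , h₃ , h₄) =
      s , a , xs , act , act∈ , trans (sym (eX 0)) h₀ , trans (cong (readInput w) (sym (eX 1))) h₁ , trans (sym (eY 0)) h₂ ,
      trans (sym (eY 1)) (trans h₃ (cong (moveInput w mv) (eX 1))) , go xs us (eX ∘ (2 +_)) (eY ∘ (2 +_)) h₄
      where
      go : ∀ {k} (xs : Vec (Fin g) k) us {X X′ Y Y′} → (∀ i → X i ≡ X′ i) → (∀ i → Y i ≡ Y′ i) → TapesStep xs us X Y → TapesStep xs us X′ Y′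
      go []       []       eX eY h = tt
      go (x ∷ xs) (u ∷ us) {X} {X′} {Y} {Y′} eX eY ((h , t) , hs) = (trans (sym (eX 1)) h , tr) , go xs us (eX ∘ (3 +_)) (eY ∘ (3 +_)) hs
        where
        tr : TapeStep u (X′ 0) (X′ 2) (Y′ 0) (Y′ 1) (Y′ 2)
        tr rewrite sym (eX 0) | sym (eX 2) | sym (eY 0) | sym (eY 1) | sym (eY 2) = t

    Fitting : Configuration → Set
    Fitting c = Small (fields c)

    enc<top : ∀ {c} → Fitting c → enc (fields c) < top
    enc<top {c} f = subst (enc (fields c) <_) top-eq (enc< f)

    step⇒edge : ∀ {c c′} → Fitting c → Fitting c′ → Step w c c′ → Edge (enc (fields c)) (enc (fields c′))
    step⇒edge {config s h ts} {c′} fc fc′ (action s′ mv us , act∈ , refl) = inj₁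
      ( enc<top {config s h ts} fc , enc<top {c′} fc′
      , transits-cong (sym ∘ dig-enc fc) (sym ∘ dig-enc fc′)
          (s , readInput w h , Vec.map Tape.scanned ts , action s′ mv us , act∈ , refl , refl , refl , refl , tapes-step ts us) )

    -- Numbers that code no configuration do no harm, because an edge out of the code of a
    -- configuration leads to the code of a successor or to `top`.
    edge⇒step : ∀ {c u} → Fitting c → u ≢ top → Edge (enc (fields c)) u → ∃[ c′ ] Step w c c′ × u ≡ enc (fields c′)
    edge⇒step fc u≢ (inj₂ (_ , e , _)) = contradiction e u≢
    edge⇒step {config s h ts} {u} fc _ (inj₁ (_ , u< , tr))
      with transits-cong {Y = λ i → dig i u} (dig-enc fc) (λ _ → refl) tr
    ... | s₁ , a , xs , act@(action s′ mv us) , act∈ , h₀ , h₁ , h₂ , h₃ , h₄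
      with Fin.toℕ-injective h₀ | h₁ | tapes-step-unique ts xs us h₄
    ... | refl | refl | refl , eq = _ , (act , act∈ , refl) , trans (enc-dig m (subst (u <_) (sym top-eq) u<))
      (cong enc (cong₂ _∷_ h₂ (cong₂ _∷_ h₃ eq)))

    head-bounded : ∀ {c} → Reachable w c → Config.headPos c ≤ suc (length w)
    head-bounded r = go r z≤n
      where
      move≤ : ∀ mv {h} → h ≤ suc (length w) → moveInput w mv h ≤ suc (length w)
      move≤ left  h = ℕ.≤-trans ℕ.pred[n]≤n h
      move≤ stay  h = h
      move≤ right h = ℕ.m⊓n≤n _ _
      go : ∀ {c c′} → Star (Step w) c c′ → Config.headPos c ≤ suc (length w) → Config.headPos c′ ≤ suc (length w)
      go ε h = h
      go ((action _ mv _ , _ , refl) ◅ r) h = go r (move≤ mv h)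

    <N : ∀ {x} a → a ≤ e → x < p ^ a → x < N
    <N a h l = ℕ.<-≤-trans l (p^-mono h)

    q≤e : q ≤ e
    q≤e = ℕ.m≤m+n q _
    2≤e : 2 ≤ e
    2≤e = ℕ.≤-trans (ℕ.m≤m+n 2 _) (ℕ.m≤n+m _ q)
    g≤e : g ≤ e
    g≤e = ℕ.≤-trans (ℕ.m≤m+n g _) (ℕ.≤-trans (ℕ.m≤n+m _ 2) (ℕ.m≤n+m _ q))

    -- The height of a stack is at most a constant times the logarithm of the input length; an
    -- exponential of that is a fixed power of `2 + n`.
    stack<N : ∀ l → length l ≤ b * suc ⌊log₂ length w ⌋ → stackCode l < N
    stack<N l h = <N ((1 + g) * (b * 2)) (ℕ.≤-trans (ℕ.m≤n+m _ g) (ℕ.≤-trans (ℕ.m≤n+m _ 2) (ℕ.m≤n+m _ q))) (ℕ.<-≤-trans (stackCode< l) (begin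
      suc g ^ length l                   ≤⟨ ℕ.^-monoʳ-≤ (suc g) h ⟩
      suc g ^ (b * lg)                   ≤⟨ ℕ.^-monoˡ-≤ (b * lg) (ℕ.<⇒≤ (k<2^k (suc g))) ⟩
      (2 ^ suc g) ^ (b * lg)             ≡⟨ ℕ.^-*-assoc 2 (suc g) (b * lg) ⟩
      2 ^ (suc g * (b * lg))             ≡⟨ cong (2 ^_) (rearrange (suc g) b lg) ⟩
      2 ^ (lg * (suc g * b))             ≡⟨ sym (ℕ.^-*-assoc 2 lg (suc g * b)) ⟩
      (2 ^ lg) ^ (suc g * b)             ≤⟨ ℕ.^-monoˡ-≤ (suc g * b) log-bound ⟩
      (p ^ 2) ^ (suc g * b)              ≡⟨ ℕ.^-*-assoc p 2 (suc g * b) ⟩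
      p ^ (2 * (suc g * b))              ≡⟨ cong (p ^_) (rearrange′ (suc g) b) ⟩
      p ^ (suc g * (b * 2))              ∎))
      where
      open ℕ.≤-Reasoning
      lg : ℕ
      lg = suc ⌊log₂ length w ⌋
      rearrange : ∀ x y z → x * (y * z) ≡ z * (x * y)
      rearrange = solve-∀
      rearrange′ : ∀ x y → 2 * (x * y) ≡ x * (y * 2)
      rearrange′ = solve-∀
      pow-log : ∀ n → 2 ^ ⌊log₂ n ⌋ ≤ 2 + n
      pow-log zero    = s≤s z≤n
      pow-log (suc n) = ℕ.≤-trans (2^⌊log₂n⌋≤n (suc n) (s≤s z≤n)) (ℕ.m≤n+m _ 2)
      log-bound : 2 ^ lg ≤ p ^ 2
      log-bound = ℕ.≤-trans (ℕ.*-mono-≤ (s≤s (s≤s (z≤n {length w}))) (pow-log (length w))) (ℕ.≤-reflexive (cong (p *_) (sym (ℕ.*-identityʳ p))))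

    reachable⇒fitting : ∀ {c} → Reachable w c → Fitting c
    reachable⇒fitting {config s h ts} r =
      <N q q≤e (ℕ.<-≤-trans (Fin.toℕ<n s) (k≤p^ q)) ∷
      <N 2 2≤e (ℕ.<-≤-trans (s≤s (head-bounded r)) (ℕ.m≤m*n p (p ^ 1) {{ℕ.m^n≢0 p 1}})) ∷
      tapes-small ts (space≤ w _ r)
      where
      tapes-small : ∀ {k} (ts : Vec (Tape γ) k) → Vec.sum (Vec.map visitedCells ts) ≤ b * suc ⌊log₂ length w ⌋ → Small (tapeFields ts)
      tapes-small [] h = []
      tapes-small (tape ls a rs ∷ ts) h =
        let here≤ = ℕ.m+n≤o⇒m≤o (length ls + suc (length rs)) h in
        stack<N ls (ℕ.m+n≤o⇒m≤o (length ls) here≤) ∷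
        <N g g≤e (ℕ.<-≤-trans (Fin.toℕ<n a) (k≤p^ g)) ∷
        stack<N rs (ℕ.≤-trans (ℕ.n≤1+n _) (ℕ.m+n≤o⇒n≤o (length ls) here≤)) ∷
        tapes-small ts (ℕ.m+n≤o⇒n≤o (length ls + suc (length rs)) h)

    begin-at : ℕ
    begin-at = enc (fields (start {σ = σ} initial))

    -- Reachable configurations obey the space bound, so their fields fit and machine steps become
    -- edges. Conversely a path is followed while it stays off `top`, together with a proof that the
    -- current configuration is reachable; the edge into `top` witnesses acceptance.
    accepts⇔reach : Accepts w ⇔ Star Edge begin-at top
    accepts⇔reach = mk⇔ (λ (c , r , acc) → path ε r ◅◅ (inj₂ (enc<top {c} (reachable⇒fitting r) , refl ,
        trans (dig-enc (reachable⇒fitting r) 0) (cong toℕ acc)) ◅ ε)) (back ε refl)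
      where
      path : ∀ {c c′} → Reachable w c → Star (Step w) c c′ → Star Edge (enc (fields c)) (enc (fields c′))
      path r ε        = ε
      path r (x ◅ xs) = step⇒edge (reachable⇒fitting r) (reachable⇒fitting (r ◅◅ (x ◅ ε))) x ◅ path (r ◅◅ (x ◅ ε)) xs
      back : ∀ {c v} → Reachable w c → v ≡ enc (fields c) → Star Edge v top → Accepts w
      back {c} r e ε = contradiction (enc<top {c} (reachable⇒fitting r)) (ℕ.<-irrefl (sym e))
      back {c} r refl (_◅_ {j = u} x xs) with u ℕ.≟ top
      ... | no u≢ = let (c′ , st , eq) = edge⇒step (reachable⇒fitting r) u≢ x in back (r ◅◅ (st ◅ ε)) eq xs
      back {c} r refl (inj₁ (_ , u< , _) ◅ xs)   | yes refl = contradiction u< (ℕ.<-irrefl refl)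
      back {c} r refl (inj₂ (_ , _ , acc) ◅ xs) | yes refl =
        c , r , Fin.toℕ-injective (trans (sym (dig-enc (reachable⇒fitting r) 0)) acc)

-- The edges of the configuration graph as a truncated function

code-injective : ∀ {σ} {a b : InputSymbol σ} → code a ≡ code b → a ≡ b
code-injective {a = ⊢}      {⊢}      e = refl
code-injective {a = ⊣}      {⊣}      e = refl
code-injective {a = char a} {char b} e = cong char (Fin.toℕ-injective (ℕ.suc-injective (ℕ.suc-injective e)))

module ConfigurationGraphFn {σ} (M : NondeterministicTM σ) (b : ℕ)
  (space≤ : ∀ w c → NondeterministicTM.Reachable M w c → space c ≤ b * suc ⌊log₂ length w ⌋) where

  open NondeterministicTM M renaming (states to q; workTapes to k; workSymbols to γ)
  open ConfigurationGraph M b space≤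

  -- The summands make room for `top + N`, needed when dividing by `N`, for `N + g * N`, needed when
  -- pushing on a stack, and for the codes of input symbols.
  exponent : ℕ
  exponent = suc (e * m + e) + (suc (e + (g + e)) + (2 + σ))

  pF NF topF : ∀ {j} → Fn σ j
  pF   = succ (succ len)
  NF   = pF ^ᶠ e
  topF = pF ^ᶠ (e * m)

  digF : ∀ {j} → ℕ → Fn σ j → Fn σ j
  digF zero    f = rem f NF
  digF (suc i) f = digF i (quot f NF)

  pushF : ∀ {j} → ℕ → Fn σ j → Fn σ j
  pushF a f = const# (suc a) ⊕ const# g ⊗ f

  popF : ∀ {j} → Fn σ j → Fn σ j → Fn σ j → Fn σ j
  popF L S L′ = L ≐ zer ∧ᶠ S ≐ zer ∧ᶠ L′ ≐ zer ∨ᶠ S ≺ const# g ∧ᶠ L ≐ (succ S ⊕ const# g ⊗ L′)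

  tapeStepF : ∀ {j} → Fin g × Move → Fn σ j → Fn σ j → Fn σ j → Fn σ j → Fn σ j → Fn σ j
  tapeStepF (b , stay)  L R L′ S′ R′ = S′ ≐ const# (toℕ b) ∧ᶠ L′ ≐ L ∧ᶠ R′ ≐ R
  tapeStepF (b , left)  L R L′ S′ R′ = R′ ≐ pushF (toℕ b) R ∧ᶠ popF L S′ L′
  tapeStepF (b , right) L R L′ S′ R′ = L′ ≐ pushF (toℕ b) L ∧ᶠ popF R S′ R′

  tapesStepF : ∀ {j k} → Vec (Fin g) k → Vec (Fin g × Move) k → (ℕ → Fn σ j) → (ℕ → Fn σ j) → Fn σ j
  tapesStepF []       []       X Y = one
  tapesStepF (x ∷ xs) (u ∷ us) X Y = (X 1 ≐ const# (toℕ x) ∧ᶠ tapeStepF u (X 0) (X 2) (Y 0) (Y 1) (Y 2))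
    ∧ᶠ tapesStepF xs us (X ∘ (3 +_)) (Y ∘ (3 +_))

  headF : ∀ {j} → Move → Fn σ j → Fn σ j
  headF left  h = prd h
  headF stay  h = h
  headF right h = choose (h ≼ len) (succ h) (succ len)

  condF : ∀ {j} → Fin q → InputSymbol σ → Vec (Fin g) k → Action q k γ → (ℕ → Fn σ j) → (ℕ → Fn σ j) → Fn σ j
  condF s a xs (action s′ mv us) X Y = X 0 ≐ const# (toℕ s) ∧ᶠ sym′ (X 1) ≐ const# (code a) ∧ᶠ Y 0 ≐ const# (toℕ s′)
    ∧ᶠ Y 1 ≐ headF mv (X 1) ∧ᶠ tapesStepF xs us (X ∘ (2 +_)) (Y ∘ (2 +_))

  transitsF : ∀ {j} → (ℕ → Fn σ j) → (ℕ → Fn σ j) → Fn σ j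
  transitsF X Y = orFin λ s → orInput λ a → orVec λ xs → orList (δ s a xs) λ act → condF s a xs act X Y

  edgeF : Fn σ 2
  edgeF = var 0F ≺ topF ∧ᶠ var 1F ≺ topF ∧ᶠ transitsF (λ i → digF i (var 0F)) (λ i → digF i (var 1F))
    ∨ᶠ var 0F ≺ topF ∧ᶠ var 1F ≐ topF ∧ᶠ digF 0 (var 0F) ≐ const# (toℕ accepting)

  module _ (w : List (Fin σ)) (cap : ℕ) (enough : (2 + length w) ^ exponent ≤ cap) where

    P N′ Top : ℕ
    P  = 2 + length w
    N′ = N w
    Top  = top w

    open Powers P (s≤s (s≤s z≤n))
    open Mixed N′ {{N≢0 w}}

    within : ∀ {x} a → a ≤ exponent → x ≤ P ^ a → x ≤ cap
    within a h l = ℕ.≤-trans l (ℕ.≤-trans (p^-mono h) enough)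

    Top+N≤cap : Top + N′ ≤ cap
    Top+N≤cap = within (suc (e * m + e)) (ℕ.m≤m+n _ _) (p^-+ (e * m) e ℕ.≤-refl ℕ.≤-refl)

    N+gN≤cap : N′ + g * N′ ≤ cap
    N+gN≤cap = within (suc (e + (g + e))) (ℕ.≤-trans (ℕ.m≤m+n _ _) (ℕ.m≤n+m _ (suc (e * m + e)))) (p^-+ e (g + e) ℕ.≤-refl (p^-* g e (k≤p^ g) ℕ.≤-refl))

    2+σ≤cap : 2 + σ ≤ cap
    2+σ≤cap = within (2 + σ) (ℕ.≤-trans (ℕ.m≤n+m _ (suc (e + (g + e)))) (ℕ.m≤n+m _ (suc (e * m + e)))) (k≤p^ (2 + σ))

    P≤cap : P ≤ cap
    P≤cap = within 1 (s≤s z≤n) (ℕ.≤-reflexive (sym (ℕ.*-identityʳ P)))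

    N≤cap : N′ ≤ cap
    N≤cap = ℕ.m+n≤o⇒m≤o N′ N+gN≤cap

    Top≤cap : Top ≤ cap
    Top≤cap = ℕ.m+n≤o⇒m≤o Top Top+N≤cap

    open Evaluation w cap
    open Truth w cap (ℕ.≤-trans (s≤s z≤n) P≤cap)

    p-eval : ∀ {j} {ρ : Vec ℕ j} → eval pF ρ ≡ P
    p-eval = trans (cong (λ x → suc x ⊓ cap) (ℕ.m≤n⇒m⊓n≡m (ℕ.≤-trans (ℕ.n≤1+n _) P≤cap))) (ℕ.m≤n⇒m⊓n≡m P≤cap)

    N-eval : ∀ {j} {ρ : Vec ℕ j} → eval NF ρ ≡ N′
    N-eval {ρ = ρ} = ^-eval pF e (s≤s z≤n) (p-eval {ρ = ρ}) N≤cap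

    top-eval : ∀ {j} {ρ : Vec ℕ j} → eval topF ρ ≡ Top
    top-eval {ρ = ρ} = ^-eval pF (e * m) (s≤s z≤n) (p-eval {ρ = ρ}) Top≤cap

    dig-eval : ∀ {j} {ρ : Vec ℕ j} i f {v} → eval f ρ ≡ v → v ≤ Top → eval (digF i f) ρ ≡ dig i v
    dig-eval {ρ = ρ} zero f {v} ev v≤ = rem-eval f NF {q = _/_ v N′ {{N≢0 w}}} ev (N-eval {ρ = ρ}) (m≡m%n+[m/n]*n v N′ {{N≢0 w}}) (m%n<n v N′ {{N≢0 w}})
      (ℕ.≤-trans (ℕ.+-monoˡ-≤ N′ v≤) Top+N≤cap)
    dig-eval {ρ = ρ} (suc i) f {v} ev v≤ = dig-eval i (quot f NF)
      (quot-eval f NF ev (N-eval {ρ = ρ}) (m≡m%n+[m/n]*n v N′ {{N≢0 w}}) (m%n<n v N′ {{N≢0 w}}) (ℕ.≤-trans (ℕ.+-monoˡ-≤ N′ v≤) Top+N≤cap))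
      (ℕ.≤-trans (ℕ.≤-trans (ℕ.≤-trans (ℕ.m≤m*n _ N′ {{N≢0 w}}) (ℕ.m≤n+m _ (_%_ v N′ {{N≢0 w}}))) (ℕ.≤-reflexive (sym (m≡m%n+[m/n]*n v N′ {{N≢0 w}})))) v≤)

    small-const : ∀ a → a ≤ e → a ≤ cap
    small-const a h = ℕ.≤-trans (ℕ.≤-trans (k≤p^ a) (p^-mono h)) N≤cap

    fin-eval : ∀ {n j} {ρ : Vec ℕ j} (i : Fin n) → n ≤ e → eval (const# (toℕ i)) ρ ≡ toℕ i
    fin-eval i h = const-eval (toℕ i) (ℕ.≤-trans (ℕ.<⇒≤ (Fin.toℕ<n i)) (small-const _ h))

    combine-eval : ∀ {j} {ρ : Vec ℕ j} s f {x y} → eval s ρ ≡ x → eval f ρ ≡ y → x ≤ N′ → y < N′ → eval (s ⊕ const# g ⊗ f) ρ ≡ x + g * y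
    combine-eval s f es ef hx hy = ⊕-eval s (const# g ⊗ f) es
      (⊗-eval (const# g) f (const-eval g (small-const g (g≤e w))) ef (ℕ.≤-trans (ℕ.*-monoʳ-≤ g (ℕ.<⇒≤ hy)) (ℕ.m+n≤o⇒n≤o N′ N+gN≤cap)))
      (ℕ.≤-trans (ℕ.+-mono-≤ hx (ℕ.*-monoʳ-≤ g (ℕ.<⇒≤ hy))) N+gN≤cap)

    g≤N : g ≤ N′
    g≤N = ℕ.≤-trans (k≤p^ g) (p^-mono (g≤e w))

    -- Field i of a configuration as a function with its value.
    Field : ∀ {j} → Fn σ j → Vec ℕ j → ℕ → Set
    Field f ρ x = eval f ρ ≡ x × x < N′

    push⇔ : ∀ {j} {ρ : Vec ℕ j} (b : Fin g) {f f′ x x′} → Field f ρ x → Field f′ ρ x′ → True (f′ ≐ pushF (toℕ b) f) ρ ⇔ (x′ ≡ 1 + toℕ b + g * x)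
    push⇔ b {f} {f′} (ef , hx) (ef′ , _) = ≐⇔ f′ (pushF (toℕ b) f) ⟫ ≡⇔ ef′
      (combine-eval (const# (suc (toℕ b))) f (const-eval (suc (toℕ b)) (ℕ.≤-trans (Fin.toℕ<n b) (small-const g (g≤e w)))) ef
        (ℕ.≤-trans (Fin.toℕ<n b) g≤N) hx)

    zero⇔ : ∀ {j} {ρ : Vec ℕ j} {f x} → Field f ρ x → True (f ≐ zer) ρ ⇔ (x ≡ 0)
    zero⇔ {f = f} (ef , _) = ≐⇔ f zer ⟫ ≡⇔ ef refl

    pop⇔ : ∀ {j} {ρ : Vec ℕ j} {L S L′ l s l′} → Field L ρ l → Field S ρ s → Field L′ ρ l′ → True (popF L S L′) ρ ⇔ Pop l s l′
    pop⇔ {ρ = ρ} {L} {S} {L′} {l} {s} {l′} fL@(eL , _) fS@(eS , hS) fL′@(eL′ , hL′) =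
      ∨⇔ (L ≐ zer ∧ᶠ S ≐ zer ∧ᶠ L′ ≐ zer) (S ≺ const# g ∧ᶠ L ≐ (succ S ⊕ const# g ⊗ L′)) ⟫
      ((∧⇔ (L ≐ zer) (S ≐ zer ∧ᶠ L′ ≐ zer) ⟫ (zero⇔ fL ×⇔ (∧⇔ (S ≐ zer) (L′ ≐ zer) ⟫ (zero⇔ fS ×⇔ zero⇔ fL′))))
       ⊎⇔ (∧⇔ (S ≺ const# g) (L ≐ (succ S ⊕ const# g ⊗ L′)) ⟫
            ((≺⇔ S (const# g) ⟫ mk⇔ (subst₂ _<_ eS eg) (subst₂ _<_ (sym eS) (sym eg)))
             ×⇔ (≐⇔ L (succ S ⊕ const# g ⊗ L′) ⟫ ≡⇔ eL (combine-eval (succ S) L′ (succ-eval S eS (ℕ.≤-trans hS N≤cap)) eL′ hS hL′)))))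
      where
      eg : eval (const# g) ρ ≡ g
      eg = const-eval g (small-const g (g≤e w))

    tapeStep⇔ : ∀ {j} {ρ : Vec ℕ j} u {L R L′ S′ R′ l r l′ s′ r′} → Field L ρ l → Field R ρ r → Field L′ ρ l′ → Field S′ ρ s′ → Field R′ ρ r′ →
      True (tapeStepF u L R L′ S′ R′) ρ ⇔ TapeStep u l r l′ s′ r′
    tapeStep⇔ (b , stay) {L} {R} {L′} {S′} {R′} fL fR fL′ fS′ fR′ = ∧⇔ (S′ ≐ const# (toℕ b)) (L′ ≐ L ∧ᶠ R′ ≐ R) ⟫
      ((≐⇔ S′ (const# (toℕ b)) ⟫ ≡⇔ (proj₁ fS′) (fin-eval b (g≤e w))) ×⇔
       (∧⇔ (L′ ≐ L) (R′ ≐ R) ⟫ ((≐⇔ L′ L ⟫ ≡⇔ (proj₁ fL′) (proj₁ fL)) ×⇔ (≐⇔ R′ R ⟫ ≡⇔ (proj₁ fR′) (proj₁ fR)))))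
    tapeStep⇔ (b , left) {L} {R} {L′} {S′} {R′} fL fR fL′ fS′ fR′ =
      ∧⇔ (R′ ≐ pushF (toℕ b) R) (popF L S′ L′) ⟫ (push⇔ b fR fR′ ×⇔ pop⇔ fL fS′ fL′)
    tapeStep⇔ (b , right) {L} {R} {L′} {S′} {R′} fL fR fL′ fS′ fR′ =
      ∧⇔ (L′ ≐ pushF (toℕ b) L) (popF R S′ R′) ⟫ (push⇔ b fL fL′ ×⇔ pop⇔ fR fS′ fR′)

    tapesStep⇔ : ∀ {j k} {ρ : Vec ℕ j} (xs : Vec (Fin g) k) us {X Y x y} → (∀ i → Field (X i) ρ (x i)) → (∀ i → Field (Y i) ρ (y i)) →
      True (tapesStepF xs us X Y) ρ ⇔ TapesStep xs us x y
    tapesStep⇔ {ρ = ρ} [] [] fX fY = mk⇔ (λ _ → tt) (λ _ → ℕ.≤-reflexive (sym (one-eval {ρ = ρ})))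
    tapesStep⇔ (x ∷ xs) (u ∷ us) {X} {Y} fX fY =
      ∧⇔ (X 1 ≐ const# (toℕ x) ∧ᶠ tapeStepF u (X 0) (X 2) (Y 0) (Y 1) (Y 2)) (tapesStepF xs us (X ∘ (3 +_)) (Y ∘ (3 +_))) ⟫
      ((∧⇔ (X 1 ≐ const# (toℕ x)) (tapeStepF u (X 0) (X 2) (Y 0) (Y 1) (Y 2)) ⟫
        ((≐⇔ (X 1) (const# (toℕ x)) ⟫ ≡⇔ (proj₁ (fX 1)) (fin-eval x (g≤e w))) ×⇔ tapeStep⇔ u (fX 0) (fX 2) (fY 0) (fY 1) (fY 2)))
       ×⇔ tapesStep⇔ xs us {X ∘ (3 +_)} {Y ∘ (3 +_)} (fX ∘ (3 +_)) (fY ∘ (3 +_)))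

    head-eval : ∀ {j} {ρ : Vec ℕ j} mv {h x} → Field h ρ x → eval (headF mv h) ρ ≡ moveInput w mv x
    head-eval left  (e , _) = cong pred e
    head-eval stay  (e , _) = e
    head-eval {ρ = ρ} right {h} {x} (e , x<N) with x ℕ.≤? length w
    ... | yes x≤ = trans (choose-true (h ≼ len) (succ h) (succ len) (from↔ (≼⇔ h len) (subst (_≤ length w) (sym e) x≤)))
          (trans (succ-eval h e (ℕ.≤-trans x<N N≤cap)) (sym (ℕ.m≤n⇒m⊓n≡m (s≤s x≤))))
    ... | no x≰ = trans (choose-false (h ≼ len) (succ h) (succ len) (x≰ ∘ subst (_≤ length w) e ∘ to↔ (≼⇔ h len)))
          (trans (succ-eval {ρ = ρ} len refl (ℕ.≤-trans (ℕ.n≤1+n _) P≤cap)) (sym (ℕ.m≥n⇒m⊓n≡n (s≤s (ℕ.<⇒≤ (ℕ.≰⇒> x≰))))))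

    cond⇔ : ∀ {j} {ρ : Vec ℕ j} s a xs act {X Y x y} → (∀ i → Field (X i) ρ (x i)) → (∀ i → Field (Y i) ρ (y i)) →
      True (condF s a xs act X Y) ρ ⇔ Cond w s a xs act x y
    cond⇔ {ρ = ρ} s a xs (action s′ mv us) {X} {Y} {x} fX fY =
      ∧⇔ (X 0 ≐ const# (toℕ s)) _ ⟫ ((≐⇔ (X 0) (const# (toℕ s)) ⟫ ≡⇔ (proj₁ (fX 0)) (fin-eval s (q≤e w))) ×⇔
      (∧⇔ (sym′ (X 1) ≐ const# (code a)) _ ⟫ ((≐⇔ (sym′ (X 1)) (const# (code a)) ⟫ ≡⇔ (cong (code ∘ readInput w) (proj₁ (fX 1))) (const-eval (code a) (ℕ.≤-trans (ℕ.<⇒≤ (code< a)) 2+σ≤cap))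
          ⟫ mk⇔ code-injective (cong code)) ×⇔
      (∧⇔ (Y 0 ≐ const# (toℕ s′)) _ ⟫ ((≐⇔ (Y 0) (const# (toℕ s′)) ⟫ ≡⇔ (proj₁ (fY 0)) (fin-eval s′ (q≤e w))) ×⇔
      (∧⇔ (Y 1 ≐ headF mv (X 1)) (tapesStepF xs us (X ∘ (2 +_)) (Y ∘ (2 +_))) ⟫ ((≐⇔ (Y 1) (headF mv (X 1)) ⟫ ≡⇔ (proj₁ (fY 1)) (head-eval mv (fX 1))) ×⇔
       tapesStep⇔ xs us {X ∘ (2 +_)} {Y ∘ (2 +_)} (fX ∘ (2 +_)) (fY ∘ (2 +_)))))))))

    transits⇔ : ∀ {j} {ρ : Vec ℕ j} {X Y x y} → (∀ i → Field (X i) ρ (x i)) → (∀ i → Field (Y i) ρ (y i)) →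
      True (transitsF X Y) ρ ⇔ Transits w x y
    transits⇔ {X = X} {Y} fX fY =
      orFin⇔ (λ s → orInput λ a → orVec λ xs → orList (δ s a xs) λ act → condF s a xs act X Y) ⟫ ∃⇔ λ s →
      orInput⇔ (λ a → orVec λ xs → orList (δ s a xs) λ act → condF s a xs act X Y) ⟫ ∃⇔ λ a →
      orVec⇔ (λ xs → orList (δ s a xs) λ act → condF s a xs act X Y) ⟫ ∃⇔ λ xs →
      orList⇔ (δ s a xs) (λ act → condF s a xs act X Y) ⟫ ∃⇔ λ act → id⇔ ×⇔ cond⇔ s a xs act {X} {Y} fX fY

    edge⇔ : ∀ v u → v ≤ Top → u ≤ Top → True edgeF (v ∷ u ∷ []) ⇔ Edge w v u
    edge⇔ v u v≤ u≤ =
      ∨⇔ (var 0F ≺ topF ∧ᶠ var 1F ≺ topF ∧ᶠ transitsF (λ i → digF i (var 0F)) (λ i → digF i (var 1F)))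
         (var 0F ≺ topF ∧ᶠ var 1F ≐ topF ∧ᶠ digF 0 (var 0F) ≐ const# (toℕ accepting)) ⟫
      ((∧⇔ (var 0F ≺ topF) (var 1F ≺ topF ∧ᶠ transitsF (λ i → digF i (var 0F)) (λ i → digF i (var 1F))) ⟫ (≺top (var 0F) ×⇔
        (∧⇔ (var 1F ≺ topF) (transitsF (λ i → digF i (var 0F)) (λ i → digF i (var 1F))) ⟫ (≺top (var 1F) ×⇔
          transits⇔ {X = λ i → digF i (var 0F)} {λ i → digF i (var 1F)} (λ i → dig-eval {ρ = ρ} i (var 0F) refl v≤ , dig< i v) (λ i → dig-eval {ρ = ρ} i (var 1F) refl u≤ , dig< i u)))))
       ⊎⇔ (∧⇔ (var 0F ≺ topF) (var 1F ≐ topF ∧ᶠ digF 0 (var 0F) ≐ const# (toℕ accepting)) ⟫ (≺top (var 0F) ×⇔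
        (∧⇔ (var 1F ≐ topF) (digF 0 (var 0F) ≐ const# (toℕ accepting)) ⟫
          ((≐⇔ (var 1F) topF ⟫ ≡⇔ refl (top-eval {ρ = ρ})) ×⇔
           (≐⇔ (digF 0 (var 0F)) (const# (toℕ accepting)) ⟫ ≡⇔ (dig-eval {ρ = ρ} 0 (var 0F) refl v≤) (fin-eval accepting (q≤e w))))))))
      where
      ρ : Vec ℕ 2
      ρ = v ∷ u ∷ []
      ≺top : ∀ f → True (f ≺ topF) ρ ⇔ (eval f ρ < Top)
      ≺top f = ≺⇔ f topF ⟫ mk⇔ (subst (eval f ρ <_) (top-eval {ρ = ρ})) (subst (eval f ρ <_) (sym (top-eval {ρ = ρ})))

  -- All fields of the initial configuration except the state are zero, so the source is a constant.
  begin-at-eq : ∀ w → begin-at w ≡ toℕ initial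
  begin-at-eq w = trans (cong (λ x → toℕ initial + x * N w) (zeros k)) (ℕ.+-identityʳ _)
    where
    zeros : ∀ k → Mixed.enc (N w) {{N≢0 w}} (0 ∷ tapeFields (Vec.replicate k blankTape)) ≡ 0
    zeros zero    = refl
    zeros (suc k) = cong (λ x → (x * N w) * N w) (cong (_* N w) (cong (_* N w) (zero-tail k)))
      where
      zero-tail : ∀ k → Mixed.enc (N w) {{N≢0 w}} (tapeFields (Vec.replicate k blankTape)) ≡ 0
      zero-tail zero    = refl
      zero-tail (suc k) rewrite zero-tail k = refl

NL⇒GraphFor : ∀ {σ ℓ} {L : Language σ ℓ} → NL L → GraphFor L
NL⇒GraphFor {σ} {ℓ} {L} (M , (b , space≤) , correct) = record
  { exponent      = exponent
  ; sourceF       = const# (toℕ initial)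
  ; targetF       = topF
  ; edgeF         = edgeF
  ; source        = λ _ → toℕ initial
  ; target        = top
  ; Edge          = Edge
  ; source<target = λ w → subst (_< top w) (begin-at-eq w) (enc<top w {start {σ = σ} initial} (reachable⇒fitting w ε))
  ; target-small  = λ w → small w
  ; edge-range    = λ { (inj₁ (v< , u< , _)) → v< , ℕ.<⇒≤ u< ; (inj₂ (v< , refl , _)) → v< , ℕ.≤-refl }
  ; reachability  = λ w → correct w ⟫ subst (λ x → Accepts w ⇔ Star (Edge w) x (top w)) (begin-at-eq w) (accepts⇔reach w)
  ; source-eval   = λ w cap h → Truth.const-eval w cap (1≤ w cap h) (toℕ initial)
      (ℕ.≤-trans (ℕ.<⇒≤ (Fin.toℕ<n initial)) (small-const w cap h _ (q≤e w)))
  ; target-eval   = λ w cap h → top-eval w cap h {ρ = []}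
  ; edge-eval     = λ w cap h → edge⇔ w cap h
  }
  where
  open NondeterministicTM M
  open ConfigurationGraph M b space≤
  open ConfigurationGraphFn M b space≤
  1≤ : ∀ w cap → (2 + length w) ^ exponent ≤ cap → 1 ≤ cap
  1≤ w cap h = ℕ.≤-trans (s≤s z≤n) (P≤cap w cap h)
  small : ∀ w → suc (top w) ≤ (2 + length w) ^ exponent
  small w = ℕ.≤-trans (ℕ.≤-trans (ℕ.≤-reflexive (ℕ.+-comm 1 (top w))) (ℕ.+-monoʳ-≤ (top w) (ℕ.m^n>0 (2 + length w) e))) (Top+N≤cap w _ ℕ.≤-refl)

-- Nondeterministic logarithmic space is closed under complement (Immerman and
-- Szelepcsényi): the number of vertices reachable in i steps determines, by
-- guessing that many of them, which vertices are not reachable in i + 1 steps.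

module Counting {A : ℕ → Set} (A? : ∀ i → Dec (A i)) where

  count : ℕ → ℕ
  count zero    = 0
  count (suc n) with A? n
  ... | yes _ = suc (count n)
  ... | no _  = count n

  count≤ : ∀ n → count n ≤ n
  count≤ zero    = z≤n
  count≤ (suc n) with A? n
  ... | yes _ = s≤s (count≤ n)
  ... | no _  = ℕ.m≤n⇒m≤1+n (count≤ n)

  count-yes : ∀ {n} → A n → count (suc n) ≡ suc (count n)
  count-yes {n} a with A? n
  ... | yes _ = refl
  ... | no ¬a = contradiction a ¬a

  count-no : ∀ {n} → ¬ A n → count (suc n) ≡ count n
  count-no {n} ¬a with A? n
  ... | yes a = contradiction a ¬a
  ... | no _  = refl

open Counting using (count; count≤; count-yes; count-no)

module _ {A B : ℕ → Set} (A? : ∀ i → Dec (A i)) (B? : ∀ i → Dec (B i)) where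

  count-mono : ∀ n → (∀ i → i < n → A i → B i) → count A? n ≤ count B? n
  count-mono zero    h = z≤n
  count-mono (suc n) h with A? n | B? n
  ... | yes a | yes b = s≤s (count-mono n λ i l → h i (ℕ.m<n⇒m<1+n l))
  ... | yes a | no ¬b = contradiction (h n (ℕ.n<1+n n) a) ¬b
  ... | no ¬a | yes b = ℕ.m≤n⇒m≤1+n (count-mono n λ i l → h i (ℕ.m<n⇒m<1+n l))
  ... | no ¬a | no ¬b = count-mono n λ i l → h i (ℕ.m<n⇒m<1+n l)

  -- A finite set has no proper subset of the same size. This is how a count certifies that an
  -- enumeration was exhaustive.
  count-reflects : ∀ n → (∀ i → i < n → A i → B i) → count B? n ≤ count A? n → ∀ i → i < n → B i → A i
  count-reflects (suc n) h le with A? n | B? n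
  ... | yes a | yes b = ∀<suc (λ i → B i → A i) (count-reflects n (λ i l → h i (ℕ.m<n⇒m<1+n l)) (ℕ.≤-pred le)) (λ _ → a)
  ... | yes a | no ¬b = contradiction (h n (ℕ.n<1+n n) a) ¬b
  ... | no ¬a | yes b = contradiction le (ℕ.<⇒≱ (s≤s (count-mono n λ i l → h i (ℕ.m<n⇒m<1+n l))))
  ... | no ¬a | no ¬b = ∀<suc (λ i → B i → A i) (count-reflects n (λ i l → h i (ℕ.m<n⇒m<1+n l)) le) (λ b → contradiction b ¬b)

module Enumeration (N : ℕ) {A B : ℕ → Set} (A? : ∀ i → Dec (A i)) where

  -- Passing the vertex `v` takes a certificate of `A v`, which is counted, or one of `B v`, which
  -- is not. In general the final count is only a lower bound for the size of `A` (`visit-upper`);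
  -- if `B` excludes `A`, it is exact.
  Visit : ℕ × ℕ → ℕ × ℕ → Set
  Visit (v , k) (v′ , k′) = v′ ≡ suc v × v′ ≤ N × k′ ≤ N × ((k′ ≡ suc k × A v) ⊎ (k′ ≡ k × B v))

  visit-upper : ∀ {v k v′ k′} → Star Visit (v , k) (v′ , k′) → k ≤ count A? v → k′ ≤ count A? v′
  visit-upper ε h = h
  visit-upper ((refl , _ , _ , inj₁ (refl , a)) ◅ xs) h = visit-upper xs (ℕ.≤-trans (s≤s h) (ℕ.≤-reflexive (sym (count-yes A? a))))
  visit-upper {v} ((refl , _ , _ , inj₂ (refl , b)) ◅ xs) h = visit-upper xs (ℕ.≤-trans h mono)
    where
    mono : count A? v ≤ count A? (suc v)
    mono with A? v
    ... | yes _ = ℕ.n≤1+n _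
    ... | no _  = ℕ.≤-refl

  visit-exact : (∀ v → v < N → B v → ¬ A v) → ∀ {v k v′ k′} → Star Visit (v , k) (v′ , k′) → k ≡ count A? v → k′ ≡ count A? v′
  visit-exact d ε h = h
  visit-exact d ((refl , _ , _ , inj₁ (refl , a)) ◅ xs) h = visit-exact d xs (trans (cong suc h) (sym (count-yes A? a)))
  visit-exact d ((refl , v< , _ , inj₂ (refl , b)) ◅ xs) h = visit-exact d xs (trans h (sym (count-no A? (d _ v< b))))

  visit-path : (∀ v → v < N → ¬ A v → B v) → ∀ n → n ≤ N → Star Visit (0 , 0) (n , count A? n)
  visit-path d zero    h = ε
  visit-path d (suc n) h with A? n | visit-path d n (ℕ.<⇒≤ h)
  ... | yes a | p = p ◅◅ ((refl , h , ℕ.≤-trans (s≤s (count≤ A? n)) h , inj₁ (refl , a)) ◅ ε)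
  ... | no ¬a | p = p ◅◅ ((refl , h , ℕ.≤-trans (count≤ A? n) (ℕ.<⇒≤ h) , inj₂ (refl , d n h ¬a)) ◅ ε)

module Layers (s t : ℕ) (s≤t : s ≤ t) (E : ℕ → ℕ → Set) (E? : ∀ u v → Dec (E u v)) (E≤ : ∀ {u v} → E u v → u ≤ t × v ≤ t) where

  R : ℕ → ℕ → Set
  R zero    v = v ≡ s
  R (suc i) v = ∃[ u ] u < suc t × R i u × (u ≡ v ⊎ E u v)

  R? : ∀ i v → Dec (R i v)
  R? zero    v = v ℕ.≟ s
  R? (suc i) v = ℕ.anyUpTo? (λ u → R? i u ×-dec (u ℕ.≟ v ⊎-dec E? u v)) (suc t)

  R≤ : ∀ i {v} → R i v → v ≤ t
  R≤ zero    refl = s≤t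
  R≤ (suc i) (u , u≤ , r , inj₁ refl) = ℕ.≤-pred u≤
  R≤ (suc i) (u , u≤ , r , inj₂ e)    = proj₂ (E≤ e)

  R-suc : ∀ i {v} → R i v → R (suc i) v
  R-suc i r = _ , s≤s (R≤ i r) , r , inj₁ refl

  N : ℕ
  N = suc t

  size : ℕ → ℕ
  size i = count (R? i) N

  size-mono : ∀ i → size i ≤ size (suc i)
  size-mono i = count-mono (R? i) (R? (suc i)) N λ _ _ → R-suc i

  size-zero : size 0 ≡ 1
  size-zero = go N (s≤s s≤t)
    where
    none : ∀ n → n ≤ s → count (R? 0) n ≡ 0
    none zero    h = refl
    none (suc n) h = trans (count-no (R? 0) (ℕ.<⇒≢ h)) (none n (ℕ.<⇒≤ h))
    go : ∀ n → s < n → count (R? 0) n ≡ 1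
    go (suc n) h with <suc-cases h
    ... | inj₁ s<n  = trans (count-no (R? 0) (λ e → ℕ.<⇒≢ s<n (sym e))) (go n s<n)
    ... | inj₂ refl = trans (count-yes (R? 0) refl) (cong suc (none n ℕ.≤-refl))

  Stable : ℕ → Set
  Stable i = size (suc i) ≡ size i

  -- Otherwise each layer would gain a vertex, and layer `N` would have more than `N` of them.
  stable-exists : ∃[ i ] i < N × Stable i
  stable-exists with search N
    where
    search : ∀ j → (∃[ i ] i < j × Stable i) ⊎ j < size j
    search zero = inj₂ (ℕ.≤-reflexive (sym size-zero))
    search (suc j) with search j
    ... | inj₁ (i , i<j , st) = inj₁ (i , ℕ.m<n⇒m<1+n i<j , st)
    ... | inj₂ j< with size (suc j) ℕ.≟ size j
    ... | yes st = inj₁ (j , ℕ.n<1+n j , st)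
    ... | no ¬st = inj₂ (ℕ.≤-trans (s≤s j<) (ℕ.≤∧≢⇒< (size-mono j) (¬st ∘ sym)))
  ... | inj₁ h  = h
  ... | inj₂ N< = contradiction N< (ℕ.≤⇒≯ (count≤ (R? N) N))

  stable-closed : ∀ {i} → Stable i → ∀ {v} → R (suc i) v → R i v
  stable-closed {i} st {v} r = count-reflects (R? i) (R? (suc i)) N (λ _ _ → R-suc i) (ℕ.≤-reflexive st) v (s≤s (R≤ (suc i) r)) r

  R⇒Star : ∀ i {v} → R i v → Star E s v
  R⇒Star zero    refl = ε
  R⇒Star (suc i) (u , _ , r , inj₁ refl) = R⇒Star i r
  R⇒Star (suc i) (u , _ , r , inj₂ e)    = R⇒Star i r ◅◅ (e ◅ ε)

  R-start : ∀ i → R i s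
  R-start zero    = refl
  R-start (suc i) = R-suc i (R-start i)

  Star⇒R : ∀ {i} → Stable i → ∀ {u v} → Star E u v → R i u → R i v
  Star⇒R st ε        r = r
  Star⇒R {i} st (e ◅ es) r = Star⇒R st es (stable-closed st (_ , s≤s (R≤ i r) , r , inj₂ e))

  reach? : Dec (Star E s t)
  reach? = let (i , _ , st) = stable-exists in map′ (R⇒Star i) (λ p → Star⇒R st p (R-start i)) (R? i t)

star-map : ∀ {A : Set} {P Q : A → A → Set} → (∀ {x y} → P x y → Q x y) → ∀ {x y} → Star P x y → Star Q x y
star-map f ε        = ε
star-map f (x ◅ xs) = f x ◅ star-map f xs

star⇔ : ∀ {A : Set} {P Q : A → A → Set} → (∀ {x y} → P x y ⇔ Q x y) → ∀ {x y} → Star P x y ⇔ Star Q x y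
star⇔ f = mk⇔ (star-map (to↔ f)) (star-map (from↔ f))

-- Inductive counting as a formula

module Unreachability {σ ℓ} {L : Language σ ℓ} (G : GraphFor L) where

  open GraphFor G

  sF tF NF : ∀ {m} → Fn σ m
  sF = comp sourceF []
  tF = comp targetF []
  NF = succ tF

  edgeAt : ∀ {m} → Fin m → Fin m → Fn σ m
  edgeAt u v = comp edgeF (var u ∷ var v ∷ [])

  -- The second component of the walking pair counts steps. Standing still is a step too, so exactly
  -- as many are made as the layer number says.
  reachIn : ∀ {m} → Fin m → Fin m → Formula σ m
  reachIn i v = reach sF zer
    (at (var 1F ≐ succ (var 3F) ∧ᶠ var 1F ≼ NF ∧ᶠ var 0F ≼ tF ∧ᶠ var 2F ≼ tF ∧ᶠ (var 2F ≐ var 0F ∨ᶠ edgeAt 2F 0F)))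
    (at (var 0F ≐ var (suc (suc v)) ∧ᶠ var 1F ≐ var (suc (suc i))))

  -- One step of an enumeration of the vertices.
  visitF : ∀ {m} → Formula σ (4 + m) → Formula σ (4 + m) → Formula σ (4 + m)
  visitF φ ψ = at (var 0F ≐ succ (var 2F) ∧ᶠ var 0F ≼ NF ∧ᶠ var 1F ≼ NF)
    and (at (var 1F ≐ succ (var 3F)) and φ or at (var 1F ≐ var 3F) and ψ)

  enumerated : ∀ {m} → Formula σ (4 + m) → Formula σ (4 + m) → Fin m → Formula σ m
  enumerated φ ψ c = reach zer zer (visitF φ ψ) (at (var 0F ≐ NF ∧ᶠ var 1F ≐ var (suc (suc c))))

  shift4 : ∀ {m} → Fin m → Fin (4 + m)
  shift4 i = suc (suc (suc (suc i)))

  -- Enumerate as many vertices of layer `i` as it has, none of them equal to `v` or with an edge to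
  -- `v`: then no vertex of the layer leads to `v` in at most one step. Vertices may be passed over
  -- freely, and the count `c` rules out omissions.
  notIn : ∀ {m} → Fin m → Fin m → Fin m → Formula σ m
  notIn i c v = enumerated
    (at (neg (var 2F ≐ var (shift4 v)) ∧ᶠ neg (edgeAt 2F (shift4 v))) and reachIn (shift4 i) 2F)
    (at one) c

  -- Each vertex is certified to lie inside or outside layer `i′`, the one after `i`. Certificates
  -- for the outside rely on the size `c` of layer `i`, already known.
  nextSize : ∀ {m} → Fin m → Fin m → Fin m → Fin m → Formula σ m
  nextSize i i′ c c′ = enumerated (reachIn (shift4 i′) 2F) (notIn (shift4 i) (shift4 c) 2F) c′

  roundF : Formula σ 4
  roundF = at (var 0F ≐ succ (var 2F) ∧ᶠ var 0F ≼ NF) and nextSize 2F 0F 3F 1F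

  -- The walk goes through pairs of a layer number and the size of that layer, starting with the one
  -- vertex of layer 0, until the next layer has the same size. From there on layers no longer grow,
  -- so it suffices that the next one misses the target.
  unreachable : Formula σ 0
  unreachable = reach zer one
    roundF
    (ex (at (var 0F ≐ succ (var 1F) ∧ᶠ var 0F ≼ NF) and nextSize 1F 0F 2F 2F)
     and ex (at (var 0F ≐ tF) and notIn 1F 2F 0F))

  module Correct (w : List (Fin σ)) (cap : ℕ) (enough : (2 + length w) ^ suc exponent ≤ cap) where

    open Satisfaction w cap
    open Evaluation w cap

    s t : ℕ
    s = source w
    t = target w

    private
      enough′ : (2 + length w) ^ exponent ≤ cap
      enough′ = ℕ.≤-trans (ℕ.m≤n*m _ (2 + length w)) enough

    -- The additional factor `2 + n` puts `N` strictly below the cap, so a value truncated at the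
    -- cap cannot pass for one up to `N`.
    N<cap : suc t < cap
    N<cap = ℕ.≤-trans (ℕ.+-mono-≤ (ℕ.≤-trans (s≤s z≤n) (target-small w)) (target-small w))
      (ℕ.≤-trans (ℕ.+-monoʳ-≤ ((2 + length w) ^ exponent) (ℕ.m≤m+n _ (length w * (2 + length w) ^ exponent))) enough)

    open Truth w cap (ℕ.≤-trans (s≤s z≤n) N<cap)

    E : ℕ → ℕ → Set
    E v u = v ≤ t × u ≤ t × Edge w v u

    E? : ∀ v u → Dec (E v u)
    E? v u with v ℕ.≤? t | u ℕ.≤? t
    ... | no v≰ | _      = no λ (v≤ , _) → v≰ v≤
    ... | yes _ | no u≰  = no λ (_ , u≤ , _) → u≰ u≤
    ... | yes v≤ | yes u≤ with true? edgeF (v ∷ u ∷ [])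
    ... | yes h = yes (v≤ , u≤ , to↔ (edge-eval w cap enough′ v u v≤ u≤) h)
    ... | no ¬h = no λ (_ , _ , e) → ¬h (from↔ (edge-eval w cap enough′ v u v≤ u≤) e)

    open Layers s t (ℕ.<⇒≤ (source<target w)) E E? (λ (v≤ , u≤ , _) → v≤ , u≤)

    t-eval : ∀ {m} {ρ : Vec ℕ m} → eval tF ρ ≡ t
    t-eval = target-eval w cap enough′

    N-eval : ∀ {m} {ρ : Vec ℕ m} → eval NF ρ ≡ N
    N-eval {ρ = ρ} = succ-eval {ρ = ρ} tF (t-eval {ρ = ρ}) (ℕ.<⇒≤ N<cap)

    ≼N⇔ : ∀ {m} {ρ : Vec ℕ m} f → True (f ≼ NF) ρ ⇔ (eval f ρ ≤ N)
    ≼N⇔ {ρ = ρ} f = subst (λ x → True (f ≼ NF) ρ ⇔ (eval f ρ ≤ x)) (N-eval {ρ = ρ}) (≼⇔ f NF)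

    ≼t⇔ : ∀ {m} {ρ : Vec ℕ m} f → True (f ≼ tF) ρ ⇔ (eval f ρ ≤ t)
    ≼t⇔ {ρ = ρ} f = subst (λ x → True (f ≼ tF) ρ ⇔ (eval f ρ ≤ x)) (t-eval {ρ = ρ}) (≼⇔ f tF)

    -- Bounded by N, a truncated successor is a successor.
    suc⇔ : ∀ {m} {ρ : Vec ℕ m} f g → eval f ρ ≤ N → True (f ≐ succ g) ρ ⇔ (eval f ρ ≡ suc (eval g ρ))
    suc⇔ {ρ = ρ} f g f≤ = ≐⇔ f (succ g) ⟫ mk⇔ to λ e → trans e (sym (ℕ.m≤n⇒m⊓n≡m (subst (_≤ cap) e (ℕ.≤-trans f≤ (ℕ.<⇒≤ N<cap)))))
      where
      to : eval f ρ ≡ suc (eval g ρ) ⊓ cap → eval f ρ ≡ suc (eval g ρ)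
      to e with suc (eval g ρ) ℕ.≤? cap
      ... | yes h = trans e (ℕ.m≤n⇒m⊓n≡m h)
      ... | no ¬h = contradiction (subst (_≤ N) (trans e (ℕ.m≥n⇒m⊓n≡n (ℕ.≰⇒≥ ¬h))) f≤) (ℕ.<⇒≱ N<cap)

    edgeAt⇔ : ∀ {m} {ρ : Vec ℕ m} u v → lookup ρ u ≤ t → lookup ρ v ≤ t → True (edgeAt u v) ρ ⇔ E (lookup ρ u) (lookup ρ v)
    edgeAt⇔ {ρ = ρ} u v u≤ v≤ = edge-eval w cap enough′ (lookup ρ u) (lookup ρ v) u≤ v≤ ⟫ mk⇔ (λ e → u≤ , v≤ , e) (proj₂ ∘ proj₂)

    Walk : ℕ × ℕ → ℕ × ℕ → Set
    Walk (x , j) (x′ , j′) = j′ ≡ suc j × j′ ≤ N × x′ ≤ t × x ≤ t × (x ≡ x′ ⊎ E x x′)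

    walk⇒R : ∀ {x j x′ j′} → Star Walk (x , j) (x′ , j′) → R j x → R j′ x′
    walk⇒R ε r = r
    walk⇒R ((refl , _ , _ , x≤ , h) ◅ xs) r = walk⇒R xs (_ , s≤s x≤ , r , h)

    R⇒walk : ∀ i {v} → i ≤ N → R i v → Star Walk (s , 0) (v , i)
    R⇒walk zero    h refl = ε
    R⇒walk (suc i) h r@(u , u≤ , ru , e) = R⇒walk i (ℕ.<⇒≤ h) ru ◅◅ ((refl , h , R≤ (suc i) r , ℕ.≤-pred u≤ , e) ◅ ε)

    reachIn⇔ : ∀ {m} {ρ : Vec ℕ m} i v → lookup ρ i ≤ N → Sat (reachIn i v) ρ ⇔ R (lookup ρ i) (lookup ρ v)
    reachIn⇔ {ρ = ρ} i v i≤ = mk⇔ to from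
      where
      φ = var 1F ≐ succ (var 3F) ∧ᶠ var 1F ≼ NF ∧ᶠ var 0F ≼ tF ∧ᶠ var 2F ≼ tF ∧ᶠ (var 2F ≐ var 0F ∨ᶠ edgeAt 2F 0F)
      step⇔ : ∀ {x j x′ j′} → True φ (x′ ∷ j′ ∷ x ∷ j ∷ ρ) ⇔ Walk (x , j) (x′ , j′)
      step⇔ {x} {j} {x′} {j′} =
        ∧⇔ (var 1F ≐ succ (var 3F)) _ ⟫ (id⇔ ×⇔ (∧⇔ (var 1F ≼ NF) _ ⟫ (≼N⇔ (var 1F) ×⇔
        (∧⇔ (var 0F ≼ tF) _ ⟫ (≼t⇔ (var 0F) ×⇔ (∧⇔ (var 2F ≼ tF) (var 2F ≐ var 0F ∨ᶠ edgeAt 2F 0F) ⟫ (≼t⇔ (var 2F) ×⇔ id⇔)))))))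
        ⟫ mk⇔ (λ (a , b , c , d , e) → to↔ (suc⇔ {ρ = ρ′} (var 1F) (var 3F) b) a , b , c , d , to↔ (last⇔ d c) e)
              (λ (a , b , c , d , e) → from↔ (suc⇔ {ρ = ρ′} (var 1F) (var 3F) b) a , b , c , d , from↔ (last⇔ d c) e)
        where
        ρ′ = x′ ∷ j′ ∷ x ∷ j ∷ ρ
        last⇔ : x ≤ t → x′ ≤ t → True (var 2F ≐ var 0F ∨ᶠ edgeAt 2F 0F) ρ′ ⇔ (x ≡ x′ ⊎ E x x′)
        last⇔ x≤ x′≤ = ∨⇔ (var 2F ≐ var 0F) (edgeAt 2F 0F) ⟫ (≐⇔ (var 2F) (var 0F) ⊎⇔ edgeAt⇔ {ρ = ρ′} 2F 0F x≤ x′≤)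
      end⇔ : ∀ {x j} → True (var 0F ≐ var (suc (suc v)) ∧ᶠ var 1F ≐ var (suc (suc i))) (x ∷ j ∷ ρ) ⇔ (x ≡ lookup ρ v × j ≡ lookup ρ i)
      end⇔ = ∧⇔ (var 0F ≐ var (suc (suc v))) (var 1F ≐ var (suc (suc i))) ⟫ (≐⇔ (var 0F) (var (suc (suc v))) ×⇔ ≐⇔ (var 1F) (var (suc (suc i))))
      to : Sat (reachIn i v) ρ → R (lookup ρ i) (lookup ρ v)
      to (x , j , p , h) with to↔ end⇔ h
      ... | refl , refl = walk⇒R (star-map (λ (_ , _ , h) → to↔ step⇔ h) p) (source-eval w cap enough′)
      from : R (lookup ρ i) (lookup ρ v) → Sat (reachIn i v) ρ
      from r = lookup ρ v , lookup ρ i ,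
        subst (λ x → Star (Link (at φ) ρ) (x , 0) (lookup ρ v , lookup ρ i)) (sym (source-eval w cap enough′))
          (star-map (λ k@(_ , b , c , _) → ℕ.≤-trans c (ℕ.≤-trans (ℕ.n≤1+n _) (ℕ.<⇒≤ N<cap)) , ℕ.≤-trans b (ℕ.<⇒≤ N<cap) , from↔ step⇔ k) (R⇒walk (lookup ρ i) i≤ r)) ,
        from↔ end⇔ (refl , refl)

    module _ {m} {ρ : Vec ℕ m} (φ ψ : Formula σ (4 + m)) (c : Fin m) (A B : ℕ → Set) (A? : ∀ v → Dec (A v))
             (φ⇔ : ∀ {v′ k′ v k} → v < N → Sat φ (v′ ∷ k′ ∷ v ∷ k ∷ ρ) ⇔ A v) (ψ⇔ : ∀ {v′ k′ v k} → v < N → Sat ψ (v′ ∷ k′ ∷ v ∷ k ∷ ρ) ⇔ B v) where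

      open Enumeration N {A} {B} A?

      enumerated⇔ : Sat (enumerated φ ψ c) ρ ⇔ Star Visit (0 , 0) (N , lookup ρ c)
      enumerated⇔ = mk⇔
        (λ (v , k , p , h) → let (e , f) = to↔ end⇔ h in subst₂ (λ x y → Star Visit (0 , 0) (x , y)) e f (star-map (to↔ link⇔) p))
        (λ p → N , lookup ρ c , star-map (from↔ link⇔) p , from↔ end⇔ (refl , refl))
        where
        end⇔ : ∀ {x k} → True (var 0F ≐ NF ∧ᶠ var 1F ≐ var (suc (suc c))) (x ∷ k ∷ ρ) ⇔ (x ≡ N × k ≡ lookup ρ c)
        end⇔ {x} {k} = ∧⇔ (var 0F ≐ NF) (var 1F ≐ var (suc (suc c))) ⟫ ((≐⇔ (var 0F) NF ⟫ ≡⇔ refl (N-eval {ρ = x ∷ k ∷ ρ})) ×⇔ ≐⇔ (var 1F) (var (suc (suc c))))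
        link⇔ : ∀ {x y} → Link (visitF φ ψ) ρ x y ⇔ Visit x y
        link⇔ {v , k} {v′ , k′} = mk⇔ to from
          where
          ρ′ = v′ ∷ k′ ∷ v ∷ k ∷ ρ
          head⇔ : True (var 0F ≐ succ (var 2F) ∧ᶠ var 0F ≼ NF ∧ᶠ var 1F ≼ NF) ρ′ ⇔ (v′ ≡ suc v × v′ ≤ N × k′ ≤ N)
          head⇔ = ∧⇔ (var 0F ≐ succ (var 2F)) _ ⟫ (id⇔ ×⇔ (∧⇔ (var 0F ≼ NF) (var 1F ≼ NF) ⟫ (≼N⇔ (var 0F) ×⇔ ≼N⇔ (var 1F)))) ⟫
            mk⇔ (λ (a , b , c) → to↔ (suc⇔ {ρ = ρ′} (var 0F) (var 2F) b) a , b , c) (λ (a , b , c) → from↔ (suc⇔ {ρ = ρ′} (var 0F) (var 2F) b) a , b , c)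
          to : Link (visitF φ ψ) ρ (v , k) (v′ , k′) → Visit (v , k) (v′ , k′)
          to (_ , _ , h , r) with to↔ head⇔ h
          ... | refl , v≤ , k≤ = refl , v≤ , k≤ , (case r of λ
            { (inj₁ (e , x)) → inj₁ (to↔ (suc⇔ {ρ = ρ′} (var 1F) (var 3F) k≤) e , to↔ (φ⇔ v≤) x)
            ; (inj₂ (e , x)) → inj₂ (to↔ (≐⇔ (var 1F) (var 3F)) e , to↔ (ψ⇔ v≤) x) })
          from : Visit (v , k) (v′ , k′) → Link (visitF φ ψ) ρ (v , k) (v′ , k′)
          from (refl , v≤ , k≤ , r) = ℕ.≤-trans v≤ (ℕ.<⇒≤ N<cap) , ℕ.≤-trans k≤ (ℕ.<⇒≤ N<cap) , from↔ head⇔ (refl , v≤ , k≤) , (case r of λ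
            { (inj₁ (e , x)) → inj₁ (from↔ (suc⇔ {ρ = ρ′} (var 1F) (var 3F) k≤) e , from↔ (φ⇔ v≤) x)
            ; (inj₂ (e , x)) → inj₂ (from↔ (≐⇔ (var 1F) (var 3F)) e , from↔ (ψ⇔ v≤) x) })

    notIn⇔ : ∀ {m} {ρ : Vec ℕ m} i c v → lookup ρ i ≤ N → lookup ρ v ≤ t → lookup ρ c ≡ size (lookup ρ i) →
             Sat (notIn i c v) ρ ⇔ (¬ R (suc (lookup ρ i)) (lookup ρ v))
    notIn⇔ {ρ = ρ} i c v i≤ v≤ ec = enumerated⇔ φ (at one) c A (λ _ → ⊤) A? φ⇔ (λ _ → mk⇔ (λ _ → tt) (λ _ → ℕ.≤-reflexive (sym one-eval))) ⟫ mk⇔ to from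
      where
      φ = at (neg (var 2F ≐ var (shift4 v)) ∧ᶠ neg (edgeAt 2F (shift4 v))) and reachIn (shift4 i) 2F
      I V : ℕ
      I = lookup ρ i
      V = lookup ρ v
      A : ℕ → Set
      A u = ((u ≢ V) × ¬ E u V) × R I u
      A? : ∀ u → Dec (A u)
      A? u = (¬? (u ℕ.≟ V) ×-dec ¬? (E? u V)) ×-dec R? I u
      φ⇔ : ∀ {v′ k′ u k} → u < N → Sat φ (v′ ∷ k′ ∷ u ∷ k ∷ ρ) ⇔ A u
      φ⇔ {v′} {k′} {u} {k} u< =
        (∧⇔ (neg (var 2F ≐ var (shift4 v))) (neg (edgeAt 2F (shift4 v))) ⟫
          ((neg⇔ (var 2F ≐ var (shift4 v)) ⟫ ¬⇔ (≐⇔ (var 2F) (var (shift4 v)))) ×⇔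
           (neg⇔ (edgeAt 2F (shift4 v)) ⟫ ¬⇔ (edgeAt⇔ {ρ = v′ ∷ k′ ∷ u ∷ k ∷ ρ} 2F (shift4 v) (ℕ.≤-pred u<) v≤))))
        ×⇔ reachIn⇔ {ρ = v′ ∷ k′ ∷ u ∷ k ∷ ρ} (shift4 i) 2F i≤
        where
        ¬⇔ : ∀ {X Y : Set} → X ⇔ Y → (¬ X) ⇔ (¬ Y)
        ¬⇔ f = mk⇔ (λ n y → n (from↔ f y)) (λ n x → n (to↔ f x))
      open Enumeration N {A} {λ _ → ⊤} A?
      to : Star Visit (0 , 0) (N , lookup ρ c) → ¬ R (suc I) V
      to p (u , u< , r , h) with count-reflects A? (R? I) N (λ _ _ → proj₂)
        (subst (_≤ count A? N) ec (visit-upper p z≤n)) u u< r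
      ... | (u≢ , ¬e) , _ = case h of λ { (inj₁ e) → u≢ e ; (inj₂ e) → ¬e e }
      from : ¬ R (suc I) V → Star Visit (0 , 0) (N , lookup ρ c)
      from ¬r = subst (λ x → Star Visit (0 , 0) (N , x)) (trans same (sym ec)) (visit-path (λ _ _ _ → tt) N ℕ.≤-refl)
        where
        same : count A? N ≡ size I
        same = ℕ.≤-antisym (count-mono A? (R? I) N λ _ _ → proj₂)
          (count-mono (R? I) A? N λ u u< r → ((λ { refl → ¬r (u , u< , r , inj₁ refl) }) , λ e → ¬r (u , u< , r , inj₂ e)) , r)

    nextSize⇔ : ∀ {m} {ρ : Vec ℕ m} i i′ c c′ → lookup ρ i′ ≡ suc (lookup ρ i) → lookup ρ i′ ≤ N → lookup ρ c ≡ size (lookup ρ i) →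
                Sat (nextSize i i′ c c′) ρ ⇔ (lookup ρ c′ ≡ size (suc (lookup ρ i)))
    nextSize⇔ {ρ = ρ} i i′ c c′ ei i≤ ec = enumerated⇔ (reachIn (shift4 i′) 2F) (notIn (shift4 i) (shift4 c) 2F) c′ A (λ v → ¬ A v) (R? (suc I)) φ⇔ ψ⇔ ⟫
      mk⇔ (λ p → visit-exact (λ _ _ n → n) p refl) (λ e → subst (λ x → Star Visit (0 , 0) (N , x)) (sym e) (visit-path (λ _ _ n → n) N ℕ.≤-refl))
      where
      I : ℕ
      I = lookup ρ i
      A : ℕ → Set
      A v = R (suc I) v
      I≤ : I ≤ N
      I≤ = ℕ.≤-trans (ℕ.n≤1+n I) (subst (_≤ N) ei i≤)
      φ⇔ : ∀ {v′ k′ v k} → v < N → Sat (reachIn (shift4 i′) 2F) (v′ ∷ k′ ∷ v ∷ k ∷ ρ) ⇔ A v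
      φ⇔ {v′} {k′} {v} {k} _ = subst (λ x → Sat (reachIn (shift4 i′) 2F) (v′ ∷ k′ ∷ v ∷ k ∷ ρ) ⇔ R x v) ei (reachIn⇔ {ρ = v′ ∷ k′ ∷ v ∷ k ∷ ρ} (shift4 i′) 2F i≤)
      ψ⇔ : ∀ {v′ k′ v k} → v < N → Sat (notIn (shift4 i) (shift4 c) 2F) (v′ ∷ k′ ∷ v ∷ k ∷ ρ) ⇔ (¬ A v)
      ψ⇔ {v′} {k′} {v} {k} v< = notIn⇔ {ρ = v′ ∷ k′ ∷ v ∷ k ∷ ρ} (shift4 i) (shift4 c) 2F I≤ (ℕ.≤-pred v<) ec
      open Enumeration N {A} {λ v → ¬ A v} (R? (suc I))

    Round : ℕ × ℕ → ℕ × ℕ → Set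
    Round (i , c) (i′ , c′) = Sat roundF (i′ ∷ c′ ∷ i ∷ c ∷ [])

    successor⇔ : ∀ {m} {ρ : Vec ℕ m} x y → True (var x ≐ succ (var y) ∧ᶠ var x ≼ NF) ρ ⇔ (lookup ρ x ≡ suc (lookup ρ y) × lookup ρ x ≤ N)
    successor⇔ {ρ = ρ} x y = ∧⇔ (var x ≐ succ (var y)) (var x ≼ NF) ⟫ (id⇔ ×⇔ ≼N⇔ (var x)) ⟫
      mk⇔ (λ (a , b) → to↔ (suc⇔ {ρ = ρ} (var x) (var y) b) a , b) (λ (a , b) → from↔ (suc⇔ {ρ = ρ} (var x) (var y) b) a , b)

    rounds-sound : ∀ {i c i′ c′} → Star Round (i , c) (i′ , c′) → i ≤ N → c ≡ size i → i′ ≤ N × c′ ≡ size i′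
    rounds-sound ε i≤ e = i≤ , e
    rounds-sound {i} {c} (_◅_ {j = i₁ , c₁} (a , n) xs) i≤ e with to↔ (successor⇔ {ρ = i₁ ∷ c₁ ∷ i ∷ c ∷ []} 0F 2F) a
    ... | refl , i₁≤ = rounds-sound xs i₁≤ (to↔ (nextSize⇔ {ρ = i₁ ∷ c₁ ∷ i ∷ c ∷ []} 2F 0F 3F 1F refl i₁≤ e) n)

    rounds-complete : ∀ i → i ≤ N → Star (Link roundF []) (0 , 1) (i , size i)
    rounds-complete zero    h = subst (λ x → Star (Link roundF []) (0 , 1) (0 , x)) (sym size-zero) ε
    rounds-complete (suc i) h = rounds-complete i (ℕ.<⇒≤ h) ◅◅
      ((ℕ.≤-trans h (ℕ.<⇒≤ N<cap) , ℕ.≤-trans (count≤ (R? (suc i)) N) (ℕ.<⇒≤ N<cap) ,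
        from↔ (successor⇔ {ρ = suc i ∷ size (suc i) ∷ i ∷ size i ∷ []} 0F 2F) (refl , h) ,
        from↔ (nextSize⇔ {ρ = suc i ∷ size (suc i) ∷ i ∷ size i ∷ []} 2F 0F 3F 1F refl h refl) refl) ◅ ε)

    unreachable⇔ : Sat unreachable [] ⇔ (¬ Star E s t)
    unreachable⇔ = mk⇔ to from
      where
      to : Sat unreachable [] → ¬ Star E s t
      to (i , c , p , (i′ , _ , a , n) , (v , _ , e , u)) path
        with rounds-sound (star-map (λ (_ , _ , h) → h) (subst (λ x → Star (Link roundF []) (0 , x) (i , c)) (one-eval {ρ = []}) p)) z≤n (sym size-zero)
      ... | i≤ , refl with to↔ (successor⇔ {ρ = i′ ∷ i ∷ size i ∷ []} 0F 1F) a
      ... | refl , i′≤ with trans (to↔ (≐⇔ (var 0F) tF) e) (t-eval {ρ = v ∷ i ∷ size i ∷ []})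
      ... | refl = to↔ (notIn⇔ {ρ = v ∷ i ∷ size i ∷ []} 1F 2F 0F i≤ ℕ.≤-refl refl) u
        (R-suc i (Star⇒R (sym (to↔ (nextSize⇔ {ρ = i′ ∷ i ∷ size i ∷ []} 1F 0F 2F 2F refl i′≤ refl) n)) path (R-start i)))
      from : ¬ Star E s t → Sat unreachable []
      from ¬path with stable-exists
      ... | i , i< , st = i , size i , subst (λ x → Star (Link roundF []) (0 , x) (i , size i)) (sym (one-eval {ρ = []})) (rounds-complete i (ℕ.<⇒≤ i<)) ,
        (suc i , ℕ.≤-trans i< (ℕ.<⇒≤ N<cap) , from↔ (successor⇔ {ρ = suc i ∷ i ∷ size i ∷ []} 0F 1F) (refl , i<) ,
          from↔ (nextSize⇔ {ρ = suc i ∷ i ∷ size i ∷ []} 1F 0F 2F 2F refl i< refl) (sym st)) ,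
        (t , ℕ.≤-trans (ℕ.n≤1+n t) (ℕ.<⇒≤ N<cap) , from↔ (≐⇔ (var 0F) tF) (sym (t-eval {ρ = t ∷ i ∷ size i ∷ []})) ,
          from↔ (notIn⇔ {ρ = t ∷ i ∷ size i ∷ []} 1F 2F 0F (ℕ.<⇒≤ i<) ℕ.≤-refl refl) (λ r → ¬path (R⇒Star (suc i) r)))

    L⇔ : L w ⇔ Star E s t
    L⇔ = reachability w ⟫ star⇔ (mk⇔ (λ e → let (v< , u≤) = edge-range e in ℕ.<⇒≤ v< , u≤ , e) (proj₂ ∘ proj₂))

    L? : Dec (L w)
    L? with reach?
    ... | yes p = yes (from↔ L⇔ p)
    ... | no ¬p = no (¬p ∘ to↔ L⇔)

    complement⇔ : (¬ L w) ⇔ Sat unreachable []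
    complement⇔ = mk⇔ (λ n → from↔ unreachable⇔ (n ∘ from↔ L⇔)) (λ h l → to↔ unreachable⇔ h (to↔ L⇔ l))

NL-complement : ∀ {σ ℓ} {L : Language σ ℓ} → NL L → NL (λ w → ¬ L w)
NL-complement {L = L} nl = NL-by-formula (Unreachability.unreachable G) (suc (GraphFor.exponent G)) (λ w → ¬ L w)
  (Unreachability.Correct.complement⇔ G)
  where
  G = NL⇒GraphFor nl

-- Reachability is decided by the stable layer. This serves to recover a language from its double
-- complement.
NL-decidable : ∀ {σ ℓ} {L : Language σ ℓ} → NL L → ∀ w → Dec (L w)
NL-decidable nl w = Unreachability.Correct.L? (NL⇒GraphFor nl) w _ ℕ.≤-refl

-- The algebra of a graph.  Its elements are two copies of every vertex and a
-- tester for every vertex.  A pair of copies of v is carried along edges out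
-- of v, and reset by testers to the source; a tester turns a pair of copies
-- of distinct vertices into the pair of copies of the target.

module GraphAlgebra (S : Signature) (N-1 : ℕ) (s t : Fin (suc N-1)) (s≢t : s ≢ t)
  (E : Fin (suc N-1) → Fin (suc N-1) → Set) (E? : ∀ v u → Dec (E v u)) (sink : ∀ {u} → ¬ E t u) (broken : Bool) where

  N : ℕ
  N = suc N-1

  Element : Set
  Element = Fin 3 × Fin N

  tester : Fin 3 → Bool
  tester 2F = true
  tester _  = false

  low? : Fin 3 → Bool
  low? 0F = true
  low? _  = false

  does : ∀ {P : Set} → Dec P → Bool
  does (yes _) = true
  does (no _)  = false

  infixl 7 _·_
  -- The right factor enters only through its vertex and through whether it is a tester, not through
  -- which copy it is. Testers leave copies of the target alone, so that in the unbroken algebra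
  -- identifying just these two is a congruence. If `broken`, multiplication by a copy of the target
  -- sends the low copy of the target, but not the high one, to the source.
  _·_ : Element → Element → Element
  (β , v) · (γ , u) =
    if tester β
    then (if tester γ then (β , v) else (if does (v Fin.≟ u) then (0F , t) else (1F , t)))
    else (if tester γ
          then (if does (v Fin.≟ t) then (β , v) else (β , s))
          else (if broken ∧ low? β ∧ does (v Fin.≟ t) ∧ does (u Fin.≟ t) then (0F , s)
                else (if does (E? v u) then (β , u) else (β , v))))

  does-yes : ∀ {P : Set} (d : Dec P) → P → does d ≡ true
  does-yes (yes _) p = refl
  does-yes (no ¬p) p = contradiction p ¬p

  does-no : ∀ {P : Set} (d : Dec P) → ¬ P → does d ≡ false
  does-no (yes p) ¬p = contradiction p ¬p
  does-no (no _)  ¬p = refl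

  encE : Element → Fin (3 * N)
  encE (β , v) = Fin.combine β v

  decE : Fin (3 * N) → Element
  decE x = Fin.remQuot N x

  dec-encE : ∀ e → decE (encE e) ≡ e
  dec-encE (β , v) = Fin.remQuot-combine β v

  enc-decE : ∀ x → encE (decE x) ≡ x
  enc-decE x = Fin.combine-remQuot {3} N x

  infixl 7 _∙_
  _∙_ : Fin (3 * N) → Fin (3 * N) → Fin (3 * N)
  x ∙ y = encE (decE x · decE y)

  -- In arities zero and one a constant and the identity are taken: every equivalence respects them,
  -- so only the product constrains congruences.
  value : ∀ {n} → Vec (Fin (3 * N)) n → Fin (3 * N)
  value []          = encE (0F , s)
  value (x ∷ [])    = x
  value (x ∷ y ∷ _) = x ∙ y

  algebra : FiniteAlgebra S
  algebra = record { size = 3 * N ; op = λ _ → value }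

  -- The candidate congruences identify the copies of the vertices in R.
  data Θ (R : Fin N → Set) : Element → Element → Set where
    same   : ∀ {x} → Θ R x x
    copies : ∀ {β γ v} → tester β ≡ false → tester γ ≡ false → R v → Θ R (β , v) (γ , v)

  module _ (R : Fin N → Set) (R-edge : ∀ {v u} → R v → E v u → R u) (R-reset : ∀ {v} → R v → v ≢ t → R s)
           (R-broken : broken ≡ true → ¬ R t) where

    unbroken : ∀ {v} → R v → ∀ β u → (broken ∧ low? β ∧ does (v Fin.≟ t) ∧ does (u Fin.≟ t)) ≡ false
    unbroken {v} r β u = go broken refl
      where
      go : ∀ b → broken ≡ b → (b ∧ low? β ∧ does (v Fin.≟ t) ∧ does (u Fin.≟ t)) ≡ false
      go false eb = refl
      go true  eb with low? β | v Fin.≟ t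
      ... | false | _        = refl
      ... | true  | no _     = refl
      ... | true  | yes refl = contradiction r (R-broken eb)

    Θ-left : ∀ {x x′} y → Θ R x x′ → Θ R (x · y) (x′ · y)
    Θ-left y same = same
    Θ-left (γ , u) (copies {β} {β′} {v} h h′ r) rewrite h | h′ with tester γ
    ... | true with v Fin.≟ t
    ... | yes _   = copies h h′ r
    ... | no v≢t  = copies h h′ (R-reset r v≢t)
    Θ-left (γ , u) (copies {β} {β′} {v} h h′ r) | false
      rewrite unbroken r β u | unbroken r β′ u with E? v u
    ... | yes e = copies h h′ (R-edge r e)
    ... | no _  = copies h h′ r

    Θ-right : ∀ x {y y′} → Θ R y y′ → x · y ≡ x · y′
    Θ-right x same = refl
    Θ-right (β , v) (copies h h′ r) rewrite h | h′ = refl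

    Θ-sym : ∀ {x y} → Θ R x y → Θ R y x
    Θ-sym same            = same
    Θ-sym (copies h h′ r) = copies h′ h r

    Θ-trans : ∀ {x y z} → Θ R x y → Θ R y z → Θ R x z
    Θ-trans same            q               = q
    Θ-trans p               same            = p
    Θ-trans (copies h h′ r) (copies k k′ _) = copies h k′ r

    θ : Fin (3 * N) → Fin (3 * N) → Set
    θ x y = Θ R (decE x) (decE y)

    -- Right multiplication takes the copies of a vertex of `R` to copies of one common vertex,
    -- again in `R` by closure under edges and resets. As right factors, copies of a vertex are
    -- indistinguishable. Only the break would separate the copies of the target, hence `R-broken`.
    θ-congruence : IsCongruence algebra θ
    θ-congruence = record
      { isEquivalence = record { refl = same ; sym = Θ-sym ; trans = Θ-trans }
      ; compatible    = λ _ → value-compatible }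
      where
      value-compatible : ∀ {n} {xs ys : Vec (Fin (3 * N)) n} → Pointwise θ xs ys → θ (value xs) (value ys)
      value-compatible []          = same
      value-compatible (p ∷ [])    = p
      value-compatible {xs = x ∷ y ∷ _} {x′ ∷ y′ ∷ _} (p ∷ q ∷ _) = subst₂ (Θ R)
        (sym (dec-encE (decE x · decE y))) (trans (Θ-right (decE x′) q) (sym (dec-encE (decE x′ · decE y′))))
        (Θ-left (decE y) p)

  Reachable : Fin N → Set
  Reachable = Star E s

  -- Decided on the numbers of the elements, in the form in which the reduction will print it.
  inClass : Fin (3 * N) → Bool
  inClass x = does (toℕ x ℕ.≟ toℕ s) ∨ does (toℕ x ℕ.≟ N + toℕ s)

  sources : Subset (3 * N)
  sources = Vec.tabulate inClass

  toℕ-0 : ∀ v → toℕ (encE (0F , v)) ≡ toℕ v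
  toℕ-0 v = trans (Fin.toℕ-combine {3} {N} 0F v) (cong (_+ toℕ v) (ℕ.*-zeroʳ N))

  toℕ-1 : ∀ v → toℕ (encE (1F , v)) ≡ N + toℕ v
  toℕ-1 v = trans (Fin.toℕ-combine {3} {N} 1F v) (cong (_+ toℕ v) (ℕ.*-identityʳ N))

  ∈sources⇔ : ∀ x → x ∈ sources ⇔ (x ≡ encE (0F , s) ⊎ x ≡ encE (1F , s))
  ∈sources⇔ x = mk⇔ (λ h → to (trans (sym (Vec.lookup∘tabulate inClass x)) (Vec.[]=⇒lookup h)))
                    (λ h → Vec.lookup⇒[]= x sources (trans (Vec.lookup∘tabulate inClass x) (from h)))
    where
    to : inClass x ≡ true → x ≡ encE (0F , s) ⊎ x ≡ encE (1F , s)
    to h with toℕ x ℕ.≟ toℕ s | toℕ x ℕ.≟ N + toℕ s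
    ... | yes e | _     = inj₁ (Fin.toℕ-injective (trans e (sym (toℕ-0 s))))
    ... | no _  | yes e = inj₂ (Fin.toℕ-injective (trans e (sym (toℕ-1 s))))
    from : x ≡ encE (0F , s) ⊎ x ≡ encE (1F , s) → inClass x ≡ true
    from (inj₁ refl) rewrite does-yes (toℕ (encE (0F , s)) ℕ.≟ toℕ s) (toℕ-0 s) = refl
    from (inj₂ refl) rewrite does-yes (toℕ (encE (1F , s)) ℕ.≟ N + toℕ s) (toℕ-1 s) with toℕ (encE (1F , s)) ℕ.≟ toℕ s
    ... | yes _ = refl
    ... | no _  = refl

  module _ (f : Fin (operations S)) (2≤f : 2 ≤ arity S f) where

    pad : ∀ {n} → 2 ≤ n → Fin (3 * N) → Fin (3 * N) → Vec (Fin (3 * N)) n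
    pad (s≤s (s≤s _)) x y = x ∷ y ∷ Vec.replicate _ x

    value-pad : ∀ {n} (h : 2 ≤ n) x y → value (pad h x y) ≡ x ∙ y
    value-pad (s≤s (s≤s _)) x y = refl

    pad-pointwise : ∀ {ℓ} {ρ : Fin (3 * N) → Fin (3 * N) → Set ℓ} {n} (h : 2 ≤ n) {x x′ y y′} → ρ x x′ → ρ y y′ → Pointwise ρ (pad h x y) (pad h x′ y′)
    pad-pointwise {ρ = ρ} (s≤s (s≤s _)) {x} {x′} p q = p ∷ q ∷ go _
      where
      go : ∀ k → Pointwise ρ (Vec.replicate k x) (Vec.replicate k x′)
      go zero    = []
      go (suc k) = p ∷ go k

    module Inside {ℓ} (ρ : Fin (3 * N) → Fin (3 * N) → Set ℓ) (ρ-congruence : IsCongruence algebra ρ) where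

      open IsCongruence ρ-congruence
      module ρ = IsEquivalence isEquivalence

      _≈_ : Element → Element → Set ℓ
      x ≈ y = ρ (encE x) (encE y)

      mult : ∀ x x′ y y′ → x ≈ x′ → y ≈ y′ → (x · y) ≈ (x′ · y′)
      mult x x′ y y′ p q = subst₂ ρ
        (trans (value-pad 2≤f (encE x) (encE y)) (cong encE (cong₂ _·_ (dec-encE x) (dec-encE y))))
        (trans (value-pad 2≤f (encE x′) (encE y′)) (cong encE (cong₂ _·_ (dec-encE x′) (dec-encE y′))))
        (compatible f (pad-pointwise 2≤f p q))

      via : ∀ x x′ y y′ {a b} → x · y ≡ a → x′ · y′ ≡ b → x ≈ x′ → y ≈ y′ → a ≈ b
      via x x′ y y′ e e′ p q = subst₂ _≈_ e e′ (mult x x′ y y′ p q)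

      -- Both copies of `v` are multiplied by the same copy of `u`. A vertex with an outgoing edge
      -- is not the target, so the exceptional product does not interfere.
      along : ∀ {v u} → E v u → (0F , v) ≈ (1F , v) → (0F , u) ≈ (1F , u)
      along {v} {u} e p = via (0F , v) (1F , v) (0F , u) (0F , u) low-edge high-edge p (ρ.refl {encE (0F , u)})
        where
        v≢t : v ≢ t
        v≢t refl = sink e
        low-edge : (0F , v) · (0F , u) ≡ (0F , u)
        low-edge rewrite does-no (v Fin.≟ t) v≢t | does-yes (E? v u) e | ∧-zeroʳ broken = refl
        high-edge : (1F , v) · (0F , u) ≡ (1F , u)
        high-edge rewrite does-yes (E? v u) e | ∧-zeroʳ broken = refl

      along* : ∀ {v u} → Star E v u → (0F , v) ≈ (1F , v) → (0F , u) ≈ (1F , u)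
      along* ε        p = p
      along* (e ◅ es) p = along* es (along e p)

    open Inside

    -- `Θ Reachable` contains the generating pair and so bounds the generated congruence from above;
    -- `along*` bounds it from below.
    reachable⇔ : broken ≡ false → Cg algebra (encE (0F , s)) (encE (1F , s)) (encE (0F , t)) (encE (1F , t)) ⇔ Reachable t
    reachable⇔ unbroken = mk⇔ to λ r → along* _ (Cg-isCongruence algebra _ _) r Cg.generator
      where
      to : Cg algebra (encE (0F , s)) (encE (1F , s)) (encE (0F , t)) (encE (1F , t)) → Reachable t
      to p with subst₂ (Θ Reachable) (dec-encE (0F , t)) (dec-encE (1F , t))
            (Cg-smallest algebra (θ-congruence Reachable (λ r e → r ◅◅ (e ◅ ε)) (λ _ _ → ε) (λ b → contradiction (trans (sym b) unbroken) λ ()))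
              (subst₂ (Θ Reachable) (sym (dec-encE (0F , s))) (sym (dec-encE (1F , s))) (copies refl refl ε)) p)
      ... | copies _ _ r = r

    -- A pair in all nontrivial congruences lies in `Θ Reachable` and in `Θ (_≡ t)`, so its vertex
    -- is `t` and is reachable. Conversely any two distinct elements generate the pair of copies of
    -- `t`, either through testers telling two vertices apart or by way of the source and a path to
    -- `t`.
    irreducible⇔ : broken ≡ false → SubdirectlyIrreducible algebra ⇔ Reachable t
    irreducible⇔ unbroken = mk⇔ to from
      where
      unbrokenΘ : ∀ {R : Fin N → Set} → broken ≡ true → ¬ R t
      unbrokenΘ b = contradiction (trans (sym b) unbroken) λ ()
      copies≢ : ∀ v → encE (0F , v) ≢ encE (1F , v)
      copies≢ v e with trans (sym (dec-encE (0F , v))) (trans (cong decE e) (dec-encE (1F , v)))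
      ... | ()
      distinct : ∀ {R : Fin N → Set} {x y} → x ≢ y → Θ R (decE x) (decE y) → R (proj₂ (decE x))
      distinct {R} {x} {y} x≢y h = go h refl refl
        where
        go : ∀ {a b} → Θ R a b → a ≡ decE x → b ≡ decE y → R (proj₂ (decE x))
        go same e e′ = contradiction (trans (sym (enc-decE x)) (trans (cong encE (trans (sym e) e′)) (enc-decE y))) x≢y
        go (copies _ _ r) e e′ = subst R (cong proj₂ e) r
      inΘ : ∀ {R : Fin N → Set} v → R v → Θ R (decE (encE (0F , v))) (decE (encE (1F , v)))
      inΘ v r = subst₂ (Θ _) (sym (dec-encE (0F , v))) (sym (dec-encE (1F , v))) (copies refl refl r)
      to : SubdirectlyIrreducible algebra → Reachable t
      to (a , b , a≢b , h) = subst Reachable at-t reached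
        where
        reached : Reachable (proj₂ (decE a))
        reached = distinct {Reachable} {a} {b} a≢b (Cg-smallest algebra (θ-congruence Reachable (λ r e → r ◅◅ (e ◅ ε)) (λ _ _ → ε) (unbrokenΘ {Reachable}))
          (inΘ s ε) (h _ _ (copies≢ s)))
        at-t : proj₂ (decE a) ≡ t
        at-t = distinct {_≡ t} {a} {b} a≢b (Cg-smallest algebra (θ-congruence (_≡ t) (λ { refl e → ⊥-elim (sink e) }) (λ { refl n → contradiction refl n }) (unbrokenΘ {_≡ t}))
          (inΘ t refl) (h _ _ (copies≢ t)))
      from : Reachable t → SubdirectlyIrreducible algebra
      from r = encE (0F , t) , encE (1F , t) , copies≢ t , λ c d c≢d →
        subst₂ (λ c d → Cg algebra c d (encE (0F , t)) (encE (1F , t))) (enc-decE c) (enc-decE d)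
          (collapse (decE c) (decE d) (λ e → c≢d (trans (sym (enc-decE c)) (trans (cong encE e) (enc-decE d)))))
        where
        module _ (c d : Element) where
          _~_ : Element → Element → Set
          _~_ = _≈_ (Cg algebra (encE c) (encE d)) (Cg-isCongruence algebra _ _)
          Goal : Set
          Goal = (0F , t) ~ (1F , t)
          via′ : ∀ x x′ y y′ {a b} → x · y ≡ a → x′ · y′ ≡ b → x ~ x′ → y ~ y′ → a ~ b
          via′ = via (Cg algebra (encE c) (encE d)) (Cg-isCongruence algebra _ _)
          tests-yes : ∀ γ v → tester γ ≡ false → (2F , v) · (γ , v) ≡ (0F , t)
          tests-yes γ v h rewrite h | does-yes (v Fin.≟ v) refl = refl
          tests-no : ∀ γ {v u} → tester γ ≡ false → v ≢ u → (2F , v) · (γ , u) ≡ (1F , t)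
          tests-no γ {v} {u} h v≢u rewrite h | does-no (v Fin.≟ u) v≢u = refl
          resets : ∀ β {v} u → tester β ≡ false → v ≢ t → (β , v) · (2F , u) ≡ (β , s)
          resets β {v} u h v≢t rewrite h | does-no (v Fin.≟ t) v≢t = refl
          loops : ∀ β u → tester β ≡ false → (β , u) · (0F , u) ≡ (β , u)
          loops β u h rewrite h | unbroken with E? u u
          ... | yes _ = refl
          ... | no _  = refl
          stays : ∀ β u → tester β ≡ false → (β , t) · (0F , u) ≡ (β , t)
          stays β u h rewrite h | unbroken with E? t u
          ... | yes e = ⊥-elim (sink e)
          ... | no _  = refl
          -- A tester resets the copies of `v` to those of the source, which are then carried along
          -- the path to the target.
          spread : ∀ v → (0F , v) ~ (1F , v) → Goal
          spread v p with v Fin.≟ t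
          ... | yes refl = p
          ... | no v≢t   = along* _ (Cg-isCongruence algebra _ _) r (via′ (0F , v) (1F , v) (2F , v) (2F , v) (resets 0F v refl v≢t) (resets 1F v refl v≢t) p (Cg.refl {x = encE (2F , v)}))
          vertices : ∀ {β γ v u} → tester β ≡ false → tester γ ≡ false → v ≢ u → (β , v) ~ (γ , u) → Goal
          vertices {β} {γ} {v} {u} h h′ v≢u p = via′ (2F , v) (2F , v) (β , v) (γ , u) (tests-yes β v h) (tests-no γ h′ v≢u) (Cg.refl {x = encE (2F , v)}) p
          testers : ∀ {v u} → v ≢ u → (2F , v) ~ (2F , u) → Goal
          testers {v} {u} v≢u p = via′ (2F , v) (2F , u) (0F , v) (0F , v) (tests-yes 0F v refl) (tests-no 0F refl (v≢u ∘ sym)) p (Cg.refl {x = encE (0F , v)})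
          other : ∀ v → ∃[ x ] v ≢ x
          other v with v Fin.≟ s
          ... | yes refl = t , s≢t
          ... | no v≢s   = s , v≢s
          -- Right multiplication by a copy of a vertex sends a tester to a copy of `t`. If `u` is
          -- not `t`, the factor `(0 , u)` fixes `(γ , u)`, so copies of two distinct vertices get
          -- identified. If `u` is `t`, the factor is chosen so that the tester goes to the other
          -- copy of `t`, while `(γ , t)` stays.
          mixed : ∀ {γ v u} → tester γ ≡ false → (2F , v) ~ (γ , u) → Goal
          mixed {γ} {v} {u} h p with u Fin.≟ t
          mixed {γ} {v} {u} h p | no u≢t with v Fin.≟ u
          ... | yes refl = vertices {0F} {γ} refl h (u≢t ∘ sym) (via′ (2F , v) (γ , u) (0F , u) (0F , u) (tests-yes 0F v refl) (loops γ u h) p (Cg.refl {x = encE (0F , u)}))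
          ... | no v≢u   = vertices {1F} {γ} refl h (u≢t ∘ sym) (via′ (2F , v) (γ , u) (0F , u) (0F , u) (tests-no 0F refl v≢u) (loops γ u h) p (Cg.refl {x = encE (0F , u)}))
          mixed {0F} {v} h p | yes refl = let (x , v≢x) = other v in
            Cg.sym (via′ (2F , v) (0F , t) (0F , x) (0F , x) (tests-no 0F refl v≢x) (stays 0F x refl) p (Cg.refl {x = encE (0F , x)}))
          mixed {2F} {v} () p | yes refl
          mixed {1F} {v} h p | yes refl = via′ (2F , v) (1F , t) (0F , v) (0F , v) (tests-yes 0F v refl) (stays 1F v refl) p (Cg.refl {x = encE (0F , v)})
        collapse : ∀ c d → c ≢ d → Cg algebra (encE c) (encE d) (encE (0F , t)) (encE (1F , t))
        collapse (β , v) (γ , u) c≢d with v Fin.≟ u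
        collapse c@(2F , v) d@(2F , u) c≢d | no v≢u = testers c d {v} {u} v≢u Cg.generator
        collapse c@(0F , v) d@(2F , u) c≢d | _ = mixed c d {0F} {u} {v} refl (Cg.sym Cg.generator)
        collapse c@(1F , v) d@(2F , u) c≢d | _ = mixed c d {1F} {u} {v} refl (Cg.sym Cg.generator)
        collapse c@(2F , v) d@(0F , u) c≢d | _ = mixed c d {0F} {v} {u} refl Cg.generator
        collapse c@(2F , v) d@(1F , u) c≢d | _ = mixed c d {1F} {v} {u} refl Cg.generator
        collapse c@(0F , v) d@(0F , u) c≢d | no v≢u = vertices c d {0F} {0F} refl refl v≢u Cg.generator
        collapse c@(0F , v) d@(1F , u) c≢d | no v≢u = vertices c d {0F} {1F} refl refl v≢u Cg.generator
        collapse c@(1F , v) d@(0F , u) c≢d | no v≢u = vertices c d {1F} {0F} refl refl v≢u Cg.generator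
        collapse c@(1F , v) d@(1F , u) c≢d | no v≢u = vertices c d {1F} {1F} refl refl v≢u Cg.generator
        collapse c@(0F , v) d@(1F , u) c≢d | yes refl = spread c d v Cg.generator
        collapse c@(1F , v) d@(0F , u) c≢d | yes refl = spread c d v (Cg.sym Cg.generator)
        collapse c@(0F , v) d@(0F , u) c≢d | yes refl = contradiction refl c≢d
        collapse c@(1F , v) d@(1F , u) c≢d | yes refl = contradiction refl c≢d
        collapse c@(2F , v) d@(2F , u) c≢d | yes refl = contradiction refl c≢d

    -- If the target is reachable, its copies are identified, and multiplying them by `(0 , t)`
    -- gives `(0 , s)` and `(1 , t)`: the class of the sources contains a further element. Otherwise
    -- `Θ Reachable` is a congruence in spite of the break, and the sources form one of its classes.
    class⇔ : broken ≡ true → (Σ[ θ ∈ (Fin (3 * N) → Fin (3 * N) → Set) ] IsCongruence algebra θ × IsClassOf algebra sources θ) ⇔ (¬ Reachable t)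
    class⇔ refl = mk⇔ to from
      where
      to : (Σ[ θ ∈ (Fin (3 * N) → Fin (3 * N) → Set) ] IsCongruence algebra θ × IsClassOf algebra sources θ) → ¬ Reachable t
      to (θ , cong-θ , a , cls) r = contradiction (to↔ (∈sources⇔ (encE (1F , t))) (from↔ (cls _) (ρ.trans θ cong-θ in₀ leak))) λ
        { (inj₁ e) → case trans (sym (dec-encE (1F , t))) (trans (cong decE e) (dec-encE (0F , s))) of λ ()
        ; (inj₂ e) → s≢t (sym (cong proj₂ (trans (sym (dec-encE (1F , t))) (trans (cong decE e) (dec-encE (1F , s)))))) }
        where
        in₀ : θ a (encE (0F , s))
        in₀ = to↔ (cls _) (from↔ (∈sources⇔ _) (inj₁ refl))
        in₁ : θ a (encE (1F , s))
        in₁ = to↔ (cls _) (from↔ (∈sources⇔ _) (inj₂ refl))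
        copies-t : θ (encE (0F , t)) (encE (1F , t))
        copies-t = along* θ cong-θ r (ρ.trans θ cong-θ (ρ.sym θ cong-θ in₀) in₁)
        breaks : (0F , t) · (0F , t) ≡ (0F , s)
        breaks rewrite does-yes (t Fin.≟ t) refl = refl
        stays : (1F , t) · (0F , t) ≡ (1F , t)
        stays with E? t t
        ... | yes e = ⊥-elim (sink e)
        ... | no _  = refl
        leak : θ (encE (0F , s)) (encE (1F , t))
        leak = via θ cong-θ (0F , t) (1F , t) (0F , t) (0F , t) breaks stays copies-t (ρ.refl θ cong-θ {encE (0F , t)})
      from : ¬ Reachable t → Σ[ θ ∈ (Fin (3 * N) → Fin (3 * N) → Set) ] IsCongruence algebra θ × IsClassOf algebra sources θ
      from ¬r = θ Reachable (λ r e → r ◅◅ (e ◅ ε)) (λ _ _ → ε) (λ _ → ¬r) ,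
        θ-congruence Reachable (λ r e → r ◅◅ (e ◅ ε)) (λ _ _ → ε) (λ _ → ¬r) ,
        encE (0F , s) , λ x → ∈sources⇔ x ⟫ mk⇔ (λ { (inj₁ refl) → same ; (inj₂ refl) → subst₂ (Θ Reachable) (sym (dec-encE (0F , s))) (sym (dec-encE (1F , s))) (copies refl refl ε) })
          (λ h → back (decE x) (enc-decE x) (subst (λ y → Θ Reachable y (decE x)) (dec-encE (0F , s)) h))
        where
        back : ∀ {x} e → encE e ≡ x → Θ Reachable (0F , s) e → x ≡ encE (0F , s) ⊎ x ≡ encE (1F , s)
        back (0F , _) refl same           = inj₁ refl
        back (0F , _) refl (copies _ _ _) = inj₁ refl
        back (1F , _) refl (copies _ _ _) = inj₂ refl
        back (2F , _) refl (copies _ () _)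

-- Printing the algebra of a graph

-- Removes the lowest digit in bijective base 2; zero, which has no digits, is fixed.
halve : ℕ → ℕ
halve x = pred x / 2

-- The least significant digit in bijective base 2.
piece : ℕ → Word
piece zero    = []
piece (suc x) = if 0 <ᵇ x % 2 then [ 1F ] else [ 0F ]

digits-piece : ∀ x → digits (ℕᵇ.fromℕ x) ≡ piece x ++ digits (ℕᵇ.fromℕ (halve x))
digits-piece zero    = refl
digits-piece (suc x) = go (x % 2) (x / 2) (m≡m%n+[m/n]*n x 2) (m%n<n x 2)
  where
  odd-even : ∀ m → suc (1 + m * 2) ≡ 2 * suc m
  odd-even = solve-∀
  go : ∀ r m → x ≡ r + m * 2 → r < 2 → digits (ℕᵇ.fromℕ (suc x)) ≡ (if 0 <ᵇ r then [ 1F ] else [ 0F ]) ++ digits (ℕᵇ.fromℕ m)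
  go 0 m eq _ = cong digits (ℕᵇ.toℕ-injective {ℕᵇ.fromℕ (suc x)} {ℕᵇ.1+[2 ℕᵇ.fromℕ m ]} (trans (ℕᵇ.toℕ-fromℕ (suc x))
    (cong suc (trans eq (trans (ℕ.*-comm m 2) (cong (2 *_) (sym (ℕᵇ.toℕ-fromℕ m))))))))
  go 1 m eq _ = cong digits (ℕᵇ.toℕ-injective {ℕᵇ.fromℕ (suc x)} {ℕᵇ.2[1+ ℕᵇ.fromℕ m ]} (trans (ℕᵇ.toℕ-fromℕ (suc x))
    (trans (cong suc eq) (trans (odd-even m) (cong (λ y → 2 * suc y) (sym (ℕᵇ.toℕ-fromℕ m)))))))
  go (suc (suc _)) m eq (s≤s (s≤s ()))

halvings : ℕ → ℕ → ℕ
halvings zero    x = x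
halvings (suc i) x = halvings i (halve x)

halve-halvings : ∀ i x → halve (halvings i x) ≡ halvings (suc i) x
halve-halvings zero    x = refl
halve-halvings (suc i) x = halve-halvings i (halve x)

halve≤pred : ∀ x → halve x ≤ pred x
halve≤pred x = ℕ.≤-trans (ℕ.m≤m*n (pred x / 2) 2) (ℕ.≤-trans (ℕ.m≤n+m _ (pred x % 2)) (ℕ.≤-reflexive (sym (m≡m%n+[m/n]*n (pred x) 2))))

halvings≤ : ∀ i x → halvings i x ≤ x
halvings≤ zero    x = ℕ.≤-refl
halvings≤ (suc i) x = ℕ.≤-trans (halvings≤ i (halve x)) (ℕ.≤-trans (halve≤pred x) ℕ.pred[n]≤n)

-- A number is printed in as many rounds as its value. Halving decreases a positive number, so zero
-- has been reached when the rounds run out, and at zero the pieces are empty.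
rounds-digits : ∀ x (G : ℕ → ℕ → Word) → (∀ k i → G k i ≡ piece (halvings i x)) → ∀ k i → halvings i x ≤ k →
                rounds G k i ≡ digits (ℕᵇ.fromℕ (halvings i x))
rounds-digits x G h zero    i le rewrite ℕ.n≤0⇒n≡0 le = refl
rounds-digits x G h (suc k) i le = trans (cong₂ _++_ (h k i) (trans
    (rounds-digits x G h k (suc i) (subst (_≤ k) (halve-halvings i x) (ℕ.≤-trans (halve≤pred (halvings i x)) (ℕ.pred-mono-≤ le))))
    (cong (digits ∘ ℕᵇ.fromℕ) (sym (halve-halvings i x)))))
  (sym (digits-piece (halvings i x)))

rounds-concatMap : ∀ {A : Set} {G : ℕ → ℕ → List A} n {g : Fin n → List A} → (∀ k x → G k (toℕ x) ≡ g x) → rounds G n 0 ≡ concatMap g (allFin n)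
rounds-concatMap {G = G} n h = go n 0 λ k x → trans (cong (G k) (ℕ.+-identityʳ (toℕ x))) (h k x)
  where
  go : ∀ {A : Set} {G : ℕ → ℕ → List A} n j {g : Fin n → List A} → (∀ k x → G k (toℕ x + j) ≡ g x) → rounds G n j ≡ concatMap g (allFin n)
  go zero    j h = refl
  go {G = G} (suc n) j {g} h = cong₂ _++_ (h n zero) (trans (go n (suc j) λ k x → trans (cong (G k) (ℕ.+-suc (toℕ x) j)) (h k (suc x)))
    (trans (sym (List.concatMap-map g suc (allFin n))) (cong (concatMap g) (List.map-tabulate id suc))))

concatMap-tuples : ∀ {A : Set} {n k} (h : Vec (Fin n) (suc k) → List A) →
  concatMap h (tuples n (suc k)) ≡ concatMap (λ x → concatMap (λ xs → h (x ∷ xs)) (tuples n k)) (allFin n)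
concatMap-tuples {n = n} {k} h = go (allFin n)
  where
  go : ∀ xs → concatMap h (cartesianProductWith _∷_ xs (tuples n k)) ≡ concatMap (λ x → concatMap (λ xs → h (x ∷ xs)) (tuples n k)) xs
  go []       = refl
  go (x ∷ xs) = trans (List.concatMap-++ h (map (x ∷_) (tuples n k)) _) (cong₂ _++_ (List.concatMap-map h (x ∷_) (tuples n k)) (go xs))

module _ {σ : ℕ} where

  later : ∀ {m} → Fn σ m → Fn σ (2 + m)
  later f = comp f (Vec.tabulate (λ i → var (suc (suc i))))

  nothing# : ∀ {m} → Out σ 3 m
  nothing# = for zer (emit 0F)

  pieceO : ∀ {m} → Fn σ m → Out σ 3 m
  pieceO f = cond f (cond (rem (prd f) (const# 2)) (emit 1F) (emit 0F)) nothing#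

  numberO : ∀ {m} → Fn σ m → Out σ 3 m
  numberO f = for f (pieceO (iter (var 1F) (later f) (quot (prd (var 1F)) (const# 2)))) ▹ emit 2F

  -- Table entries depend on the first two arguments only, so each product is printed once for every
  -- choice of the remaining `k` arguments.
  repeatO : ∀ {m} → Fn σ 0 → ℕ → Fn σ m → Out σ 3 m
  repeatO size zero    f = numberO f
  repeatO size (suc k) f = for (comp size []) (repeatO size k (later f))

  forFin : ∀ {n m} → (Fin n → Out σ 3 m) → Out σ 3 m
  forFin {zero}  p = nothing#
  forFin {suc n} p = p zero ▹ forFin (p ∘ suc)

  module PrintingNumbers (w : List (Fin σ)) (cap : ℕ) (2≤cap : 2 ≤ cap) where

    open Evaluation w cap
    open Truth w cap (ℕ.≤-trans (s≤s z≤n) 2≤cap)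
    open Printing {τ = 3} w cap

    later-eval : ∀ {m} (f : Fn σ m) {k i ρ} → eval (later f) (k ∷ i ∷ ρ) ≡ eval f ρ
    later-eval f {k} {i} {ρ} = cong (eval f) (trans (evals-shift (λ j → suc (suc j)) (k ∷ i ∷ ρ)) (Vec.tabulate∘lookup ρ))

    if-pos : ∀ {A : Set} x {p q : A} → (if isPos x then p else q) ≡ (if 0 <ᵇ x then p else q)
    if-pos zero    = refl
    if-pos (suc x) = refl

    piece-print : ∀ {m} {ρ : Vec ℕ m} f {x} → eval f ρ ≡ x → x + 2 ≤ cap → print (pieceO f) ρ ≡ piece x
    piece-print {ρ = ρ} f {x} e h
      rewrite rem-eval {ρ = ρ} (prd f) (const# 2) {q = pred x / 2} (cong pred e) (const-eval 2 2≤cap) (m≡m%n+[m/n]*n (pred x) 2) (m%n<n (pred x) 2)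
                (ℕ.≤-trans (ℕ.+-monoˡ-≤ 2 ℕ.pred[n]≤n) h) | e with x
    ... | zero  = refl
    ... | suc y = trans (if-pos (y % 2)) refl

    number-print : ∀ {m} {ρ : Vec ℕ m} f {x} → eval f ρ ≡ x → x + 2 ≤ cap → print (numberO f) ρ ≡ encodeℕ x
    number-print {ρ = ρ} f {x} e h = cong (_++ [ 2F ]) (trans (cong (λ n → rounds G n 0) e) (rounds-digits x G pieces x 0 ℕ.≤-refl))
      where
      step : Fn σ _
      step = quot (prd (var 1F)) (const# 2)
      G : ℕ → ℕ → Word
      G k i = print (pieceO (iter (var 1F) (later f) step)) (k ∷ i ∷ ρ)
      half-eval : ∀ j a k i → a + 2 ≤ cap → eval step (j ∷ a ∷ k ∷ i ∷ ρ) ≡ halve a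
      half-eval j a k i h = quot-eval {ρ = j ∷ a ∷ k ∷ i ∷ ρ} (prd (var 1F)) (const# 2) refl (const-eval 2 2≤cap) (m≡m%n+[m/n]*n (pred a) 2) (m%n<n (pred a) 2)
        (ℕ.≤-trans (ℕ.+-monoˡ-≤ 2 ℕ.pred[n]≤n) h)
      iterate : ∀ n a k i → a + 2 ≤ cap → foldDown (λ j a → eval step (j ∷ a ∷ k ∷ i ∷ ρ)) n a ≡ halvings n a
      iterate zero    a k i h = refl
      iterate (suc n) a k i h rewrite half-eval n a k i h =
        iterate n (halve a) k i (ℕ.≤-trans (ℕ.+-monoˡ-≤ 2 (ℕ.≤-trans (halve≤pred a) ℕ.pred[n]≤n)) h)
      value : ∀ k i → eval (iter (var 1F) (later f) step) (k ∷ i ∷ ρ) ≡ halvings i x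
      value k i = trans (cong (foldDown (λ j a → eval step (j ∷ a ∷ k ∷ i ∷ ρ)) i) (trans (later-eval f) e)) (iterate i x k i h)
      pieces : ∀ k i → G k i ≡ piece (halvings i x)
      pieces k i = piece-print {ρ = k ∷ i ∷ ρ} (iter (var 1F) (later f) step) (value k i) (ℕ.≤-trans (ℕ.+-monoˡ-≤ 2 (halvings≤ i x)) h)

    repeat-print : ∀ {m} {ρ : Vec ℕ m} size {n} k f {x} → eval size [] ≡ n → eval f ρ ≡ x → x + 2 ≤ cap →
      print (repeatO size k f) ρ ≡ concatMap (λ _ → encodeℕ x) (tuples n k)
    repeat-print size zero f es e h = trans (number-print f e h) (sym (List.++-identityʳ _))
    repeat-print {ρ = ρ} size {n} (suc k) f {x} es e h = trans (cong (λ n → rounds (λ r i → print (repeatO size k (later f)) (r ∷ i ∷ ρ)) n 0) es)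
      (trans (rounds-concatMap n (λ r i → repeat-print {ρ = r ∷ toℕ i ∷ ρ} size k (later f) es (trans (later-eval f) e) h))
             (sym (concatMap-tuples {n = n} {k} (λ _ → encodeℕ x))))

    forFin-print : ∀ {n m} {ρ : Vec ℕ m} (p : Fin n → Out σ 3 m) {g : Fin n → Word} → (∀ i → print (p i) ρ ≡ g i) → print (forFin p) ρ ≡ concatMap g (allFin n)
    forFin-print {zero}  p h = refl
    forFin-print {suc n} p {g} h = cong₂ _++_ (h zero) (trans (forFin-print (p ∘ suc) (h ∘ suc))
      (trans (sym (List.concatMap-map g suc (allFin n))) (cong (concatMap g) (List.map-tabulate id suc))))

-- The reduction from graph reachability to algebras

module Reduction (S : Signature) {σ ℓ} {L : Language σ ℓ} (G : GraphFor L) (broken : Bool) where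

  open GraphFor G

  cap₀ : List (Fin σ) → ℕ
  cap₀ w = (2 + length w) ^ exponent

  module Instance (w : List (Fin σ)) where

    s t : Fin (suc (target w))
    s = fromℕ< (ℕ.m<n⇒m<1+n (source<target w))
    t = fromℕ (target w)

    toℕ-s : toℕ s ≡ source w
    toℕ-s = Fin.toℕ-fromℕ< _

    toℕ-t : toℕ t ≡ target w
    toℕ-t = Fin.toℕ-fromℕ _

    s≢t : s ≢ t
    s≢t e = ℕ.<⇒≢ (source<target w) (trans (sym toℕ-s) (trans (cong toℕ e) toℕ-t))

    E : Fin (suc (target w)) → Fin (suc (target w)) → Set
    E v u = Edge w (toℕ v) (toℕ u)

    edge⇔ : ∀ cap → cap₀ w ≤ cap → ∀ v u → (1 ≤ Evaluation.eval w cap edgeF (toℕ v ∷ toℕ u ∷ [])) ⇔ E v u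
    edge⇔ cap h v u = edge-eval w cap h (toℕ v) (toℕ u) (ℕ.≤-pred (Fin.toℕ<n v)) (ℕ.≤-pred (Fin.toℕ<n u))

    E? : ∀ v u → Dec (E v u)
    E? v u = map′ (to↔ (edge⇔ _ ℕ.≤-refl v u)) (from↔ (edge⇔ _ ℕ.≤-refl v u)) (1 ℕ.≤? _)

    sink : ∀ {u} → ¬ E t u
    sink e = ℕ.<-irrefl toℕ-t (proj₁ (edge-range e))

    open GraphAlgebra S (target w) s t s≢t E E? sink broken public

    reach⇔ : Star (Edge w) (source w) (target w) ⇔ Star E s t
    reach⇔ = mk⇔ (λ p → subst (Star E s) (Fin.toℕ-injective (trans (proj₂ (proj₂ (lift s toℕ-s p))) (sym toℕ-t))) (proj₁ (proj₂ (lift s toℕ-s p))))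
                 (λ p → subst₂ (Star (Edge w)) toℕ-s toℕ-t (lower p))
      where
      lift : ∀ {x y} (v : Fin (suc (target w))) → toℕ v ≡ x → Star (Edge w) x y → ∃[ u ] Star E v u × toℕ u ≡ y
      lift v e ε = v , ε , e
      lift v refl (_◅_ {j = j} x xs) =
        let j< = s≤s (proj₂ (edge-range x))
            (u , p , e) = lift (fromℕ< j<) (Fin.toℕ-fromℕ< j<) xs
        in u , subst (Edge w (toℕ v)) (sym (Fin.toℕ-fromℕ< j<)) x ◅ p , e
      lower : ∀ {v u} → Star E v u → Star (Edge w) (toℕ v) (toℕ u)
      lower ε        = ε
      lower (x ◅ xs) = x ◅ lower xs

  sF tF NF N2F : ∀ {m} → Fn σ m
  sF  = comp sourceF []
  tF  = comp targetF []
  NF  = succ tF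
  N2F = NF ⊕ NF

  sizeF : Fn σ 0
  sizeF = NF ⊕ N2F

  -- The number of an element is a multiple of `N` for its kind plus its vertex; `copyF` is that
  -- multiple, to which another vertex can be added.
  vertexF copyF testerF : ∀ {m} → Fn σ m → Fn σ m
  vertexF x = choose (x ≺ NF) x (choose (x ≺ N2F) (x ⊖ NF) (x ⊖ N2F))
  copyF x   = x ⊖ vertexF x
  testerF x = neg (x ≺ N2F)

  brokenF : ∀ {m} → Fn σ m
  brokenF = if broken then one else zer

  productF : ∀ {m} → Fn σ m → Fn σ m → Fn σ m
  productF x y = choose (testerF x)
    (choose (testerF y) x (choose (vertexF x ≐ vertexF y) tF (NF ⊕ tF)))
    (choose (testerF y)
      (choose (vertexF x ≐ tF) x (copyF x ⊕ sF))
      (choose (brokenF ∧ᶠ x ≺ NF ∧ᶠ vertexF x ≐ tF ∧ᶠ vertexF y ≐ tF) sF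
        (choose (comp edgeF (vertexF x ∷ vertexF y ∷ [])) (copyF x ⊕ vertexF y) x)))

  tableO : ℕ → Out σ 3 0
  tableO 0             = numberO sF
  tableO 1             = for sizeF (numberO (var 1F))
  tableO (suc (suc k)) = for sizeF (for (comp sizeF []) (repeatO sizeF k (productF (var 3F) (var 1F))))

  algebraO : Out σ 3 0
  algebraO = numberO sizeF ▹ forFin (tableO ∘ arity S)

  pairsO : Out σ 3 0
  pairsO = numberO tF ▹ numberO (NF ⊕ tF) ▹ numberO sF ▹ numberO (NF ⊕ sF)

  subsetO : Out σ 3 0
  subsetO = for sizeF (cond (var 1F ≐ sF ∨ᶠ var 1F ≐ NF ⊕ sF) (emit 1F) (emit 0F))

  module Correct (w : List (Fin σ)) (cap : ℕ) (enough : (2 + length w) ^ (3 + exponent) ≤ cap) where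

    open Instance w
    open Evaluation w cap
    open Printing {τ = 3} w cap

    private
      P : ℕ
      P = 2 + length w
      1≤cap₀ : 1 ≤ cap₀ w
      1≤cap₀ = ℕ.m^n>0 P exponent

    -- Printing `x` divides by 2 and so needs `x + 2` within the cap; the largest number printed is
    -- the size `3 * N`. The factor `(2 + n) ^ 3`, at least 8, absorbs the resulting 5.
    room : 3 * N + 2 ≤ cap
    room = ℕ.≤-trans (begin
      3 * N + 2                   ≤⟨ ℕ.+-mono-≤ (ℕ.*-monoʳ-≤ 3 (target-small w)) (ℕ.*-monoʳ-≤ 2 1≤cap₀) ⟩
      3 * cap₀ w + 2 * cap₀ w     ≡⟨ sym (ℕ.*-distribʳ-+ (cap₀ w) 3 2) ⟩
      5 * cap₀ w                  ≤⟨ ℕ.*-monoˡ-≤ (cap₀ w) (ℕ.≤-trans (ℕ.m≤m+n 5 3) (ℕ.^-monoˡ-≤ 3 (s≤s (s≤s (z≤n {length w}))))) ⟩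
      P ^ 3 * cap₀ w              ≡⟨ sym (ℕ.^-distribˡ-+-* P 3 exponent) ⟩
      P ^ (3 + exponent)          ∎) enough
      where open ℕ.≤-Reasoning

    cap₀≤ : cap₀ w ≤ cap
    cap₀≤ = ℕ.≤-trans (ℕ.^-monoʳ-≤ P (ℕ.m≤n+m exponent 3)) enough

    2≤cap : 2 ≤ cap
    2≤cap = ℕ.m+n≤o⇒n≤o (3 * N) room

    open Truth w cap (ℕ.≤-trans (s≤s z≤n) 2≤cap)
    open PrintingNumbers w cap 2≤cap

    small : ∀ {x} → x ≤ 3 * N → x + 2 ≤ cap
    small h = ℕ.≤-trans (ℕ.+-monoˡ-≤ 2 h) room

    small′ : ∀ {x} → x ≤ 3 * N → x ≤ cap
    small′ h = ℕ.m+n≤o⇒m≤o _ (small h)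

    N≤3N : N ≤ 3 * N
    N≤3N = ℕ.m≤m+n N (N + (N + 0))

    N+N≤3N : N + N ≤ 3 * N
    N+N≤3N = ℕ.+-monoʳ-≤ N (ℕ.m≤m+n N (N + 0))

    t-eval : ∀ {m} {ρ : Vec ℕ m} → eval tF ρ ≡ toℕ t
    t-eval = trans (target-eval w cap cap₀≤) (sym toℕ-t)

    s-eval : ∀ {m} {ρ : Vec ℕ m} → eval sF ρ ≡ toℕ s
    s-eval = trans (source-eval w cap cap₀≤) (sym toℕ-s)

    N-eval : ∀ {m} {ρ : Vec ℕ m} → eval NF ρ ≡ N
    N-eval {ρ = ρ} = succ-eval {ρ = ρ} tF (target-eval w cap cap₀≤) (small′ N≤3N)

    N2-eval : ∀ {m} {ρ : Vec ℕ m} → eval N2F ρ ≡ N + N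
    N2-eval {ρ = ρ} = ⊕-eval NF NF (N-eval {ρ = ρ}) (N-eval {ρ = ρ}) (small′ N+N≤3N)

    size-eval : eval sizeF [] ≡ 3 * N
    size-eval = trans (⊕-eval NF N2F (N-eval {ρ = []}) (N2-eval {ρ = []}) (ℕ.≤-trans (ℕ.≤-reflexive (sym triple)) (small′ ℕ.≤-refl))) (sym triple)
      where
      triple : 3 * N ≡ N + (N + N)
      triple = cong (λ x → N + (N + x)) (ℕ.+-identityʳ N)

    number : Element → ℕ
    number (0F , v) = toℕ v
    number (1F , v) = N + toℕ v
    number (2F , v) = N + N + toℕ v

    number-eq : ∀ e → toℕ (encE e) ≡ number e
    number-eq (0F , v) = trans (Fin.toℕ-combine {3} {N} 0F v) (cong (_+ toℕ v) (ℕ.*-zeroʳ N))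
    number-eq (1F , v) = trans (Fin.toℕ-combine {3} {N} 1F v) (cong (_+ toℕ v) (ℕ.*-identityʳ N))
    number-eq (2F , v) = trans (Fin.toℕ-combine {3} {N} 2F v) (cong (_+ toℕ v) (trans (ℕ.*-comm N 2) (cong (N +_) (ℕ.+-identityʳ N))))

    number≤ : ∀ e → number e ≤ 3 * N
    number≤ e = subst (_≤ 3 * N) (number-eq e) (ℕ.<⇒≤ (Fin.toℕ<n (encE e)))

    offset : Fin 3 → ℕ
    offset 0F = 0
    offset 1F = N
    offset 2F = N + N

    number-offset : ∀ β v → number (β , v) ≡ offset β + toℕ v
    number-offset 0F v = refl
    number-offset 1F v = refl
    number-offset 2F v = refl

    module _ {m} {ρ : Vec ℕ m} where

      <N⇔ : ∀ f → True (f ≺ NF) ρ ⇔ (eval f ρ < N)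
      <N⇔ f = subst (λ x → True (f ≺ NF) ρ ⇔ (eval f ρ < x)) (N-eval {ρ = ρ}) (≺⇔ f NF)

      <2N⇔ : ∀ f → True (f ≺ N2F) ρ ⇔ (eval f ρ < N + N)
      <2N⇔ f = subst (λ x → True (f ≺ N2F) ρ ⇔ (eval f ρ < x)) (N2-eval {ρ = ρ}) (≺⇔ f N2F)

      vertex-eval : ∀ f e → eval f ρ ≡ number e → eval (vertexF f) ρ ≡ toℕ (proj₂ e)
      vertex-eval f (0F , v) e = trans (choose-true (f ≺ NF) f _ (from↔ (<N⇔ f) (subst (_< N) (sym e) (Fin.toℕ<n v)))) e
      vertex-eval f (1F , v) e = trans (choose-false (f ≺ NF) f _ (λ h → ℕ.<⇒≱ (subst (_< N) e (to↔ (<N⇔ f) h)) (ℕ.m≤m+n N _)))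
        (trans (choose-true (f ≺ N2F) (f ⊖ NF) _ (from↔ (<2N⇔ f) (subst (_< N + N) (sym e) (ℕ.+-monoʳ-< N (Fin.toℕ<n v)))))
          (trans (⊖-eval f NF) (trans (cong₂ _∸_ e (N-eval {ρ = ρ})) (ℕ.m+n∸m≡n N (toℕ v)))))
      vertex-eval f (2F , v) e = trans (choose-false (f ≺ NF) f _ (λ h → ℕ.<⇒≱ (subst (_< N) e (to↔ (<N⇔ f) h)) (ℕ.≤-trans (ℕ.m≤m+n N N) (ℕ.m≤m+n (N + N) _))))
        (trans (choose-false (f ≺ N2F) (f ⊖ NF) (f ⊖ N2F) (λ h → ℕ.<⇒≱ (subst (_< N + N) e (to↔ (<2N⇔ f) h)) (ℕ.m≤m+n (N + N) _)))
          (trans (⊖-eval f N2F) (trans (cong₂ _∸_ e (N2-eval {ρ = ρ})) (ℕ.m+n∸m≡n (N + N) (toℕ v)))))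

      copy-eval : ∀ f β v → eval f ρ ≡ number (β , v) → eval (copyF f) ρ ≡ offset β
      copy-eval f β v e = trans (⊖-eval f (vertexF f)) (trans (cong₂ _∸_ (trans e (number-offset β v)) (vertex-eval f (β , v) e)) (ℕ.m+n∸n≡m (offset β) (toℕ v)))

      moved-eval : ∀ f g β v u → eval f ρ ≡ number (β , v) → eval g ρ ≡ toℕ u → eval (copyF f ⊕ g) ρ ≡ number (β , u)
      moved-eval f g β v u e eg = trans (⊕-eval (copyF f) g (copy-eval f β v e) eg (ℕ.≤-trans (ℕ.≤-reflexive (sym (number-offset β u))) (small′ (number≤ (β , u)))))
        (sym (number-offset β u))

      tester⇔ : ∀ f e → eval f ρ ≡ number e → True (testerF f) ρ ⇔ (tester (proj₁ e) ≡ true)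
      tester⇔ f (0F , v) e = neg⇔ (f ≺ N2F) ⟫ mk⇔ (λ n → contradiction (from↔ (<2N⇔ f) (subst (_< N + N) (sym e) (ℕ.≤-trans (Fin.toℕ<n v) (ℕ.m≤m+n N N)))) n) λ ()
      tester⇔ f (1F , v) e = neg⇔ (f ≺ N2F) ⟫ mk⇔ (λ n → contradiction (from↔ (<2N⇔ f) (subst (_< N + N) (sym e) (ℕ.+-monoʳ-< N (Fin.toℕ<n v)))) n) λ ()
      tester⇔ f (2F , v) e = neg⇔ (f ≺ N2F) ⟫ mk⇔ (λ _ → refl) (λ _ h → ℕ.<⇒≱ (subst (_< N + N) e (to↔ (<2N⇔ f) h)) (ℕ.m≤m+n (N + N) _))

      low⇔ : ∀ f e → eval f ρ ≡ number e → True (f ≺ NF) ρ ⇔ (low? (proj₁ e) ≡ true)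
      low⇔ f (0F , v) e = <N⇔ f ⟫ mk⇔ (λ _ → refl) (λ _ → subst (_< N) (sym e) (Fin.toℕ<n v))
      low⇔ f (1F , v) e = <N⇔ f ⟫ mk⇔ (λ h → contradiction (subst (_< N) e h) (ℕ.≤⇒≯ (ℕ.m≤m+n N _))) λ ()
      low⇔ f (2F , v) e = <N⇔ f ⟫ mk⇔ (λ h → contradiction (subst (_< N) e h) (ℕ.≤⇒≯ (ℕ.≤-trans (ℕ.m≤m+n N N) (ℕ.m≤m+n (N + N) _)))) λ ()

      broken⇔ : True brokenF ρ ⇔ (broken ≡ true)
      broken⇔ = go broken
        where
        go : ∀ b → True (if b then one else zer) ρ ⇔ (b ≡ true)
        go true  = mk⇔ (λ _ → refl) (λ _ → ℕ.≤-reflexive (sym (one-eval {ρ = ρ})))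
        go false = mk⇔ (λ ()) λ ()

      choose-if : ∀ c f g b {x y : Element} → True c ρ ⇔ (b ≡ true) → eval f ρ ≡ number x → eval g ρ ≡ number y → eval (choose c f g) ρ ≡ number (if b then x else y)
      choose-if c f g true  h ef eg = trans (choose-true c f g (from↔ h refl)) ef
      choose-if c f g false h ef eg = trans (choose-false c f g (λ k → case to↔ h k of λ ())) eg

      does⇔ : ∀ {A : Set} (d : Dec A) → A ⇔ (does d ≡ true)
      does⇔ (yes a) = mk⇔ (λ _ → refl) (λ _ → a)
      does⇔ (no ¬a) = mk⇔ (λ a → contradiction a ¬a) λ ()

      ∧-true : ∀ a b → (a ≡ true × b ≡ true) ⇔ (a ∧ b ≡ true)
      ∧-true true  b = mk⇔ proj₂ (refl ,_)
      ∧-true false b = mk⇔ (λ ()) λ ()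

      vertex≐ : ∀ f g (v u : Fin N) → eval f ρ ≡ toℕ v → eval g ρ ≡ toℕ u → True (f ≐ g) ρ ⇔ (does (v Fin.≟ u) ≡ true)
      vertex≐ f g v u ef eg = ≐⇔ f g ⟫ ≡⇔ ef eg ⟫ mk⇔ Fin.toℕ-injective (cong toℕ) ⟫ does⇔ (v Fin.≟ u)

      edge-true : ∀ f g v u → eval f ρ ≡ toℕ v → eval g ρ ≡ toℕ u → True (comp edgeF (f ∷ g ∷ [])) ρ ⇔ (does (E? v u) ≡ true)
      edge-true f g v u ef eg rewrite ef | eg = edge⇔ cap cap₀≤ v u ⟫ does⇔ (E? v u)

      product-eval : ∀ f g x y → eval f ρ ≡ number x → eval g ρ ≡ number y → eval (productF f g) ρ ≡ number (x · y)
      product-eval f g x@(β , v) y@(γ , u) ef eg =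
        choose-if (testerF f) _ _ (tester β) (tester⇔ f x ef)
          (choose-if (testerF g) f _ (tester γ) (tester⇔ g y eg) ef
            (choose-if (vertexF f ≐ vertexF g) tF (NF ⊕ tF) (does (v Fin.≟ u)) {0F , t} {1F , t} (vertex≐ (vertexF f) (vertexF g) v u (vertex-eval f x ef) (vertex-eval g y eg))
              (t-eval {ρ = ρ}) (⊕-eval NF tF (N-eval {ρ = ρ}) (t-eval {ρ = ρ}) (small′ (number≤ (1F , t))))))
          (choose-if (testerF g) _ _ (tester γ) (tester⇔ g y eg)
            (choose-if (vertexF f ≐ tF) f _ (does (v Fin.≟ t)) {x} {β , s} (vertex≐ (vertexF f) tF v t (vertex-eval f x ef) (t-eval {ρ = ρ})) ef (moved-eval f sF β v s ef (s-eval {ρ = ρ})))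
            (choose-if _ sF _ (broken ∧ low? β ∧ does (v Fin.≟ t) ∧ does (u Fin.≟ t)) {0F , s} breaking (s-eval {ρ = ρ})
              (choose-if (comp edgeF (vertexF f ∷ vertexF g ∷ [])) (copyF f ⊕ vertexF g) f (does (E? v u)) {β , u} {x}
                (edge-true (vertexF f) (vertexF g) v u (vertex-eval f x ef) (vertex-eval g y eg)) (moved-eval f (vertexF g) β v u ef (vertex-eval g y eg)) ef)))
        where
        breaking : True (brokenF ∧ᶠ f ≺ NF ∧ᶠ vertexF f ≐ tF ∧ᶠ vertexF g ≐ tF) ρ ⇔ (broken ∧ low? β ∧ does (v Fin.≟ t) ∧ does (u Fin.≟ t) ≡ true)
        breaking = ∧⇔ brokenF _ ⟫ (broken⇔ ×⇔ (∧⇔ (f ≺ NF) _ ⟫ (low⇔ f x ef ×⇔ (∧⇔ (vertexF f ≐ tF) (vertexF g ≐ tF) ⟫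
          (vertex≐ (vertexF f) tF v t (vertex-eval f x ef) (t-eval {ρ = ρ}) ×⇔ vertex≐ (vertexF g) tF u t (vertex-eval g y eg) (t-eval {ρ = ρ})) ⟫
          ∧-true _ _) ⟫ ∧-true _ _)) ⟫ ∧-true _ _)

    element-print : ∀ f e → eval f [] ≡ number e → print (numberO f) [] ≡ encodeFin (encE e)
    element-print f e ev = trans (number-print {ρ = []} f ev (small (number≤ e))) (cong encodeℕ (sym (number-eq e)))

    table-print : ∀ n → print (tableO n) [] ≡ concatMap (encodeFin ∘ value) (tuples (3 * N) n)
    table-print 0 = trans (element-print sF (0F , s) (s-eval {ρ = []})) (sym (List.++-identityʳ _))
    table-print 1 = trans (cong (λ n → rounds (λ k i → print (numberO (var 1F)) (k ∷ i ∷ [])) n 0) size-eval)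
      (trans (rounds-concatMap {G = λ k i → print (numberO (var 1F)) (k ∷ i ∷ [])} (3 * N) {λ x → encodeFin x ++ []} λ k x → trans (number-print {ρ = k ∷ toℕ x ∷ []} (var 1F) refl (small (ℕ.<⇒≤ (Fin.toℕ<n x)))) (sym (List.++-identityʳ _)))
        (sym (concatMap-tuples {n = 3 * N} {0} (encodeFin ∘ value))))
    table-print (suc (suc k)) = trans (cong (λ n → rounds (λ r i → print (for (comp sizeF []) body) (r ∷ i ∷ [])) n 0) size-eval)
      (trans (rounds-concatMap (3 * N) λ r x → trans (cong (λ n → rounds (λ q j → print body (q ∷ j ∷ r ∷ toℕ x ∷ [])) n 0) size-eval)
          (trans (rounds-concatMap (3 * N) λ q y → repeat-print {ρ = q ∷ toℕ y ∷ r ∷ toℕ x ∷ []} sizeF k (productF (var 3F) (var 1F)) size-eval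
              (trans (product-eval (var 3F) (var 1F) (decE x) (decE y) (number-dec x) (number-dec y)) (sym (number-eq (decE x · decE y))))
              (small (ℕ.<⇒≤ (Fin.toℕ<n (x ∙ y)))))
            (sym (concatMap-tuples {n = 3 * N} {k} (λ xs → encodeFin (value (x ∷ xs)))))))
        (sym (concatMap-tuples {n = 3 * N} {suc k} (encodeFin ∘ value))))
      where
      body : Out σ 3 4
      body = repeatO sizeF k (productF (var 3F) (var 1F))
      number-dec : ∀ x → toℕ x ≡ number (decE x)
      number-dec x = trans (cong toℕ (sym (enc-decE x))) (number-eq (decE x))

    algebra-print : print algebraO [] ≡ encodeAlgebra algebra
    algebra-print = cong₂ _++_ (number-print {ρ = []} sizeF size-eval room) (forFin-print (tableO ∘ arity S) (λ f → table-print (arity S f)))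

    pairs-print : print pairsO [] ≡ encodeFin (encE (0F , t)) ++ encodeFin (encE (1F , t)) ++ encodeFin (encE (0F , s)) ++ encodeFin (encE (1F , s))
    pairs-print = cong₂ _++_ (element-print tF (0F , t) (t-eval {ρ = []})) (cong₂ _++_
      (element-print (NF ⊕ tF) (1F , t) (⊕-eval NF tF (N-eval {ρ = []}) (t-eval {ρ = []}) (small′ (number≤ (1F , t))))) (cong₂ _++_
      (element-print sF (0F , s) (s-eval {ρ = []}))
      (element-print (NF ⊕ sF) (1F , s) (⊕-eval NF sF (N-eval {ρ = []}) (s-eval {ρ = []}) (small′ (number≤ (1F , s)))))))

    subset-print : print subsetO [] ≡ encodeSubset sources
    subset-print = trans (cong (λ n → rounds row n 0) size-eval) (go (3 * N) 0 inClass λ k x → trans (cong (row k) (ℕ.+-identityʳ (toℕ x))) (bit k x))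
      where
      member : Fn σ 2
      member = var 1F ≐ sF ∨ᶠ var 1F ≐ NF ⊕ sF
      row : ℕ → ℕ → Word
      row k i = if isPos (eval member (k ∷ i ∷ [])) then [ 1F ] else [ 0F ]
      go : ∀ n j (p : Fin n → Bool) → (∀ k x → row k (toℕ x + j) ≡ (if p x then [ 1F ] else [ 0F ])) → rounds row n j ≡ encodeSubset (Vec.tabulate p)
      go zero    j p h = refl
      go (suc n) j p h with p zero | h n zero
      ... | true  | e = cong₂ _++_ e (go n (suc j) (p ∘ suc) λ k x → trans (cong (row k) (ℕ.+-suc (toℕ x) j)) (h k (suc x)))
      ... | false | e = cong₂ _++_ e (go n (suc j) (p ∘ suc) λ k x → trans (cong (row k) (ℕ.+-suc (toℕ x) j)) (h k (suc x)))
      isPos-if : ∀ x b → (1 ≤ x) ⇔ (b ≡ true) → (if isPos x then [ 1F ] else [ 0F ]) ≡ (if b then [ 1F ] else [ 0F ])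
      isPos-if zero    true  h = case from↔ h refl of λ ()
      isPos-if zero    false h = refl
      isPos-if (suc x) true  h = refl
      isPos-if (suc x) false h = case to↔ h (s≤s z≤n) of λ ()
      ∨-true : ∀ a b → (a ≡ true ⊎ b ≡ true) ⇔ (a ∨ b ≡ true)
      ∨-true true  b = mk⇔ (λ _ → refl) (λ _ → inj₁ refl)
      ∨-true false b = mk⇔ (λ { (inj₁ ()) ; (inj₂ h) → h }) inj₂
      bit : ∀ k (x : Fin (3 * N)) → row k (toℕ x) ≡ (if inClass x then [ 1F ] else [ 0F ])
      bit k x = isPos-if (eval member (k ∷ toℕ x ∷ [])) (inClass x)
        (∨⇔ (var 1F ≐ sF) (var 1F ≐ NF ⊕ sF) ⟫
          ((≐⇔ (var 1F) sF ⟫ ≡⇔ refl (s-eval {ρ = k ∷ toℕ x ∷ []}) ⟫ does⇔ {ρ = []} (toℕ x ℕ.≟ toℕ s)) ⊎⇔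
           (≐⇔ (var 1F) (NF ⊕ sF) ⟫ ≡⇔ refl (⊕-eval NF sF (N-eval {ρ = k ∷ toℕ x ∷ []}) (s-eval {ρ = k ∷ toℕ x ∷ []}) (small′ (number≤ (1F , s)))) ⟫ does⇔ {ρ = []} (toℕ x ℕ.≟ N + toℕ s))) ⟫
          ∨-true _ _)

-- Congruences generated by a set of pairs as chains of translated generators

module Chains {S : Signature} (A : FiniteAlgebra S) (Gen : FiniteAlgebra.Carrier A → FiniteAlgebra.Carrier A → Set) where

  open FiniteAlgebra A

  -- A basic translation applied to both components at once. Composites are walks along this
  -- relation, so no composite polynomial ever has to be represented.
  Translates : Carrier × Carrier → Carrier × Carrier → Set
  Translates (u , v) (u′ , v′) = ∃[ f ] ∃[ i ] ∃[ xs ] u′ ≡ op f (xs [ i ]≔ u) × v′ ≡ op f (xs [ i ]≔ v)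

  Image : Carrier → Carrier → Set
  Image u v = ∃₂ λ c d → Gen c d × Star Translates (c , d) (u , v)

  Near : Carrier → Carrier → Set
  Near u v = Image u v ⊎ Image v u

  Chain : Carrier → Carrier → Set
  Chain = Star Near

  near-sym : ∀ {u v} → Near u v → Near v u
  near-sym (inj₁ h) = inj₂ h
  near-sym (inj₂ h) = inj₁ h

  chain-sym : ∀ {u v} → Chain u v → Chain v u
  chain-sym ε        = ε
  chain-sym (h ◅ hs) = chain-sym hs ◅◅ (near-sym h ◅ ε)

  chain-translate : ∀ f i xs {u v} → Chain u v → Chain (op f (xs [ i ]≔ u)) (op f (xs [ i ]≔ v))
  chain-translate f i xs ε = ε
  chain-translate f i xs (inj₁ (c , d , g , p) ◅ hs) = inj₁ (c , d , g , p ◅◅ ((f , i , xs , refl , refl) ◅ ε)) ◅ chain-translate f i xs hs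
  chain-translate f i xs (inj₂ (c , d , g , p) ◅ hs) = inj₂ (c , d , g , p ◅◅ ((f , i , xs , refl , refl) ◅ ε)) ◅ chain-translate f i xs hs

  -- A function all of whose translations preserve chains is compatible.
  coordinatewise : ∀ {n} (g : Vec Carrier n → Carrier) → (∀ i xs {u v} → Chain u v → Chain (g (xs [ i ]≔ u)) (g (xs [ i ]≔ v))) →
                   ∀ {xs ys} → Pointwise Chain xs ys → Chain (g xs) (g ys)
  coordinatewise g h []                            = ε
  coordinatewise g h {x ∷ xs} {y ∷ ys} (p ∷ ps) =
    h zero (x ∷ xs) p ◅◅ coordinatewise (g ∘ (y ∷_)) (λ i zs → h (suc i) (y ∷ zs)) ps

  chain-congruence : IsCongruence A Chain
  chain-congruence = record
    { isEquivalence = record { refl = ε ; sym = chain-sym ; trans = _◅◅_ }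
    ; compatible    = λ f → coordinatewise (op f) (chain-translate f) }

  chain-generator : ∀ {c d} → Gen c d → Chain c d
  chain-generator g = inj₁ (_ , _ , g , ε) ◅ ε

  chain-smallest : ∀ {ℓ} {θ : Carrier → Carrier → Set ℓ} → IsCongruence A θ → (∀ {c d} → Gen c d → θ c d) → ∀ {u v} → Chain u v → θ u v
  chain-smallest {θ = θ} cong-θ gen = go
    where
    open IsCongruence cong-θ
    module ≈ = IsEquivalence isEquivalence
    update : ∀ {n} (xs : Vec Carrier n) i {u v} → θ u v → Pointwise θ (xs [ i ]≔ u) (xs [ i ]≔ v)
    update (x ∷ xs) zero    p = p ∷ same xs
      where
      same : ∀ {n} (xs : Vec Carrier n) → Pointwise θ xs xs
      same []       = []
      same (x ∷ xs) = ≈.refl ∷ same xs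
    update (x ∷ xs) (suc i) p = ≈.refl ∷ update xs i p
    image : ∀ {c d u v} → Star Translates (c , d) (u , v) → θ c d → θ u v
    image ε p = p
    image ((f , i , xs , refl , refl) ◅ ts) p = image ts (compatible f (update xs i p))
    go : ∀ {u v} → Chain u v → θ u v
    go ε                              = ≈.refl
    go (inj₁ (c , d , g , p) ◅ hs) = ≈.trans (image p (gen g)) (go hs)
    go (inj₂ (c , d , g , p) ◅ hs) = ≈.trans (≈.sym (image p (gen g))) (go hs)

-- Maltsev's lemma for principal congruences: chains form a congruence containing the generator and
-- lie in every other such congruence.
chain⇔Cg : ∀ {S} (A : FiniteAlgebra S) c d {a b} → Chains.Chain A (λ x y → x ≡ c × y ≡ d) a b ⇔ Cg A c d a b
chain⇔Cg A c d = mk⇔ (chain-smallest (Cg-isCongruence A c d) (λ { (refl , refl) → Cg.generator }))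
                      (Cg-smallest A chain-congruence (chain-generator (refl , refl)))
  where open Chains A (λ x y → x ≡ c × y ≡ d)

-- Words as sequences of numbers

delims : Word → ℕ
delims []       = 0
delims (2F ∷ w) = suc (delims w)
delims (0F ∷ w) = delims w
delims (1F ∷ w) = delims w

-- The number denoted by the digits between two consecutive delimiters.
token : Word → ℕ → ℕ
token []       j       = 0
token (2F ∷ w) zero    = 0
token (2F ∷ w) (suc j) = token w j
token (0F ∷ w) zero    = 1 + 2 * token w zero
token (0F ∷ w) (suc j) = token w (suc j)
token (1F ∷ w) zero    = 2 + 2 * token w zero
token (1F ∷ w) (suc j) = token w (suc j)

-- What follows the last delimiter.
rest : Word → Word
rest []       = []
rest (2F ∷ w) = rest w
rest (0F ∷ w) with delims w
... | zero  = 0F ∷ w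
... | suc _ = rest w
rest (1F ∷ w) with delims w
... | zero  = 1F ∷ w
... | suc _ = rest w

rest-delimfree : ∀ w → delims w ≡ 0 → rest w ≡ w
rest-delimfree []       h = refl
rest-delimfree (2F ∷ w) ()
rest-delimfree (0F ∷ w) h with delims w | h
... | zero | _ = refl
rest-delimfree (1F ∷ w) h with delims w | h
... | zero | _ = refl

numbers : List ℕ → Word
numbers = concatMap encodeℕ

digits-odd : ∀ m → digits (ℕᵇ.fromℕ (1 + 2 * m)) ≡ 0F ∷ digits (ℕᵇ.fromℕ m)
digits-odd m = cong digits (ℕᵇ.toℕ-injective {ℕᵇ.fromℕ (1 + 2 * m)} {ℕᵇ.1+[2 ℕᵇ.fromℕ m ]} (trans (ℕᵇ.toℕ-fromℕ (1 + 2 * m))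
  (cong (λ x → 1 + 2 * x) (sym (ℕᵇ.toℕ-fromℕ m)))))

digits-even : ∀ m → digits (ℕᵇ.fromℕ (2 + 2 * m)) ≡ 1F ∷ digits (ℕᵇ.fromℕ m)
digits-even m = cong digits (ℕᵇ.toℕ-injective {ℕᵇ.fromℕ (2 + 2 * m)} {ℕᵇ.2[1+ ℕᵇ.fromℕ m ]} (trans (ℕᵇ.toℕ-fromℕ (2 + 2 * m))
  (trans (sym (ℕ.*-suc 2 m)) (cong (λ x → 2 * suc x) (sym (ℕᵇ.toℕ-fromℕ m))))))

-- In bijective base 2 every string of digits is the numeral of exactly one number, so every word
-- parses. Valid words can then be recognised by counting and comparing alone.
word-tokens : ∀ w → w ≡ numbers (applyUpTo (token w) (delims w)) ++ rest w
word-tokens []       = refl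
word-tokens (2F ∷ w) = cong (2F ∷_) (word-tokens w)
word-tokens (0F ∷ w) with delims w | word-tokens w
... | zero  | _  = refl
... | suc k | ih = trans (cong (0F ∷_) ih) (cong (λ ds → ((ds ++ [ 2F ]) ++ numbers (applyUpTo (λ j → token w (suc j)) k)) ++ rest w) (sym (digits-odd (token w 0))))
word-tokens (1F ∷ w) with delims w | word-tokens w
... | zero  | _  = refl
... | suc k | ih = trans (cong (1F ∷_) ih) (cong (λ ds → ((ds ++ [ 2F ]) ++ numbers (applyUpTo (λ j → token w (suc j)) k)) ++ rest w) (sym (digits-even (token w 0))))

module _ (w : Word) where

  private
    delims-digits : ∀ b → delims (digits b ++ 2F ∷ w) ≡ suc (delims w)
    delims-digits ℕᵇ.zero     = refl
    delims-digits ℕᵇ.2[1+ b ] = delims-digits b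
    delims-digits ℕᵇ.1+[2 b ] = delims-digits b

    token-digits : ∀ b → token (digits b ++ 2F ∷ w) 0 ≡ ℕᵇ.toℕ b
    token-digits ℕᵇ.zero     = refl
    token-digits ℕᵇ.2[1+ b ] = trans (cong (λ x → 2 + 2 * x) (token-digits b)) (sym (ℕ.*-suc 2 (ℕᵇ.toℕ b)))
    token-digits ℕᵇ.1+[2 b ] = cong (λ x → 1 + 2 * x) (token-digits b)

    token-digits-suc : ∀ b j → token (digits b ++ 2F ∷ w) (suc j) ≡ token w j
    token-digits-suc ℕᵇ.zero     j = refl
    token-digits-suc ℕᵇ.2[1+ b ] j = token-digits-suc b j
    token-digits-suc ℕᵇ.1+[2 b ] j = token-digits-suc b j

    rest-digits : ∀ b → rest (digits b ++ 2F ∷ w) ≡ rest w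
    rest-digits ℕᵇ.zero     = refl
    rest-digits ℕᵇ.2[1+ b ] rewrite delims-digits b = rest-digits b
    rest-digits ℕᵇ.1+[2 b ] rewrite delims-digits b = rest-digits b

    flat : ∀ n → encodeℕ n ++ w ≡ digits (ℕᵇ.fromℕ n) ++ 2F ∷ w
    flat n = List.++-assoc (digits (ℕᵇ.fromℕ n)) [ 2F ] w

  delims-encodeℕ : ∀ n → delims (encodeℕ n ++ w) ≡ suc (delims w)
  delims-encodeℕ n = trans (cong delims (flat n)) (delims-digits (ℕᵇ.fromℕ n))

  token-encodeℕ : ∀ n → token (encodeℕ n ++ w) 0 ≡ n
  token-encodeℕ n = trans (cong (λ x → token x 0) (flat n)) (trans (token-digits (ℕᵇ.fromℕ n)) (ℕᵇ.toℕ-fromℕ n))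

  token-encodeℕ-suc : ∀ n j → token (encodeℕ n ++ w) (suc j) ≡ token w j
  token-encodeℕ-suc n j = trans (cong (λ x → token x (suc j)) (flat n)) (token-digits-suc (ℕᵇ.fromℕ n) j)

  rest-encodeℕ : ∀ n → rest (encodeℕ n ++ w) ≡ rest w
  rest-encodeℕ n = trans (cong rest (flat n)) (rest-digits (ℕᵇ.fromℕ n))

nthL : List ℕ → ℕ → ℕ
nthL []       j       = 0
nthL (x ∷ xs) zero    = x
nthL (x ∷ xs) (suc j) = nthL xs j

module _ (r : Word) where

  delims-numbers : ∀ ns → delims (numbers ns ++ r) ≡ length ns + delims r
  delims-numbers []       = refl
  delims-numbers (n ∷ ns) rewrite List.++-assoc (encodeℕ n) (numbers ns) r = trans (delims-encodeℕ (numbers ns ++ r) n) (cong suc (delims-numbers ns))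

  token-numbers : ∀ ns j → j < length ns → token (numbers ns ++ r) j ≡ nthL ns j
  token-numbers (n ∷ ns) zero    h rewrite List.++-assoc (encodeℕ n) (numbers ns) r = token-encodeℕ (numbers ns ++ r) n
  token-numbers (n ∷ ns) (suc j) (s≤s h) rewrite List.++-assoc (encodeℕ n) (numbers ns) r =
    trans (token-encodeℕ-suc (numbers ns ++ r) n j) (token-numbers ns j h)

  rest-numbers : ∀ ns → rest (numbers ns ++ r) ≡ rest r
  rest-numbers []       = refl
  rest-numbers (n ∷ ns) rewrite List.++-assoc (encodeℕ n) (numbers ns) r = trans (rest-encodeℕ (numbers ns ++ r) n) (rest-numbers ns)

-- Positions in operation tables

offset : ∀ {m} → (Fin m → ℕ) → Fin m → ℕ
offset a zero    = 0
offset a (suc i) = a zero + offset (a ∘ suc) i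

total# : ∀ {m} → (Fin m → ℕ) → ℕ
total# {zero}  a = 0
total# {suc m} a = a zero + total# (a ∘ suc)

offset< : ∀ {m} (a : Fin m → ℕ) i {j} → j < a i → offset a i + j < total# a
offset< a zero    h = ℕ.≤-trans h (ℕ.m≤m+n _ _)
offset< a (suc i) {j} h = subst (_< total# a) (sym (ℕ.+-assoc (a zero) _ j)) (ℕ.+-monoʳ-< (a zero) (offset< (a ∘ suc) i h))

offset-const : ∀ {m} k (i : Fin m) → offset (λ _ → k) i ≡ toℕ i * k
offset-const k zero    = refl
offset-const k (suc i) = cong (k +_) (offset-const k i)

nthL-++ˡ : ∀ xs {ys j} → j < length xs → nthL (xs ++ ys) j ≡ nthL xs j
nthL-++ˡ (x ∷ xs) {j = zero}  h       = refl
nthL-++ˡ (x ∷ xs) {j = suc j} (s≤s h) = nthL-++ˡ xs h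

nthL-++ʳ : ∀ xs {ys j} → nthL (xs ++ ys) (length xs + j) ≡ nthL ys j
nthL-++ʳ []       = refl
nthL-++ʳ (x ∷ xs) = nthL-++ʳ xs

module _ {A : Set} where

  concatMap-suc : ∀ {m} (F : Fin (suc m) → List A) → concatMap F (allFin (suc m)) ≡ F zero ++ concatMap (F ∘ suc) (allFin m)
  concatMap-suc {m} F = cong (F zero ++_) (trans (cong (concatMap F) (sym (List.map-tabulate id suc))) (List.concatMap-map F suc (allFin m)))

length-blocks : ∀ {A : Set} {m} (F : Fin m → List A) (a : Fin m → ℕ) → (∀ i → length (F i) ≡ a i) → length (concatMap F (allFin m)) ≡ total# a
length-blocks {m = zero}  F a h = refl
length-blocks {m = suc m} F a h = trans (cong length (concatMap-suc F)) (trans (List.length-++ (F zero)) (cong₂ _+_ (h zero) (length-blocks (F ∘ suc) (a ∘ suc) (h ∘ suc))))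

nthL-blocks : ∀ {m} (F : Fin m → List ℕ) (a : Fin m → ℕ) → (∀ i → length (F i) ≡ a i) → ∀ i {j} → j < a i →
              nthL (concatMap F (allFin m)) (offset a i + j) ≡ nthL (F i) j
nthL-blocks F a h zero {j} l = trans (cong (λ xs → nthL xs j) (concatMap-suc F)) (nthL-++ˡ (F zero) (subst (j <_) (sym (h zero)) l))
nthL-blocks F a h (suc i) {j} l = trans (cong₂ nthL (concatMap-suc F) (trans (ℕ.+-assoc (a zero) _ j) (cong (_+ (offset (a ∘ suc) i + j)) (sym (h zero)))))
  (trans (nthL-++ʳ (F zero)) (nthL-blocks (F ∘ suc) (a ∘ suc) (h ∘ suc) i l))

module _ {n : ℕ} where

  index : ∀ {k} → Vec (Fin n) k → ℕ
  index []               = 0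
  index {suc k} (x ∷ xs) = toℕ x * n ^ k + index xs

  index< : ∀ {k} (xs : Vec (Fin n) k) → index xs < n ^ k
  index< []               = s≤s z≤n
  index< {suc k} (x ∷ xs) = ℕ.<-≤-trans (ℕ.+-monoʳ-< (toℕ x * n ^ k) (index< xs))
    (ℕ.≤-trans (ℕ.≤-reflexive (ℕ.+-comm _ (n ^ k))) (ℕ.*-monoˡ-≤ (n ^ k) (Fin.toℕ<n x)))

  length-tuples : ∀ k → length (tuples n k) ≡ n ^ k
  length-tuples zero    = refl
  length-tuples (suc k) = trans (go (allFin n)) (cong₂ _*_ (List.length-tabulate {n = n} id) (length-tuples k))
    where
    cons : Fin n → Vec (Fin n) k → Vec (Fin n) (suc k)
    cons = _∷_
    go : ∀ xs → length (cartesianProductWith cons xs (tuples n k)) ≡ length xs * length (tuples n k)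
    go []       = refl
    go (x ∷ xs) = trans (List.length-++ (map (cons x) (tuples n k))) (cong₂ _+_ (List.length-map (cons x) (tuples n k)) (go xs))

  map-tuples : ∀ {k} (g : Vec (Fin n) (suc k) → ℕ) → map g (tuples n (suc k)) ≡ concatMap (λ x → map (g ∘ (x ∷_)) (tuples n k)) (allFin n)
  map-tuples {k} g = go (allFin n)
    where
    go : ∀ xs → map g (cartesianProductWith _∷_ xs (tuples n k)) ≡ concatMap (λ x → map (g ∘ (x ∷_)) (tuples n k)) xs
    go []       = refl
    go (x ∷ xs) = trans (List.map-++ g (map (x ∷_) (tuples n k)) _) (cong₂ _++_ (sym (List.map-∘ (tuples n k))) (go xs))

  nthL-tuples : ∀ {k} (g : Vec (Fin n) k → ℕ) xs → nthL (map g (tuples n k)) (index xs) ≡ g xs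
  nthL-tuples {zero}  g []       = refl
  nthL-tuples {suc k} g (x ∷ xs) = trans (cong₂ nthL (map-tuples g) (cong (_+ index xs) (sym (offset-const (n ^ k) x))))
    (trans (nthL-blocks (λ x → map (g ∘ (x ∷_)) (tuples n k)) (λ _ → n ^ k) (λ y → trans (List.length-map _ (tuples n k)) (length-tuples k)) x (index< xs))
      (nthL-tuples (g ∘ (x ∷_)) xs))

  unindex : ∀ k {l} → l < n ^ k → ∃[ xs ] index {k} xs ≡ l
  unindex zero    {zero} h = [] , refl
  unindex zero    {suc l} (s≤s ())
  unindex (suc k) {l} h =
    let (x , y)   = Fin.remQuot {n} (n ^ k) (fromℕ< h)
        (xs , eq) = unindex k (Fin.toℕ<n y)
    in x ∷ xs , trans (cong₂ _+_ (ℕ.*-comm (toℕ x) (n ^ k)) eq) (trans (sym (Fin.toℕ-combine x y))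
         (trans (cong toℕ (Fin.combine-remQuot {n} (n ^ k) (fromℕ< h))) (Fin.toℕ-fromℕ< h)))

  -- The coordinates after the i-th.
  after : ∀ {k} → Fin k → ℕ
  after {suc k} zero    = k
  after {suc k} (suc i) = after i

  -- The lexicographic index of a tuple, read as a numeral in base `n`, above and below coordinate
  -- `i`. Two numbers thus stand for all fixed arguments of a translation.
  high low : ∀ {k} → Vec (Fin n) k → Fin k → ℕ
  high (x ∷ xs) zero    = 0
  high (x ∷ xs) (suc i) = toℕ x * n ^ toℕ i + high xs i
  low (x ∷ xs) zero     = index xs
  low (x ∷ xs) (suc i)  = low xs i

  power-split : ∀ {k} (i : Fin k) → n ^ k ≡ n ^ toℕ i * (n * n ^ after i)
  power-split {suc k} zero    = sym (ℕ.+-identityʳ _)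
  power-split {suc k} (suc i) = trans (cong (n *_) (power-split i)) (sym (ℕ.*-assoc n (n ^ toℕ i) _))

  index-update : ∀ {k} (xs : Vec (Fin n) k) i u → index (xs [ i ]≔ u) ≡ (high xs i * n + toℕ u) * n ^ after i + low xs i
  index-update (x ∷ xs) zero    u = refl
  index-update {suc k} (x ∷ xs) (suc i) u = trans (cong₂ (λ a b → toℕ x * a + b) (power-split i) (index-update xs i u))
    (lemma (toℕ x) (n ^ toℕ i) n (n ^ after i) (high xs i) (toℕ u) (low xs i))
    where
    lemma : ∀ x p n q h u l → x * (p * (n * q)) + ((h * n + u) * q + l) ≡ ((x * p + h) * n + u) * q + l
    lemma = solve-∀

  high< : ∀ {k} (xs : Vec (Fin n) k) i → high xs i < n ^ toℕ i
  high< (x ∷ xs) zero    = s≤s z≤n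
  high< (x ∷ xs) (suc i) = ℕ.<-≤-trans (ℕ.+-monoʳ-< (toℕ x * n ^ toℕ i) (high< xs i))
    (ℕ.≤-trans (ℕ.≤-reflexive (ℕ.+-comm _ (n ^ toℕ i))) (ℕ.*-monoˡ-≤ (n ^ toℕ i) (Fin.toℕ<n x)))

  low< : ∀ {k} (xs : Vec (Fin n) k) i → low xs i < n ^ after i
  low< (x ∷ xs) zero    = index< xs
  low< (x ∷ xs) (suc i) = low< xs i

  -- The element `z` only fills coordinate `i`, which a translation overwrites.
  unsplit : ∀ {k} (i : Fin k) {h l} → Fin n → h < n ^ toℕ i → l < n ^ after i → ∃[ xs ] high {k} xs i ≡ h × low {k} xs i ≡ l
  unsplit {suc k} zero    z (s≤s z≤n) l< = let (xs , eq) = unindex k l< in z ∷ xs , refl , eq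
  unsplit {suc k} (suc i) {h} z h<  l< =
    let (x , y)      = Fin.remQuot {n} (n ^ toℕ i) (fromℕ< h<)
        (xs , e , f) = unsplit i z (Fin.toℕ<n y) l<
    in x ∷ xs , trans (cong₂ _+_ (ℕ.*-comm (toℕ x) (n ^ toℕ i)) e) (trans (sym (Fin.toℕ-combine x y))
         (trans (cong toℕ (Fin.combine-remQuot {n} (n ^ toℕ i) (fromℕ< h<))) (Fin.toℕ-fromℕ< h<))) , f

-- Boolean tests and arithmetic under truncation

≡ᵇ⇔ : ∀ {x y} → (x ≡ y) ⇔ ((x ≡ᵇ y) ≡ true)
≡ᵇ⇔ {x} {y} = mk⇔ (ℕ.≡⇒≡ᵇ x y) (ℕ.≡ᵇ⇒≡ x y) ⟫ T-≡

<ᵇ⇔ : ∀ {x y} → (x < y) ⇔ ((x <ᵇ y) ≡ true)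
<ᵇ⇔ {x} {y} = mk⇔ ℕ.<⇒<ᵇ (ℕ.<ᵇ⇒< x y) ⟫ T-≡

∧≡true : ∀ {a b} → (a ≡ true × b ≡ true) ⇔ (a ∧ b ≡ true)
∧≡true {true}  = mk⇔ proj₂ (refl ,_)
∧≡true {false} = mk⇔ (λ ()) λ ()

trunc-+ : ∀ a b c → (a + b ⊓ c) ⊓ c ≡ (a + b) ⊓ c
trunc-+ a b c with ℕ.≤-total b c
... | inj₁ h = cong (λ x → (a + x) ⊓ c) (ℕ.m≤n⇒m⊓n≡m h)
... | inj₂ h = trans (cong (λ x → (a + x) ⊓ c) (ℕ.m≥n⇒m⊓n≡n h))
  (trans (ℕ.m≥n⇒m⊓n≡n (ℕ.m≤n+m c a)) (sym (ℕ.m≥n⇒m⊓n≡n (ℕ.≤-trans h (ℕ.m≤n+m b a)))))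

trunc-++ : ∀ a b c → (a ⊓ c + b ⊓ c) ⊓ c ≡ (a + b) ⊓ c
trunc-++ a b c = trans (trunc-+ (a ⊓ c) b c) (trans (cong (_⊓ c) (ℕ.+-comm (a ⊓ c) b)) (trans (trunc-+ b a c) (cong (_⊓ c) (ℕ.+-comm b a))))

trunc-* : ∀ a b c → (a * (b ⊓ c)) ⊓ c ≡ (a * b) ⊓ c
trunc-* zero    b c = refl
trunc-* (suc a) b c with ℕ.≤-total b c
... | inj₁ h = cong (λ x → (suc a * x) ⊓ c) (ℕ.m≤n⇒m⊓n≡m h)
... | inj₂ h = trans (cong (λ x → (suc a * x) ⊓ c) (ℕ.m≥n⇒m⊓n≡n h))
  (trans (ℕ.m≥n⇒m⊓n≡n (ℕ.m≤m+n c (a * c))) (sym (ℕ.m≥n⇒m⊓n≡n (ℕ.≤-trans h (ℕ.m≤m+n b (a * b))))))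

-- Counting delimiters and reading tokens

sumTo : (ℕ → ℕ) → ℕ → ℕ
sumTo h zero    = 0
sumTo h (suc n) = sumTo h n + h n

sumTo-suc : ∀ h n → sumTo h (suc n) ≡ h 0 + sumTo (h ∘ suc) n
sumTo-suc h zero    = ℕ.+-comm 0 (h 0)
sumTo-suc h (suc n) = trans (cong (_+ h (suc n)) (sumTo-suc h n)) (ℕ.+-assoc (h 0) _ _)

foldDown-suc : ∀ {A : Set} (f : ℕ → A → A) n {a} → foldDown f (suc n) a ≡ f 0 (foldDown (f ∘ suc) n a)
foldDown-suc f zero    = refl
foldDown-suc f (suc n) = foldDown-suc f n

foldDown-const : ∀ {A : Set} n {a : A} → foldDown (λ _ a → a) n a ≡ a
foldDown-const zero    = refl
foldDown-const (suc n) = foldDown-const n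

delimiter : Fin 3 → ℕ
delimiter 2F = 1
delimiter _  = 0

-- The number of delimiters among the first i symbols.
delimsBefore : Word → ℕ → ℕ
delimsBefore []      i       = 0
delimsBefore (a ∷ w) zero    = 0
delimsBefore (a ∷ w) (suc i) = delimiter a + delimsBefore w i

symbol : Word → ℕ → ℕ
symbol w i = code (readInput w (suc i))

-- Codes of letters start at 2, so 4 is the code of the delimiter `2F`.
is4 : ℕ → ℕ
is4 x = if x ≡ᵇ 4 then 1 else 0

delims-symbols : ∀ w i → sumTo (is4 ∘ symbol w) i ≡ delimsBefore w i
delims-symbols []       zero    = refl
delims-symbols []       (suc i) = trans (ℕ.+-identityʳ _) (delims-symbols [] i)
delims-symbols (a ∷ w)  zero    = refl
delims-symbols (a ∷ w)  (suc i) = trans (sumTo-suc (is4 ∘ symbol (a ∷ w)) i) (cong₂ _+_ (head a) (delims-symbols w i))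
  where
  head : ∀ a → is4 (code {3} (char a)) ≡ delimiter a
  head 0F = refl
  head 1F = refl
  head 2F = refl

delimsBefore-all : ∀ w → delimsBefore w (length w) ≡ delims w
delimsBefore-all []       = refl
delimsBefore-all (0F ∷ w) = delimsBefore-all w
delimsBefore-all (1F ∷ w) = delimsBefore-all w
delimsBefore-all (2F ∷ w) = cong suc (delimsBefore-all w)

delims≤length : ∀ w → delims w ≤ length w
delims≤length []       = z≤n
delims≤length (0F ∷ w) = ℕ.m≤n⇒m≤1+n (delims≤length w)
delims≤length (1F ∷ w) = ℕ.m≤n⇒m≤1+n (delims≤length w)
delims≤length (2F ∷ w) = s≤s (delims≤length w)

delimsBefore≤ : ∀ w i → delimsBefore w i ≤ delims w
delimsBefore≤ []       i       = z≤n
delimsBefore≤ (a ∷ w)  zero    = z≤n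
delimsBefore≤ (0F ∷ w) (suc i) = delimsBefore≤ w i
delimsBefore≤ (1F ∷ w) (suc i) = delimsBefore≤ w i
delimsBefore≤ (2F ∷ w) (suc i) = s≤s (delimsBefore≤ w i)

bit≡ : ℕ → ℕ → ℕ
bit≡ x y = if x ≡ᵇ y then 1 else 0

-- The symbols behind the last delimiter are those preceded by all delimiters.
rest-length : ∀ w → sumTo (λ i → bit≡ (delimsBefore w i) (delims w)) (length w) ≡ length (rest w)
rest-length []       = refl
rest-length (2F ∷ w) = trans (sumTo-suc _ (length w)) (rest-length w)
rest-length (0F ∷ w) with rest-length w
... | ih = trans (sumTo-suc _ (length w)) (trans (cong (bit≡ 0 (delims w) +_) ih) (tail 0F w (delims w) refl))
  where
  tail : ∀ (a : Fin 3) w k → delims w ≡ k → bit≡ 0 k + length (rest w) ≡ length (rest (0F ∷ w))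
  tail a w zero    e rewrite e = cong suc (cong length (rest-delimfree w e))
  tail a w (suc k) e rewrite e = refl
rest-length (1F ∷ w) with rest-length w
... | ih = trans (sumTo-suc _ (length w)) (trans (cong (bit≡ 0 (delims w) +_) ih) (tail w (delims w) refl))
  where
  tail : ∀ w k → delims w ≡ k → bit≡ 0 k + length (rest w) ≡ length (rest (1F ∷ w))
  tail w zero    e rewrite e = cong suc (cong length (rest-delimfree w e))
  tail w (suc k) e rewrite e = refl

-- Reading a token from right to left, as its least significant digit comes first.
tokenStep : ℕ → Word → ℕ → ℕ → ℕ → ℕ
tokenStep cap w j i a = if (delimsBefore w i ≡ᵇ j) ∧ (symbol w i <ᵇ 4) then (pred (symbol w i) + (a + a) ⊓ cap) ⊓ cap else a

truncated-double : ∀ d x c → (d + (x ⊓ c + x ⊓ c) ⊓ c) ⊓ c ≡ (d + 2 * x) ⊓ c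
truncated-double d x c = trans (cong (λ y → (d + y) ⊓ c) (trunc-++ x x c)) (trans (trunc-+ d (x + x) c)
  (cong (λ y → (d + (x + y)) ⊓ c) (sym (ℕ.+-identityʳ x))))

tokenStep≤ : ∀ cap w j i {a} → a ≤ cap → tokenStep cap w j i a ≤ cap
tokenStep≤ cap w j i h with (delimsBefore w i ≡ᵇ j) ∧ (symbol w i <ᵇ 4)
... | true  = ℕ.m⊓n≤n _ cap
... | false = h

-- Horner's rule in bijective base 2. Truncating at every stage amounts to truncating the result,
-- because a truncated sum does not change when its summands are truncated.
token-fold : ∀ cap w j → foldDown (tokenStep cap w j) (length w) 0 ≡ token w j ⊓ cap
token-fold cap []       j       = refl
token-fold cap (2F ∷ w) zero    = trans (foldDown-suc (tokenStep cap (2F ∷ w) zero) (length w)) (foldDown-const (length w))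
token-fold cap (2F ∷ w) (suc j) = trans (foldDown-suc (tokenStep cap (2F ∷ w) (suc j)) (length w)) (token-fold cap w j)
token-fold cap (0F ∷ w) zero    = trans (foldDown-suc (tokenStep cap (0F ∷ w) zero) (length w))
  (trans (cong (λ a → (1 + (a + a) ⊓ cap) ⊓ cap) (token-fold cap w zero)) (truncated-double 1 (token w zero) cap))
token-fold cap (0F ∷ w) (suc j) = trans (foldDown-suc (tokenStep cap (0F ∷ w) (suc j)) (length w)) (token-fold cap w (suc j))
token-fold cap (1F ∷ w) zero    = trans (foldDown-suc (tokenStep cap (1F ∷ w) zero) (length w))
  (trans (cong (λ a → (2 + (a + a) ⊓ cap) ⊓ cap) (token-fold cap w zero)) (truncated-double 2 (token w zero) cap))
token-fold cap (1F ∷ w) (suc j) = trans (foldDown-suc (tokenStep cap (1F ∷ w) (suc j)) (length w)) (token-fold cap w (suc j))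

symbolF : ∀ {m} → Fn 3 m → Fn 3 m
symbolF f = sym′ (succ f)

opaque
  tokenC delimsC : Fn 3 1
  delimsC = total (var 0F) (choose (symbolF (var 0F) ≐ const# 4) one zer)

  tokenC = iter len zer (choose (comp delimsC (var 0F ∷ []) ≐ var 2F ∧ᶠ symbolF (var 0F) ≺ const# 4)
    (prd (symbolF (var 0F)) ⊕ (var 1F ⊕ var 1F)) (var 1F))

  tokenF : ∀ {m} → Fn 3 m → Fn 3 m
  tokenF f = comp tokenC (f ∷ [])

  delimsF restF sizeF : ∀ {m} → Fn 3 m
  delimsF = comp delimsC (len ∷ [])
  restF   = comp (total len (choose (comp delimsC (var 0F ∷ []) ≐ comp delimsC (len ∷ [])) one zer)) []
  sizeF   = tokenF zer

  totalF : ∀ {m k} → (Fin k → ℕ) → Fn 3 m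
  totalF {k = zero}  a = zer
  totalF {k = suc k} a = sizeF ^ᶠ a zero ⊕ totalF (a ∘ suc)

  offsetF : ∀ {m k} → (Fin k → ℕ) → Fin k → Fn 3 m
  offsetF a zero    = zer
  offsetF a (suc i) = sizeF ^ᶠ a zero ⊕ offsetF (a ∘ suc) i

module WordFns (w : Word) (cap : ℕ) (enough : (2 + length w) ^ 3 ≤ cap) where

  open Evaluation w cap

  2+w≤cap : 2 + length w ≤ cap
  2+w≤cap = ℕ.≤-trans (ℕ.m≤m*n (2 + length w) ((2 + length w) ^ 2) {{ℕ.m^n≢0 (2 + length w) 2}}) enough

  8≤cap : 8 ≤ cap
  8≤cap = ℕ.≤-trans (ℕ.^-monoˡ-≤ 3 {2} {2 + length w} (s≤s (s≤s z≤n))) enough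

  w≤cap : length w ≤ cap
  w≤cap = ℕ.≤-trans (ℕ.m≤n+m _ 2) 2+w≤cap

  open Truth w cap (ℕ.≤-trans (s≤s z≤n) 8≤cap)

  symbol-eval : ∀ {m} {ρ : Vec ℕ m} f {i} → eval f ρ ≡ i → i ≤ length w → eval (symbolF f) ρ ≡ symbol w i
  symbol-eval f refl h = cong (code ∘ readInput w) (ℕ.m≤n⇒m⊓n≡m (ℕ.≤-trans (s≤s h) (ℕ.≤-trans (ℕ.n≤1+n _) 2+w≤cap)))

  4-eval : ∀ {m} {ρ : Vec ℕ m} → eval (const# 4) ρ ≡ 4
  4-eval = const-eval 4 (ℕ.≤-trans (ℕ.m≤m+n 4 4) 8≤cap)

  bit-eval : ∀ {m} {ρ : Vec ℕ m} f g {x y} → eval f ρ ≡ x → eval g ρ ≡ y → eval (choose (f ≐ g) one zer) ρ ≡ bit≡ x y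
  bit-eval {ρ = ρ} f g {x} {y} ef eg with x ≡ᵇ y in e
  ... | true  = trans (choose-true (f ≐ g) one zer (from↔ (≐⇔ f g) (trans ef (trans (from↔ ≡ᵇ⇔ e) (sym eg))))) (one-eval {ρ = ρ})
  ... | false = choose-false (f ≐ g) one zer λ h → case trans (sym e) (to↔ ≡ᵇ⇔ (trans (sym ef) (trans (to↔ (≐⇔ f g) h) eg))) of λ ()

  opaque
    unfolding total

    total-eval : ∀ {m} {ρ : Vec ℕ m} b f {n} h → eval b ρ ≡ n → (∀ i → i < n → eval f (i ∷ ρ) ≡ h i) → sumTo h n ≤ cap → eval (total b f) ρ ≡ sumTo h n
    total-eval {ρ = ρ} b f {n} h refl eq le = trans (go n 0 eq (subst (_≤ cap) (sym (ℕ.+-identityʳ _)) le)) (ℕ.+-identityʳ _)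
      where
      go : ∀ n a → (∀ i → i < n → eval f (i ∷ ρ) ≡ h i) → sumTo h n + a ≤ cap →
           foldDown (λ i a → eval (skipping f ⊕ var 1F) (i ∷ a ∷ ρ)) n a ≡ sumTo h n + a
      go zero    a eq le = refl
      go (suc n) a eq le = trans (cong (foldDown _ n) (⊕-eval {ρ = n ∷ a ∷ ρ} (skipping f) (var 1F) (trans (skipping-eval f) (eq n (ℕ.n<1+n n))) refl
          (ℕ.m+n≤o⇒n≤o (sumTo h n) le′)))
        (trans (go n (h n + a) (λ i i<n → eq i (ℕ.m<n⇒m<1+n i<n)) le′) (sym (ℕ.+-assoc (sumTo h n) (h n) a)))
        where
        le′ : sumTo h n + (h n + a) ≤ cap
        le′ = subst (_≤ cap) (ℕ.+-assoc (sumTo h n) (h n) a) le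

  opaque
    unfolding tokenC
    delimsBefore-eval : ∀ i → i ≤ length w → eval delimsC (i ∷ []) ≡ delimsBefore w i
    delimsBefore-eval i h = trans (total-eval {ρ = i ∷ []} (var 0F) (choose (symbolF (var 0F) ≐ const# 4) one zer) {i} (is4 ∘ symbol w) refl
        (λ j j<i → bit-eval {ρ = j ∷ i ∷ []} (symbolF (var 0F)) (const# 4) (symbol-eval {ρ = j ∷ i ∷ []} (var 0F) refl (ℕ.≤-trans (ℕ.<⇒≤ j<i) h)) (4-eval {ρ = j ∷ i ∷ []}))
        (ℕ.≤-trans (ℕ.≤-reflexive (delims-symbols w i)) (ℕ.≤-trans (delimsBefore≤ w i) (ℕ.≤-trans (delims≤length w) w≤cap))))
      (delims-symbols w i)

    delims-eval : ∀ {m} {ρ : Vec ℕ m} → eval delimsF ρ ≡ delims w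
    delims-eval = trans (delimsBefore-eval (length w) ℕ.≤-refl) (delimsBefore-all w)

    rest-eval : ∀ {m} {ρ : Vec ℕ m} → eval restF ρ ≡ length (rest w)
    rest-eval = trans (total-eval {ρ = []} len (choose (comp delimsC (var 0F ∷ []) ≐ comp delimsC (len ∷ [])) one zer) (λ i → bit≡ (delimsBefore w i) (delims w)) refl
        (λ i i< → bit-eval {ρ = i ∷ []} (comp delimsC (var 0F ∷ [])) (comp delimsC (len ∷ [])) (delimsBefore-eval i (ℕ.<⇒≤ i<)) (trans (delimsBefore-eval (length w) ℕ.≤-refl) (delimsBefore-all w)))
        (ℕ.≤-trans (ℕ.≤-reflexive (rest-length w)) (ℕ.≤-trans (rest≤ w) w≤cap)))
      (rest-length w)
      where
      rest≤ : ∀ w → length (rest w) ≤ length w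
      rest≤ []       = z≤n
      rest≤ (2F ∷ w) = ℕ.m≤n⇒m≤1+n (rest≤ w)
      rest≤ (0F ∷ w) with delims w
      ... | zero  = ℕ.≤-refl
      ... | suc _ = ℕ.m≤n⇒m≤1+n (rest≤ w)
      rest≤ (1F ∷ w) with delims w
      ... | zero  = ℕ.≤-refl
      ... | suc _ = ℕ.m≤n⇒m≤1+n (rest≤ w)

  opaque
    unfolding tokenC
    token-trunc : ∀ {m} {ρ : Vec ℕ m} f → eval (tokenF f) ρ ≡ token w (eval f ρ) ⊓ cap
    token-trunc {ρ = ρ} f = trans (go (length w) 0 z≤n ℕ.≤-refl) (token-fold cap w j)
      where
      j : ℕ
      j = eval f ρ
      here? next body : Fn 3 3
      here? = comp delimsC (var 0F ∷ []) ≐ var 2F ∧ᶠ symbolF (var 0F) ≺ const# 4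
      next = prd (symbolF (var 0F)) ⊕ (var 1F ⊕ var 1F)
      body = choose here? next (var 1F)
      step : ∀ i a → i ≤ length w → a ≤ cap → eval body (i ∷ a ∷ j ∷ []) ≡ tokenStep cap w j i a
      step i a i≤ a≤ = decide ((delimsBefore w i ≡ᵇ j) ∧ (symbol w i <ᵇ 4)) here?⇔
        where
        ρ′ : Vec ℕ 3
        ρ′ = i ∷ a ∷ j ∷ []
        symbol′ : eval (symbolF (var 0F)) ρ′ ≡ symbol w i
        symbol′ = symbol-eval {ρ = ρ′} (var 0F) refl i≤
        here?⇔ : True here? ρ′ ⇔ ((delimsBefore w i ≡ᵇ j) ∧ (symbol w i <ᵇ 4) ≡ true)
        here?⇔ = ∧⇔ (comp delimsC (var 0F ∷ []) ≐ var 2F) (symbolF (var 0F) ≺ const# 4) ⟫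
          ((≐⇔ (comp delimsC (var 0F ∷ [])) (var 2F) ⟫ ≡⇔ (delimsBefore-eval i i≤) refl ⟫ ≡ᵇ⇔) ×⇔
           (≺⇔ (symbolF (var 0F)) (const# 4) ⟫ mk⇔ (subst₂ _<_ symbol′ (4-eval {ρ = ρ′})) (subst₂ _<_ (sym symbol′) (sym (4-eval {ρ = ρ′}))) ⟫ <ᵇ⇔)) ⟫ ∧≡true
        double : eval (var 1F ⊕ var 1F) ρ′ ≡ (a + a) ⊓ cap
        double = ⊕-trunc {ρ = ρ′} (var 1F) (var 1F) a≤
        value : eval next ρ′ ≡ (pred (symbol w i) + (a + a) ⊓ cap) ⊓ cap
        value = trans (⊕-trunc {ρ = ρ′} (prd (symbolF (var 0F))) (var 1F ⊕ var 1F) (subst (_≤ cap) (sym double) (ℕ.m⊓n≤n _ cap)))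
          (cong₂ (λ x y → (pred x + y) ⊓ cap) symbol′ double)
        decide : ∀ b → True here? ρ′ ⇔ (b ≡ true) → eval body ρ′ ≡ (if b then (pred (symbol w i) + (a + a) ⊓ cap) ⊓ cap else a)
        decide true  h = trans (choose-true here? next (var 1F) (from↔ h refl)) value
        decide false h = choose-false here? next (var 1F) λ t → case to↔ h t of λ ()
      go : ∀ n a → a ≤ cap → n ≤ length w → foldDown (λ i a → eval body (i ∷ a ∷ j ∷ [])) n a ≡ foldDown (tokenStep cap w j) n a
      go zero    a a≤ n≤ = refl
      go (suc n) a a≤ n≤ rewrite step n a (ℕ.<⇒≤ n≤) a≤ = go n _ (tokenStep≤ cap w j n a≤) (ℕ.<⇒≤ n≤)

-- Words that encode algebras

applyUpTo-++ : ∀ {A : Set} (T : ℕ → A) a b → applyUpTo T (a + b) ≡ applyUpTo T a ++ applyUpTo (λ j → T (a + j)) b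
applyUpTo-++ T zero    b = refl
applyUpTo-++ T (suc a) b = cong (T 0 ∷_) (applyUpTo-++ (T ∘ suc) a b)

applyUpTo-cong : ∀ {A : Set} {T U : ℕ → A} n → (∀ j → T j ≡ U j) → applyUpTo T n ≡ applyUpTo U n
applyUpTo-cong zero    h = refl
applyUpTo-cong (suc n) h = cong₂ _∷_ (h 0) (applyUpTo-cong n (h ∘ suc))

blocks-upTo : ∀ {m} (F : Fin m → List ℕ) (a : Fin m → ℕ) (T : ℕ → ℕ) → (∀ i → F i ≡ applyUpTo (λ j → T (offset a i + j)) (a i)) →
              concatMap F (allFin m) ≡ applyUpTo T (total# a)
blocks-upTo {zero}  F a T h = refl
blocks-upTo {suc m} F a T h = trans (concatMap-suc F) (trans (cong₂ _++_ (h zero)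
    (blocks-upTo (F ∘ suc) (a ∘ suc) (λ j → T (a zero + j)) λ i → trans (h (suc i)) (applyUpTo-cong (a (suc i)) λ j → cong T (ℕ.+-assoc (a zero) _ j))))
  (sym (applyUpTo-++ T (a zero) (total# (a ∘ suc)))))

total-const : ∀ m k → total# {m} (λ _ → k) ≡ m * k
total-const zero    k = refl
total-const (suc m) k = cong (k +_) (total-const m k)

tuples-upTo : ∀ {n} k (g : Vec (Fin n) k → ℕ) T → (∀ xs → g xs ≡ T (index xs)) → map g (tuples n k) ≡ applyUpTo T (n ^ k)
tuples-upTo zero    g T h = cong [_] (h [])
tuples-upTo {n} (suc k) g T h = trans (map-tuples g) (trans
  (blocks-upTo (λ x → map (g ∘ (x ∷_)) (tuples n k)) (λ _ → n ^ k) T λ x →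
    tuples-upTo k (g ∘ (x ∷_)) (λ j → T (offset (λ _ → n ^ k) x + j)) λ xs → trans (h (x ∷ xs)) (cong (λ y → T (y + index xs)) (sym (offset-const (n ^ k) x))))
  (cong (applyUpTo T) (total-const n (n ^ k))))

AllBelow : ℕ → List ℕ → Set
AllBelow n xs = ∀ j → j < length xs → nthL xs j < n

allBelow-++ : ∀ {n} xs {ys} → AllBelow n xs → AllBelow n ys → AllBelow n (xs ++ ys)
allBelow-++ []       h k = k
allBelow-++ (x ∷ xs) h k zero    l       = h 0 (s≤s z≤n)
allBelow-++ (x ∷ xs) h k (suc j) (s≤s l) = allBelow-++ xs (λ j l → h (suc j) (s≤s l)) k j l

allBelow-map : ∀ {A : Set} {n} {g : A → ℕ} → (∀ x → g x < n) → ∀ xs → AllBelow n (map g xs)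
allBelow-map h (x ∷ xs) zero    l       = h x
allBelow-map h (x ∷ xs) (suc j) (s≤s l) = allBelow-map h xs j l

allBelow-blocks : ∀ {n m} {F : Fin m → List ℕ} → (∀ i → AllBelow n (F i)) → AllBelow n (concatMap F (allFin m))
allBelow-blocks {m = zero}  h j ()
allBelow-blocks {n} {suc m} {F} h = subst (AllBelow n) (sym (concatMap-suc F)) (allBelow-++ (F zero) (h zero) (allBelow-blocks (h ∘ suc)))

module AlgebraWords (S : Signature) where

  sizes : ℕ → Fin (operations S) → ℕ
  sizes n f = n ^ arity S f

  entries : ℕ → ℕ
  entries n = total# (sizes n)

  record Matches (A : FiniteAlgebra S) (w : Word) : Set where
    open FiniteAlgebra A
    field
      size-token : token w 0 ≡ size
      entry      : ∀ f xs → token w (suc (offset (sizes size) f + index xs)) ≡ toℕ (op f xs)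

  -- Checkable by truncated functions, and by `word-eq` sufficient for the word to consist of the
  -- encoding of an algebra, `extra` numbers below its size and `tail` bare symbols.
  record Valid (w : Word) (extra tail : ℕ) : Set where
    field
      nonempty : 1 ≤ token w 0
      counted  : delims w ≡ suc (entries (token w 0) + extra)
      tailed   : length (rest w) ≡ tail
      below    : ∀ j → j < entries (token w 0) + extra → token w (suc j) < token w 0

  module _ (A : FiniteAlgebra S) where

    open FiniteAlgebra A

    values : Fin (operations S) → List ℕ
    values f = map (toℕ ∘ op f) (tuples size (arity S f))

    table : List ℕ
    table = concatMap values (allFin (operations S))

    length-values : ∀ f → length (values f) ≡ sizes size f
    length-values f = trans (List.length-map _ (tuples size (arity S f))) (length-tuples (arity S f))

    length-table : length table ≡ entries size
    length-table = length-blocks values (sizes size) length-values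

    encode-numbers : encodeAlgebra A ≡ numbers (size ∷ table)
    encode-numbers = cong (encodeℕ size ++_) (go (allFin (operations S)))
      where
      go : ∀ fs → concatMap (λ f → concatMap (encodeFin ∘ op f) (tuples size (arity S f))) fs ≡ numbers (concatMap values fs)
      go []       = refl
      go (f ∷ fs) = trans (cong₂ _++_ (sym (List.concatMap-map encodeℕ (toℕ ∘ op f) (tuples size (arity S f)))) (go fs))
        (sym (List.concatMap-++ encodeℕ (values f) (concatMap values fs)))

    size≥1 : 1 ≤ size
    size≥1 = positive size
      where
      positive : ∀ n .{{_ : NonZero n}} → 1 ≤ n
      positive (suc n) = s≤s z≤n

    module Encoded (es : List ℕ) (es< : AllBelow size es) (r : Word) (r-free : delims r ≡ 0) {w : Word}
                   (w≡ : encodeAlgebra A ++ (numbers es ++ r) ≡ w) where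

      all : List ℕ
      all = size ∷ table ++ es

      w-eq : w ≡ numbers all ++ r
      w-eq = trans (sym w≡) (trans (cong (_++ (numbers es ++ r)) encode-numbers) (trans (sym (List.++-assoc (numbers (size ∷ table)) (numbers es) r))
        (cong (_++ r) (sym (List.concatMap-++ encodeℕ (size ∷ table) es)))))

      token-eq : ∀ j → j < length all → token w j ≡ nthL all j
      token-eq j h = trans (cong (λ x → token x j) w-eq) (token-numbers r all j h)

      size-eq : token w 0 ≡ size
      size-eq = token-eq 0 (s≤s z≤n)

      length-tail : length (table ++ es) ≡ entries size + length es
      length-tail = trans (List.length-++ table) (cong (_+ length es) length-table)

      tail-token : ∀ j → j < entries size + length es → token w (suc j) ≡ nthL (table ++ es) j
      tail-token j h = token-eq (suc j) (s≤s (subst (j <_) (sym length-tail) h))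

      matches : Matches A w
      matches = record
        { size-token = size-eq
        ; entry      = λ f xs → trans (tail-token _ (ℕ.≤-trans (offset< (sizes size) f (index< xs)) (ℕ.m≤m+n _ _)))
            (trans (nthL-++ˡ table (subst (offset (sizes size) f + index xs <_) (sym length-table) (offset< (sizes size) f (index< xs))))
              (trans (nthL-blocks values (sizes size) length-values f (index< xs)) (nthL-tuples (toℕ ∘ op f) xs))) }

      extra-token : ∀ j → j < length es → token w (suc (entries size + j)) ≡ nthL es j
      extra-token j h = trans (tail-token _ (ℕ.+-monoʳ-< (entries size) h)) (trans (cong (λ x → nthL (table ++ es) (x + j)) (sym length-table)) (nthL-++ʳ table))

      rest-eq : rest w ≡ r
      rest-eq = trans (cong rest w-eq) (trans (rest-numbers r all) (rest-delimfree r r-free))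

      valid : Valid w (length es) (length r)
      valid = record
        { nonempty = subst (1 ≤_) (sym size-eq) size≥1
        ; counted  = trans (cong delims w-eq) (trans (delims-numbers r all) (trans (cong (length all +_) r-free) (trans (ℕ.+-identityʳ _)
                       (cong suc (trans length-tail (cong (λ n → entries n + length es) (sym size-eq)))))))
        ; tailed   = cong length rest-eq
        ; below    = λ j h → let h′ = subst (λ n → j < entries n + length es) size-eq h in
            subst₂ _<_ (sym (tail-token j h′)) (sym size-eq)
              (allBelow-++ table (allBelow-blocks {F = values} λ f → allBelow-map (λ xs → Fin.toℕ<n (op f xs)) (tuples size (arity S f))) es< j
                (subst (j <_) (sym length-tail) h′)) }

  module Decoded {w : Word} {extra tail : ℕ} (valid : Valid w extra tail) where

    open Valid valid

    n : ℕ
    n = token w 0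

    entry< : ∀ f (xs : Vec (Fin n) (arity S f)) → token w (suc (offset (sizes n) f + index xs)) < n
    entry< f xs = below _ (ℕ.≤-trans (offset< (sizes n) f (index< xs)) (ℕ.m≤m+n _ extra))

    decoded : FiniteAlgebra S
    decoded = record { size = n ; nonEmpty = >-nonZero nonempty ; op = λ f xs → fromℕ< (entry< f xs) }

    matches : Matches decoded w
    matches = record { size-token = refl ; entry = λ f xs → sym (Fin.toℕ-fromℕ< (entry< f xs)) }

    table-eq : table decoded ≡ applyUpTo (λ j → token w (suc j)) (entries n)
    table-eq = blocks-upTo (values decoded) (sizes n) (λ j → token w (suc j)) λ f →
      tuples-upTo (arity S f) _ (λ j → token w (suc (offset (sizes n) f + j))) λ xs → Fin.toℕ-fromℕ< (entry< f xs)

    extras : List ℕ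
    extras = applyUpTo (λ j → token w (suc (entries n + j))) extra

    -- Both words list the same numbers before the same rest; the tables agree because the
    -- lexicographic enumeration of tuples runs through their indices in order.
    word-eq : encodeAlgebra decoded ++ (numbers extras ++ rest w) ≡ w
    word-eq = sym (begin
      w                                                                  ≡⟨ word-tokens w ⟩
      numbers (applyUpTo (token w) (delims w)) ++ rest w                 ≡⟨ cong (λ k → numbers (applyUpTo (token w) k) ++ rest w) counted ⟩
      numbers (n ∷ applyUpTo (λ j → token w (suc j)) (entries n + extra)) ++ rest w
        ≡⟨ cong (λ xs → numbers (n ∷ xs) ++ rest w) (trans (applyUpTo-++ (λ j → token w (suc j)) (entries n) extra) (cong (_++ extras) (sym table-eq))) ⟩
      numbers ((n ∷ table decoded) ++ extras) ++ rest w                  ≡⟨ cong (_++ rest w) (List.concatMap-++ encodeℕ (n ∷ table decoded) extras) ⟩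
      (numbers (n ∷ table decoded) ++ numbers extras) ++ rest w          ≡⟨ List.++-assoc (numbers (n ∷ table decoded)) (numbers extras) (rest w) ⟩
      numbers (n ∷ table decoded) ++ (numbers extras ++ rest w)          ≡⟨ cong (_++ (numbers extras ++ rest w)) (sym (encode-numbers decoded)) ⟩
      encodeAlgebra decoded ++ (numbers extras ++ rest w)                ∎)
      where open ≡-Reasoning

-- Subsets as words

bits : (r : Word) → Subset (length r)
bits []       = []
bits (1F ∷ r) = true ∷ bits r
bits (_ ∷ r)  = false ∷ bits r

encode-bits : ∀ r → delims r ≡ 0 → encodeSubset (bits r) ≡ r
encode-bits []       h = refl
encode-bits (0F ∷ r) h = cong (0F ∷_) (encode-bits r h)
encode-bits (1F ∷ r) h = cong (1F ∷_) (encode-bits r h)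
encode-bits (2F ∷ r) ()

delims-rest : ∀ w → delims (rest w) ≡ 0
delims-rest []       = refl
delims-rest (2F ∷ w) = delims-rest w
delims-rest (0F ∷ w) with delims w in e
... | zero  = e
... | suc _ = delims-rest w
delims-rest (1F ∷ w) with delims w in e
... | zero  = e
... | suc _ = delims-rest w

delims-encodeSubset : ∀ {n} (C : Subset n) → delims (encodeSubset C) ≡ 0
delims-encodeSubset []          = refl
delims-encodeSubset (true ∷ C)  = delims-encodeSubset C
delims-encodeSubset (false ∷ C) = delims-encodeSubset C

length-encodeSubset : ∀ {n} (C : Subset n) → length (encodeSubset C) ≡ n
length-encodeSubset []          = refl
length-encodeSubset (true ∷ C)  = cong suc (length-encodeSubset C)
length-encodeSubset (false ∷ C) = cong suc (length-encodeSubset C)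

encodeSubset-∈ : ∀ {n} (C : Subset n) x → x ∈ C ⇔ (symbol (encodeSubset C) (toℕ x) ≡ 3)
encodeSubset-∈ C x = mk⇔ (to C x ∘ Vec.[]=⇒lookup) (λ h → Vec.lookup⇒[]= x C (from C x h))
  where
  to : ∀ {n} (C : Subset n) x → lookup C x ≡ true → symbol (encodeSubset C) (toℕ x) ≡ 3
  to (true ∷ C)  zero    h = refl
  to (true ∷ C)  (suc x) h = to C x h
  to (false ∷ C) (suc x) h = to C x h
  from : ∀ {n} (C : Subset n) x → symbol (encodeSubset C) (toℕ x) ≡ 3 → lookup C x ≡ true
  from (true ∷ C)  zero    h = refl
  from (false ∷ C) zero    ()
  from (true ∷ C)  (suc x) h = from C x h
  from (false ∷ C) (suc x) h = from C x h

symbol-++ : ∀ (u : Word) {r} x → symbol (u ++ r) (length u + x) ≡ symbol r x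
symbol-++ []      x = refl
symbol-++ (a ∷ u) x = symbol-++ u x

-- The three problems as formulas

module ProblemFormulas (S : Signature) where

  open AlgebraWords S

  orFinF : ∀ {m n} → (Fin n → Formula 3 m) → Formula 3 m
  orFinF {n = zero}  φ = at zer
  orFinF {n = suc n} φ = φ zero or orFinF (φ ∘ suc)

  totF : ∀ {m} → Fn 3 m
  totF = totalF (arity S)

  opaque
    validF : ℕ → Fn 3 0 → Fn 3 0
    validF extra tail = one ≼ sizeF ∧ᶠ delimsF ≐ (succ totF ⊕ const# extra) ∧ᶠ restF ≐ tail
      ∧ᶠ every (totF ⊕ const# extra) (tokenF (succ (var 0F)) ≺ sizeF)

  opaque
    -- The entry of the table of f at coordinates h before i, u at i, l after i.
    entryF : ∀ {m} f → Fin (arity S f) → Fn 3 m → Fn 3 m → Fn 3 m → Fn 3 m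
    entryF f i h u l = tokenF (succ (offsetF (arity S) f ⊕ ((h ⊗ sizeF ⊕ u) ⊗ sizeF ^ᶠ after {0} i ⊕ l)))

  opaque
    -- Operation and argument position range over finite sets fixed by the signature, so they are
    -- disjunctions. The other arguments are guessed as two numbers, the parts of the table index
    -- above and below the position, shared by both components of the pair.
    translateF : ∀ {m} → Formula 3 (4 + m)
    translateF = orFinF λ f → orFinF λ i → ex (ex (at (var 1F ≺ sizeF ^ᶠ toℕ i ∧ᶠ var 0F ≺ sizeF ^ᶠ after {0} i
      ∧ᶠ var 2F ≐ entryF f i (var 1F) (var 4F) (var 0F) ∧ᶠ var 3F ≐ entryF f i (var 1F) (var 5F) (var 0F))))

  opaque
    -- Variables 0 and 1 hold the image pair reached, variables 4 and 6 the new and the old element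
    -- of the chain; a link may be used in both directions.
    endsF : ∀ {m} → Fn 3 (8 + m)
    endsF = var 0F ≐ var 6F ∧ᶠ var 1F ≐ var 4F ∨ᶠ var 0F ≐ var 4F ∧ᶠ var 1F ≐ var 6F

  -- A single link of a chain is itself found by a walk, on pairs, that starts at a guessed
  -- generating pair: reachability nested in reachability.
  nearF : ∀ {m} → Fn 3 (6 + m) → Formula 3 (4 + m)
  nearF gen = at (var 0F ≺ sizeF) and ex (ex (at (var 1F ≺ sizeF ∧ᶠ var 0F ≺ sizeF ∧ᶠ gen)
    and reach (var 1F) (var 0F) translateF (at endsF)))

  chainF : ∀ {m} → Fin m → Fn 3 (6 + m) → Fn 3 (2 + m) → Formula 3 m
  chainF start gen end = reach (var start) zer (nearF gen) (at end)

  cgF : ∀ {m} → Fin m → Fin m → Fin m → Fin m → Formula 3 m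
  cgF a b c d = chainF a (var 1F ≐ var (6 ↑ʳ c) ∧ᶠ var 0F ≐ var (6 ↑ʳ d)) (var 0F ≐ var (2 ↑ʳ b))

  extraF : ∀ {m} → ℕ → Fn 3 m
  extraF j = tokenF (succ (totF ⊕ const# j))

  membershipF : Formula 3 0
  membershipF = at (validF 4 zer) and ex (ex (ex (ex
    (at (var 3F ≐ extraF 0 ∧ᶠ var 2F ≐ extraF 1 ∧ᶠ var 1F ≐ extraF 2 ∧ᶠ var 0F ≐ extraF 3) and cgF 3F 2F 1F 0F))))

  -- The quantifier over all pairs stays within NL since the pairs are tested one after another,
  -- each test guessing its own chain.
  irreducibleF : Formula 3 0
  irreducibleF = at (validF 0 zer) and ex (ex (at (var 1F ≺ sizeF ∧ᶠ var 0F ≺ sizeF ∧ᶠ neg (var 1F ≐ var 0F))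
    and all< sizeF (all< sizeF (at (var 1F ≐ var 0F) or cgF 3F 2F 1F 0F))))

  -- The characteristic string occupies the last `size` symbols of the word.
  bitF : ∀ {m} → Fn 3 m → Fn 3 m
  bitF f = symbolF ((len ⊖ sizeF) ⊕ f) ≐ const# 3

  -- Failure is the existential side of the problem. Words that encode no instance count as
  -- failures, so that the complement is the problem itself.
  noClassF : Formula 3 0
  noClassF = at (neg (validF 0 sizeF ∧ᶠ some sizeF (bitF (var 0F))))
    or ex (at (var 0F ≺ sizeF ∧ᶠ bitF (var 0F)) and chainF 0F (bitF (var 1F) ∧ᶠ bitF (var 0F)) (neg (bitF (var 0F))))

  -- Correctness of the formulas on a given word

  module FormulaSpecs (binary : ∃[ f ] 2 ≤ arity S f) (w : Word) (cap : ℕ) (enough : (2 + length w) ^ 3 ≤ cap) where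

    open WordFns w cap enough
    open Satisfaction w cap
    open Evaluation w cap
    open Truth w cap (ℕ.≤-trans (s≤s z≤n) 8≤cap)

    opaque
      unfolding _^ᶠ_

      ^-trunc : ∀ {m} {ρ : Vec ℕ m} f k → eval (f ^ᶠ k) ρ ≡ (eval f ρ ^ k) ⊓ cap
      ^-trunc {ρ = ρ} f zero    = trans (one-eval {ρ = ρ}) (sym (ℕ.m≤n⇒m⊓n≡m (ℕ.≤-trans (s≤s z≤n) 8≤cap)))
      ^-trunc {ρ = ρ} f (suc k) = trans (⊗-trunc f (f ^ᶠ k)) (trans (cong (λ x → (eval f ρ * x) ⊓ cap) (^-trunc f k)) (trunc-* (eval f ρ) (eval f ρ ^ k) cap))

    n̂ : ℕ
    n̂ = token w 0 ⊓ cap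

    opaque
      unfolding sizeF
      size-trunc : ∀ {m} {ρ : Vec ℕ m} → eval sizeF ρ ≡ n̂
      size-trunc {ρ = ρ} = token-trunc {ρ = ρ} zer

    power-trunc : ∀ {m} {ρ : Vec ℕ m} k → eval (sizeF ^ᶠ k) ρ ≡ (n̂ ^ k) ⊓ cap
    power-trunc {ρ = ρ} k = trans (^-trunc sizeF k) (cong (λ x → (x ^ k) ⊓ cap) (size-trunc {ρ = ρ}))

    sum-trunc : ∀ {m} {ρ : Vec ℕ m} f g {x y} → eval f ρ ≡ x ⊓ cap → eval g ρ ≡ y ⊓ cap → eval (f ⊕ g) ρ ≡ (x + y) ⊓ cap
    sum-trunc f g {x} {y} ef eg = trans (⊕-trunc f g (subst (_≤ cap) (sym eg) (ℕ.m⊓n≤n y cap))) (trans (cong₂ (λ a b → (a + b) ⊓ cap) ef eg) (trunc-++ x y cap))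

    opaque
      unfolding totalF
      total-trunc : ∀ {m k} {ρ : Vec ℕ m} (a : Fin k → ℕ) → eval (totalF a) ρ ≡ total# (λ i → n̂ ^ a i) ⊓ cap
      total-trunc {k = zero}  a = refl
      total-trunc {k = suc k} {ρ} a = sum-trunc (sizeF ^ᶠ a zero) (totalF (a ∘ suc)) (power-trunc {ρ = ρ} (a zero)) (total-trunc (a ∘ suc))

      offset-trunc : ∀ {m k} {ρ : Vec ℕ m} (a : Fin k → ℕ) i → eval (offsetF a i) ρ ≡ offset (λ i → n̂ ^ a i) i ⊓ cap
      offset-trunc a zero    = refl
      offset-trunc {ρ = ρ} a (suc i) = sum-trunc (sizeF ^ᶠ a zero) (offsetF (a ∘ suc) i) (power-trunc {ρ = ρ} (a zero)) (offset-trunc (a ∘ suc) i)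

    block≤total : ∀ {k} (a : Fin k → ℕ) i → a i ≤ total# a
    block≤total a zero    = ℕ.m≤m+n _ _
    block≤total a (suc i) = ℕ.≤-trans (block≤total (a ∘ suc) i) (ℕ.m≤n+m _ (a zero))

    -- The table of an operation of positive arity has at least `n` entries, each followed by a
    -- delimiter, so the size is bounded by the length of the word. With constants alone it could be
    -- exponential in that length.
    size≤entries : ∀ n → n ≤ entries n
    size≤entries zero      = z≤n
    size≤entries n@(suc _) = let (f , 2≤) = binary in
      ℕ.≤-trans (ℕ.≤-trans (ℕ.≤-reflexive (sym (ℕ.*-identityʳ n))) (ℕ.^-monoʳ-≤ n (ℕ.≤-trans (s≤s z≤n) 2≤))) (block≤total (sizes n) f)

    delims<cap : delims w < cap
    delims<cap = ℕ.≤-trans (s≤s (delims≤length w)) (ℕ.≤-trans (ℕ.n≤1+n _) 2+w≤cap)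

    untrunc : ∀ {x y} → x ⊓ cap ≡ y → y < cap → x ≡ y
    untrunc {x} e h with ℕ.≤-total x cap
    ... | inj₁ l = trans (sym (ℕ.m≤n⇒m⊓n≡m l)) e
    ... | inj₂ l = contradiction (trans (sym e) (ℕ.m≥n⇒m⊓n≡n l)) (ℕ.<⇒≢ h)

    const-trunc : ∀ {m} {ρ : Vec ℕ m} k → k ≤ 4 → eval (const# k) ρ ≡ k ⊓ cap
    const-trunc k h = trans (const-eval k k≤) (sym (ℕ.m≤n⇒m⊓n≡m k≤))
      where
      k≤ : k ≤ cap
      k≤ = ℕ.≤-trans h (ℕ.≤-trans (ℕ.m≤m+n 4 4) 8≤cap)

    bound-trunc : ∀ {m} {ρ : Vec ℕ m} k → k ≤ 4 → eval (totF ⊕ const# k) ρ ≡ (entries n̂ + k) ⊓ cap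
    bound-trunc {ρ = ρ} k h = sum-trunc totF (const# k) (total-trunc {ρ = ρ} (arity S)) (const-trunc {ρ = ρ} k h)

    count-trunc : ∀ {m} {ρ : Vec ℕ m} k → k ≤ 4 → eval (succ totF ⊕ const# k) ρ ≡ suc (entries n̂ + k) ⊓ cap
    count-trunc {ρ = ρ} k h = sum-trunc (succ totF) (const# k) {suc (entries n̂)}
      (trans (cong (λ x → suc x ⊓ cap) (total-trunc {ρ = ρ} (arity S))) (trunc-+ 1 (entries n̂) cap)) (const-trunc {ρ = ρ} k h)

    -- Once the number of delimiters is right, nothing has been truncated.
    n̂-exact : ∀ {k} → delims w ≡ suc (entries n̂ + k) → n̂ ≡ token w 0
    n̂-exact {k} e = sym (untrunc refl (ℕ.≤-<-trans (ℕ.≤-trans (size≤entries n̂) (ℕ.≤-trans (ℕ.m≤m+n _ k) (ℕ.≤-trans (ℕ.n≤1+n _) (ℕ.≤-reflexive (sym e))))) delims<cap))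

    n̂-exact′ : ∀ {k} → delims w ≡ suc (entries (token w 0) + k) → n̂ ≡ token w 0
    n̂-exact′ {k} e = ℕ.m≤n⇒m⊓n≡m (ℕ.≤-trans (ℕ.≤-trans (size≤entries (token w 0)) (ℕ.≤-trans (ℕ.m≤m+n _ k) (ℕ.≤-trans (ℕ.n≤1+n _) (ℕ.≤-reflexive (sym e))))) (ℕ.<⇒≤ delims<cap))

    opaque
      unfolding validF
      -- The test is made on truncated quantities. In its equation for the number of delimiters one
      -- side is below the cap; hence neither the other side nor the size was truncated, and the
      -- remaining comparisons are exact.
      valid⇔ : ∀ extra tailF (tail : ℕ → ℕ) → extra ≤ 4 → (n̂ ≡ token w 0 → eval tailF [] ≡ tail (token w 0)) →
               True (validF extra tailF) [] ⇔ Valid w extra (tail (token w 0))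
      valid⇔ extra tailF tail e≤4 et =
        ∧⇔ (one ≼ sizeF) _ ⟫ (≼⇔ one sizeF ×⇔ (∧⇔ (delimsF ≐ (succ totF ⊕ const# extra)) _ ⟫ (≐⇔ delimsF (succ totF ⊕ const# extra) ×⇔
        (∧⇔ (restF ≐ tailF) _ ⟫ (≐⇔ restF tailF ×⇔ every⇔ (totF ⊕ const# extra) (tokenF (succ (var 0F)) ≺ sizeF)))))) ⟫ mk⇔ to from
        where
        Raw : Set
        Raw = eval one [] ≤ eval sizeF [] × eval delimsF [] ≡ eval (succ totF ⊕ const# extra) [] × eval restF [] ≡ eval tailF []
          × (∀ j → j < eval (totF ⊕ const# extra) [] → True (tokenF (succ (var 0F)) ≺ sizeF) (j ∷ []))
        module Exactly (exact : n̂ ≡ token w 0) (count₁ : delims w ≡ suc (entries n̂ + extra)) where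
          bound≤ : entries n̂ + extra ≤ cap
          bound≤ = ℕ.≤-trans (ℕ.≤-trans (ℕ.n≤1+n _) (ℕ.≤-reflexive (sym count₁))) (ℕ.<⇒≤ delims<cap)
          bound-eval : eval (totF ⊕ const# extra) [] ≡ entries n̂ + extra
          bound-eval = trans (bound-trunc {ρ = []} extra e≤4) (ℕ.m≤n⇒m⊓n≡m bound≤)
          n̂≤ : n̂ ≤ cap
          n̂≤ = ℕ.m⊓n≤n (token w 0) cap
          below⇔ : ∀ j → j < entries n̂ + extra → True (tokenF (succ (var 0F)) ≺ sizeF) (j ∷ []) ⇔ (token w (suc j) < token w 0)
          below⇔ j h = ≺⇔ (tokenF (succ (var 0F))) sizeF ⟫ mk⇔
            (λ l → let l′ = subst₂ _<_ (trans (token-trunc {ρ = j ∷ []} (succ (var 0F))) (cong (λ x → token w x ⊓ cap) suc-j)) (size-trunc {ρ = j ∷ []}) l in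
                   subst₂ _<_ (sym (untrunc refl (ℕ.<-≤-trans l′ n̂≤))) exact l′)
            (λ l → subst₂ _<_ (sym (trans (token-trunc {ρ = j ∷ []} (succ (var 0F))) (trans (cong (λ x → token w x ⊓ cap) suc-j)
                     (ℕ.m≤n⇒m⊓n≡m (ℕ.≤-trans (ℕ.<⇒≤ l) (subst (_≤ cap) exact n̂≤)))))) (sym (trans (size-trunc {ρ = j ∷ []}) exact)) l)
            where
            suc-j : suc j ⊓ cap ≡ suc j
            suc-j = ℕ.m≤n⇒m⊓n≡m (ℕ.≤-trans h bound≤)
        to : Raw → Valid w extra (tail (token w 0))
        to (h₁ , h₂ , h₃ , h₄) = record
          { nonempty = subst (1 ≤_) exact (subst₂ _≤_ (one-eval {ρ = []}) (size-trunc {ρ = []}) h₁)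
          ; counted  = subst (λ n → delims w ≡ suc (entries n + extra)) exact count₁
          ; tailed   = trans (sym (rest-eval {ρ = []})) (trans h₃ (et exact))
          ; below    = λ j h → let h′ = subst (λ n → j < entries n + extra) (sym exact) h in to↔ (below⇔ j h′) (h₄ j (subst (j <_) (sym bound-eval) h′)) }
          where
          count₁ : delims w ≡ suc (entries n̂ + extra)
          count₁ = sym (untrunc (trans (sym (count-trunc {ρ = []} extra e≤4)) (trans (sym h₂) (delims-eval {ρ = []}))) delims<cap)
          exact : n̂ ≡ token w 0
          exact = n̂-exact count₁
          open Exactly exact count₁
        from : Valid w extra (tail (token w 0)) → Raw
        from v = subst₂ _≤_ (sym (one-eval {ρ = []})) (sym (trans (size-trunc {ρ = []}) exact)) nonempty
          , trans (delims-eval {ρ = []}) (trans count′ (sym (trans (count-trunc {ρ = []} extra e≤4)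
              (ℕ.m≤n⇒m⊓n≡m (ℕ.≤-trans (ℕ.≤-reflexive (sym count′)) (ℕ.<⇒≤ delims<cap))))))
          , trans (rest-eval {ρ = []}) (trans tailed (sym (et exact)))
          , λ j h → let h′ = subst (j <_) bound-eval h in from↔ (below⇔ j h′) (below j (subst (λ n → j < entries n + extra) exact h′))
          where
          open Valid v
          exact : n̂ ≡ token w 0
          exact = n̂-exact′ counted
          count′ : delims w ≡ suc (entries n̂ + extra)
          count′ = subst (λ n → delims w ≡ suc (entries n + extra)) (sym exact) counted
          open Exactly exact count′

    orFinF⇔ : ∀ {m k} {ρ : Vec ℕ m} (φ : Fin k → Formula 3 m) → Sat (orFinF φ) ρ ⇔ (∃[ i ] Sat (φ i) ρ)
    orFinF⇔ {k = zero}  φ = mk⇔ (λ ()) λ ()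
    orFinF⇔ {k = suc k} φ = (id⇔ ⊎⇔ orFinF⇔ (φ ∘ suc)) ⟫
      mk⇔ (λ { (inj₁ h) → zero , h ; (inj₂ (i , h)) → suc i , h }) λ { (zero , h) → inj₁ h ; (suc i , h) → inj₂ (i , h) }

    opaque
      unfolding endsF

      ends⇔ : ∀ {m} {ρ : Vec ℕ m} {u v g₁ g₂ z′ y′ z y} → True endsF (u ∷ v ∷ g₂ ∷ g₁ ∷ z′ ∷ y′ ∷ z ∷ y ∷ ρ) ⇔ ((u ≡ z × v ≡ z′) ⊎ (u ≡ z′ × v ≡ z))
      ends⇔ = ∨⇔ (var 0F ≐ var 6F ∧ᶠ var 1F ≐ var 4F) (var 0F ≐ var 4F ∧ᶠ var 1F ≐ var 6F) ⟫
        ((∧⇔ (var 0F ≐ var 6F) (var 1F ≐ var 4F) ⟫ (≐⇔ (var 0F) (var 6F) ×⇔ ≐⇔ (var 1F) (var 4F))) ⊎⇔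
         (∧⇔ (var 0F ≐ var 4F) (var 1F ≐ var 6F) ⟫ (≐⇔ (var 0F) (var 4F) ×⇔ ≐⇔ (var 1F) (var 6F))))

    module Matched (A : FiniteAlgebra S) (matches : Matches A w) (fits : entries (FiniteAlgebra.size A) < delims w) where

      open FiniteAlgebra A
      open Matches matches

      private
        n : ℕ
        n = size

      1≤n : 1 ≤ n
      1≤n = size≥1 A

      instance
        n≢0 : NonZero n
        n≢0 = >-nonZero 1≤n

      entries≤ : entries n ≤ cap
      entries≤ = ℕ.<⇒≤ (ℕ.<-trans fits delims<cap)

      n≤cap : n ≤ cap
      n≤cap = ℕ.≤-trans (size≤entries n) entries≤

      n̂≡n : n̂ ≡ n
      n̂≡n = trans (cong (_⊓ cap) size-token) (ℕ.m≤n⇒m⊓n≡m n≤cap)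

      size-eval : ∀ {m} {ρ : Vec ℕ m} → eval sizeF ρ ≡ n
      size-eval {ρ = ρ} = trans (size-trunc {ρ = ρ}) n̂≡n

      power-eval : ∀ {m} {ρ : Vec ℕ m} k → n ^ k ≤ cap → eval (sizeF ^ᶠ k) ρ ≡ n ^ k
      power-eval {ρ = ρ} k h = trans (power-trunc {ρ = ρ} k) (trans (cong (λ x → (x ^ k) ⊓ cap) n̂≡n) (ℕ.m≤n⇒m⊓n≡m h))

      <size⇔ : ∀ {m} {ρ : Vec ℕ m} f → True (f ≺ sizeF) ρ ⇔ (eval f ρ < n)
      <size⇔ {ρ = ρ} f = subst (λ x → True (f ≺ sizeF) ρ ⇔ (eval f ρ < x)) (size-eval {ρ = ρ}) (≺⇔ f sizeF)

      module _ (f : Fin (operations S)) (i : Fin (arity S f)) where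

        private
          q : ℕ
          q = n ^ after {n} i

        after≡ : ∀ {k} (i : Fin k) → after {0} i ≡ after {n} i
        after≡ {suc k} zero    = refl
        after≡ {suc k} (suc i) = after≡ i

        arity≤ : n ^ arity S f ≤ cap
        arity≤ = ℕ.≤-trans (block≤total (sizes n) f) entries≤

        before≤ : n ^ toℕ i ≤ cap
        before≤ = ℕ.≤-trans (ℕ.≤-trans (ℕ.m≤m*n (n ^ toℕ i) (n * q) {{ℕ.m*n≢0 n q {{n≢0}} {{ℕ.m^n≢0 n (after {n} i)}}}}) (ℕ.≤-reflexive (sym (power-split i)))) arity≤

        after≤ : q ≤ cap
        after≤ = ℕ.≤-trans (ℕ.≤-trans (ℕ.≤-trans (ℕ.m≤n*m q n) (ℕ.m≤n*m (n * q) (n ^ toℕ i) {{ℕ.m^n≢0 n (toℕ i)}})) (ℕ.≤-reflexive (sym (power-split i)))) arity≤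

        after-eval : ∀ {m} {ρ : Vec ℕ m} → eval (sizeF ^ᶠ after {0} i) ρ ≡ q
        after-eval {ρ = ρ} = subst (λ k → eval (sizeF ^ᶠ k) ρ ≡ q) (sym (after≡ i)) (power-eval {ρ = ρ} (after {n} i) after≤)

        opaque
          unfolding entryF
          entry-eval : ∀ {m} {ρ : Vec ℕ m} hF uF lF xs (U : Carrier) → eval hF ρ ≡ high xs i → eval uF ρ ≡ toℕ U → eval lF ρ ≡ low xs i →
                       eval (entryF f i hF uF lF) ρ ≡ toℕ (op f (xs [ i ]≔ U))
          entry-eval {m} {ρ} hF uF lF xs U eh eu el =
            trans (token-trunc {ρ = ρ} (succ posF)) (trans (cong (λ x → token w x ⊓ cap) (succ-eval {ρ = ρ} posF pos-eval (ℕ.≤-trans (offset< (sizes n) f (index< (xs [ i ]≔ U))) entries≤)))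
              (trans (cong (_⊓ cap) (entry f (xs [ i ]≔ U))) (ℕ.m≤n⇒m⊓n≡m (ℕ.≤-trans (ℕ.<⇒≤ (Fin.toℕ<n (op f (xs [ i ]≔ U)))) n≤cap))))
            where
            posF innerF : Fn 3 m
            innerF = hF ⊗ sizeF ⊕ uF
            posF = offsetF (arity S) f ⊕ (innerF ⊗ sizeF ^ᶠ after {0} i ⊕ lF)
            h u l : ℕ
            h = high xs i
            u = toℕ U
            l = low xs i
            index≤ : (h * n + u) * q + l ≤ cap
            index≤ = ℕ.≤-trans (ℕ.≤-reflexive (sym (index-update xs i U))) (ℕ.≤-trans (ℕ.<⇒≤ (index< (xs [ i ]≔ U))) arity≤)
            product≤ : (h * n + u) * q ≤ cap
            product≤ = ℕ.m+n≤o⇒m≤o _ index≤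
            inner≤ : h * n + u ≤ cap
            inner≤ = ℕ.≤-trans (ℕ.m≤m*n (h * n + u) q {{ℕ.m^n≢0 n (after {n} i)}}) product≤
            inner-eval : eval innerF ρ ≡ h * n + u
            inner-eval = ⊕-eval {ρ = ρ} (hF ⊗ sizeF) uF (⊗-eval {ρ = ρ} hF sizeF eh (size-eval {ρ = ρ}) (ℕ.m+n≤o⇒m≤o _ inner≤)) eu inner≤
            offset-eval : eval (offsetF (arity S) f) ρ ≡ offset (sizes n) f
            offset-eval = trans (offset-trunc {ρ = ρ} (arity S) f) (trans (cong (λ x → offset (sizes x) f ⊓ cap) n̂≡n)
              (ℕ.m≤n⇒m⊓n≡m (ℕ.≤-trans (ℕ.m≤m+n _ _) (ℕ.≤-trans (ℕ.<⇒≤ (offset< (sizes n) f (index< (xs [ i ]≔ U)))) entries≤))))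
            pos-eval : eval posF ρ ≡ offset (sizes n) f + index (xs [ i ]≔ U)
            pos-eval = ⊕-eval {ρ = ρ} (offsetF (arity S) f) (innerF ⊗ sizeF ^ᶠ after {0} i ⊕ lF) offset-eval
              (trans (⊕-eval {ρ = ρ} (innerF ⊗ sizeF ^ᶠ after {0} i) lF (⊗-eval {ρ = ρ} innerF (sizeF ^ᶠ after {0} i) inner-eval (after-eval {ρ = ρ}) product≤) el index≤) (sym (index-update xs i U)))
              (ℕ.≤-trans (ℕ.<⇒≤ (offset< (sizes n) f (index< (xs [ i ]≔ U)))) entries≤)

      module Generated (Gen : Carrier → Carrier → Set) where

        open Chains A Gen

        carrier≤ : ∀ (U : Carrier) → toℕ U ≤ cap
        carrier≤ U = ℕ.≤-trans (ℕ.<⇒≤ (Fin.toℕ<n U)) n≤cap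

        opaque
          unfolding translateF
          translate⇔ : ∀ {m} {ρ : Vec ℕ m} U V u′ v′ → Sat translateF (u′ ∷ v′ ∷ toℕ U ∷ toℕ V ∷ ρ) ⇔
                       (∃₂ λ U′ V′ → (u′ ≡ toℕ U′ × v′ ≡ toℕ V′) × Translates (U , V) (U′ , V′))
          translate⇔ {m} {ρ} U V u′ v′ = orFinF⇔ {ρ = ρ₄} _ ⟫ (∃⇔ λ f → orFinF⇔ {ρ = ρ₄} _) ⟫ mk⇔ to from
            where
            ρ₄ : Vec ℕ (4 + m)
            ρ₄ = u′ ∷ v′ ∷ toℕ U ∷ toℕ V ∷ ρ
            condF : ∀ f → Fin (arity S f) → Fn 3 (6 + m)
            condF f i = var 1F ≺ sizeF ^ᶠ toℕ i ∧ᶠ var 0F ≺ sizeF ^ᶠ after {0} i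
              ∧ᶠ var 2F ≐ entryF f i (var 1F) (var 4F) (var 0F) ∧ᶠ var 3F ≐ entryF f i (var 1F) (var 5F) (var 0F)
            cond⇔ : ∀ f i {h l} → True (condF f i) (l ∷ h ∷ ρ₄) ⇔ (h < n ^ toℕ i × l < n ^ after {n} i
              × u′ ≡ eval (entryF f i (var 1F) (var 4F) (var 0F)) (l ∷ h ∷ ρ₄) × v′ ≡ eval (entryF f i (var 1F) (var 5F) (var 0F)) (l ∷ h ∷ ρ₄))
            cond⇔ f i {h} {l} = ∧⇔ (var 1F ≺ sizeF ^ᶠ toℕ i) _ ⟫
              ((≺⇔ (var 1F) (sizeF ^ᶠ toℕ i) ⟫ mk⇔ (subst (h <_) (power-eval {ρ = l ∷ h ∷ ρ₄} (toℕ i) (before≤ f i))) (subst (h <_) (sym (power-eval {ρ = l ∷ h ∷ ρ₄} (toℕ i) (before≤ f i))))) ×⇔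
               (∧⇔ (var 0F ≺ sizeF ^ᶠ after {0} i) _ ⟫
                ((≺⇔ (var 0F) (sizeF ^ᶠ after {0} i) ⟫ mk⇔ (subst (l <_) (after-eval f i {ρ = l ∷ h ∷ ρ₄})) (subst (l <_) (sym (after-eval f i {ρ = l ∷ h ∷ ρ₄})))) ×⇔
                 (∧⇔ (var 2F ≐ entryF f i (var 1F) (var 4F) (var 0F)) (var 3F ≐ entryF f i (var 1F) (var 5F) (var 0F)) ⟫
                  (≐⇔ (var 2F) (entryF f i (var 1F) (var 4F) (var 0F)) ×⇔ ≐⇔ (var 3F) (entryF f i (var 1F) (var 5F) (var 0F)))))))
            to : (∃[ f ] ∃[ i ] ∃[ h ] h ≤ cap × (∃[ l ] l ≤ cap × True (condF f i) (l ∷ h ∷ ρ₄))) → ∃₂ λ U′ V′ → (u′ ≡ toℕ U′ × v′ ≡ toℕ V′) × Translates (U , V) (U′ , V′)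
            to (f , i , h , _ , l , _ , c) with to↔ (cond⇔ f i {h} {l}) c
            ... | h< , l< , eu , ev with unsplit i U h< l<
            ... | xs , refl , refl = op f (xs [ i ]≔ U) , op f (xs [ i ]≔ V) ,
              (trans eu (entry-eval f i {ρ = low xs i ∷ high xs i ∷ ρ₄} (var 1F) (var 4F) (var 0F) xs U refl refl refl) ,
               trans ev (entry-eval f i {ρ = low xs i ∷ high xs i ∷ ρ₄} (var 1F) (var 5F) (var 0F) xs V refl refl refl)) , f , i , xs , refl , refl
            from : (∃₂ λ U′ V′ → (u′ ≡ toℕ U′ × v′ ≡ toℕ V′) × Translates (U , V) (U′ , V′)) → ∃[ f ] ∃[ i ] ∃[ h ] h ≤ cap × (∃[ l ] l ≤ cap × True (condF f i) (l ∷ h ∷ ρ₄))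
            from (_ , _ , (eu , ev) , f , i , xs , refl , refl) = f , i , high xs i , ℕ.≤-trans (ℕ.<⇒≤ (high< xs i)) (before≤ f i) ,
              low xs i , ℕ.≤-trans (ℕ.<⇒≤ (low< xs i)) (after≤ f i) , from↔ (cond⇔ f i {high xs i} {low xs i}) (high< xs i , low< xs i ,
                trans eu (sym (entry-eval f i {ρ = low xs i ∷ high xs i ∷ ρ₄} (var 1F) (var 4F) (var 0F) xs U refl refl refl)) ,
                trans ev (sym (entry-eval f i {ρ = low xs i ∷ high xs i ∷ ρ₄} (var 1F) (var 5F) (var 0F) xs V refl refl refl)))

        images-to : ∀ {m} {ρ : Vec ℕ m} {x y x′ y′} → Star (Link translateF ρ) (x , y) (x′ , y′) → ∀ U V → x ≡ toℕ U → y ≡ toℕ V →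
                    ∃₂ λ U′ V′ → (x′ ≡ toℕ U′ × y′ ≡ toℕ V′) × Star Translates (U , V) (U′ , V′)
        images-to ε U V e e′ = U , V , (e , e′) , ε
        images-to {ρ = ρ} (_◅_ {j = x₁ , y₁} (_ , _ , h) p) U V refl refl with to↔ (translate⇔ {ρ = ρ} U V x₁ y₁) h
        ... | U₁ , V₁ , (e , f) , t with images-to p U₁ V₁ e f
        ... | U′ , V′ , es , ts = U′ , V′ , es , t ◅ ts

        images-from : ∀ {m} {ρ : Vec ℕ m} {U V U′ V′} → Star Translates (U , V) (U′ , V′) → Star (Link translateF ρ) (toℕ U , toℕ V) (toℕ U′ , toℕ V′)
        images-from ε = ε
        images-from {ρ = ρ} {U} {V} (_◅_ {j = U₁ , V₁} t ts) = (carrier≤ U₁ , carrier≤ V₁ , from↔ (translate⇔ {ρ = ρ} U V (toℕ U₁) (toℕ V₁)) (U₁ , V₁ , (refl , refl) , t)) ◅ images-from ts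

        module _ {m} {ρ : Vec ℕ m} (gen : Fn 3 (6 + m)) (gen⇔ : ∀ {g₁ g₂ z′ y′ z y} → True gen (toℕ g₂ ∷ toℕ g₁ ∷ z′ ∷ y′ ∷ z ∷ y ∷ ρ) ⇔ Gen g₁ g₂) where

          near⇔ : ∀ {z′ y′ y} Z → Sat (nearF gen) (z′ ∷ y′ ∷ toℕ Z ∷ y ∷ ρ) ⇔ (∃[ Z′ ] z′ ≡ toℕ Z′ × Near Z Z′)
          near⇔ {z′} {y′} {y} Z = mk⇔ to from
            where
            ρ₄ : Vec ℕ (4 + m)
            ρ₄ = z′ ∷ y′ ∷ toℕ Z ∷ y ∷ ρ
            start⇔ : ∀ {g₁ g₂} → True (var 1F ≺ sizeF ∧ᶠ var 0F ≺ sizeF ∧ᶠ gen) (g₂ ∷ g₁ ∷ ρ₄) ⇔ (g₁ < n × g₂ < n × True gen (g₂ ∷ g₁ ∷ ρ₄))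
            start⇔ {g₁} {g₂} = ∧⇔ (var 1F ≺ sizeF) _ ⟫ (<size⇔ {ρ = g₂ ∷ g₁ ∷ ρ₄} (var 1F) ×⇔ (∧⇔ (var 0F ≺ sizeF) gen ⟫ (<size⇔ {ρ = g₂ ∷ g₁ ∷ ρ₄} (var 0F) ×⇔ id⇔)))
            to : Sat (nearF gen) ρ₄ → ∃[ Z′ ] z′ ≡ toℕ Z′ × Near Z Z′
            to (z<ᶠ , g₁ , _ , g₂ , _ , st , u , v , p , e) with to↔ (start⇔ {g₁} {g₂}) st
            ... | g₁< , g₂< , g
              with images-to {ρ = g₂ ∷ g₁ ∷ ρ₄} p (fromℕ< g₁<) (fromℕ< g₂<) (sym (Fin.toℕ-fromℕ< g₁<)) (sym (Fin.toℕ-fromℕ< g₂<))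
            ... | U , V , (refl , refl) , ts = fromℕ< z< , sym (Fin.toℕ-fromℕ< z<) , near (to↔ (ends⇔ {ρ = ρ} {g₁ = g₁} {g₂} {y′ = y′} {y = y}) e)
              where
              z< : z′ < n
              z< = to↔ (<size⇔ {ρ = ρ₄} (var 0F)) z<ᶠ
              image : Image U V
              image = fromℕ< g₁< , fromℕ< g₂< , to↔ gen⇔ (subst₂ (λ a b → True gen (b ∷ a ∷ ρ₄)) (sym (Fin.toℕ-fromℕ< g₁<)) (sym (Fin.toℕ-fromℕ< g₂<)) g) , ts
              same : ∀ {W} → toℕ W ≡ z′ → W ≡ fromℕ< z<
              same e = Fin.toℕ-injective (trans e (sym (Fin.toℕ-fromℕ< z<)))
              near : (toℕ U ≡ toℕ Z × toℕ V ≡ z′) ⊎ (toℕ U ≡ z′ × toℕ V ≡ toℕ Z) → Near Z (fromℕ< z<)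
              near (inj₁ (a , b)) = inj₁ (subst₂ Image (Fin.toℕ-injective a) (same b) image)
              near (inj₂ (a , b)) = inj₂ (subst₂ Image (same a) (Fin.toℕ-injective b) image)
            from : (∃[ Z′ ] z′ ≡ toℕ Z′ × Near Z Z′) → Sat (nearF gen) ρ₄
            from (Z′ , refl , near) = from↔ (<size⇔ {ρ = ρ₄} (var 0F)) (Fin.toℕ<n Z′) , inner near
              where
              build : ∀ {U V} → Image U V → ((toℕ U ≡ toℕ Z × toℕ V ≡ toℕ Z′) ⊎ (toℕ U ≡ toℕ Z′ × toℕ V ≡ toℕ Z)) →
                      Sat (ex (ex (at (var 1F ≺ sizeF ∧ᶠ var 0F ≺ sizeF ∧ᶠ gen) and reach (var 1F) (var 0F) translateF (at endsF)))) ρ₄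
              build {U} {V} (g₁ , g₂ , g , ts) e = toℕ g₁ , carrier≤ g₁ , toℕ g₂ , carrier≤ g₂ ,
                from↔ (start⇔ {toℕ g₁} {toℕ g₂}) (Fin.toℕ<n g₁ , Fin.toℕ<n g₂ , from↔ gen⇔ g) ,
                toℕ U , toℕ V , images-from ts , from↔ (ends⇔ {ρ = ρ} {g₁ = toℕ g₁} {toℕ g₂} {y′ = y′} {y = y}) e
              inner : Near Z Z′ → Sat (ex (ex (at (var 1F ≺ sizeF ∧ᶠ var 0F ≺ sizeF ∧ᶠ gen) and reach (var 1F) (var 0F) translateF (at endsF)))) ρ₄
              inner (inj₁ i) = build i (inj₁ (refl , refl))
              inner (inj₂ i) = build i (inj₂ (refl , refl))

          chain⇔ : ∀ start (end : Fn 3 (2 + m)) (End : Carrier → Set) → (∀ {Z y} → True end (toℕ Z ∷ y ∷ ρ) ⇔ End Z) → ∀ a → lookup ρ start ≡ toℕ a →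
                   Sat (chainF start gen end) ρ ⇔ (∃[ Z ] Chain a Z × End Z)
          chain⇔ start end End end⇔ a ea = mk⇔ to from
            where
            path-to : ∀ {x y x′ y′} → Star (Link (nearF gen) ρ) (x , y) (x′ , y′) → ∀ Z → x ≡ toℕ Z → ∃[ Z′ ] x′ ≡ toℕ Z′ × Chain Z Z′
            path-to ε Z e = Z , e , ε
            path-to ((_ , _ , h) ◅ p) Z refl with to↔ (near⇔ Z) h
            ... | Z₁ , e₁ , nr with path-to p Z₁ e₁
            ... | Z′ , e′ , c = Z′ , e′ , nr ◅ c
            path-from : ∀ {Z Z′} → Chain Z Z′ → Star (Link (nearF gen) ρ) (toℕ Z , 0) (toℕ Z′ , 0)
            path-from ε = ε
            path-from {Z} (_◅_ {j = Z₁} nr c) = (carrier≤ Z₁ , z≤n , from↔ (near⇔ Z) (Z₁ , refl , nr)) ◅ path-from c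
            to : Sat (chainF start gen end) ρ → ∃[ Z ] Chain a Z × End Z
            to (x , y , p , e) with path-to p a ea
            ... | Z , refl , c = Z , c , to↔ end⇔ e
            from : (∃[ Z ] Chain a Z × End Z) → Sat (chainF start gen end) ρ
            from (Z , c , e) = toℕ Z , 0 , subst (λ x → Star (Link (nearF gen) ρ) (x , 0) (toℕ Z , 0)) (sym ea) (path-from c) , from↔ end⇔ e

      toℕ⇔ : ∀ {x y : Carrier} → (toℕ x ≡ toℕ y) ⇔ (x ≡ y)
      toℕ⇔ = mk⇔ Fin.toℕ-injective (cong toℕ)

      cg⇔ : ∀ {m} {ρ : Vec ℕ m} a b c d (A′ B C D : Carrier) → lookup ρ a ≡ toℕ A′ → lookup ρ b ≡ toℕ B → lookup ρ c ≡ toℕ C → lookup ρ d ≡ toℕ D →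
            Sat (cgF a b c d) ρ ⇔ Cg A C D A′ B
      cg⇔ {m} {ρ} a b c d A′ B C D ea eb ec ed =
        chain⇔ {ρ = ρ} (var 1F ≐ var (6 ↑ʳ c) ∧ᶠ var 0F ≐ var (6 ↑ʳ d))
          (∧⇔ (var 1F ≐ var (6 ↑ʳ c)) (var 0F ≐ var (6 ↑ʳ d)) ⟫
            ((≐⇔ (var 1F) (var (6 ↑ʳ c)) ⟫ ≡⇔ refl ec ⟫ toℕ⇔) ×⇔ (≐⇔ (var 0F) (var (6 ↑ʳ d)) ⟫ ≡⇔ refl ed ⟫ toℕ⇔)))
          a (var 0F ≐ var (2 ↑ʳ b)) (_≡ B) (≐⇔ (var 0F) (var (2 ↑ʳ b)) ⟫ ≡⇔ refl eb ⟫ toℕ⇔) A′ ea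
        ⟫ mk⇔ (λ { (_ , ch , refl) → ch }) (λ ch → B , ch , refl) ⟫ chain⇔Cg A C D
        where open Generated (λ x y → x ≡ C × y ≡ D)

-- The formulas describe the problems

module Interpretation (S : Signature) (binary : ∃[ f ] 2 ≤ arity S f) (w : Word) (cap : ℕ) (enough : (2 + length w) ^ 3 ≤ cap) where

  open AlgebraWords S
  open ProblemFormulas S
  open FormulaSpecs binary w cap enough
  open WordFns w cap enough
  open Satisfaction w cap
  open Evaluation w cap
  open Truth w cap (ℕ.≤-trans (s≤s z≤n) 8≤cap)

  valid-zero⇔ : ∀ extra → extra ≤ 4 → True (validF extra zer) [] ⇔ Valid w extra 0
  valid-zero⇔ extra e≤4 = valid⇔ extra zer (λ _ → 0) e≤4 (λ _ → refl)

  valid-size⇔ : True (validF 0 sizeF) [] ⇔ Valid w 0 (token w 0)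
  valid-size⇔ = valid⇔ 0 sizeF id z≤n (trans (size-trunc {ρ = []}))

  fits : ∀ {n extra tail} → token w 0 ≡ n → Valid w extra tail → entries n + extra < delims w
  fits refl v = ℕ.≤-reflexive (sym (Valid.counted v))

  module Member (A : FiniteAlgebra S) (a b c d : FiniteAlgebra.Carrier A)
                (w≡ : encodeAlgebra A ++ encodeFin a ++ encodeFin b ++ encodeFin c ++ encodeFin d ≡ w) where

    open FiniteAlgebra A

    es : List ℕ
    es = toℕ a ∷ toℕ b ∷ toℕ c ∷ toℕ d ∷ []

    es< : AllBelow size es
    es< 0 _ = Fin.toℕ<n a
    es< 1 _ = Fin.toℕ<n b
    es< 2 _ = Fin.toℕ<n c
    es< 3 _ = Fin.toℕ<n d
    es< (suc (suc (suc (suc _)))) (s≤s (s≤s (s≤s (s≤s ()))))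

    open Encoded A es es< [] refl (trans (cong (encodeAlgebra A ++_) (trans (List.++-identityʳ (numbers es))
      (cong (λ u → encodeFin a ++ encodeFin b ++ encodeFin c ++ u) (List.++-identityʳ (encodeFin d))))) w≡)

    room : entries size + 4 < delims w
    room = fits size-eq valid

    open Matched A matches (ℕ.≤-<-trans (ℕ.m≤m+n _ 4) room)

    extra-eval : ∀ {m} {ρ : Vec ℕ m} j → j < 4 → eval (extraF j) ρ ≡ nthL es j
    extra-eval {ρ = ρ} j j<4 = trans (token-trunc {ρ = ρ} (succ (totF ⊕ const# j))) (trans (cong (λ x → token w x ⊓ cap) position)
      (trans (cong (_⊓ cap) (extra-token j j<4)) (ℕ.m≤n⇒m⊓n≡m (ℕ.≤-trans (ℕ.<⇒≤ (es< j j<4)) n≤cap))))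
      where
      position≤ : suc (entries size + j) ≤ cap
      position≤ = ℕ.≤-trans (s≤s (ℕ.+-monoʳ-≤ (entries size) (ℕ.<⇒≤ j<4))) (ℕ.≤-trans room (ℕ.<⇒≤ delims<cap))
      position : eval (succ (totF ⊕ const# j)) ρ ≡ suc (entries size + j)
      position = succ-eval {ρ = ρ} (totF ⊕ const# j) (trans (bound-trunc {ρ = ρ} j (ℕ.<⇒≤ j<4))
        (trans (cong (λ n → (entries n + j) ⊓ cap) n̂≡n) (ℕ.m≤n⇒m⊓n≡m (ℕ.≤-trans (ℕ.n≤1+n _) position≤)))) position≤

    extras⇔ : ∀ {x y z u} → True (var 3F ≐ extraF 0 ∧ᶠ var 2F ≐ extraF 1 ∧ᶠ var 1F ≐ extraF 2 ∧ᶠ var 0F ≐ extraF 3) (u ∷ z ∷ y ∷ x ∷ []) ⇔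
              (x ≡ toℕ a × y ≡ toℕ b × z ≡ toℕ c × u ≡ toℕ d)
    extras⇔ {x} {y} {z} {u} =
      ∧⇔ (var 3F ≐ extraF 0) _ ⟫ (is 3F 0 (s≤s z≤n) ×⇔ (∧⇔ (var 2F ≐ extraF 1) _ ⟫ (is 2F 1 (s≤s (s≤s z≤n)) ×⇔
      (∧⇔ (var 1F ≐ extraF 2) (var 0F ≐ extraF 3) ⟫ (is 1F 2 (s≤s (s≤s (s≤s z≤n))) ×⇔ is 0F 3 ℕ.≤-refl)))))
      where
      ρ : Vec ℕ 4
      ρ = u ∷ z ∷ y ∷ x ∷ []
      is : ∀ i j → j < 4 → True (var i ≐ extraF j) ρ ⇔ (lookup ρ i ≡ nthL es j)
      is i j h = ≐⇔ (var i) (extraF j) ⟫ ≡⇔ refl (extra-eval {ρ = ρ} j h)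

    membership⇔ : Cg A c d a b ⇔ Sat membershipF []
    membership⇔ = mk⇔
      (λ h → from↔ (valid-zero⇔ 4 ℕ.≤-refl) valid , toℕ a , below a , toℕ b , below b , toℕ c , below c , toℕ d , below d ,
        from↔ extras⇔ (refl , refl , refl , refl) , from↔ (cg⇔ 3F 2F 1F 0F a b c d refl refl refl refl) h)
      λ (_ , x , _ , y , _ , z , _ , u , _ , es , h) → let (ea , eb , ec , ed) = to↔ (extras⇔ {x} {y} {z} {u}) es in
        to↔ (cg⇔ 3F 2F 1F 0F a b c d ea eb ec ed) h
      where
      below : ∀ (x : Carrier) → toℕ x ≤ cap
      below x = ℕ.≤-trans (ℕ.<⇒≤ (Fin.toℕ<n x)) n≤cap

  decode-membership : Sat membershipF [] → ∃[ I ] DecisionProblem.encode (PrincipalCongruenceMembership S) I ≡ w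
  decode-membership (v , _) = (decoded , (element 0F , element 1F) , (element 2F , element 3F)) , trans (cong (encodeAlgebra decoded ++_) (trans
      (cong₂ _++_ (value 0F) (cong₂ _++_ (value 1F) (cong₂ _++_ (value 2F) (trans (value 3F) (sym (List.++-identityʳ _))))))
      (trans (sym (List.++-identityʳ (numbers extras))) (cong (numbers extras ++_) (sym (empty (rest w) (Valid.tailed valid))))))) word-eq
    where
    valid : Valid w 4 0
    valid = to↔ (valid-zero⇔ 4 ℕ.≤-refl) v
    open Decoded valid
    extra< : ∀ (j : Fin 4) → token w (suc (entries n + toℕ j)) < n
    extra< j = Valid.below valid _ (ℕ.+-monoʳ-< (entries n) (Fin.toℕ<n j))
    element : Fin 4 → Fin n
    element j = fromℕ< (extra< j)
    value : ∀ j → encodeFin (element j) ≡ encodeℕ (token w (suc (entries n + toℕ j)))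
    value j = cong encodeℕ (Fin.toℕ-fromℕ< (extra< j))
    empty : ∀ (u : Word) → length u ≡ 0 → u ≡ []
    empty [] _ = refl

  module Irreducible (A : FiniteAlgebra S) (w≡ : encodeAlgebra A ≡ w) where

    open FiniteAlgebra A
    open Encoded A [] (λ _ ()) [] refl (trans (List.++-identityʳ (encodeAlgebra A)) w≡)
    open Matched A matches (ℕ.≤-<-trans (ℕ.m≤m+n _ 0) (fits size-eq valid))

    pair⇔ : ∀ {x y} → True (var 1F ≺ sizeF ∧ᶠ var 0F ≺ sizeF ∧ᶠ neg (var 1F ≐ var 0F)) (y ∷ x ∷ []) ⇔ (x < size × y < size × x ≢ y)
    pair⇔ {x} {y} = ∧⇔ (var 1F ≺ sizeF) _ ⟫ (<size⇔ {ρ = y ∷ x ∷ []} (var 1F) ×⇔ (∧⇔ (var 0F ≺ sizeF) (neg (var 1F ≐ var 0F)) ⟫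
      (<size⇔ {ρ = y ∷ x ∷ []} (var 0F) ×⇔ (neg⇔ (var 1F ≐ var 0F) ⟫ mk⇔ (_∘ from↔ (≐⇔ (var 1F) (var 0F))) (_∘ to↔ (≐⇔ (var 1F) (var 0F)))))))

    irreducible⇔ : SubdirectlyIrreducible A ⇔ Sat irreducibleF []
    irreducible⇔ = mk⇔ to from
      where
      to : SubdirectlyIrreducible A → Sat irreducibleF []
      to (a , b , a≢b , h) = from↔ (valid-zero⇔ 0 z≤n) valid ,
        toℕ a , ℕ.≤-trans (ℕ.<⇒≤ (Fin.toℕ<n a)) n≤cap , toℕ b , ℕ.≤-trans (ℕ.<⇒≤ (Fin.toℕ<n b)) n≤cap ,
        from↔ (pair⇔ {toℕ a} {toℕ b}) (Fin.toℕ<n a , Fin.toℕ<n b , a≢b ∘ Fin.toℕ-injective) ,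
        λ x x< y y< → both x y (subst (x <_) (size-eval {ρ = toℕ b ∷ toℕ a ∷ []}) x<) (subst (y <_) (size-eval {ρ = x ∷ toℕ b ∷ toℕ a ∷ []}) y<)
        where
        both : ∀ x y → x < size → y < size → Sat (at (var 1F ≐ var 0F) or cgF 3F 2F 1F 0F) (y ∷ x ∷ toℕ b ∷ toℕ a ∷ [])
        both x y x< y< with x ℕ.≟ y
        ... | yes e = inj₁ (from↔ (≐⇔ (var 1F) (var 0F)) e)
        ... | no ne = inj₂ (from↔ (cg⇔ 3F 2F 1F 0F a b (fromℕ< x<) (fromℕ< y<) refl refl (sym (Fin.toℕ-fromℕ< x<)) (sym (Fin.toℕ-fromℕ< y<)))
          (h _ _ λ e → ne (trans (sym (Fin.toℕ-fromℕ< x<)) (trans (cong toℕ e) (Fin.toℕ-fromℕ< y<)))))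
      from : Sat irreducibleF [] → SubdirectlyIrreducible A
      from (_ , x , _ , y , _ , p , h) with to↔ (pair⇔ {x} {y}) p
      ... | x< , y< , x≢y = fromℕ< x< , fromℕ< y< , (λ e → x≢y (trans (sym ex≡) (trans (cong toℕ e) ey≡))) , all-pairs
        where
        ex≡ : toℕ (fromℕ< x<) ≡ x
        ex≡ = Fin.toℕ-fromℕ< x<
        ey≡ : toℕ (fromℕ< y<) ≡ y
        ey≡ = Fin.toℕ-fromℕ< y<
        all-pairs : ∀ c d → c ≢ d → Cg A c d (fromℕ< x<) (fromℕ< y<)
        all-pairs c d c≢d with h (toℕ c) (subst (toℕ c <_) (sym (size-eval {ρ = y ∷ x ∷ []})) (Fin.toℕ<n c))
                                 (toℕ d) (subst (toℕ d <_) (sym (size-eval {ρ = toℕ c ∷ y ∷ x ∷ []})) (Fin.toℕ<n d))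
        ... | inj₁ e = contradiction (Fin.toℕ-injective (to↔ (≐⇔ (var 1F) (var 0F)) e)) c≢d
        ... | inj₂ k = to↔ (cg⇔ 3F 2F 1F 0F (fromℕ< x<) (fromℕ< y<) c d (sym ex≡) (sym ey≡) refl refl) k

  decode-irreducible : Sat irreducibleF [] → ∃[ A ] encodeAlgebra A ≡ w
  decode-irreducible (v , _) = decoded , trans (sym (trans (cong (encodeAlgebra decoded ++_) (empty (rest w) (Valid.tailed valid))) (List.++-identityʳ _))) word-eq
    where
    valid : Valid w 0 0
    valid = to↔ (valid-zero⇔ 0 z≤n) v
    open Decoded valid
    empty : ∀ (u : Word) → length u ≡ 0 → u ≡ []
    empty [] _ = refl


-- Subsets that are not congruence classes

module ClassRefutation {S : Signature} (A : FiniteAlgebra S) (C : Subset (FiniteAlgebra.size A)) where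

  open Chains A (λ x y → x ∈ C × y ∈ C)

  Refuted : Set
  Refuted = ¬ ∃ (_∈ C) ⊎ ∃[ x ] x ∈ C × (∃[ y ] Chain x y × ¬ y ∈ C)

  -- The chains generated by the pairs within `C` form the least congruence that puts `C` into one
  -- class. If `C` is a class of any congruence, no chain leaves it; if it is nonempty and no chain
  -- leaves it, it is a class of the congruence of chains. Membership in `C` is decidable, so the
  -- negative form suffices.
  class⇔¬refuted : DecisionProblem.Yes (CongClass S) (A , C) ⇔ (¬ Refuted)
  class⇔¬refuted = mk⇔ to from
    where
    to : DecisionProblem.Yes (CongClass S) (A , C) → ¬ Refuted
    to (θ , cong-θ , a , cls) = λ
      { (inj₁ empty)              → empty (a , from↔ (cls a) ≈.refl)
      ; (inj₂ (x , x∈ , y , c , y∉)) → y∉ (from↔ (cls y) (≈.trans (to↔ (cls x) x∈)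
          (chain-smallest cong-θ (λ (c∈ , d∈) → ≈.trans (≈.sym (to↔ (cls _) c∈)) (to↔ (cls _) d∈)) c))) }
      where module ≈ = IsEquivalence (IsCongruence.isEquivalence cong-θ)
    from : ¬ Refuted → DecisionProblem.Yes (CongClass S) (A , C)
    from ok with Fin.any? (λ x → x Subset.∈? C)
    ... | no empty     = contradiction (inj₁ empty) ok
    ... | yes (a , a∈) = Chain , chain-congruence , a , λ y → mk⇔ (λ y∈ → chain-generator (a∈ , y∈)) λ c →
      case y Subset.∈? C of λ { (yes y∈) → y∈ ; (no y∉) → contradiction (inj₂ (a , a∈ , y , c , y∉)) ok }

open ClassRefutation using (Refuted; class⇔¬refuted) public

module ClassInterpretation (S : Signature) (binary : ∃[ f ] 2 ≤ arity S f) (w : Word) (cap : ℕ) (enough : (2 + length w) ^ 3 ≤ cap) where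

  open AlgebraWords S
  open ProblemFormulas S
  open FormulaSpecs binary w cap enough
  open WordFns w cap enough
  open Satisfaction w cap
  open Evaluation w cap
  open Truth w cap (ℕ.≤-trans (s≤s z≤n) 8≤cap)
  open Interpretation S binary w cap enough using (fits; valid-size⇔)

  module Class (A : FiniteAlgebra S) (C : Subset (FiniteAlgebra.size A)) (w≡ : encodeAlgebra A ++ encodeSubset C ≡ w) where

    open FiniteAlgebra A
    open Encoded A [] (λ _ ()) (encodeSubset C) (delims-encodeSubset C) w≡
    open Matched A matches (ℕ.≤-<-trans (ℕ.m≤m+n _ 0) (fits size-eq valid))
    open Generated (λ x y → x ∈ C × y ∈ C)
    open Chains A (λ x y → x ∈ C × y ∈ C)

    sized : Valid w 0 (token w 0)
    sized = subst (Valid w 0) (trans (length-encodeSubset C) (sym size-eq)) valid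

    private
      u : Word
      u = encodeAlgebra A

    length-w : length w ≡ length u + size
    length-w = trans (cong length (sym w≡)) (trans (List.length-++ u) (cong (length u +_) (length-encodeSubset C)))

    bit⇔ : ∀ {m} {ρ : Vec ℕ m} f X → eval f ρ ≡ toℕ X → True (bitF f) ρ ⇔ X ∈ C
    bit⇔ {ρ = ρ} f X e = ≐⇔ (symbolF ((len ⊖ sizeF) ⊕ f)) (const# 3) ⟫ ≡⇔ value (const-eval {ρ = ρ} 3 (ℕ.≤-trans (ℕ.m≤m+n 3 5) 8≤cap))
      ⟫ mk⇔ (from↔ (encodeSubset-∈ C X)) (to↔ (encodeSubset-∈ C X))
      where
      position≤ : length u + toℕ X ≤ length w
      position≤ = ℕ.≤-trans (ℕ.+-monoʳ-≤ (length u) (ℕ.<⇒≤ (Fin.toℕ<n X))) (ℕ.≤-reflexive (sym length-w))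
      start-eval : eval (len ⊖ sizeF) ρ ≡ length u
      start-eval = trans (⊖-eval {ρ = ρ} len sizeF) (trans (cong₂ _∸_ length-w (size-eval {ρ = ρ})) (ℕ.m+n∸n≡m (length u) size))
      value : eval (symbolF ((len ⊖ sizeF) ⊕ f)) ρ ≡ symbol (encodeSubset C) (toℕ X)
      value = trans (symbol-eval {ρ = ρ} ((len ⊖ sizeF) ⊕ f) (⊕-eval {ρ = ρ} (len ⊖ sizeF) f start-eval e (ℕ.≤-trans position≤ w≤cap)) position≤)
        (trans (cong (λ v → symbol v (length u + toℕ X)) (sym w≡)) (symbol-++ u (toℕ X)))

    some-bit⇔ : True (some sizeF (bitF (var 0F))) [] ⇔ ∃ (_∈ C)
    some-bit⇔ = some⇔ sizeF (bitF (var 0F)) ⟫ mk⇔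
      (λ (i , i< , h) → let i<n = subst (i <_) (size-eval {ρ = []}) i< in
        fromℕ< i<n , to↔ (bit⇔ {ρ = i ∷ []} (var 0F) (fromℕ< i<n) (sym (Fin.toℕ-fromℕ< i<n))) h)
      (λ (x , x∈) → toℕ x , subst (toℕ x <_) (sym (size-eval {ρ = []})) (Fin.toℕ<n x) , from↔ (bit⇔ {ρ = toℕ x ∷ []} (var 0F) x refl) x∈)

    refuted⇔ : Sat noClassF [] ⇔ Refuted A C
    refuted⇔ = (neg⇔ (validF 0 sizeF ∧ᶠ some sizeF (bitF (var 0F))) ⟫ mk⇔
        (λ ne h → ne (from↔ (∧⇔ (validF 0 sizeF) _) (from↔ valid-size⇔ sized , from↔ some-bit⇔ h)))
        (λ ne h → ne (to↔ some-bit⇔ (proj₂ (to↔ (∧⇔ (validF 0 sizeF) _) h)))))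
      ⊎⇔ mk⇔ to from
      where
      member⇔ : ∀ {x} → True (var 0F ≺ sizeF ∧ᶠ bitF (var 0F)) (x ∷ []) ⇔ (∃[ X ] x ≡ toℕ X × X ∈ C)
      member⇔ {x} = ∧⇔ (var 0F ≺ sizeF) (bitF (var 0F)) ⟫ mk⇔
        (λ (l , h) → let x< = to↔ (<size⇔ {ρ = x ∷ []} (var 0F)) l in
          fromℕ< x< , sym (Fin.toℕ-fromℕ< x<) , to↔ (bit⇔ {ρ = x ∷ []} (var 0F) (fromℕ< x<) (sym (Fin.toℕ-fromℕ< x<))) h)
        (λ { (X , refl , X∈) → from↔ (<size⇔ {ρ = toℕ X ∷ []} (var 0F)) (Fin.toℕ<n X) , from↔ (bit⇔ {ρ = toℕ X ∷ []} (var 0F) X refl) X∈ })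
      escape⇔ : ∀ X → Sat (chainF 0F (bitF (var 1F) ∧ᶠ bitF (var 0F)) (neg (bitF (var 0F)))) (toℕ X ∷ []) ⇔ (∃[ Y ] Chain X Y × ¬ Y ∈ C)
      escape⇔ X = chain⇔ {ρ = toℕ X ∷ []} (bitF (var 1F) ∧ᶠ bitF (var 0F))
        (λ {g₁} {g₂} {z′} {y′} {z} {y} → ∧⇔ (bitF (var 1F)) (bitF (var 0F)) ⟫
          (bit⇔ {ρ = toℕ g₂ ∷ toℕ g₁ ∷ z′ ∷ y′ ∷ z ∷ y ∷ toℕ X ∷ []} (var 1F) g₁ refl ×⇔ bit⇔ {ρ = toℕ g₂ ∷ toℕ g₁ ∷ z′ ∷ y′ ∷ z ∷ y ∷ toℕ X ∷ []} (var 0F) g₂ refl))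
        0F (neg (bitF (var 0F))) (λ Y → ¬ Y ∈ C)
        (λ {Z} {y} → neg⇔ (bitF (var 0F)) ⟫ mk⇔ (_∘ from↔ (bit⇔ {ρ = toℕ Z ∷ y ∷ toℕ X ∷ []} (var 0F) Z refl)) (_∘ to↔ (bit⇔ {ρ = toℕ Z ∷ y ∷ toℕ X ∷ []} (var 0F) Z refl)))
        X refl
      Escape : ℕ → Set
      Escape x = Sat (at (var 0F ≺ sizeF ∧ᶠ bitF (var 0F)) and chainF 0F (bitF (var 1F) ∧ᶠ bitF (var 0F)) (neg (bitF (var 0F)))) (x ∷ [])
      to : (∃[ x ] x ≤ cap × Escape x) → ∃[ X ] X ∈ C × (∃[ Y ] Chain X Y × ¬ Y ∈ C)
      to (x , _ , m , h) with to↔ (member⇔ {x}) m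
      ... | X , refl , X∈ = X , X∈ , to↔ (escape⇔ X) h
      from : (∃[ X ] X ∈ C × (∃[ Y ] Chain X Y × ¬ Y ∈ C)) → ∃[ x ] x ≤ cap × Escape x
      from (X , X∈ , h) = toℕ X , carrier≤ X , from↔ (member⇔ {toℕ X}) (X , refl , X∈) , from↔ (escape⇔ X) h

  decode-class : Valid w 0 (token w 0) → ∃[ I ] DecisionProblem.encode (CongClass S) I ≡ w
  decode-class v = (decoded , subst Subset tailed (bits (rest w))) ,
    trans (cong (encodeAlgebra decoded ++_) (trans (transported tailed) (encode-bits (rest w) (delims-rest w)))) word-eq
    where
    open Decoded v
    open Valid v
    transported : ∀ {n} (e : length (rest w) ≡ n) → encodeSubset (subst Subset e (bits (rest w))) ≡ encodeSubset (bits (rest w))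
    transported refl = refl

  valid? : Dec (Valid w 0 (token w 0))
  valid? = map′ (to↔ valid-size⇔) (from↔ valid-size⇔) (true? (validF 0 sizeF) [])


-- Membership

NL-resp-⇔ : ∀ {σ ℓ ℓ′} {L : Language σ ℓ} {L′ : Language σ ℓ′} → (∀ w → L w ⇔ L′ w) → NL L → NL L′
NL-resp-⇔ e (M , small , accepts) = M , small , λ w → mk⇔ (from↔ (e w)) (to↔ (e w)) ⟫ accepts w

enough₀ : Word → ℕ
enough₀ w = (2 + length w) ^ 3

module InNL (S : Signature) (binary : ∃[ f ] 2 ≤ arity S f) where

  open ProblemFormulas S

  membership-NL : NL (DecisionProblem.language (PrincipalCongruenceMembership S))
  membership-NL = NL-by-formula membershipF 3 _ λ w cap enough → let open Interpretation S binary w cap enough in mk⇔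
    (λ { ((A , (a , b) , (c , d)) , e , yes-I) → to↔ (Member.membership⇔ A a b c d e) yes-I })
    (λ h → let ((A , (a , b) , (c , d)) , e) = decode-membership h in (A , (a , b) , (c , d)) , e , from↔ (Member.membership⇔ A a b c d e) h)

  irreducibility-NL : NL (DecisionProblem.language (SubdirectIrreducibility S))
  irreducibility-NL = NL-by-formula irreducibleF 3 _ λ w cap enough → let open Interpretation S binary w cap enough in mk⇔
    (λ { (A , e , yes-I) → to↔ (Irreducible.irreducible⇔ A e) yes-I })
    (λ h → let (A , e) = decode-irreducible h in A , e , from↔ (Irreducible.irreducible⇔ A e) h)

  -- The complement of `CongClass` among all words, in the positive form that a formula can express.
  RefutedWord : Language 3 0ℓ
  RefutedWord w = ¬ AlgebraWords.Valid S w 0 (token w 0) ⊎ ∃[ I ] DecisionProblem.encode (CongClass S) I ≡ w × Refuted (proj₁ I) (proj₂ I)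

  refuted-NL : NL RefutedWord
  refuted-NL = NL-by-formula noClassF 3 RefutedWord λ w cap enough → mk⇔ (to w cap enough) (from w cap enough)
    where
    module _ (w : Word) (cap : ℕ) (enough : enough₀ w ≤ cap) where
      open ClassInterpretation S binary w cap enough
      open Truth w cap (ℕ.≤-trans (s≤s z≤n) (WordFns.8≤cap w cap enough))
      to : RefutedWord w → Satisfaction.Sat w cap noClassF []
      to (inj₁ invalid)         = inj₁ (from↔ (neg⇔ _) (invalid ∘ to↔ valid-size⇔ ∘ proj₁ ∘ to↔ (∧⇔ (validF 0 sizeF) _)))
        where open Interpretation S binary w cap enough using (valid-size⇔)
      to (inj₂ ((A , C) , e , r)) = from↔ (Class.refuted⇔ A C e) r
      from : Satisfaction.Sat w cap noClassF [] → RefutedWord w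
      from h with valid?
      ... | no invalid = inj₁ invalid
      ... | yes v      = let ((A , C) , e) = decode-class v in inj₂ ((A , C) , e , to↔ (Class.refuted⇔ A C e) h)

  class-NL : NL (DecisionProblem.language (CongClass S))
  class-NL = NL-resp-⇔ (λ w → mk⇔ (to w) (from w)) (NL-complement refuted-NL)
    where
    module _ (w : Word) where
      open ClassInterpretation S binary w (enough₀ w) ℕ.≤-refl
      to : ¬ RefutedWord w → DecisionProblem.language (CongClass S) w
      to h with valid?
      ... | no invalid = contradiction (inj₁ invalid) h
      ... | yes v      = let ((A , C) , e) = decode-class v in (A , C) , e , from↔ (class⇔¬refuted A C) λ r → h (inj₂ ((A , C) , e , r))
      from : DecisionProblem.language (CongClass S) w → ¬ RefutedWord w
      from ((A , C) , e , yes-I) = λ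
        { (inj₁ invalid)             → invalid (Class.sized A C e)
        -- Both instances are encoded by `w`, and whether either is refuted is read off the same
        -- formula at `w`.
        ; (inj₂ ((B , D) , e′ , r)) → to↔ (class⇔¬refuted A C) yes-I (to↔ (Class.refuted⇔ A C e) (from↔ (Class.refuted⇔ B D e′) r)) }


-- Hardness

-- Whether an instance is a yes-instance depends on its encoding only.
language-encode : ∀ {ℓ q} (P : DecisionProblem ℓ) (Q : Word → Set q) → let open DecisionProblem P in
                  (∀ I w → encode I ≡ w → Yes I ⇔ Q w) → ∀ I → Yes I ⇔ language (encode I)
language-encode P Q h I = mk⇔ (λ y → I , refl , y) λ (I′ , e , y) → from↔ (h I _ refl) (to↔ (h I′ _ e) y)

⇔-sym : ∀ {a b} {A : Set a} {B : Set b} → A ⇔ B → B ⇔ A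
⇔-sym e = mk⇔ (from↔ e) (to↔ e)

¬⇔ : ∀ {a b} {A : Set a} {B : Set b} → A ⇔ B → (¬ A) ⇔ (¬ B)
¬⇔ e = mk⇔ (_∘ from↔ e) (_∘ to↔ e)

module Hard (S : Signature) (f : Fin (operations S)) (2≤ : 2 ≤ arity S f) where

  open ProblemFormulas S
  open Satisfaction using (Sat)

  module Membership {σ ℓ} {K : Language σ ℓ} (G : GraphFor K) where

    open DecisionProblem (PrincipalCongruenceMembership S)
    open Reduction S G false hiding (module Instance)
    module I w = Reduction.Instance S G false w

    reduced : List (Fin σ) → Instance
    reduced w = I.algebra w , (encE (0F , t) , encE (1F , t)) , (encE (0F , s) , encE (1F , s))
      where open I w

    printed : ∀ w cap → (2 + length w) ^ (3 + GraphFor.exponent G) ≤ cap → Printing.print w cap (algebraO ▹ pairsO) [] ≡ encode (reduced w)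
    printed w cap enough = cong₂ _++_ algebra-print pairs-print
      where open Correct w cap enough

    correct : ∀ w → K w ⇔ Yes (reduced w)
    correct w = GraphFor.reachability G w ⟫ reach⇔ ⟫ ⇔-sym (reachable⇔ f 2≤ refl)
      where open I w

    language⇔ : ∀ I → Yes I ⇔ language (encode I)
    language⇔ = language-encode (PrincipalCongruenceMembership S) (λ v → Sat v (enough₀ v) membershipF [])
      λ { (A , (a , b) , (c , d)) v e → Interpretation.Member.membership⇔ S (f , 2≤) v (enough₀ v) ℕ.≤-refl A a b c d e }

    reduction : K ≤ₗ language
    reduction = (λ w → encode (reduced w)) , logSpace-by-printing (algebraO ▹ pairsO) (3 + GraphFor.exponent G) (λ w → encode (reduced w)) printed ,
      λ w → correct w ⟫ language⇔ (reduced w)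

  module Irreducibility {σ ℓ} {K : Language σ ℓ} (G : GraphFor K) where

    open DecisionProblem (SubdirectIrreducibility S)
    open Reduction S G false hiding (module Instance)
    module I w = Reduction.Instance S G false w

    printed : ∀ w cap → (2 + length w) ^ (3 + GraphFor.exponent G) ≤ cap → Printing.print w cap algebraO [] ≡ encode (I.algebra w)
    printed w cap enough = Correct.algebra-print w cap enough

    correct : ∀ w → K w ⇔ Yes (I.algebra w)
    correct w = GraphFor.reachability G w ⟫ reach⇔ ⟫ ⇔-sym (irreducible⇔ f 2≤ refl)
      where open I w

    language⇔ : ∀ I → Yes I ⇔ language (encode I)
    language⇔ = language-encode (SubdirectIrreducibility S) (λ v → Sat v (enough₀ v) irreducibleF [])
      λ A v e → Interpretation.Irreducible.irreducible⇔ S (f , 2≤) v (enough₀ v) ℕ.≤-refl A e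

    reduction : K ≤ₗ language
    reduction = (λ w → encode (I.algebra w)) , logSpace-by-printing algebraO (3 + GraphFor.exponent G) (λ w → encode (I.algebra w)) printed ,
      λ w → correct w ⟫ language⇔ (I.algebra w)

  -- Classes are hard for the complements of the languages in NL.
  module Classes {σ ℓ} {K : Language σ ℓ} (G : GraphFor (λ w → ¬ K w)) (stable : ∀ w → ¬ ¬ K w → K w) where

    open DecisionProblem (CongClass S)
    open Reduction S G true hiding (module Instance)
    module I w = Reduction.Instance S G true w

    reduced : List (Fin σ) → Instance
    reduced w = I.algebra w , I.sources w

    printed : ∀ w cap → (2 + length w) ^ (3 + GraphFor.exponent G) ≤ cap → Printing.print w cap (algebraO ▹ subsetO) [] ≡ encode (reduced w)
    printed w cap enough = cong₂ _++_ algebra-print subset-print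
      where open Correct w cap enough

    correct : ∀ w → K w ⇔ Yes (reduced w)
    -- The graph belongs to the complement of `K`, and the class exists exactly if the target is
    -- unreachable; `stable` removes the resulting double negation.
    correct w = mk⇔ (λ k ¬k → ¬k k) (stable w) ⟫ ¬⇔ (GraphFor.reachability G w ⟫ reach⇔) ⟫ ⇔-sym (class⇔ f 2≤ refl)
      where open I w

    language⇔ : ∀ I → Yes I ⇔ language (encode I)
    language⇔ = language-encode (CongClass S) (λ v → ¬ Sat v (enough₀ v) noClassF [])
      λ { (A , C) v e → class⇔¬refuted A C ⟫ ¬⇔ (⇔-sym (ClassInterpretation.Class.refuted⇔ S (f , 2≤) v (enough₀ v) ℕ.≤-refl A C e)) }

    reduction : K ≤ₗ language
    reduction = (λ w → encode (reduced w)) , logSpace-by-printing (algebraO ▹ subsetO) (3 + GraphFor.exponent G) (λ w → encode (reduced w)) printed ,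
      λ w → correct w ⟫ language⇔ (reduced w)

theorem3p2 : (S : Signature) → (∃[ f ] 2 ≤ arity S f) →
  NL-complete (DecisionProblem.language (PrincipalCongruenceMembership S)) ×
  NL-complete (DecisionProblem.language (SubdirectIrreducibility S)) ×
  NL-complete (DecisionProblem.language (CongClass S))
theorem3p2 S binary@(f , 2≤) =
  (membership-NL     , λ K nl → Membership.reduction (NL⇒GraphFor nl)) ,
  (irreducibility-NL , λ K nl → Irreducibility.reduction (NL⇒GraphFor nl)) ,
  -- Yes-instances correspond to unreachable targets, so the graph is taken for the complement of
  -- `K`, which is again in NL.
  (class-NL          , λ K nl → Classes.reduction (NL⇒GraphFor (NL-complement nl)) λ w ¬¬k → case NL-decidable nl w of λ
    { (yes k) → k ; (no ¬k) → contradiction ¬k ¬¬k })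
  where
  open InNL S binary
  open Hard S f 2≤
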